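{- Let $a$ be an integer. The progression $\{11184810h+a : h=0,1,2,\dots\}$ is a longest quasi-non-representable infinite arithmetic progression if and only if $a\in\{509203, 762701, 992077, 1247173, 1254341, 1330207, 1330319, 1730653, 1730681, 1976473, 2313487, 2344211, 2554843, 3177553, 3292241, 3419789, 3423373, 3661529, 3661543, 3784439, 4384979, 4442323, 4506097, 4507889, 4626967, 5049251, 5050147, 6610811, 7117807, 7576559, 7629217, 8086751, 8101087, 8252819, 8253043, 8643209, 9053711, 9053767, 9545351, 9560713, 9666029, 10219379, 10280827, 10581097, 10609769, 10702091, 10913233, 10913681\}$.
   Context: $\mathcal{U}$ denotes the set of positive odd integers $n$ that cannot be written as $n=p+2^k$ with $p$ a prime and $k$ a positive integer. An infinite arithmetic progression $\{mh+a : h=0,1,2,\dots\}$ with $m$ a positive integer is called quasi-non-representable if $a>0$ and $\{mh+a : h=0,1,\dots\}\setminus\mathcal{U}$ has asymptotic density zero. A quasi-non-representable progression $\{mh+a : h\ge0\}$ is called longest if there is no quasi-non-representable progression $\{m'h+a' : h\ge 0\}$ of which $\{mh+a : h\ge 0\}$ is a proper subset. Asymptotic density of a set $A$ of positive integers is $\lim |A\cap[1,x]|/x$. -}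

module Defs where

open import Data.Nat using (ℕ; zero; suc; _+_; _*_; _^_; _≤_; _<_)
open import Data.Nat.Primality using (Prime)
open import Data.Integer as ℤ using (ℤ; +_)
open import Data.List using (List; []; _∷_; length; filter)
open import Data.List.Relation.Unary.All using (All)
open import Data.List.Relation.Unary.Unique.Propositional using (Unique)
open import Data.Product using (Σ; ∃; ∃-syntax; _×_)
open import Relation.Nullary using (¬_)
open import Relation.Binary.PropositionalEquality using (_≡_)

Odd : ℕ → Set
Odd n = ∃[ k ] n ≡ suc (2 * k)

InU : ℕ → Set
InU n = 0 < n × Odd n × ((p k : ℕ) → 1 ≤ k → n ≡ p + 2 ^ k → ¬ Prime p)

InProg : ℕ → ℤ → ℤ → Set
InProg m a x = ∃[ h ] x ≡ (+ (m * h)) ℤ.+ a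

ProgSub : ℕ → ℤ → ℕ → ℤ → Set
ProgSub m a m' a' = ∀ x → InProg m a x → InProg m' a' x

-- a set A of positive integers (predicate on ℕ) has asymptotic density zero:
-- for every k ≥ 1 there is N such that for all x ≥ N, |A ∩ [1,x]| ≤ x / k,
-- where |A ∩ [1,x]| ≤ c is expressed as: every duplicate-free list of
-- elements of A ∩ [1,x] has length at most c (here: k * length ≤ x).
DensityZero : (ℕ → Set) → Set
DensityZero A = ∀ k → 1 ≤ k → ∃[ N ] ∀ x → N ≤ x →
  (xs : List ℕ) → Unique xs → All (λ n → 1 ≤ n × n ≤ x × A n) xs →
  k * length xs ≤ x

QuasiNonRep : ℕ → ℤ → Set
QuasiNonRep m a = 1 ≤ m × + 0 ℤ.< a ×
  DensityZero (λ n → InProg m a (+ n) × ¬ InU n)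

ProgProperSub : ℕ → ℤ → ℕ → ℤ → Set
ProgProperSub m a m' a' = ProgSub m a m' a' × ¬ ProgSub m' a' m a

LongestQNR : ℕ → ℤ → Set
LongestQNR m a = QuasiNonRep m a ×
  ¬ (Σ ℕ λ m' → Σ ℤ λ a' → QuasiNonRep m' a' × ProgProperSub m a m' a')

residues : List ℤ
residues = + 509203 ∷ + 762701 ∷ + 992077 ∷ + 1247173 ∷ + 1254341 ∷ + 1330207 ∷ + 1330319 ∷ + 1730653 ∷ + 1730681 ∷ + 1976473 ∷ + 2313487 ∷ + 2344211 ∷ + 2554843 ∷ + 3177553 ∷ + 3292241 ∷ + 3419789 ∷ + 3423373 ∷ + 3661529 ∷ + 3661543 ∷ + 3784439 ∷ + 4384979 ∷ + 4442323 ∷ + 4506097 ∷ + 4507889 ∷ + 4626967 ∷ + 5049251 ∷ + 5050147 ∷ + 6610811 ∷ + 7117807 ∷ + 7576559 ∷ + 7629217 ∷ + 8086751 ∷ + 8101087 ∷ + 8252819 ∷ + 8253043 ∷ + 8643209 ∷ + 9053711 ∷ + 9053767 ∷ + 9545351 ∷ + 9560713 ∷ + 9666029 ∷ + 10219379 ∷ + 10280827 ∷ + 10581097 ∷ + 10609769 ∷ + 10702091 ∷ + 10913233 ∷ + 10913681 ∷ []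

{-# OPTIONS --safe #-}
module Submission where

-- For a listed class a, in n = p + 2^k with n ≡ a the covering congruences force p to be one of
-- 3, 5, 7, 13, 17, 241, so there are only O(log x) exceptions up to x. Conversely, an odd class a
-- that is not listed has some k₀ with b = a − 2^k₀ coprime to the modulus M, and then the numbers
-- p + 2^k with p ≡ b (mod M) and k ≡ k₀ (mod 24) cannot have density zero. Indeed, Selberg's sieve
-- for the pairs p, p + h and Romanoff's estimate of the average of ∏_{q ∣ 2^m − 1} (1 + 6/q)
-- bound the second moment of the number of representations, so density zero would force the
-- primes p ≡ b (mod M) to have relative density zero. That contradicts Dirichlet's theorem in the
-- following weak form, proved as in Selberg's elementary approach: the classes with a large share
-- of ∑ Λ(n)/n are closed under triple products and, together with their pairwise products,
-- exhaust the reduced classes; so if b were missing there would be a real character χ that is −1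
-- on all large classes, whereas L(1, χ) ≠ 0 bounds ∑ χ(n)Λ(n)/n from below. Finally, a
-- progression strictly containing {Mh + a} would make the class a + M/r quasi-non-representable
-- for a prime r ∣ M, but this class is never listed.

open import Defs
open import Data.Integer using (ℤ)
open import Data.List.Membership.Propositional using (_∈_)
open import Function.Bundles using (_⇔_)

open import Data.Bool using (Bool; true; false; T; not; _∧_; if_then_else_)
open import Data.Bool.Properties using (T-∧)
open import Data.Empty using (⊥; ⊥-elim)
open import Data.Integer using (+_; -[1+_]; _+_; _-_; -_; _≤_; 0ℤ; 1ℤ; +≤+; -≤+; +<+)
import Data.Integer as ℤ
import Data.Integer.Properties as ℤP
open ℤP using (*-cancelˡ-≤-pos; +-assoc; +-comm; +-identityʳ; +-identityˡ; +-injective; +-inverseʳ; +-inverseˡ; +-mono-≤; +-monoʳ-≤; +-monoˡ-≤; 0≤i⇒+∣i∣≡i; <-≤-trans; <⇒≱; drop‿+≤+; i<j⇒suc[i]≤j; i≤j⇒0≤j-i; i≤j⇒i-j≤0; neg-distrib-+; neg-involutive; neg-mono-≤; suc[i]≤j⇒i<j; ≤-antisym; ≤-refl; ≤-reflexive; ≤-total; ≤-trans; ≤∧≢⇒<)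
open import Data.Integer.Solver using (module +-*-Solver)
open import Data.List using (List; []; _∷_; _++_; map; upTo; length; cartesianProductWith)
import Data.List.Properties as LP
open import Data.List.Membership.Propositional using (find)
open import Data.List.Membership.Propositional.Properties using (∈-map⁻; ∈-map⁺; ∈-upTo⁺; ∈-upTo⁻; ∈-∃++; ∈-++⁻; ∈-++⁺ˡ; ∈-++⁺ʳ; ∈-cartesianProductWith⁺)
import Data.List.Relation.Binary.Permutation.Propositional as ↭
open ↭ using (_↭_)
open import Data.List.Relation.Binary.Permutation.Propositional.Properties using (↭-length)
open import Data.List.Relation.Unary.All as All using (All; []; _∷_)
import Data.List.Relation.Unary.All.Properties as AllP
open import Data.List.Relation.Unary.AllPairs using ([]; _∷_)
open import Data.List.Relation.Unary.Any as Any using (Any; here; there)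
open import Data.List.Relation.Unary.Unique.Propositional using (Unique)
import Data.List.Relation.Unary.Unique.Propositional.Properties as Un
open import Data.Maybe using (Maybe; just; nothing)
import Data.Nat as ℕ
open ℕ using (ℕ; zero; suc; z≤n; s≤s; _^_; _<_; _!)
open import Data.List.Membership.DecPropositional ℕ._≟_ using (_∈?_)
open import Data.Nat.Coprimality as Co using (Coprime; coprime?; coprime-divisor)
import Data.Nat.Divisibility as Dv
open Dv using (_∣_; _∣?_; divides)
import Data.Nat.DivMod as DM
open import Data.Nat.GCD using (module Bézout)
open import Data.Nat.Induction using (<-rec)
open import Data.Nat.ListAction using (product)
open import Data.Nat.ListAction.Properties using (product-++)
open import Data.Nat.Primality using (Prime; prime?; prime[2]; euclidsLemma; prime⇒irreducible; prime⇒nonZero; prime⇒nonTrivial; ¬prime[1])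
open import Data.Nat.Primality.Factorisation using (PrimeFactorisation; factorise; factorisationUnique; factorisationHasAllPrimeFactors)
import Data.Nat.Properties as ℕP
open ℕP using (*-cancelˡ-≡; *-cancelˡ-≤; *-mono-<; *-mono-≤; *-monoʳ-≤; *-monoˡ-≤; +-suc; <⇒≢; <⇒≤; ^-*-assoc; ^-distribˡ-+-*; ^-monoʳ-<; ^-monoʳ-≤; ^-monoˡ-≤; anyUpTo?; m+[n∸m]≡n; m^n>0; m∸n+n≡m; m∸n≤m; m≤m*n; m≤m+n; m≤n*m; m≤n+m; m≤n⇒m≤1+n; m≤n⇒∃[o]m+o≡n; m≤n⇒∣m-n∣≡n∸m; n≢0⇒n>0; n≤0⇒n≡0; n≤1+n; ≡ᵇ⇒≡; ≤-<-trans; ≤-pred; ≮⇒≥; ≰⇒>)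
open import Data.Product using (∃; _×_; _,_; proj₁; proj₂)
open import Data.Sum using (_⊎_; inj₁; inj₂)
open import Data.Unit using (⊤; tt)
open import Function using (_∘_; Equivalence; mk⇔)
open import Relation.Binary.Definitions using (tri<; tri≈; tri>)
open import Relation.Binary.PropositionalEquality using (_≡_; _≢_; refl; sym; trans; cong; cong₂; subst; subst₂; module ≡-Reasoning)
open import Relation.Nullary using (Dec; yes; no; does; ¬_; ¬?; contradiction; _×-dec_)
open import Relation.Nullary.Decidable using (from-yes)

-- The modulus is 2 · (2^24 - 1) / 3 = 2 · 3 · 5 · 7 · 13 · 17 · 241. Modulo 3, 5, 7, 13, 17, 241
-- the powers of 2 have the periods 2, 4, 3, 12, 8, 24, so an exponent matters only modulo 24, and a
-- listed class is an odd one for which these six primes cover all exponents. The obstacle is the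
-- converse, which needs many primes in one given reduced class. Selberg's formula counts primes
-- together with products of two primes and cannot exclude that almost all primes lie where a real
-- character is -1; the nonvanishing of L(1, χ) is the input that breaks this parity. A positive
-- share suffices: the second moment turns about x representations into a support of positive
-- density. The closure of the large classes is lossy: a share 1/D at height 2^t yields the share
-- 1/(48 D³) at height 2^(3t). It is therefore applied at a scale where the set of large classes has
-- stopped growing, and all bounds must be uniform in T. Every estimate is a cross-multiplied
-- inequality between integers with explicit constants.

opaque
  infixl 7 _*_
  -- Integer multiplication, kept from unfolding in the type checker.
  _*_ : ℤ → ℤ → ℤ
  a * b = a ℤ.* b

  *-def : ∀ a b → a * b ≡ a ℤ.* b
  *-def a b = refl

  *-comm : ∀ a b → a * b ≡ b * a
  *-comm = ℤP.*-comm

  *-assoc : ∀ a b c → a * b * c ≡ a * (b * c)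
  *-assoc = ℤP.*-assoc

  *-identityˡ : ∀ a → 1ℤ * a ≡ a
  *-identityˡ = ℤP.*-identityˡ

  *-identityʳ : ∀ a → a * 1ℤ ≡ a
  *-identityʳ = ℤP.*-identityʳ

  *-zeroˡ : ∀ a → 0ℤ * a ≡ 0ℤ
  *-zeroˡ = ℤP.*-zeroˡ

  *-zeroʳ : ∀ a → a * 0ℤ ≡ 0ℤ
  *-zeroʳ = ℤP.*-zeroʳ

  *-distribˡ-+ : ∀ a b c → a * (b + c) ≡ a * b + a * c
  *-distribˡ-+ = ℤP.*-distribˡ-+

  *-distribʳ-+ : ∀ a b c → (b + c) * a ≡ b * a + c * a
  *-distribʳ-+ = ℤP.*-distribʳ-+

  pos-* : ∀ m n → + (m ℕ.* n) ≡ + m * + n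
  pos-* = ℤP.pos-*

  neg-distribˡ-* : ∀ a b → - (a * b) ≡ - a * b
  neg-distribˡ-* = ℤP.neg-distribˡ-*

  neg-distribʳ-* : ∀ a b → - (a * b) ≡ a * - b
  neg-distribʳ-* = ℤP.neg-distribʳ-*

  -1*i≡-i : ∀ a → - 1ℤ * a ≡ - a
  -1*i≡-i = ℤP.-1*i≡-i

-- Linear arithmetic

module Linear where

  open +-*-Solver using (solve; _:=_; _:+_; _:*_; _:-_; con)

  infixl 7 _⊗_
  infixl 6 _⊕_ _⊖_
  infix 4 _≤'_ _≡'_ _<'_
  infixr 3 _⇒_

  data E : Set where
    var : ℕ → E
    κ : ℕ → E
    _⊕_ _⊗_ _⊖_ : E → E → E

  data Rel : Set where
    _≤'_ _≡'_ : E → E → Rel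

  data Sys : Set where
    _≤'_ _≡'_ : E → E → Sys
    _⇒_ : Rel → Sys → Sys

  _<'_ : E → E → Rel
  a <' b = (κ 1 ⊕ a) ≤' b

  -- A monomial is the sorted list of its variables with repetition, so that equal products become
  -- the same unknown of the linear problem.
  Mono : Set
  Mono = List ℕ

  Poly : Set
  Poly = List (Mono × ℤ)

  eqM : Mono → Mono → Bool
  eqM [] [] = true
  eqM [] (_ ∷ _) = false
  eqM (_ ∷ _) [] = false
  eqM (x ∷ m) (y ∷ n) = (x ℕ.≡ᵇ y) ∧ eqM m n

  leM : Mono → Mono → Bool
  leM [] _ = true
  leM (_ ∷ _) [] = false
  leM (x ∷ m) (y ∷ n) = if x ℕ.≡ᵇ y then leM m n else (x ℕ.<ᵇ y)

  eqM-sound : ∀ m n → T (eqM m n) → m ≡ n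
  eqM-sound [] [] _ = refl
  eqM-sound (x ∷ m) (y ∷ n) t with Equivalence.to (T-∧ {x ℕ.≡ᵇ y}) t
  ... | p , q = cong₂ _∷_ (≡ᵇ⇒≡ x y p) (eqM-sound m n q)

  isZ : ℤ → Bool
  isZ (+ zero) = true
  isZ _ = false

  insM : ℕ → Mono → Mono
  insM x [] = x ∷ []
  insM x (y ∷ m) = if x ℕ.<ᵇ y then x ∷ y ∷ m else y ∷ insM x m

  mulM : Mono → Mono → Mono
  mulM [] n = n
  mulM (x ∷ m) n = insM x (mulM m n)

  consP : Mono → ℤ → Poly → Poly
  consP m c p = if isZ c then p else (m , c) ∷ p

  addT : Mono → ℤ → Poly → Poly
  addT m c [] = (m , c) ∷ []
  addT m c ((n , d) ∷ p) =
    if eqM m n then consP n (c ℤ.+ d) p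
    else if leM m n then (m , c) ∷ (n , d) ∷ p
    else (n , d) ∷ addT m c p

  addP : Poly → Poly → Poly
  addP [] q = q
  addP ((m , c) ∷ p) q = addT m c (addP p q)

  scaleP : ℤ → Poly → Poly
  scaleP k [] = []
  scaleP k ((m , c) ∷ p) = (m , k ℤ.* c) ∷ scaleP k p

  mulTP : Mono → ℤ → Poly → Poly
  mulTP m c [] = []
  mulTP m c ((n , d) ∷ p) = addT (mulM m n) (c ℤ.* d) (mulTP m c p)

  mulP : Poly → Poly → Poly
  mulP [] q = []
  mulP ((m , c) ∷ p) q = addP (mulTP m c q) (mulP p q)

  norm : E → Poly
  norm (var i) = (i ∷ [] , 1ℤ) ∷ []
  norm (κ n) = consP [] (+ n) []
  norm (a ⊕ b) = addP (norm a) (norm b)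
  norm (a ⊗ b) = mulP (norm a) (norm b)
  norm (a ⊖ b) = addP (norm a) (scaleP (ℤ.- 1ℤ) (norm b))

  look : ∀ {A : Set} → A → List A → ℕ → A
  look d [] _ = d
  look d (x ∷ ρ) zero = x
  look d (x ∷ ρ) (suc i) = look d ρ i

  evM : List ℤ → Mono → ℤ
  evM ρ [] = 1ℤ
  evM ρ (x ∷ m) = look 0ℤ ρ x ℤ.* evM ρ m

  evP : List ℤ → Poly → ℤ
  evP ρ [] = 0ℤ
  evP ρ ((m , c) ∷ p) = c ℤ.* evM ρ m ℤ.+ evP ρ p

  evE : List ℤ → E → ℤ
  evE ρ (var i) = look 0ℤ ρ i
  evE ρ (κ n) = + n
  evE ρ (a ⊕ b) = evE ρ a ℤ.+ evE ρ b
  evE ρ (a ⊗ b) = evE ρ a * evE ρ b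
  evE ρ (a ⊖ b) = evE ρ a ℤ.- evE ρ b

  module Sound (ρ : List ℤ) where
    insM-ev : ∀ x m → evM ρ (insM x m) ≡ look 0ℤ ρ x ℤ.* evM ρ m
    insM-ev x [] = refl
    insM-ev x (y ∷ m) with x ℕ.<ᵇ y
    ... | true = refl
    ... | false rewrite insM-ev x m = l (look 0ℤ ρ y) (look 0ℤ ρ x) (evM ρ m)
      where
      l : ∀ a b c → a ℤ.* (b ℤ.* c) ≡ b ℤ.* (a ℤ.* c)
      l = solve 3 (λ a b c → a :* (b :* c) := b :* (a :* c)) refl

    mulM-ev : ∀ m n → evM ρ (mulM m n) ≡ evM ρ m ℤ.* evM ρ n
    mulM-ev [] n = sym (ℤP.*-identityˡ _)
    mulM-ev (x ∷ m) n rewrite insM-ev x (mulM m n) | mulM-ev m n =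
      sym (ℤP.*-assoc (look 0ℤ ρ x) (evM ρ m) (evM ρ n))

    consP-ev : ∀ m c p → evP ρ (consP m c p) ≡ c ℤ.* evM ρ m ℤ.+ evP ρ p
    consP-ev m (+ zero) p = sym (trans (cong (ℤ._+ evP ρ p) (ℤP.*-zeroˡ (evM ρ m))) (ℤP.+-identityˡ _))
    consP-ev m (+ suc n) p = refl
    consP-ev m -[1+ n ] p = refl

    addT-ev : ∀ m c p → evP ρ (addT m c p) ≡ c ℤ.* evM ρ m ℤ.+ evP ρ p
    addT-ev m c [] = refl
    addT-ev m c ((n , d) ∷ p) with eqM m n in eq
    ... | true rewrite eqM-sound m n (subst T (sym eq) tt) =
      trans (consP-ev n (c ℤ.+ d) p) (l c d (evM ρ n) (evP ρ p))
      where
      l : ∀ a b c d → (a ℤ.+ b) ℤ.* c ℤ.+ d ≡ a ℤ.* c ℤ.+ (b ℤ.* c ℤ.+ d)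
      l = solve 4 (λ a b c d → (a :+ b) :* c :+ d := a :* c :+ (b :* c :+ d)) refl
    ... | false with leM m n
    ...   | true = refl
    ...   | false rewrite addT-ev m c p = l (d ℤ.* evM ρ n) (c ℤ.* evM ρ m) (evP ρ p)
      where
      l : ∀ a b c → a ℤ.+ (b ℤ.+ c) ≡ b ℤ.+ (a ℤ.+ c)
      l = solve 3 (λ a b c → a :+ (b :+ c) := b :+ (a :+ c)) refl

    addP-ev : ∀ p q → evP ρ (addP p q) ≡ evP ρ p ℤ.+ evP ρ q
    addP-ev [] q = sym (ℤP.+-identityˡ _)
    addP-ev ((m , c) ∷ p) q rewrite addT-ev m c (addP p q) | addP-ev p q =
      sym (ℤP.+-assoc (c ℤ.* evM ρ m) (evP ρ p) (evP ρ q))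

    scaleP-ev : ∀ k p → evP ρ (scaleP k p) ≡ k ℤ.* evP ρ p
    scaleP-ev k [] = sym (ℤP.*-zeroʳ k)
    scaleP-ev k ((m , c) ∷ p) rewrite scaleP-ev k p = l k c (evM ρ m) (evP ρ p)
      where
      l : ∀ k c m p → k ℤ.* c ℤ.* m ℤ.+ k ℤ.* p ≡ k ℤ.* (c ℤ.* m ℤ.+ p)
      l = solve 4 (λ k c m p → k :* c :* m :+ k :* p := k :* (c :* m :+ p)) refl

    mulTP-ev : ∀ m c p → evP ρ (mulTP m c p) ≡ c ℤ.* evM ρ m ℤ.* evP ρ p
    mulTP-ev m c [] = sym (ℤP.*-zeroʳ (c ℤ.* evM ρ m))
    mulTP-ev m c ((n , d) ∷ p)
      rewrite addT-ev (mulM m n) (c ℤ.* d) (mulTP m c p) | mulM-ev m n | mulTP-ev m c p =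
      l c d (evM ρ m) (evM ρ n) (evP ρ p)
      where
      l : ∀ c d m n p → c ℤ.* d ℤ.* (m ℤ.* n) ℤ.+ c ℤ.* m ℤ.* p ≡ c ℤ.* m ℤ.* (d ℤ.* n ℤ.+ p)
      l = solve 5 (λ c d m n p → c :* d :* (m :* n) :+ c :* m :* p := c :* m :* (d :* n :+ p)) refl

    mulP-ev : ∀ p q → evP ρ (mulP p q) ≡ evP ρ p ℤ.* evP ρ q
    mulP-ev [] q = sym (ℤP.*-zeroˡ (evP ρ q))
    mulP-ev ((m , c) ∷ p) q
      rewrite addP-ev (mulTP m c q) (mulP p q) | mulTP-ev m c q | mulP-ev p q =
      sym (ℤP.*-distribʳ-+ (evP ρ q) (c ℤ.* evM ρ m) (evP ρ p))

    norm-ev : ∀ e → evP ρ (norm e) ≡ evE ρ e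
    norm-ev (var i) = l (look 0ℤ ρ i)
      where
      l : ∀ a → 1ℤ ℤ.* (a ℤ.* 1ℤ) ℤ.+ 0ℤ ≡ a
      l = solve 1 (λ a → con 1ℤ :* (a :* con 1ℤ) :+ con 0ℤ := a) refl
    norm-ev (κ n) = trans (consP-ev [] (+ n) []) (l (+ n))
      where
      l : ∀ a → a ℤ.* 1ℤ ℤ.+ 0ℤ ≡ a
      l = solve 1 (λ a → a :* con 1ℤ :+ con 0ℤ := a) refl
    norm-ev (a ⊕ b) rewrite addP-ev (norm a) (norm b) | norm-ev a | norm-ev b = refl
    norm-ev (a ⊗ b) rewrite mulP-ev (norm a) (norm b) | norm-ev a | norm-ev b = sym (*-def (evE ρ a) (evE ρ b))
    norm-ev (a ⊖ b) rewrite addP-ev (norm a) (scaleP (ℤ.- 1ℤ) (norm b))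
      | scaleP-ev (ℤ.- 1ℤ) (norm b) | norm-ev a | norm-ev b = l (evE ρ a) (evE ρ b)
      where
      l : ∀ a b → a ℤ.+ ℤ.- 1ℤ ℤ.* b ≡ a ℤ.- b
      l = solve 2 (λ a b → a :+ con (ℤ.- 1ℤ) :* b := a :- b) refl

    Nonneg : List Poly → Set
    Nonneg [] = ⊤
    Nonneg (p ∷ ps) = 0ℤ ℤ.≤ evP ρ p × Nonneg ps

    Nonneg-++ : ∀ ps {qs} → Nonneg ps → Nonneg qs → Nonneg (ps ++ qs)
    Nonneg-++ [] _ h = h
    Nonneg-++ (p ∷ ps) (a , b) h = a , Nonneg-++ ps b h

  combine : List ℕ → List Poly → Poly
  combine [] _ = []
  combine (_ ∷ _) [] = []
  combine (zero ∷ cs) (p ∷ ps) = combine cs ps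
  combine (suc c ∷ cs) (p ∷ ps) = addP (scaleP (+ suc c) p) (combine cs ps)

  isNeg : Poly → Bool
  isNeg (([] , -[1+ _ ]) ∷ []) = true
  isNeg _ = false

  module _ (ρ : List ℤ) where
    open Sound ρ

    combine-nonneg : ∀ cs ps → Nonneg ps → 0ℤ ℤ.≤ evP ρ (combine cs ps)
    combine-nonneg [] _ _ = ℤP.≤-refl
    combine-nonneg (_ ∷ _) [] _ = ℤP.≤-refl
    combine-nonneg (zero ∷ cs) (p ∷ ps) (h , hs) = combine-nonneg cs ps hs
    combine-nonneg (suc c ∷ cs) (p ∷ ps) (h , hs)
      rewrite addP-ev (scaleP (+ suc c) p) (combine cs ps) | scaleP-ev (+ suc c) p =
      ℤP.+-mono-≤ (subst (ℤ._≤ + suc c ℤ.* evP ρ p) (ℤP.*-zeroʳ (+ suc c)) (ℤP.*-monoˡ-≤-nonNeg (+ suc c) h))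
        (combine-nonneg cs ps hs)

    isNeg-sound : ∀ p → T (isNeg p) → ¬ (0ℤ ℤ.≤ evP ρ p)
    isNeg-sound (([] , -[1+ n ]) ∷ []) _ h
      rewrite ℤP.+-identityʳ (-[1+ n ] ℤ.* 1ℤ) | ℤP.*-identityʳ -[1+ n ] = case h
      where
      case : ¬ (0ℤ ℤ.≤ -[1+ n ])
      case ()

  -- Fourier–Motzkin elimination with the monomials as unknowns; each row carries the
  -- nonnegative multipliers of the input inequalities that produce it.
  Row : Set
  Row = Poly × List ℕ

  addL : List ℕ → List ℕ → List ℕ
  addL [] ys = ys
  addL xs [] = xs
  addL (x ∷ xs) (y ∷ ys) = (x ℕ.+ y) ∷ addL xs ys

  coef : Mono → Poly → ℤ
  coef m [] = 0ℤ
  coef m ((n , c) ∷ p) = if eqM m n then c else coef m p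

  splitRows : Mono → List Row → List (ℕ × Row) × List (ℕ × Row) × List Row
  splitRows m [] = [] , [] , []
  splitRows m (r@(p , _) ∷ rs) with splitRows m rs | coef m p
  ... | ps , ns , zs | + zero = ps , ns , r ∷ zs
  ... | ps , ns , zs | + suc k = (suc k , r) ∷ ps , ns , zs
  ... | ps , ns , zs | -[1+ k ] = ps , (suc k , r) ∷ ns , zs

  joinRow : ℕ × Row → ℕ × Row → Row
  joinRow (a , p , c) (b , q , d) =
    addP (scaleP (+ b) p) (scaleP (+ a) q) , addL (map (b ℕ.*_) c) (map (a ℕ.*_) d)

  trivial : Poly → Bool
  trivial [] = true
  trivial (([] , + _) ∷ []) = true
  trivial _ = false

  addRow : Row → List Row → List Row
  addRow r@(p , _) rs = if trivial p then rs else r ∷ rs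

  joinAll : ℕ × Row → List (ℕ × Row) → List Row → List Row
  joinAll p [] acc = acc
  joinAll p (n ∷ ns) acc = addRow (joinRow p n) (joinAll p ns acc)

  joins : List (ℕ × Row) → List (ℕ × Row) → List Row → List Row
  joins [] ns acc = acc
  joins (p ∷ ps) ns acc = joinAll p ns (joins ps ns acc)

  -- A row together with its negation is an equation, and then substituting it is enough.
  opposite : ℕ × Row → List (ℕ × Row) → Maybe ((ℕ × Row) × (ℕ × Row))
  opposite p [] = nothing
  opposite p (n ∷ ns) with joinRow p n
  ... | [] , _ = just (p , n)
  ... | _ ∷ _ , _ = opposite p ns

  equation : List (ℕ × Row) → List (ℕ × Row) → Maybe ((ℕ × Row) × (ℕ × Row))
  equation [] ns = nothing
  equation (p ∷ ps) ns with opposite p ns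
  ... | just e = just e
  ... | nothing = equation ps ns

  eliminate : List (ℕ × Row) → List (ℕ × Row) → List Row → List Row
  eliminate ps ns zs with equation ps ns
  ... | just (p , n) = joinAll p ns (joinAll n ps zs)
  ... | nothing = joins ps ns zs

  lenᵃ : ∀ {A : Set} → List A → ℕ
  lenᵃ [] = 0
  lenᵃ (_ ∷ xs) = suc (lenᵃ xs)

  cost : Mono → List Row → ℕ
  cost m rs with splitRows m rs
  ... | ps , ns , _ = lenᵃ ps ℕ.* lenᵃ ns

  monos : List Row → List Mono
  monos [] = []
  monos ((p , _) ∷ rs) = go p (monos rs)
    where
    mem : Mono → List Mono → Bool
    mem m [] = false
    mem m (n ∷ ns) = if eqM m n then true else mem m ns
    go : Poly → List Mono → List Mono
    go [] ms = ms
    go (([] , _) ∷ p) ms = go p ms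
    go ((m@(_ ∷ _) , _) ∷ p) ms = if mem m ms then go p ms else m ∷ go p ms

  cheapest : Mono → ℕ → List Mono → List Row → Mono
  cheapest best _ [] rs = best
  cheapest best c (m ∷ ms) rs with cost m rs
  ... | c' = if c' ℕ.<ᵇ c then cheapest m c' ms rs else cheapest best c ms rs

  refuted : List Row → List ℕ
  refuted [] = []
  refuted ((p , c) ∷ rs) = if isNeg p then c else refuted rs

  search : ℕ → List Row → List ℕ
  search zero rs = []
  search (suc k) rs with monos rs
  ... | [] = refuted rs
  ... | m ∷ ms with splitRows (cheapest m (cost m rs) ms rs) rs
  ...   | ps , ns , zs = search k (eliminate ps ns zs)

  mkRows : ℕ → List Poly → List Row
  mkRows i [] = []
  mkRows i (p ∷ ps) = (p , unitL i) ∷ mkRows (suc i) ps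
    where
    unitL : ℕ → List ℕ
    unitL zero = 1 ∷ []
    unitL (suc j) = 0 ∷ unitL j

  -- Soundness rests on rechecking the certificate: a nonnegative combination of the rows that is a
  -- negative constant refutes them, whatever procedure proposed the multipliers. The number 40
  -- limits how many monomials are eliminated.
  certified : List Poly → Bool
  certified ps = isNeg (combine (search 40 (mkRows 0 ps)) ps)

  diff : E → E → Poly
  diff a b = addP (norm a) (scaleP (ℤ.- 1ℤ) (norm b))

  relP : Rel → List Poly
  relP (a ≤' b) = diff b a ∷ []
  relP (a ≡' b) = diff b a ∷ diff a b ∷ []

  -- Over the integers the negation of a ≤ b is b + 1 ≤ a, so refutations stay within weak
  -- inequalities.
  negP : E → E → Poly
  negP a b = addT [] (ℤ.- 1ℤ) (diff a b)

  check : List Poly → Sys → Bool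
  check hs (a ≤' b) = certified (negP a b ∷ hs)
  check hs (a ≡' b) = certified (negP a b ∷ hs) ∧ certified (negP b a ∷ hs)
  check hs (r ⇒ s) = check (relP r ++ hs) s

  ⟦_⟧R : Rel → List ℤ → Set
  ⟦ a ≤' b ⟧R ρ = evE ρ a ℤ.≤ evE ρ b
  ⟦ a ≡' b ⟧R ρ = evE ρ a ≡ evE ρ b

  ⟦_⟧S : Sys → List ℤ → Set
  ⟦ a ≤' b ⟧S ρ = evE ρ a ℤ.≤ evE ρ b
  ⟦ a ≡' b ⟧S ρ = evE ρ a ≡ evE ρ b
  ⟦ r ⇒ s ⟧S ρ = ⟦ r ⟧R ρ → ⟦ s ⟧S ρ

  module _ (ρ : List ℤ) where
    open Sound ρ

    diff-ev : ∀ a b → evP ρ (diff a b) ≡ evE ρ a ℤ.- evE ρ b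
    diff-ev a b = norm-ev (a ⊖ b)

    diff-nonneg : ∀ a b → evE ρ a ℤ.≤ evE ρ b → 0ℤ ℤ.≤ evP ρ (diff b a)
    diff-nonneg a b h = subst (0ℤ ℤ.≤_) (sym (diff-ev b a)) (ℤP.i≤j⇒0≤j-i h)

    relP-nonneg : ∀ r → ⟦ r ⟧R ρ → Nonneg (relP r)
    relP-nonneg (a ≤' b) h = diff-nonneg a b h , tt
    relP-nonneg (a ≡' b) h = diff-nonneg a b (ℤP.≤-reflexive h) , diff-nonneg b a (ℤP.≤-reflexive (sym h)) , tt

    refute : ∀ hs a b → T (certified (negP a b ∷ hs)) → Nonneg hs → evE ρ a ℤ.≤ evE ρ b
    refute hs a b t h with evE ρ a ℤ.≤? evE ρ b
    ... | yes p = p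
    ... | no np = ⊥-elim (isNeg-sound ρ _ t (combine-nonneg ρ (search 40 (mkRows 0 (negP a b ∷ hs)))
        (negP a b ∷ hs) (neg-nonneg , h)))
      where
      s : ∀ x y → ℤ.- 1ℤ ℤ.* 1ℤ ℤ.+ (x ℤ.- y) ≡ x ℤ.- (1ℤ ℤ.+ y)
      s = solve 2 (λ x y → con (ℤ.- 1ℤ) :* con 1ℤ :+ (x :- y) := x :- (con 1ℤ :+ y)) refl
      neg-nonneg : 0ℤ ℤ.≤ evP ρ (negP a b)
      neg-nonneg = subst (0ℤ ℤ.≤_)
        (sym (trans (addT-ev [] (ℤ.- 1ℤ) (diff a b))
          (trans (cong (λ z → ℤ.- 1ℤ ℤ.* 1ℤ ℤ.+ z) (diff-ev a b)) (s (evE ρ a) (evE ρ b)))))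
        (ℤP.i≤j⇒0≤j-i (ℤP.i<j⇒suc[i]≤j (ℤP.≰⇒> np)))

    check-sound : ∀ hs s → T (check hs s) → Nonneg hs → ⟦ s ⟧S ρ
    check-sound hs (a ≤' b) t h = refute hs a b t h
    check-sound hs (a ≡' b) t h with Equivalence.to (T-∧ {certified (negP a b ∷ hs)}) t
    ... | t1 , t2 = ℤP.≤-antisym (refute hs a b t1 h) (refute hs b a t2 h)
    check-sound hs (r ⇒ s) t h g = check-sound (relP r ++ hs) s t (Nonneg-++ (relP r) (relP-nonneg r g) h)

  SysFun : ℕ → Set
  SysFun zero = Sys
  SysFun (suc n) = E → SysFun n

  close : ∀ n → ℕ → SysFun n → Sys
  close zero _ f = f
  close (suc n) i f = close n (suc i) (f (var i))

  Allⁿ : ∀ {A : Set} → ℕ → (List A → Set) → Set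
  Allⁿ zero P = P []
  Allⁿ {A} (suc n) P = (x : A) → Allⁿ n (λ ρ → P (x ∷ ρ))

  allⁿ : ∀ {A : Set} n {P : List A → Set} → (∀ ρ → P ρ) → Allⁿ n P
  allⁿ zero h = h []
  allⁿ (suc n) h x = allⁿ n (λ ρ → h (x ∷ ρ))

  -- lin n f tt x₁ … xₙ h₁ … hₖ proves the goal of the system f from its hypotheses h₁ … hₖ.
  lin : ∀ n (f : SysFun n) → T (check [] (close n 0 f)) → Allⁿ n ⟦ close n 0 f ⟧S
  lin n f t = allⁿ n λ ρ → check-sound ρ [] (close n 0 f) t tt

  -- The same procedure over ℕ, with every monomial of the system assumed nonnegative.
  nonneg-monos : List Poly → List Poly
  nonneg-monos ps = map (λ m → (m , 1ℤ) ∷ []) (monos (mkRows 0 ps))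

  checkℕ : List Poly → Sys → Bool
  checkℕ hs (a ≤' b) = certified (negP a b ∷ hs ++ nonneg-monos (negP a b ∷ hs))
  checkℕ hs (a ≡' b) = certified (negP a b ∷ hs ++ nonneg-monos (negP a b ∷ hs))
    ∧ certified (negP b a ∷ hs ++ nonneg-monos (negP b a ∷ hs))
  checkℕ hs (r ⇒ s) = checkℕ (relP r ++ hs) s

  evN : List ℕ → E → ℕ
  evN ρ (var i) = look 0 ρ i
  evN ρ (κ n) = n
  evN ρ (a ⊕ b) = evN ρ a ℕ.+ evN ρ b
  evN ρ (a ⊗ b) = evN ρ a ℕ.* evN ρ b
  evN ρ (a ⊖ b) = 0

  -- Subtraction on ℕ is truncated and does not match that of ℤ, so terms with `⊖`, to which `evN`
  -- gives the dummy value 0, are rejected.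
  noSub : E → Bool
  noSub (var i) = true
  noSub (κ n) = true
  noSub (a ⊕ b) = noSub a ∧ noSub b
  noSub (a ⊗ b) = noSub a ∧ noSub b
  noSub (a ⊖ b) = false

  noSubR : Rel → Bool
  noSubR (a ≤' b) = noSub a ∧ noSub b
  noSubR (a ≡' b) = noSub a ∧ noSub b

  noSubS : Sys → Bool
  noSubS (a ≤' b) = noSub a ∧ noSub b
  noSubS (a ≡' b) = noSub a ∧ noSub b
  noSubS (r ⇒ s) = noSubR r ∧ noSubS s

  ⟦_⟧RN : Rel → List ℕ → Set
  ⟦ a ≤' b ⟧RN ρ = evN ρ a ℕ.≤ evN ρ b
  ⟦ a ≡' b ⟧RN ρ = evN ρ a ≡ evN ρ b

  ⟦_⟧SN : Sys → List ℕ → Set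
  ⟦ a ≤' b ⟧SN ρ = evN ρ a ℕ.≤ evN ρ b
  ⟦ a ≡' b ⟧SN ρ = evN ρ a ≡ evN ρ b
  ⟦ r ⇒ s ⟧SN ρ = ⟦ r ⟧RN ρ → ⟦ s ⟧SN ρ

  module _ (ν : List ℕ) where
    ρ⁺ : List ℤ
    ρ⁺ = map +_ ν
    open Sound ρ⁺

    look-map : ∀ (ν : List ℕ) i → look 0ℤ (map +_ ν) i ≡ + look 0 ν i
    look-map [] i = refl
    look-map (x ∷ ν) zero = refl
    look-map (x ∷ ν) (suc i) = look-map ν i

    evN-ev : ∀ e → T (noSub e) → evE ρ⁺ e ≡ + evN ν e
    evN-ev (var i) _ = look-map ν i
    evN-ev (κ n) _ = refl
    evN-ev (a ⊕ b) t with Equivalence.to (T-∧ {noSub a}) t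
    ... | p , q rewrite evN-ev a p | evN-ev b q = refl
    evN-ev (a ⊗ b) t with Equivalence.to (T-∧ {noSub a}) t
    ... | p , q rewrite evN-ev a p | evN-ev b q = sym (pos-* (evN ν a) (evN ν b))

    evM-nonneg : ∀ m → ∃ λ k → evM ρ⁺ m ≡ + k
    evM-nonneg [] = 1 , refl
    evM-nonneg (x ∷ m) with evM-nonneg m
    ... | k , e rewrite e | look-map ν x = look 0 ν x ℕ.* k , sym (ℤP.pos-* (look 0 ν x) k)

    monos-nonneg : ∀ ms → Nonneg (map (λ m → (m , 1ℤ) ∷ []) ms)
    monos-nonneg [] = tt
    monos-nonneg (m ∷ ms) with evM-nonneg m
    ... | k , e rewrite e | ℤP.+-identityʳ (1ℤ ℤ.* + k) | ℤP.*-identityˡ (+ k) = +≤+ ℕ.z≤n , monos-nonneg ms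

    toR : ∀ r → T (noSubR r) → ⟦ r ⟧RN ν → ⟦ r ⟧R ρ⁺
    toR (a ≤' b) t h with Equivalence.to (T-∧ {noSub a}) t
    ... | p , q rewrite evN-ev a p | evN-ev b q = +≤+ h
    toR (a ≡' b) t h with Equivalence.to (T-∧ {noSub a}) t
    ... | p , q rewrite evN-ev a p | evN-ev b q = cong +_ h

    refuteℕ : ∀ hs a b → T (certified (negP a b ∷ hs ++ nonneg-monos (negP a b ∷ hs))) →
      Nonneg hs → evE ρ⁺ a ℤ.≤ evE ρ⁺ b
    refuteℕ hs a b t h = refute ρ⁺ _ a b t (Nonneg-++ hs h (monos-nonneg (monos (mkRows 0 (negP a b ∷ hs)))))

    leN : ∀ a b → T (noSub a ∧ noSub b) → evE ρ⁺ a ℤ.≤ evE ρ⁺ b → evN ν a ℕ.≤ evN ν b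
    leN a b t h with Equivalence.to (T-∧ {noSub a}) t
    ... | p , q = ℤP.drop‿+≤+ (subst₂ ℤ._≤_ (evN-ev a p) (evN-ev b q) h)

    checkℕ-sound : ∀ hs s → T (noSubS s) → T (checkℕ hs s) → Nonneg hs → ⟦ s ⟧SN ν
    checkℕ-sound hs (a ≤' b) ns t h = leN a b ns (refuteℕ hs a b t h)
    checkℕ-sound hs (a ≡' b) ns t h with Equivalence.to (T-∧ {noSub a}) ns
      | Equivalence.to (T-∧ {certified (negP a b ∷ hs ++ nonneg-monos (negP a b ∷ hs))}) t
    ... | p , q | t1 , t2 = ℤP.+-injective (trans (sym (evN-ev a p)) (trans
        (ℤP.≤-antisym (refuteℕ hs a b t1 h) (refuteℕ hs b a t2 h)) (evN-ev b q)))
    checkℕ-sound hs (r ⇒ s) ns t h g with Equivalence.to (T-∧ {noSubR r}) ns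
    ... | n1 , n2 = checkℕ-sound (relP r ++ hs) s n2 t (Nonneg-++ (relP r) (relP-nonneg ρ⁺ r (toR r n1 g)) h)

  linℕ : ∀ n (f : SysFun n) →
    T (noSubS (close n 0 f) ∧ checkℕ [] (close n 0 f)) → Allⁿ n ⟦ close n 0 f ⟧SN
  linℕ n f t with Equivalence.to (T-∧ {noSubS (close n 0 f)}) t
  ... | s , t' = allⁿ n λ ρ → checkℕ-sound ρ [] (close n 0 f) s t' tt

open Linear using (lin; linℕ; κ; _⊕_; _⊗_; _⊖_; _≤'_; _≡'_; _<'_; _⇒_)

pos≥0 : ∀ {n} → 0ℤ ≤ + n
pos≥0 = +≤+ z≤n

opaque
  unfolding _*_

  *-nonneg : ∀ {a b} → 0ℤ ≤ a → 0ℤ ≤ b → 0ℤ ≤ a * b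
  *-nonneg {+ m} {+ n} _ _ = subst (0ℤ ≤_) (pos-* m n) pos≥0

  *-cancel : ∀ {c a b} → 1ℤ ≤ c → c * a ≤ c * b → a ≤ b
  *-cancel {+ suc n} {a} {b} _ h = *-cancelˡ-≤-pos a b (+ suc n) h
  *-cancel {+ 0} (+≤+ ())

*-monoˡ : ∀ {c a b} → 0ℤ ≤ c → a ≤ b → c * a ≤ c * b
*-monoˡ {c} {a} {b} hc h =
  lin 3 (λ c a b → κ 0 ≤' c ⊗ (b ⊖ a) ⇒ c ⊗ a ≤' c ⊗ b) tt c a b (*-nonneg hc (i≤j⇒0≤j-i h))

*-monoʳ : ∀ {c a b} → 0ℤ ≤ c → a ≤ b → a * c ≤ b * c
*-monoʳ {c} {a} {b} hc h =
  lin 3 (λ c a b → κ 0 ≤' c ⊗ (b ⊖ a) ⇒ a ⊗ c ≤' b ⊗ c) tt c a b (*-nonneg hc (i≤j⇒0≤j-i h))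

*-mono : ∀ {a b c d} → 0ℤ ≤ a → a ≤ b → 0ℤ ≤ c → c ≤ d → a * c ≤ b * d
*-mono ha h hc k = ≤-trans (*-monoʳ hc h) (*-monoˡ (≤-trans ha h) k)

*-≥1 : ∀ {a b} → 1ℤ ≤ a → 1ℤ ≤ b → 1ℤ ≤ a * b
*-≥1 {a} {b} h k = subst (_≤ a * b) (*-identityˡ 1ℤ) (*-mono {1ℤ} pos≥0 h pos≥0 k)

suc≤sq : ∀ k → + suc k ≤ + suc k * + suc k
suc≤sq k = subst (+ suc k ≤_) (pos-* (suc k) (suc k)) (+≤+ (m≤m*n (suc k) (suc k)))

*-cancel-≡ : ∀ {c a b} → 1ℤ ≤ c → c * a ≡ c * b → a ≡ b
*-cancel-≡ h e = ≤-antisym (*-cancel h (≤-reflexive e)) (*-cancel h (≤-reflexive (sym e)))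

≤+ʳ : ∀ {a b} → 0ℤ ≤ b → a ≤ a + b
≤+ʳ {a} {b} h = lin 2 (λ a b → κ 0 ≤' b ⇒ a ≤' a ⊕ b) tt a b h

≤+ˡ : ∀ {a b} → 0ℤ ≤ a → b ≤ a + b
≤+ˡ {a} {b} h = lin 2 (λ a b → κ 0 ≤' a ⇒ b ≤' a ⊕ b) tt a b h

neg-≤ : ∀ {a b} → 0ℤ - a ≤ b → - a ≤ b
neg-≤ {a} {b} = subst (_≤ b) (+-identityˡ (- a))

neg-≤⁻¹ : ∀ {a b} → - a ≤ b → 0ℤ - a ≤ b
neg-≤⁻¹ {a} {b} = subst (_≤ b) (sym (+-identityˡ (- a)))

-- Finite sums

∑ : ℕ → (ℕ → ℤ) → ℤ
∑ zero f = 0ℤ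
∑ (suc n) f = ∑ n f + f (suc n)

∑-cong : ∀ x {f g : ℕ → ℤ} → (∀ n → 1 ℕ.≤ n → n ℕ.≤ x → f n ≡ g n) → ∑ x f ≡ ∑ x g
∑-cong zero h = refl
∑-cong (suc x) h = cong₂ _+_ (∑-cong x λ n a b → h n a (m≤n⇒m≤1+n b)) (h (suc x) (s≤s z≤n) ℕP.≤-refl)

∑-ext : ∀ x {f g : ℕ → ℤ} → (∀ n → f n ≡ g n) → ∑ x f ≡ ∑ x g
∑-ext x h = ∑-cong x λ n _ _ → h n

∑-mono : ∀ x {f g : ℕ → ℤ} → (∀ n → 1 ℕ.≤ n → n ℕ.≤ x → f n ≤ g n) → ∑ x f ≤ ∑ x g
∑-mono zero h = ≤-refl
∑-mono (suc x) h = +-mono-≤ (∑-mono x λ n a b → h n a (m≤n⇒m≤1+n b)) (h (suc x) (s≤s z≤n) ℕP.≤-refl)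

∑-+ : ∀ x (f g : ℕ → ℤ) → ∑ x (λ n → f n + g n) ≡ ∑ x f + ∑ x g
∑-+ zero f g = refl
∑-+ (suc x) f g rewrite ∑-+ x f g =
  lin 4 (λ a b c d → a ⊕ b ⊕ (c ⊕ d) ≡' a ⊕ c ⊕ (b ⊕ d)) tt (∑ x f) (∑ x g) (f (suc x)) (g (suc x))

∑-- : ∀ x (f g : ℕ → ℤ) → ∑ x (λ n → f n - g n) ≡ ∑ x f - ∑ x g
∑-- zero f g = refl
∑-- (suc x) f g rewrite ∑-- x f g =
  lin 4 (λ a b c d → a ⊖ b ⊕ (c ⊖ d) ≡' a ⊕ c ⊖ (b ⊕ d)) tt (∑ x f) (∑ x g) (f (suc x)) (g (suc x))

∑-*ˡ : ∀ x c (f : ℕ → ℤ) → ∑ x (λ n → c * f n) ≡ c * ∑ x f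
∑-*ˡ zero c f = sym (*-zeroʳ c)
∑-*ˡ (suc x) c f rewrite ∑-*ˡ x c f = sym (*-distribˡ-+ c (∑ x f) (f (suc x)))

∑-*ʳ : ∀ x c (f : ℕ → ℤ) → ∑ x (λ n → f n * c) ≡ ∑ x f * c
∑-*ʳ x c f = trans (∑-ext x λ n → *-comm (f n) c) (trans (∑-*ˡ x c f) (*-comm c (∑ x f)))

∑-const : ∀ x c → ∑ x (λ _ → c) ≡ + x * c
∑-const zero c = sym (*-zeroˡ c)
∑-const (suc x) c rewrite ∑-const x c = lin 2 (λ x c → x ⊗ c ⊕ c ≡' (κ 1 ⊕ x) ⊗ c) tt (+ x) c

∑-zero : ∀ x {f : ℕ → ℤ} → (∀ n → 1 ℕ.≤ n → n ℕ.≤ x → f n ≡ 0ℤ) → ∑ x f ≡ 0ℤ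
∑-zero x h = trans (∑-cong x h) (trans (∑-const x 0ℤ) (*-zeroʳ (+ x)))

∑-nonneg : ∀ x {f : ℕ → ℤ} → (∀ n → 1 ℕ.≤ n → n ℕ.≤ x → 0ℤ ≤ f n) → 0ℤ ≤ ∑ x f
∑-nonneg zero h = ≤-refl
∑-nonneg (suc x) h = +-mono-≤ (∑-nonneg x λ n a b → h n a (m≤n⇒m≤1+n b)) (h (suc x) (s≤s z≤n) ℕP.≤-refl)

∑-swap : ∀ x y (f : ℕ → ℕ → ℤ) → ∑ x (λ i → ∑ y (f i)) ≡ ∑ y (λ j → ∑ x (λ i → f i j))
∑-swap zero y f = sym (∑-zero y λ _ _ _ → refl)
∑-swap (suc x) y f rewrite ∑-swap x y f = sym (∑-+ y (λ j → ∑ x (λ i → f i j)) (f (suc x)))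

∑-* : ∀ x y (f g : ℕ → ℤ) → ∑ x f * ∑ y g ≡ ∑ x (λ i → ∑ y (λ j → f i * g j))
∑-* x y f g = trans (sym (∑-*ʳ x (∑ y g) f)) (∑-ext x λ i → sym (∑-*ˡ y (f i) g))

∑-split : ∀ a b (f : ℕ → ℤ) → ∑ (a ℕ.+ b) f ≡ ∑ a f + ∑ b (λ n → f (a ℕ.+ n))
∑-split a zero f rewrite ℕP.+-identityʳ a = sym (+-identityʳ _)
∑-split a (suc b) f rewrite +-suc a b | ∑-split a b f = +-assoc (∑ a f) _ _

∑-extend : ∀ {x y} {f : ℕ → ℤ} → x ℕ.≤ y → (∀ n → x < n → n ℕ.≤ y → f n ≡ 0ℤ) → ∑ y f ≡ ∑ x f
∑-extend {x} {y} {f} h z with m≤n⇒∃[o]m+o≡n h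
... | o , refl = trans (∑-split x o f) (trans
  (cong (λ z → ∑ x f + z) (∑-zero o λ n a b → z (x ℕ.+ n) (linℕ 2 (λ x n → κ 1 ≤' n ⇒ κ 1 ⊕ x ≤' x ⊕ n) tt x n a) (ℕP.+-monoʳ-≤ x b)))
  (+-identityʳ _))

∑-range : ∀ {x y} {f : ℕ → ℤ} → x ℕ.≤ y → (∀ n → x < n → n ℕ.≤ y → 0ℤ ≤ f n) → ∑ x f ≤ ∑ y f
∑-range {x} {y} {f} h z with m≤n⇒∃[o]m+o≡n h
... | o , refl = subst (∑ x f ≤_) (sym (∑-split x o f)) (≤-trans (≤-reflexive (sym (+-identityʳ _)))
  (+-monoʳ-≤ (∑ x f) (∑-nonneg o λ n a b → z (x ℕ.+ n) (linℕ 2 (λ x n → κ 1 ≤' n ⇒ κ 1 ⊕ x ≤' x ⊕ n) tt x n a) (ℕP.+-monoʳ-≤ x b))))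

∑-single : ∀ {x k} {f : ℕ → ℤ} → 1 ℕ.≤ k → k ℕ.≤ x → (∀ n → 1 ℕ.≤ n → n ℕ.≤ x → n ≢ k → f n ≡ 0ℤ) → ∑ x f ≡ f k
∑-single {x} {suc k} {f} (s≤s _) h z = trans
  (∑-extend h λ n a b → z n (ℕP.≤-trans (s≤s z≤n) a) b λ e → <⇒≢ a (sym e))
  (trans (cong (_+ f (suc k)) (∑-zero k λ n a b → z n a (ℕP.≤-trans (m≤n⇒m≤1+n b) h) λ e → <⇒≢ (s≤s b) e))
    (+-identityˡ _))

∑-term : ∀ {x k} {f : ℕ → ℤ} → 1 ℕ.≤ k → k ℕ.≤ x → (∀ n → 1 ℕ.≤ n → n ℕ.≤ x → 0ℤ ≤ f n) → f k ≤ ∑ x f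
∑-term {x} {suc k} {f} _ h z = ≤-trans
  (≤-trans (≤-reflexive (sym (+-identityˡ _)))
    (+-monoˡ-≤ (f (suc k)) (∑-nonneg k λ n a b → z n a (ℕP.≤-trans (m≤n⇒m≤1+n b) h))))
  (∑-range h λ n a b → z n (ℕP.≤-trans (s≤s z≤n) a) b)

-- Bounds for absolute values

infix 4 _≲_
-- |a| ≤ b, as two inequalities that can be handed to `lin`.
_≲_ : ℤ → ℤ → Set
a ≲ b = (- b ≤ a) × (a ≤ b)

≲-+ : ∀ {a b c d} → a ≲ b → c ≲ d → a + c ≲ b + d
≲-+ {a} {b} {c} {d} (p , q) (r , s) = subst (_≤ a + c) (sym (neg-distrib-+ b d)) (+-mono-≤ p r) , +-mono-≤ q s

≲-*ˡ : ∀ {c a b} → 0ℤ ≤ c → a ≲ b → c * a ≲ c * b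
≲-*ˡ {c} {a} {b} h (p , q) = subst (_≤ c * a) (sym (neg-distribʳ-* c b)) (*-monoˡ h p) , *-monoˡ h q

≲-neg : ∀ {a b} → a ≲ b → - a ≲ b
≲-neg {a} {b} (p , q) = neg-mono-≤ q , subst (- a ≤_) (neg-involutive b) (neg-mono-≤ p)

≲-trans : ∀ {a b c} → a ≲ b → b ≤ c → a ≲ c
≲-trans (p , q) h = ≤-trans (neg-mono-≤ h) p , ≤-trans q h

≲-nonneg : ∀ {a b} → 0ℤ ≤ a → a ≤ b → a ≲ b
≲-nonneg {a} {b} h k = ≤-trans (neg-mono-≤ (≤-trans h k)) h , k

≲-bound : ∀ {a b} → a ≲ b → 0ℤ ≤ b
≲-bound {a} {b} (p , q) with ≤-total 0ℤ b
... | inj₁ h = h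
... | inj₂ h = lin 3 (λ a b c → c ≤' a ⇒ a ≤' b ⇒ c ⊕ b ≡' κ 0 ⇒ κ 0 ≤' b) tt a b (- b) p q (+-inverseˡ b)

≲-zero : ∀ {b} → 0ℤ ≤ b → 0ℤ ≲ b
≲-zero h = ≲-nonneg ≤-refl h

≲-* : ∀ {a b c d} → a ≲ b → c ≲ d → a * c ≲ b * d
≲-* {a} {b} {c} {d} hb@(p , q) hd@(r , s) with ≤-total 0ℤ a
... | inj₁ h = ≲-trans (≲-*ˡ h hd) (*-monoʳ (≲-bound hd) q)
... | inj₂ h = ≲-trans (subst (_≲ (- a) * d) eq (≲-*ˡ (neg-mono-≤ h) (≲-neg hd)))
    (*-monoʳ (≲-bound hd) (proj₂ (≲-neg hb)))
  where
  eq : - a * - c ≡ a * c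
  eq = trans (sym (neg-distribˡ-* a (- c))) (trans (cong -_ (sym (neg-distribʳ-* a c))) (neg-involutive (a * c)))

∑-≲ : ∀ x {f g : ℕ → ℤ} → (∀ n → 1 ℕ.≤ n → n ℕ.≤ x → f n ≲ g n) → ∑ x f ≲ ∑ x g
∑-≲ zero h = ≤-refl , ≤-refl
∑-≲ (suc x) h = ≲-+ (∑-≲ x λ n a b → h n a (m≤n⇒m≤1+n b)) (h (suc x) (s≤s z≤n) ℕP.≤-refl)

-- Indicator functions

opaque
  𝟙 : ∀ {P : Set} → Dec P → ℤ
  𝟙 d = if does d then 1ℤ else 0ℤ

  𝟙-yes : ∀ {P : Set} (d : Dec P) → P → 𝟙 d ≡ 1ℤ
  𝟙-yes (yes _) p = refl
  𝟙-yes (no np) p = contradiction p np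

  𝟙-no : ∀ {P : Set} (d : Dec P) → ¬ P → 𝟙 d ≡ 0ℤ
  𝟙-no (yes p) np = contradiction p np
  𝟙-no (no _) np = refl

  𝟙-cong : ∀ {P Q : Set} (d : Dec P) (e : Dec Q) → (P → Q) → (Q → P) → 𝟙 d ≡ 𝟙 e
  𝟙-cong (yes p) e f g = sym (𝟙-yes e (f p))
  𝟙-cong (no np) e f g = sym (𝟙-no e (np ∘ g))

  𝟙-nonneg : ∀ {P : Set} (d : Dec P) → 0ℤ ≤ 𝟙 d
  𝟙-nonneg (yes _) = pos≥0
  𝟙-nonneg (no _) = pos≥0

  𝟙≤1 : ∀ {P : Set} (d : Dec P) → 𝟙 d ≤ 1ℤ
  𝟙≤1 (yes _) = ≤-refl
  𝟙≤1 (no _) = pos≥0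

𝟙-case : ∀ {P : Set} (d : Dec P) → (P × 𝟙 d ≡ 1ℤ) ⊎ (¬ P × 𝟙 d ≡ 0ℤ)
𝟙-case (yes p) = inj₁ (p , 𝟙-yes (yes p) p)
𝟙-case (no np) = inj₂ (np , 𝟙-no (no np) np)

𝟙-* : ∀ {P : Set} (d : Dec P) {a b : ℤ} → (P → a ≡ b) → 𝟙 d * a ≡ 𝟙 d * b
𝟙-* d {a} {b} h with 𝟙-case d
... | inj₁ (p , e) = cong (𝟙 d *_) (h p)
... | inj₂ (_ , e) rewrite e = trans (*-zeroˡ a) (sym (*-zeroˡ b))

𝟙-*-≤ : ∀ {P : Set} (d : Dec P) {a b : ℤ} → (P → a ≤ b) → 𝟙 d * a ≤ 𝟙 d * b
𝟙-*-≤ d {a} {b} h with 𝟙-case d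
... | inj₁ (p , e) = *-monoˡ (𝟙-nonneg d) (h p)
... | inj₂ (_ , e) rewrite e = ≤-reflexive (trans (*-zeroˡ a) (sym (*-zeroˡ b)))

-- Floor quotients and divisor sums

infixl 7 _÷_

opaque
  -- Division with x ÷ 0 = 0.
  _÷_ : ℕ → ℕ → ℕ
  x ÷ zero = 0
  x ÷ suc d = x ℕ./ suc d

  ÷-≤ : ∀ {x d m} → 1 ℕ.≤ d → m ℕ.≤ x ÷ d → d ℕ.* m ℕ.≤ x
  ÷-≤ {x} {suc d} {m} _ h = ℕP.≤-trans (*-monoʳ-≤ (suc d) h) (subst (ℕ._≤ x) (ℕP.*-comm (x ℕ./ suc d) (suc d)) (DM.m/n*n≤m x (suc d)))

  ≤-÷ : ∀ {x d m} → 1 ℕ.≤ d → d ℕ.* m ℕ.≤ x → m ℕ.≤ x ÷ d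
  ≤-÷ {x} {suc d} {m} _ h = subst (ℕ._≤ x ℕ./ suc d) (DM.m*n/n≡m m (suc d)) (DM./-monoˡ-≤ (suc d) (subst (ℕ._≤ x) (ℕP.*-comm (suc d) m) h))

  ÷-≤x : ∀ x d → x ÷ d ℕ.≤ x
  ÷-≤x x zero = z≤n
  ÷-≤x x (suc d) = DM.m/n≤m x (suc d)

≤-ext : ∀ {a b} → (∀ m → m ℕ.≤ a → m ℕ.≤ b) → (∀ m → m ℕ.≤ b → m ℕ.≤ a) → a ≡ b
≤-ext {a} {b} f g = ℕP.≤-antisym (f a ℕP.≤-refl) (g b ℕP.≤-refl)

÷-÷ : ∀ x {d e} → 1 ℕ.≤ d → 1 ℕ.≤ e → x ÷ d ÷ e ≡ x ÷ (d ℕ.* e)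
÷-÷ x {d} {e} hd he = ≤-ext
  (λ m h → ≤-÷ (*-mono-≤ hd he) (subst (ℕ._≤ x) (sym (ℕP.*-assoc d e m)) (÷-≤ hd (÷-≤ he h))))
  (λ m h → ≤-÷ he (≤-÷ hd (subst (ℕ._≤ x) (ℕP.*-assoc d e m) (÷-≤ (*-mono-≤ hd he) h))))

÷-comm : ∀ x {d e} → 1 ℕ.≤ d → 1 ℕ.≤ e → x ÷ d ÷ e ≡ x ÷ e ÷ d
÷-comm x {d} {e} hd he = trans (÷-÷ x hd he) (trans (cong (x ÷_) (ℕP.*-comm d e)) (sym (÷-÷ x he hd)))

÷-mono : ∀ {x y d} → 1 ℕ.≤ d → x ℕ.≤ y → x ÷ d ℕ.≤ y ÷ d
÷-mono hd h = ≤-÷ hd (ℕP.≤-trans (÷-≤ hd ℕP.≤-refl) h)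

÷-lt : ∀ x {d} → 1 ℕ.≤ d → x < d ℕ.* suc (x ÷ d)
÷-lt x {d} hd with x ℕ.<? d ℕ.* suc (x ÷ d)
... | yes p = p
... | no np = contradiction (≤-÷ hd (≮⇒≥ np)) (ℕP.<⇒≱ ℕP.≤-refl)

÷-pos : ∀ {x d} → 1 ℕ.≤ d → d ℕ.≤ x → 1 ℕ.≤ x ÷ d
÷-pos {x} {d} hd h = ≤-÷ hd (subst (ℕ._≤ x) (sym (ℕP.*-identityʳ d)) h)

∑-÷ : ∀ x {d} (f : ℕ → ℤ) → 1 ℕ.≤ d → ∑ (x ÷ d) f ≡ ∑ x (λ m → 𝟙 (d ℕ.* m ℕ.≤? x) * f m)
∑-÷ x {d} f hd = sym (trans
  (∑-extend (÷-≤x x d) λ n a b → trans (cong (_* f n) (𝟙-no (d ℕ.* n ℕ.≤? x) λ h → ℕP.<⇒≱ a (≤-÷ hd h))) (*-zeroˡ (f n)))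
  (∑-cong (x ÷ d) λ n a b → trans (cong (_* f n) (𝟙-yes (d ℕ.* n ℕ.≤? x) (÷-≤ hd b))) (*-identityˡ (f n))))

-- Both sides run over the pairs with d m ≤ x; an indicator of this condition makes the two ranges
-- independent.
∑∑-swap : ∀ x (h : ℕ → ℕ → ℤ) → ∑ x (λ d → ∑ (x ÷ d) (h d)) ≡ ∑ x (λ m → ∑ (x ÷ m) (λ d → h d m))
∑∑-swap x h = trans (∑-cong x λ d a _ → ∑-÷ x (h d) a) (trans (∑-swap x x _)
  (∑-cong x λ m a _ → sym (trans (∑-÷ x (λ d → h d m) a) (∑-ext x λ d → cong (_* h d m)
    (𝟙-cong (m ℕ.* d ℕ.≤? x) (d ℕ.* m ℕ.≤? x) (subst (ℕ._≤ x) (ℕP.*-comm m d)) (subst (ℕ._≤ x) (ℕP.*-comm d m)))))))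

∑-multiples : ∀ x {k} (g : ℕ → ℤ) → 1 ℕ.≤ k → ∑ (x ÷ k) (λ j → g (k ℕ.* j)) ≡ ∑ x (λ n → 𝟙 (k ∣? n) * g n)
∑-multiples zero {k} g hk = cong (λ z → ∑ z (λ j → g (k ℕ.* j))) (n≤0⇒n≡0 (÷-≤x 0 k))
∑-multiples (suc x) {k} g hk with 𝟙-case (k ∣? suc x)
... | inj₁ (divides q e , i) rewrite i = trans (cong (λ z → ∑ z (λ j → g (k ℕ.* j))) eq)
    (cong₂ _+_ (∑-multiples x g hk) (trans (cong g (trans (cong (k ℕ.*_) (sym q≡)) (sym kq))) (sym (*-identityˡ (g (suc x))))))
  where
  kq : suc x ≡ k ℕ.* q
  kq = trans e (ℕP.*-comm q k)
  eq1 : suc x ÷ k ≡ q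
  eq1 = ≤-ext (λ m h → *-cancelˡ-≤ k {{ℕ.>-nonZero hk}} (subst (k ℕ.* m ℕ.≤_) kq (÷-≤ hk h)))
    (λ m h → ≤-÷ hk (subst (k ℕ.* m ℕ.≤_) (sym kq) (*-monoʳ-≤ k h)))
  q≡ : q ≡ suc (x ÷ k)
  q≡ = ≤-ext lo λ m h → hi m h
    where
    lo : ∀ m → m ℕ.≤ q → m ℕ.≤ suc (x ÷ k)
    lo zero h = z≤n
    lo (suc m) h = s≤s (≤-÷ hk (≤-pred (ℕP.≤-trans (ℕP.≤-trans
      (linℕ 3 (λ k m q → κ 1 ≤' k ⇒ κ 1 ⊕ k ⊗ m ≤' k ⊗ (κ 1 ⊕ m)) tt k m q hk) (*-monoʳ-≤ k h)) (ℕP.≤-reflexive (sym kq)))))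
    hi : ∀ m → m ℕ.≤ suc (x ÷ k) → m ℕ.≤ q
    hi m h = ℕP.≤-trans h (ℕP.*-cancelˡ-< k (x ÷ k) q (ℕP.<-≤-trans (s≤s (÷-≤ hk ℕP.≤-refl)) (ℕP.≤-reflexive kq)))
  eq : suc x ÷ k ≡ suc (x ÷ k)
  eq = trans eq1 q≡
... | inj₂ (nd , i) rewrite i = trans (cong (λ z → ∑ z (λ j → g (k ℕ.* j))) eq)
    (trans (∑-multiples x g hk) (trans (sym (+-identityʳ _)) (cong (λ z → ∑ x (λ n → 𝟙 (k ∣? n) * g n) + z) (sym (*-zeroˡ (g (suc x)))))))
  where
  eq : suc x ÷ k ≡ x ÷ k
  eq = ≤-ext (λ m h → ≤-÷ hk (≤-pred (ℕP.≤∧≢⇒< (÷-≤ hk h) λ e → nd (divides m (trans (sym e) (ℕP.*-comm k m))))))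
    (λ m h → ≤-÷ hk (m≤n⇒m≤1+n (÷-≤ hk h)))

-- The Dirichlet convolution of f with the constant 1.
σ : (ℕ → ℤ) → ℕ → ℤ
σ f n = ∑ n (λ d → 𝟙 (d ∣? n) * f d)

σ-extend : ∀ {x n} (f : ℕ → ℤ) → 1 ℕ.≤ n → n ℕ.≤ x → ∑ x (λ d → 𝟙 (d ∣? n) * f d) ≡ σ f n
σ-extend {x} {n} f hn h = ∑-extend h λ d a _ → trans
  (cong (_* f d) (𝟙-no (d ∣? n) λ dv → ℕP.<⇒≱ a (Dv.∣⇒≤ {{ℕ.>-nonZero hn}} dv))) (*-zeroˡ (f d))

∑∑-σ : ∀ x (f G : ℕ → ℤ) → ∑ x (λ k → ∑ (x ÷ k) (λ j → f k * G (k ℕ.* j))) ≡ ∑ x (λ n → σ f n * G n)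
∑∑-σ x f G = trans (∑-cong x λ k a _ → ∑-multiples x (λ n → f k * G n) a) (trans (∑-swap x x _)
  (∑-cong x λ n a b → trans (∑-ext x λ k → sym (*-assoc (𝟙 (k ∣? n)) (f k) (G n)))
    (trans (∑-*ʳ x (G n) (λ k → 𝟙 (k ∣? n) * f k)) (cong (_* G n) (σ-extend f a b)))))

-- Binary logarithms

bump : ∀ {P : Set} → ℕ → Dec P → ℕ
bump k (yes _) = suc k
bump k (no _) = k

opaque
  -- ⌊log₂ n⌋, with lg 0 = 0.
  lg : ℕ → ℕ
  lg zero = 0
  lg (suc n) = bump (lg n) (2 ^ suc (lg n) ℕ.≤? suc n)

  lg-suc : ∀ n → lg (suc n) ≡ bump (lg n) (2 ^ suc (lg n) ℕ.≤? suc n)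
  lg-suc n = refl

  lg-0 : lg 0 ≡ 0
  lg-0 = refl

  lg-1 : lg 1 ≡ 0
  lg-1 = refl

2^≥1 : ∀ k → 1 ℕ.≤ 2 ^ k
2^≥1 k = m^n>0 2 k

lg-upper : ∀ n → n < 2 ^ suc (lg n)
lg-upper zero = subst (λ k → 0 < 2 ^ suc k) (sym lg-0) (s≤s z≤n)
lg-upper (suc n) = subst (λ k → suc n < 2 ^ suc k) (sym (lg-suc n)) (go (2 ^ suc (lg n) ℕ.≤? suc n))
  where
  go : ∀ d → suc n < 2 ^ suc (bump (lg n) d)
  go (no p) = ≰⇒> p
  go (yes p) = linℕ 2 (λ n a → κ 1 ⊕ n ≤' a ⇒ κ 1 ≤' a ⇒ κ 1 ⊕ (κ 1 ⊕ n) ≤' a ⊕ (a ⊕ κ 0)) tt n (2 ^ suc (lg n)) (lg-upper n) (2^≥1 (suc (lg n)))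

-- The exact place of a jump is recorded, because the closed formulas for sums with `lg` are proved
-- by induction across the powers of 2.
data LgStep (n : ℕ) : Set where
  same : lg (suc n) ≡ lg n → LgStep n
  jump : lg (suc n) ≡ suc (lg n) → suc n ≡ 2 ^ suc (lg n) → LgStep n

lg-step : ∀ n → LgStep n
lg-step n = go (2 ^ suc (lg n) ℕ.≤? suc n) (lg-suc n)
  where
  go : ∀ d → lg (suc n) ≡ bump (lg n) d → LgStep n
  go (yes p) e = jump e (ℕP.≤-antisym (lg-upper n) p)
  go (no _) e = same e

lg-lower′ : ∀ n → 2 ^ lg (suc n) ℕ.≤ suc n
lg-lower′ zero = subst (λ k → 2 ^ k ℕ.≤ 1) (sym lg-1) (s≤s z≤n)
lg-lower′ (suc n) with lg-step (suc n)
... | same e = subst (λ k → 2 ^ k ℕ.≤ suc (suc n)) (sym e) (m≤n⇒m≤1+n (lg-lower′ n))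
... | jump e p = subst (λ k → 2 ^ k ℕ.≤ suc (suc n)) (sym e) (ℕP.≤-reflexive (sym p))

lg-lower : ∀ {n} → 1 ℕ.≤ n → 2 ^ lg n ℕ.≤ n
lg-lower {suc n} _ = lg-lower′ n

2^-cancel-< : ∀ {a b} → 2 ^ a < 2 ^ b → a < b
2^-cancel-< {a} {b} h with a ℕ.<? b
... | yes p = p
... | no np = contradiction (^-monoʳ-≤ 2 (≮⇒≥ np)) (ℕP.<⇒≱ h)

≤-lg : ∀ {n j} → 2 ^ j ℕ.≤ n → j ℕ.≤ lg n
≤-lg {n} h = ≤-pred (2^-cancel-< (≤-<-trans h (lg-upper n)))

lg-< : ∀ {n j} → n < 2 ^ suc j → lg n ℕ.≤ j
lg-< {zero} {j} h = subst (ℕ._≤ j) (sym lg-0) z≤n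
lg-< {suc n} h = ≤-pred (2^-cancel-< (≤-<-trans (lg-lower (s≤s z≤n)) h))

lg-mono : ∀ {m n} → m ℕ.≤ n → lg m ℕ.≤ lg n
lg-mono {zero} {n} h = subst (ℕ._≤ lg n) (sym lg-0) z≤n
lg-mono {suc m} h = ≤-lg (ℕP.≤-trans (lg-lower (s≤s z≤n)) h)

lg-2^ : ∀ j → lg (2 ^ j) ≡ j
lg-2^ j = ℕP.≤-antisym (lg-< (^-monoʳ-< 2 (s≤s (s≤s z≤n)) {j} {suc j} ℕP.≤-refl)) (≤-lg ℕP.≤-refl)

lg-*-≥ : ∀ {m n} → 1 ℕ.≤ m → 1 ℕ.≤ n → lg m ℕ.+ lg n ℕ.≤ lg (m ℕ.* n)
lg-*-≥ {m} {n} hm hn = ≤-lg (subst (ℕ._≤ m ℕ.* n) (sym (^-distribˡ-+-* 2 (lg m) (lg n))) (*-mono-≤ (lg-lower hm) (lg-lower hn)))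

lg-*-≤ : ∀ m n → lg (m ℕ.* n) ℕ.≤ suc (lg m ℕ.+ lg n)
lg-*-≤ m n = lg-< (subst (m ℕ.* n ℕ.<_) eq (*-mono-< (lg-upper m) (lg-upper n)))
  where
  eq : 2 ^ suc (lg m) ℕ.* 2 ^ suc (lg n) ≡ 2 ^ suc (suc (lg m ℕ.+ lg n))
  eq = trans (sym (^-distribˡ-+-* 2 (suc (lg m)) (suc (lg n)))) (cong (λ k → 2 ^ suc k) (+-suc (lg m) (lg n)))

n<2^n : ∀ n → n < 2 ^ n
n<2^n zero = s≤s z≤n
n<2^n (suc n) = linℕ 2 (λ n a → κ 1 ⊕ n ≤' a ⇒ κ 1 ≤' a ⇒ κ 1 ⊕ (κ 1 ⊕ n) ≤' a ⊕ (a ⊕ κ 0)) tt n (2 ^ n) (n<2^n n) (2^≥1 n)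

-- Summation by parts

abel-increasing : ∀ {B} (u a : ℕ → ℤ) y → (∀ m → ∑ m u ≲ B) → 0ℤ ≤ a 0 → (∀ m → m < y → a m ≤ a (suc m)) →
  ∑ y (λ m → u m * a m) ≲ + 2 * B * a y
abel-increasing {B} u a y hU h0 inc = subst₂ _≲_
    (lin 3 (λ s U a → (s ⊖ U ⊗ a) ⊕ a ⊗ U ≡' s) tt (∑ y (λ m → u m * a m)) (∑ y u) (a y))
    (lin 2 (λ B a → B ⊗ a ⊕ a ⊗ B ≡' κ 2 ⊗ B ⊗ a) tt B (a y))
    (≲-+ (core y ℕP.≤-refl) (≲-*ˡ (a≥0 y ℕP.≤-refl) (hU y)))
  where
  a≥0 : ∀ m → m ℕ.≤ y → 0ℤ ≤ a m
  a≥0 zero _ = h0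
  a≥0 (suc m) h = ≤-trans (a≥0 m (<⇒≤ h)) (inc m h)
  -- Without its boundary term the sum is bounded by B times the total variation of a. The boundary
  -- term itself gives the second half of the factor 2.
  core : ∀ m → m ℕ.≤ y → ∑ m (λ k → u k * a k) - ∑ m u * a m ≲ B * a m
  core zero _ = subst (_≲ B * a 0) (lin 1 (λ a → κ 0 ≡' κ 0 ⊖ κ 0 ⊗ a) tt (a 0)) (≲-zero (*-nonneg (≲-bound (hU 0)) h0))
  core (suc m) h = subst₂ _≲_
    (lin 5 (λ s U v a a' → (s ⊖ U ⊗ a) ⊖ (a' ⊖ a) ⊗ U ≡' s ⊕ v ⊗ a' ⊖ (U ⊕ v) ⊗ a') tt (∑ m (λ k → u k * a k)) (∑ m u) (u (suc m)) (a m) (a (suc m)))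
    (lin 3 (λ B a a' → B ⊗ a ⊕ (a' ⊖ a) ⊗ B ≡' B ⊗ a') tt B (a m) (a (suc m)))
    (≲-+ (core m (<⇒≤ h)) (≲-neg (≲-*ˡ (i≤j⇒0≤j-i (inc m h)) (hU m))))

abel-sum : ∀ (v w : ℕ → ℤ) y → ∑ y (λ m → v m * w m) ≡ ∑ y (λ m → (w m - w (suc m)) * ∑ m v) + w (suc y) * ∑ y v
abel-sum v w zero = sym (trans (+-identityˡ _) (*-zeroʳ (w 1)))
abel-sum v w (suc y) = trans (cong (_+ v (suc y) * w (suc y)) (abel-sum v w y))
  (lin 5 (λ S w' w'' A v → S ⊕ w' ⊗ A ⊕ v ⊗ w' ≡' S ⊕ (w' ⊖ w'') ⊗ (A ⊕ v) ⊕ w'' ⊗ (A ⊕ v)) tt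
    (∑ y (λ m → (w m - w (suc m)) * ∑ m v)) (w (suc y)) (w (suc (suc y))) (∑ y v) (v (suc y)))

abel-decreasing : ∀ (v w b : ℕ → ℤ) y → (∀ m → m ℕ.≤ y → ∑ m v ≲ b m) → (∀ m → 1 ℕ.≤ m → w (suc m) ≤ w m) → (∀ m → 0ℤ ≤ w m) →
  ∑ y (λ m → v m * w m) ≲ ∑ y (λ m → (w m - w (suc m)) * b m) + w (suc y) * b y
abel-decreasing v w b y hb dec hw = subst (_≲ ∑ y (λ m → (w m - w (suc m)) * b m) + w (suc y) * b y) (sym (abel-sum v w y))
  (≲-+ (∑-≲ y λ m h1 h2 → ≲-*ˡ (i≤j⇒0≤j-i (dec m h1)) (hb m h2)) (≲-*ˡ (hw (suc y)) (hb y ℕP.≤-refl)))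

telescope : ∀ (w : ℕ → ℤ) y → ∑ y (λ m → w m - w (suc m)) + w (suc y) ≡ w 1
telescope w zero = +-identityˡ (w 1)
telescope w (suc y) = trans (lin 3 (λ S w' w'' → S ⊕ (w' ⊖ w'') ⊕ w'' ≡' S ⊕ w') tt (∑ y (λ m → w m - w (suc m))) (w (suc y)) (w (suc (suc y)))) (telescope w y)

abel-bounded : ∀ {B} (v w : ℕ → ℤ) y → (∀ m → ∑ m v ≲ B) → (∀ m → 1 ℕ.≤ m → w (suc m) ≤ w m) → (∀ m → 0ℤ ≤ w m) →
  ∑ y (λ m → v m * w m) ≲ w 1 * B
abel-bounded {B} v w y hB dec hw = subst (∑ y (λ m → v m * w m) ≲_)
  (trans (cong (_+ w (suc y) * B) (∑-*ʳ y B (λ m → w m - w (suc m))))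
    (trans (sym (*-distribʳ-+ B (∑ y (λ m → w m - w (suc m))) (w (suc y)))) (cong (_* B) (telescope w y))))
  (abel-decreasing v w (λ _ → B) y (λ m _ → hB m) dec hw)

-- Full periods contribute 0, and the rest has fewer than M terms.
periodic-bounded : ∀ {M c} (u : ℕ → ℤ) → 1 ℕ.≤ M → (∀ n → u (M ℕ.+ n) ≡ u n) → ∑ M u ≡ 0ℤ → (∀ n → u n ≲ c) →
  ∀ m → ∑ m u ≲ + M * c
periodic-bounded {M} {c} u hM per zs hc = <-rec _ go
  where
  go : ∀ m → (∀ {k} → k < m → ∑ k u ≲ + M * c) → ∑ m u ≲ + M * c
  go m rec with M ℕ.≤? m
  ... | no h = ≲-trans (subst (∑ m u ≲_) (∑-const m c) (∑-≲ m λ n _ _ → hc n)) (*-monoʳ (≲-bound (hc 0)) (+≤+ (<⇒≤ (≰⇒> h))))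
  ... | yes h with m≤n⇒∃[o]m+o≡n h
  ...   | o , refl = subst (_≲ + M * c) (sym (trans (∑-split M o u) (trans (cong₂ _+_ zs (∑-ext o per)) (+-identityˡ _))))
          (rec {o} (ℕP.m<n+m o hM))

open PrimeFactorisation

-- Arithmetic functions

prime≥2 : ∀ {p} → Prime p → 2 ℕ.≤ p
prime≥2 {p} pp = ℕ.nonTrivial⇒n>1 p {{prime⇒nonTrivial pp}}

prime≥1 : ∀ {p} → Prime p → 1 ℕ.≤ p
prime≥1 pp = ℕP.≤-trans (s≤s z≤n) (prime≥2 pp)

nz : ∀ {n} → 1 ℕ.≤ n → ℕ.NonZero n
nz = ℕ.>-nonZero

factorsOf : ℕ → List ℕ
factorsOf zero = []
factorsOf (suc n) = factors (factorise (suc n))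

factorsOf-prime : ∀ n → All Prime (factorsOf n)
factorsOf-prime zero = []
factorsOf-prime (suc n) = factorsPrime (factorise (suc n))

factorsOf-product : ∀ {n} → 1 ℕ.≤ n → n ≡ product (factorsOf n)
factorsOf-product {suc n} _ = isFactorisation (factorise (suc n))

factorsOf-↭ : ∀ {n ps} → 1 ℕ.≤ n → n ≡ product ps → All Prime ps → factorsOf n ↭ ps
factorsOf-↭ {suc n} {ps} _ e h =
  factorisationUnique (factorise (suc n)) (record { factors = ps ; isFactorisation = e ; factorsPrime = h })

factorsOf-* : ∀ {m n} → 1 ℕ.≤ m → 1 ℕ.≤ n → factorsOf (m ℕ.* n) ↭ factorsOf m ++ factorsOf n
factorsOf-* {m} {n} hm hn = factorsOf-↭ (*-mono-≤ hm hn)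
  (trans (cong₂ ℕ._*_ (factorsOf-product hm) (factorsOf-product hn)) (sym (product-++ (factorsOf m) (factorsOf n))))
  (AllP.++⁺ (factorsOf-prime m) (factorsOf-prime n))

factorsOf-p : ∀ {p} → Prime p → factorsOf p ↭ p ∷ []
factorsOf-p {p} pp = factorsOf-↭ (prime≥1 pp) (sym (ℕP.*-identityʳ p)) (pp ∷ [])

prime-divisor : ∀ {n} → 2 ℕ.≤ n → ∃ λ p → Prime p × p ∣ n
prime-divisor {n} h = go (factorsOf n) (factorsOf-prime n) (factorsOf-product (ℕP.≤-trans (s≤s z≤n) h))
  where
  go : ∀ ps → All Prime ps → n ≡ product ps → ∃ λ p → Prime p × p ∣ n
  go [] _ refl = contradiction h λ { (s≤s ()) }
  go (p ∷ ps) (pp ∷ _) e = p , pp , subst (p ∣_) (sym e) (Dv.m∣m*n (product ps))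

p∤1 : ∀ {p} → Prime p → ¬ p ∣ 1
p∤1 pp d = contradiction (Dv.∣⇒≤ d) (ℕP.<⇒≱ (prime≥2 pp))

prime-∣-prime : ∀ {p q} → Prime p → Prime q → p ∣ q → p ≡ q
prime-∣-prime pp pq d with prime⇒irreducible pq d
... | inj₁ refl = contradiction pp ¬prime[1]
... | inj₂ e = e

prime-∣-^ : ∀ {p} n k → Prime p → p ∣ n ^ k → p ∣ n
prime-∣-^ n zero pp d = contradiction d (p∤1 pp)
prime-∣-^ n (suc k) pp d with euclidsLemma n (n ^ k) pp d
... | inj₁ h = h
... | inj₂ h = prime-∣-^ n k pp h

coprime-prime : ∀ {p d} → Prime p → ¬ p ∣ d → Coprime d p
coprime-prime pp nd (a , b) with prime⇒irreducible pp b
... | inj₁ e = e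
... | inj₂ refl = contradiction a nd

∣-cancel-prime : ∀ {p d n} → Prime p → ¬ p ∣ d → d ∣ p ℕ.* n → d ∣ n
∣-cancel-prime pp nd h = coprime-divisor (coprime-prime pp nd) h

∣-cancel-prime-^ : ∀ {p d n} k → Prime p → ¬ p ∣ d → d ∣ p ^ k ℕ.* n → d ∣ n
∣-cancel-prime-^ {p} {d} {n} zero pp nd h = subst (d ∣_) (ℕP.*-identityˡ n) h
∣-cancel-prime-^ {p} {d} {n} (suc k) pp nd h =
  ∣-cancel-prime-^ k pp nd (∣-cancel-prime pp nd (subst (d ∣_) (ℕP.*-assoc p (p ^ k) n) h))

record Strip (p n : ℕ) : Set where
  constructor strip
  field
    exponent cofactor : ℕ
    splitting : n ≡ p ^ exponent ℕ.* cofactor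
    indivisible : ¬ p ∣ cofactor
    positive : 1 ℕ.≤ cofactor

*-pos⁻ʳ : ∀ a {b} → 1 ℕ.≤ a ℕ.* b → 1 ℕ.≤ b
*-pos⁻ʳ a {zero} h = subst (1 ℕ.≤_) (ℕP.*-zeroʳ a) h
*-pos⁻ʳ a {suc b} _ = s≤s z≤n

stripPrime : ∀ {p} → Prime p → ∀ n → 1 ℕ.≤ n → Strip p n
stripPrime {p} pp = <-rec _ go
  where
  go : ∀ n → (∀ {m} → m < n → 1 ℕ.≤ m → Strip p m) → 1 ℕ.≤ n → Strip p n
  go n rec hn with p ∣? n
  ... | no nd = strip 0 n (sym (ℕP.*-identityˡ n)) nd hn
  ... | yes (divides q e) with rec {q} q<n hq
    where
    hq : 1 ℕ.≤ q
    hq = *-pos⁻ʳ p (subst (1 ℕ.≤_) (trans e (ℕP.*-comm q p)) hn)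
    q<n : q < n
    q<n = subst (q ℕ.<_) (sym e) (ℕP.m<m*n q p {{nz hq}} (prime≥2 pp))
  ...   | strip a m e' nd hm = strip (suc a) m
    (trans e (trans (ℕP.*-comm q p) (trans (cong (p ℕ.*_) e') (sym (ℕP.*-assoc p (p ^ a) m))))) nd hm

^-pos : ∀ {p} → Prime p → ∀ k → 1 ℕ.≤ p ^ k
^-pos {p} pp k = m^n>0 p {{prime⇒nonZero pp}} k

^-∣ : ∀ p {i j} → i ℕ.≤ j → p ^ i ∣ p ^ j
^-∣ p {i} {j} h with m≤n⇒∃[o]m+o≡n h
... | o , refl = subst (p ^ i ∣_) (sym (^-distribˡ-+-* p i o)) (Dv.m∣m*n (p ^ o))

-- A divisor of p^(a+1) m that does not divide p^a m must contain p^(a+1), hence is p^(a+1) e with e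
-- ∣ m. Together with `prime-power-ind` this stands in for a theory of multiplicative functions.
σ-prime-power : ∀ {p m} (f : ℕ → ℤ) a → Prime p → ¬ p ∣ m → 1 ℕ.≤ m →
  σ f (p ^ suc a ℕ.* m) ≡ σ f (p ^ a ℕ.* m) + ∑ m (λ e → 𝟙 (e ∣? m) * f (p ^ suc a ℕ.* e))
σ-prime-power {p} {m} f a pp nd hm = begin
  σ f N ≡⟨ ∑-cong N pointwise ⟩
  ∑ N (λ d → 𝟙 (d ∣? N') * f d + 𝟙 (P ∣? d) * (𝟙 (d ∣? N) * f d)) ≡⟨ ∑-+ N _ _ ⟩
  ∑ N (λ d → 𝟙 (d ∣? N') * f d) + ∑ N (λ d → 𝟙 (P ∣? d) * (𝟙 (d ∣? N) * f d))
    ≡⟨ cong₂ _+_ (σ-extend f (*-mono-≤ (^-pos pp a) hm) (*-monoˡ-≤ m (m≤n*m (p ^ a) p {{prime⇒nonZero pp}})))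
         (sym (∑-multiples N (λ d → 𝟙 (d ∣? N) * f d) hP)) ⟩
  σ f N' + ∑ (N ÷ P) (λ j → 𝟙 (P ℕ.* j ∣? N) * f (P ℕ.* j)) ≡⟨ cong (λ z → σ f N' + ∑ z (λ j → 𝟙 (P ℕ.* j ∣? N) * f (P ℕ.* j))) N÷P ⟩
  σ f N' + ∑ m (λ j → 𝟙 (P ℕ.* j ∣? N) * f (P ℕ.* j))
    ≡⟨ cong (λ z → σ f N' + z) (∑-ext m λ j → cong (_* f (P ℕ.* j)) (𝟙-cong (P ℕ.* j ∣? N) (j ∣? m) (Dv.*-cancelˡ-∣ P {{nz hP}}) (Dv.*-monoʳ-∣ P))) ⟩
  σ f N' + ∑ m (λ e → 𝟙 (e ∣? m) * f (P ℕ.* e)) ∎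
  where
  open ≡-Reasoning
  P N N' : ℕ
  P = p ^ suc a
  N = P ℕ.* m
  N' = p ^ a ℕ.* m
  hP : 1 ℕ.≤ P
  hP = ^-pos pp (suc a)
  N÷P : N ÷ P ≡ m
  N÷P = ≤-ext (λ k h → *-cancelˡ-≤ P {{nz hP}} (÷-≤ hP h)) (λ k h → ≤-÷ hP (*-monoʳ-≤ P h))
  P∤N' : ¬ P ∣ N'
  P∤N' h = nd (Dv.*-cancelˡ-∣ (p ^ a) {{nz (^-pos pp a)}} (subst (_∣ N') (ℕP.*-comm p (p ^ a)) h))
  N'∣N : N' ∣ N
  N'∣N = subst (N' ∣_) (sym (ℕP.*-assoc p (p ^ a) m)) (Dv.n∣m*n p)
  key : ∀ d → 1 ℕ.≤ d → ¬ P ∣ d → d ∣ N → d ∣ N'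
  key d hd nP h with stripPrime pp d hd
  ... | strip i d' e nd' _ with i ℕ.≤? a
  ...   | yes i≤a = subst (_∣ N') (sym e) (Dv.*-pres-∣ (^-∣ p i≤a)
            (∣-cancel-prime-^ (suc a) pp nd' (Dv.∣-trans (subst (d' ∣_) (sym e) (Dv.n∣m*n (p ^ i))) h)))
  ...   | no i≰a = contradiction (subst (P ∣_) (sym e) (Dv.∣-trans (^-∣ p (≰⇒> i≰a)) (Dv.m∣m*n d'))) nP
  pointwise : ∀ d → 1 ℕ.≤ d → d ℕ.≤ N → 𝟙 (d ∣? N) * f d ≡ 𝟙 (d ∣? N') * f d + 𝟙 (P ∣? d) * (𝟙 (d ∣? N) * f d)
  pointwise d hd _ with 𝟙-case (P ∣? d)
  ... | inj₁ (Pd , i) rewrite i = trans (sym (*-identityˡ _)) (trans (sym (+-identityˡ _))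
        (cong (_+ 1ℤ * (𝟙 (d ∣? N) * f d)) (sym (trans (cong (_* f d) (𝟙-no (d ∣? N') λ h → P∤N' (Dv.∣-trans Pd h))) (*-zeroˡ (f d))))))
  ... | inj₂ (nP , i) rewrite i = trans (cong (_* f d) (𝟙-cong (d ∣? N) (d ∣? N') (key d hd nP) (λ h → Dv.∣-trans h N'∣N)))
        (trans (sym (+-identityʳ _)) (cong (λ z → 𝟙 (d ∣? N') * f d + z) (sym (*-zeroˡ (𝟙 (d ∣? N) * f d)))))

prime-power-ind : (Q : ℕ → Set) → Q 1 →
  (∀ p a m → Prime p → ¬ p ∣ m → 1 ℕ.≤ m → Q m → Q (p ^ suc a ℕ.* m)) → ∀ n → 1 ℕ.≤ n → Q n
prime-power-ind Q q1 step = <-rec _ go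
  where
  go : ∀ n → (∀ {m} → m < n → 1 ℕ.≤ m → Q m) → 1 ℕ.≤ n → Q n
  go (suc zero) rec _ = q1
  go n@(suc (suc _)) rec hn with prime-divisor {n} (s≤s (s≤s z≤n))
  ... | p , pp , d with stripPrime pp n hn
  ...   | strip zero m e nd hm = contradiction (subst (p ∣_) (trans e (ℕP.*-identityˡ m)) d) nd
  ...   | strip (suc a) m e nd hm = subst Q (sym e) (step p a m pp nd hm (rec (subst (m ℕ.<_) (sym e)
            (subst (_< p ^ suc a ℕ.* m) (ℕP.*-identityˡ m) (ℕP.*-monoˡ-< m {{nz hm}} (ℕP.<-≤-trans (prime≥2 pp)
              (m≤m*n p (p ^ a) {{nz (^-pos pp a)}}))))) hm))

-- The Möbius function

sgn : ℕ → ℤ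
sgn zero = 1ℤ
sgn (suc k) = - sgn k

-- The bounded quantifier over the possible square divisors (d + 2)² makes the property decidable.
Squarefree : ℕ → Set
Squarefree n = ∀ {d} → d < n → ¬ (suc (suc d) ℕ.* suc (suc d) ∣ n)

squarefree? : ∀ n → Dec (Squarefree n)
squarefree? n = ℕP.allUpTo? (λ d → ¬? (suc (suc d) ℕ.* suc (suc d) ∣? n)) n

squarefree-∣ : ∀ {n} → 1 ℕ.≤ n → Squarefree n → ∀ d → 2 ℕ.≤ d → ¬ d ℕ.* d ∣ n
squarefree-∣ {n} hn h (suc (suc d)) _ dv = h {d}
  (ℕP.≤-trans (linℕ 1 (λ d → κ 1 ⊕ d ≤' (κ 2 ⊕ d) ⊗ (κ 2 ⊕ d)) tt d) (Dv.∣⇒≤ {{nz hn}} dv)) dv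
squarefree-∣ hn h (suc zero) (s≤s ()) _

opaque
  μ : ℕ → ℤ
  μ n = 𝟙 (squarefree? n) * sgn (length (factorsOf n))

  sgn-≲ : ∀ k → sgn k ≲ 1ℤ
  sgn-≲ zero = ≲-nonneg pos≥0 ≤-refl
  sgn-≲ (suc k) = ≲-neg (sgn-≲ k)

  μ-≲ : ∀ n → μ n ≲ 1ℤ
  μ-≲ n = subst (μ n ≲_) (*-identityʳ 1ℤ) (≲-* (≲-nonneg (𝟙-nonneg (squarefree? n)) (𝟙≤1 (squarefree? n))) (sgn-≲ (length (factorsOf n))))

  μ-1 : μ 1 ≡ 1ℤ
  μ-1 = trans (*-identityʳ _) (𝟙-yes (squarefree? 1) λ { {d} _ h → contradiction (Dv.∣⇒≤ h) (ℕP.<⇒≱ (s≤s (s≤s z≤n))) })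

  μ-p∤ : ∀ {p e} → Prime p → 1 ℕ.≤ e → ¬ p ∣ e → μ (p ℕ.* e) ≡ - μ e
  μ-p∤ {p} {e} pp he nd = trans (cong₂ _*_
    (𝟙-cong (squarefree? (p ℕ.* e)) (squarefree? e) to from)
    (cong sgn (trans (↭-length (factorsOf-* (prime≥1 pp) he)) (trans (LP.length-++ (factorsOf p)) (cong (ℕ._+ length (factorsOf e)) (↭-length (factorsOf-p pp)))))))
    (sym (neg-distribʳ-* (𝟙 (squarefree? e)) (sgn (length (factorsOf e)))))
    where
    hpe : 1 ℕ.≤ p ℕ.* e
    hpe = *-mono-≤ (prime≥1 pp) he
    to : Squarefree (p ℕ.* e) → Squarefree e
    to h {d} _ dv = squarefree-∣ hpe h (suc (suc d)) (s≤s (s≤s z≤n)) (Dv.∣-trans dv (Dv.n∣m*n p))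
    from : Squarefree e → Squarefree (p ℕ.* e)
    from h {d} _ dv with p ∣? suc (suc d)
    ... | yes pd = nd (Dv.*-cancelˡ-∣ p {{prime⇒nonZero pp}} (Dv.∣-trans (Dv.*-pres-∣ pd pd) dv))
    ... | no npd = squarefree-∣ he h (suc (suc d)) (s≤s (s≤s z≤n)) (∣-cancel-prime pp npd2 dv)
      where
      npd2 : ¬ p ∣ suc (suc d) ℕ.* suc (suc d)
      npd2 x with euclidsLemma (suc (suc d)) (suc (suc d)) pp x
      ... | inj₁ y = npd y
      ... | inj₂ y = npd y

  μ-square : ∀ {p n} → Prime p → 1 ℕ.≤ n → p ℕ.* p ∣ n → μ n ≡ 0ℤ
  μ-square {p} {n} pp hn d = trans (cong (_* sgn (length (factorsOf n)))
    (𝟙-no (squarefree? n) λ h → squarefree-∣ hn h p (prime≥2 pp) d)) (*-zeroˡ (sgn (length (factorsOf n))))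

∣-pos : ∀ {e m} → 1 ℕ.≤ m → e ∣ m → 1 ℕ.≤ e
∣-pos {zero} hm d = contradiction (Dv.0∣⇒≡0 d) λ { refl → contradiction hm λ () }
∣-pos {suc e} _ _ = s≤s z≤n

σμ-prime-power : ∀ p a m → Prime p → ¬ p ∣ m → 1 ℕ.≤ m → σ μ (p ^ suc a ℕ.* m) ≡ 0ℤ
σμ-prime-power p zero m pp nd hm = trans (σ-prime-power μ 0 pp nd hm) (trans (cong₂ _+_
  (cong (σ μ) (ℕP.*-identityˡ m))
  (trans (∑-cong m λ e he _ → trans (𝟙-* (e ∣? m) λ h → trans (cong (λ z → μ (z ℕ.* e)) (ℕP.*-identityʳ p))
      (μ-p∤ pp he λ pe → nd (Dv.∣-trans pe h))) (*-comm (𝟙 (e ∣? m)) (- μ e)))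
    (trans (∑-ext m λ e → neg-lem (μ e) (𝟙 (e ∣? m))) (∑-*ˡ m (- 1ℤ) (λ e → 𝟙 (e ∣? m) * μ e)))))
  (cancel-lem (σ μ m)))
  where
  neg-lem : ∀ x y → - x * y ≡ - 1ℤ * (y * x)
  neg-lem x y = trans (sym (neg-distribˡ-* x y)) (trans (cong -_ (*-comm x y)) (sym (-1*i≡-i (y * x))))
  cancel-lem : ∀ x → x + - 1ℤ * x ≡ 0ℤ
  cancel-lem x = trans (cong (λ z → x + z) (-1*i≡-i x)) (+-inverseʳ x)
σμ-prime-power p (suc a) m pp nd hm = trans (σ-prime-power μ (suc a) pp nd hm) (cong₂ _+_ (σμ-prime-power p a m pp nd hm)
  (∑-zero m λ e he _ → trans (cong (𝟙 (e ∣? m) *_) (μ-square pp (*-mono-≤ (^-pos pp (suc (suc a))) he)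
    (Dv.∣-trans (subst (p ℕ.* p ∣_) (ℕP.*-assoc p p (p ^ a)) (Dv.m∣m*n (p ^ a))) (Dv.m∣m*n e)))) (*-zeroʳ (𝟙 (e ∣? m)))))

σμ-1 : σ μ 1 ≡ 1ℤ
σμ-1 = trans (+-identityˡ _) (trans (cong₂ _*_ (𝟙-yes (1 ∣? 1) (Dv.1∣ 1)) μ-1) (*-identityʳ 1ℤ))

σμ-0 : ∀ n → 2 ℕ.≤ n → σ μ n ≡ 0ℤ
σμ-0 n h = prime-power-ind (λ n → 2 ℕ.≤ n → σ μ n ≡ 0ℤ) (λ { (s≤s ()) })
  (λ p a m pp nd hm _ _ → σμ-prime-power p a m pp nd hm) n (ℕP.≤-trans (s≤s z≤n) h) h

-- Grouping the pairs by n = d m gives n the weight σ μ n, which vanishes for n > 1.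
μ-inversion : ∀ x (G : ℕ → ℤ) → 1 ℕ.≤ x → ∑ x (λ d → ∑ (x ÷ d) (λ m → μ d * G (d ℕ.* m))) ≡ G 1
μ-inversion x G hx = trans (∑∑-σ x μ G) (trans
  (∑-single {k = 1} (s≤s z≤n) hx λ n h1 _ ne → trans (cong (_* G n) (σμ-0 n (ℕP.≤∧≢⇒< h1 (ne ∘ sym)))) (*-zeroˡ (G n)))
  (trans (cong (_* G 1) σμ-1) (*-identityˡ (G 1))))

-- The von Mangoldt function

module Mangoldt (ℓ : ℕ → ℕ) where

  logSum : List ℕ → ℤ
  logSum [] = 0ℤ
  logSum (p ∷ ps) = + ℓ p + logSum ps

  logSum-↭ : ∀ {ps qs} → ps ↭ qs → logSum ps ≡ logSum qs
  logSum-↭ ↭.refl = refl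
  logSum-↭ (↭.prep x h) = cong (λ z → + ℓ x + z) (logSum-↭ h)
  logSum-↭ (↭.swap {ps} {qs} x y h) = trans (cong (λ z → + ℓ x + (+ ℓ y + z)) (logSum-↭ h))
    (lin 3 (λ x y z → x ⊕ (y ⊕ z) ≡' y ⊕ (x ⊕ z)) tt (+ ℓ x) (+ ℓ y) (logSum qs))
  logSum-↭ (↭.trans h k) = trans (logSum-↭ h) (logSum-↭ k)

  logSum-++ : ∀ ps qs → logSum (ps ++ qs) ≡ logSum ps + logSum qs
  logSum-++ [] qs = sym (+-identityˡ _)
  logSum-++ (p ∷ ps) qs = trans (cong (λ z → + ℓ p + z) (logSum-++ ps qs)) (sym (+-assoc (+ ℓ p) (logSum ps) (logSum qs)))

  opaque
    -- The completely additive function with the values ℓ p at primes. It serves as the logarithm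
    -- because rounded logarithms are additive only approximately, whereas σ Λ = L and Selberg's
    -- identity have to hold exactly.
    L : ℕ → ℤ
    L n = logSum (factorsOf n)

    L-* : ∀ {m n} → 1 ℕ.≤ m → 1 ℕ.≤ n → L (m ℕ.* n) ≡ L m + L n
    L-* {m} {n} hm hn = trans (logSum-↭ (factorsOf-* hm hn)) (logSum-++ (factorsOf m) (factorsOf n))

    L-p : ∀ {p} → Prime p → L p ≡ + ℓ p
    L-p {p} pp = trans (logSum-↭ (factorsOf-p pp)) (+-identityʳ (+ ℓ p))

    L-1 : L 1 ≡ 0ℤ
    L-1 = refl

    logSum-nonneg : ∀ ps → 0ℤ ≤ logSum ps
    logSum-nonneg [] = ≤-refl
    logSum-nonneg (p ∷ ps) = +-mono-≤ (pos≥0 {ℓ p}) (logSum-nonneg ps)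

    L-nonneg : ∀ n → 0ℤ ≤ L n
    L-nonneg n = logSum-nonneg (factorsOf n)

  opaque
    unfolding L
    L-def : ∀ n → L n ≡ logSum (factorsOf n)
    L-def n = refl

  -- n is a power of p with positive exponent: if n = p^a then a ≤ n, so n divides p^n. The form is
  -- decidable without searching for a.
  PowerOf : ℕ → ℕ → Set
  PowerOf n p = Prime p × p ∣ n × n ∣ p ^ n

  powerOf? : ∀ n p → Dec (PowerOf n p)
  powerOf? n p = prime? p ×-dec (p ∣? n ×-dec n ∣? p ^ n)

  opaque
    Λ : ℕ → ℤ
    Λ n = ∑ n (λ p → 𝟙 (powerOf? n p) * + ℓ p)

    Λ-nonneg : ∀ n → 0ℤ ≤ Λ n
    Λ-nonneg n = ∑-nonneg n λ p _ _ → *-nonneg (𝟙-nonneg (powerOf? n p)) (pos≥0 {ℓ p})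

    Λ-power : ∀ {p} a → Prime p → Λ (p ^ suc a) ≡ + ℓ p
    Λ-power {p} a pp = trans (∑-single {P} {p} {λ q → 𝟙 (powerOf? P q) * + ℓ q} (prime≥1 pp) (m≤m*n p (p ^ a) {{nz (^-pos pp a)}}) other)
      (trans (cong (_* + ℓ p) (𝟙-yes (powerOf? P p) (pp , Dv.m∣m*n (p ^ a) , ^-∣ p sa≤))) (*-identityˡ (+ ℓ p)))
      where
      P : ℕ
      P = p ^ suc a
      sa≤ : suc a ℕ.≤ P
      sa≤ = ℕP.≤-trans (<⇒≤ (n<2^n (suc a))) (^-monoˡ-≤ (suc a) (prime≥2 pp))
      other : ∀ q → 1 ℕ.≤ q → q ℕ.≤ P → q ≢ p → 𝟙 (powerOf? P q) * + ℓ q ≡ 0ℤ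
      other q _ _ ne = trans (cong (_* + ℓ q) (𝟙-no (powerOf? P q) λ { (pq , d , _) → ne (prime-∣-prime pq pp (prime-∣-^ p (suc a) pq d)) })) (*-zeroˡ (+ ℓ q))

    Λ-1 : Λ 1 ≡ 0ℤ
    Λ-1 = ∑-zero 1 λ p _ _ → trans (cong (_* + ℓ p) (𝟙-no (powerOf? 1 p) λ { (pp , d , _) → p∤1 pp d })) (*-zeroˡ (+ ℓ p))

    Λ-p : ∀ {p} → Prime p → Λ p ≡ + ℓ p
    Λ-p {p} pp = trans (cong Λ (sym (ℕP.*-identityʳ p))) (Λ-power 0 pp)

    Λ-mixed : ∀ {p} a e → Prime p → ¬ p ∣ e → 2 ℕ.≤ e → Λ (p ^ suc a ℕ.* e) ≡ 0ℤ
    Λ-mixed {p} a e pp nd he = ∑-zero N λ q _ _ → trans (cong (_* + ℓ q) (𝟙-no (powerOf? N q) (impossible q))) (*-zeroˡ (+ ℓ q))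
      where
      N : ℕ
      N = p ^ suc a ℕ.* e
      p∣N : p ∣ N
      p∣N = Dv.∣-trans (Dv.m∣m*n (p ^ a)) (Dv.m∣m*n e)
      impossible : ∀ q → ¬ PowerOf N q
      impossible q (pq , _ , d) with prime-divisor he
      ... | r , pr , re with prime-∣-prime pr pq (prime-∣-^ q N pr (Dv.∣-trans (Dv.∣-trans re (Dv.n∣m*n (p ^ suc a))) d))
                           | prime-∣-prime pp pq (prime-∣-^ q N pp (Dv.∣-trans p∣N d))
      ...   | refl | refl = nd re

  σΛ : ∀ n → 1 ℕ.≤ n → σ Λ n ≡ L n
  σΛ = prime-power-ind (λ n → σ Λ n ≡ L n) (trans (+-identityˡ _) (trans (cong (𝟙 (1 ∣? 1) *_) Λ-1) (trans (*-zeroʳ (𝟙 (1 ∣? 1))) (sym L-1))))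
    λ { p a m pp nd hm ih → trans (peel p a m pp nd hm) (trans (cong (λ z → + suc a * + ℓ p + z) ih) (sym (L-peel p (suc a) m pp hm))) }
    where
    L-peel : ∀ p a m → Prime p → 1 ℕ.≤ m → L (p ^ a ℕ.* m) ≡ + a * + ℓ p + L m
    L-peel p zero m pp hm = trans (cong L (ℕP.*-identityˡ m)) (sym (trans (cong (_+ L m) (*-zeroˡ (+ ℓ p))) (+-identityˡ (L m))))
    L-peel p (suc a) m pp hm = trans (cong L (ℕP.*-assoc p (p ^ a) m)) (trans (L-* (prime≥1 pp) (*-mono-≤ (^-pos pp a) hm))
      (trans (cong₂ _+_ (L-p pp) (L-peel p a m pp hm)) (lin 3 (λ l a m → l ⊕ (a ⊗ l ⊕ m) ≡' (κ 1 ⊕ a) ⊗ l ⊕ m) tt (+ ℓ p) (+ a) (L m))))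
    top : ∀ p a m → Prime p → ¬ p ∣ m → 1 ℕ.≤ m → ∑ m (λ e → 𝟙 (e ∣? m) * Λ (p ^ suc a ℕ.* e)) ≡ + ℓ p
    top p a m pp nd hm = trans (∑-single {k = 1} (s≤s z≤n) hm λ e h1 _ ne →
        trans (𝟙-* (e ∣? m) λ d → Λ-mixed a e pp (λ pe → nd (Dv.∣-trans pe d)) (ℕP.≤∧≢⇒< h1 (ne ∘ sym))) (*-zeroʳ (𝟙 (e ∣? m))))
      (trans (cong₂ _*_ (𝟙-yes (1 ∣? m) (Dv.1∣ m)) (trans (cong Λ (ℕP.*-identityʳ (p ^ suc a))) (Λ-power a pp))) (*-identityˡ (+ ℓ p)))
    peel : ∀ p a m → Prime p → ¬ p ∣ m → 1 ℕ.≤ m → σ Λ (p ^ suc a ℕ.* m) ≡ + suc a * + ℓ p + σ Λ m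
    peel p zero m pp nd hm = trans (σ-prime-power Λ 0 pp nd hm) (trans (cong₂ _+_ (cong (σ Λ) (ℕP.*-identityˡ m)) (top p 0 m pp nd hm))
      (lin 2 (λ x l → x ⊕ l ≡' κ 1 ⊗ l ⊕ x) tt (σ Λ m) (+ ℓ p)))
    peel p (suc a) m pp nd hm = trans (σ-prime-power Λ (suc a) pp nd hm) (trans (cong₂ _+_ (peel p a m pp nd hm) (top p (suc a) m pp nd hm))
      (lin 3 (λ x l a → (κ 1 ⊕ a) ⊗ l ⊕ x ⊕ l ≡' (κ 2 ⊕ a) ⊗ l ⊕ x) tt (σ Λ m) (+ ℓ p) (+ a)))

  ∑∑-Λ : ∀ x (G : ℕ → ℤ) → ∑ x (λ k → ∑ (x ÷ k) (λ j → Λ k * G (k ℕ.* j))) ≡ ∑ x (λ n → L n * G n)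
  ∑∑-Λ x G = trans (∑∑-σ x Λ G) (∑-cong x λ n h _ → cong (_* G n) (σΛ n h))

÷-antitone : ∀ x {d e} → 1 ℕ.≤ d → d ℕ.≤ e → x ÷ e ℕ.≤ x ÷ d
÷-antitone x {d} {e} hd h = ≤-÷ hd (ℕP.≤-trans (*-monoˡ-≤ (x ÷ e) h) (÷-≤ (ℕP.≤-trans hd h) ℕP.≤-refl))

-- An identity instead of an estimate survives the induction: between powers of 2 one term `lg x` is
-- added, and at a jump x + 1 equals 2^(lg x + 1).
∑-lg : ∀ x → 1 ℕ.≤ x → ∑ x (λ n → + lg n) + + 2 * + (2 ^ lg x) ≡ (+ x + 1ℤ) * + lg x + + 2
∑-lg (suc zero) _ rewrite lg-1 = lin 0 (κ 0 ⊕ κ 2 ⊗ κ 1 ≡' κ 2 ⊗ κ 0 ⊕ κ 2) tt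
∑-lg (suc (suc x)) _ with lg-step (suc x) | ∑-lg (suc x) (s≤s z≤n)
... | same e | ih rewrite e =
  lin 4 (λ S t x l → S ⊕ κ 2 ⊗ t ≡' (x ⊕ κ 1) ⊗ l ⊕ κ 2 ⇒ S ⊕ l ⊕ κ 2 ⊗ t ≡' (κ 1 ⊕ x ⊕ κ 1) ⊗ l ⊕ κ 2) tt
    (∑ (suc x) (λ n → + lg n)) (+ (2 ^ lg (suc x))) (+ suc x) (+ lg (suc x)) ih
... | jump e p | ih rewrite e =
  lin 5 (λ S t x l t' → S ⊕ κ 2 ⊗ t ≡' (x ⊕ κ 1) ⊗ l ⊕ κ 2 ⇒ κ 1 ⊕ x ≡' t' ⇒ t' ≡' κ 2 ⊗ t ⇒
      S ⊕ (κ 1 ⊕ l) ⊕ κ 2 ⊗ t' ≡' (κ 1 ⊕ x ⊕ κ 1) ⊗ (κ 1 ⊕ l) ⊕ κ 2) tt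
    (∑ (suc x) (λ n → + lg n)) (+ (2 ^ lg (suc x))) (+ suc x) (+ lg (suc x)) (+ (2 ^ suc (lg (suc x)))) ih (cong +_ p)
    (pos-* 2 (2 ^ lg (suc x)))

∑-lg-upper : ∀ x → 1 ℕ.≤ x → ∑ x (λ n → + lg n) ≤ + x * + lg x
∑-lg-upper x hx = ≤-trans (∑-mono x λ n _ h → +≤+ (lg-mono h)) (≤-reflexive (∑-const x (+ lg x)))

∑-lg-lower : ∀ x → 1 ℕ.≤ x → + x * + lg x ≤ ∑ x (λ n → + lg n) + + 2 * + x
∑-lg-lower x hx = lin 4 (λ S t x l → S ⊕ κ 2 ⊗ t ≡' (x ⊕ κ 1) ⊗ l ⊕ κ 2 ⇒ t ≤' x ⇒ κ 0 ≤' l ⇒ x ⊗ l ≤' S ⊕ κ 2 ⊗ x) tt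
  (∑ x (λ n → + lg n)) (+ (2 ^ lg x)) (+ x) (+ lg x) (∑-lg x hx) (+≤+ (lg-lower hx)) pos≥0

lg-pred-2^ : ∀ {T n} → n ℕ.≤ 2 ^ T → lg n ℕ.≤ T
lg-pred-2^ {T} h = subst (lg _ ℕ.≤_) (lg-2^ T) (lg-mono h)

lg≤n : ∀ n → lg n ℕ.≤ n
lg≤n n = subst (lg n ℕ.≤_) (lg-2^ n) (lg-mono (<⇒≤ (n<2^n n)))

^-*-distrib : ∀ m n k → (m ℕ.* n) ^ k ≡ m ^ k ℕ.* n ^ k
^-*-distrib m n zero = refl
^-*-distrib m n (suc k) = trans (cong (m ℕ.* n ℕ.*_) (^-*-distrib m n k))
  (linℕ 4 (λ a b c d → (a ⊗ b) ⊗ (c ⊗ d) ≡' (a ⊗ c) ⊗ (b ⊗ d)) tt m n (m ^ k) (n ^ k))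

∣! : ∀ {n x} → 1 ℕ.≤ n → n ℕ.≤ x → n ∣ x !
∣! {suc n} _ h = Dv.∣-trans (Dv.m∣m*n (n !)) (Dv.m≤n⇒m!∣n! h)

-- All logarithms are scaled by s and all reciprocals by V, so that the analysis of
-- sums over n ≤ X = 2 ^ T takes place in ℤ.
module Scaled (T : ℕ) where

  X : ℕ
  X = 2 ^ T

  opaque
    -- The cube absorbs the rounding in `∑uL²w`: replacing ℓ² by L² costs up to T · 2 S (T + 1) per
    -- term, and the harmonic weights sum to V (T + 1), so 2 T (T + 1)² ≤ S is what must hold.
    s : ℕ
    s = 2 ℕ.* (suc T ℕ.* (suc T ℕ.* suc T))

    s-def : s ≡ 2 ℕ.* (suc T ℕ.* (suc T ℕ.* suc T))
    s-def = refl

    -- With a factorial, `w n` is exactly V / n for every n ≤ X.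
    V₀ : ℕ
    V₀ = X !

    V₀≥1 : 1 ℕ.≤ V₀
    V₀≥1 = ℕP.1≤n! X

    ∣V₀ : ∀ {n} → 1 ℕ.≤ n → n ℕ.≤ X → n ∣ V₀
    ∣V₀ = ∣!

    w₀ : ℕ → ℕ
    w₀ n = V₀ ÷ n

    w₀-def : ∀ n → w₀ n ≡ V₀ ÷ n
    w₀-def n = refl

  S V : ℤ
  S = + s
  V = + V₀

  w : ℕ → ℤ
  w n = + w₀ n

  V≥1 : 1ℤ ≤ V
  V≥1 = +≤+ V₀≥1

  T<s : suc T ℕ.≤ s
  T<s = subst (suc T ℕ.≤_) (sym s-def) (linℕ 1 (λ T → κ 1 ⊕ T ≤' κ 2 ⊗ ((κ 1 ⊕ T) ⊗ ((κ 1 ⊕ T) ⊗ (κ 1 ⊕ T)))) tt T)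

  S≥1 : 1ℤ ≤ S
  S≥1 = +≤+ (ℕP.≤-trans (s≤s z≤n) T<s)

  T≤S : + T ≤ S
  T≤S = +≤+ (<⇒≤ T<s)

  SV≥0 : 0ℤ ≤ S * V
  SV≥0 = *-nonneg (pos≥0 {s}) (pos≥0 {V₀})

  w-nonneg : ∀ n → 0ℤ ≤ w n
  w-nonneg n = pos≥0

  w-* : ∀ {n} → 1 ℕ.≤ n → n ℕ.≤ X → w n * + n ≡ V
  w-* {n} h1 h2 with ∣V₀ h1 h2
  ... | divides q e = trans (sym (pos-* (w₀ n) n)) (cong +_ (trans (cong (ℕ._* n) (trans (w₀-def n) V÷n)) (sym e)))
    where
    V÷n : V₀ ÷ n ≡ q
    V÷n = ≤-ext (λ m h → *-cancelˡ-≤ n {{nz h1}} (ℕP.≤-trans (÷-≤ h1 h) (ℕP.≤-reflexive (trans e (ℕP.*-comm q n)))))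
      (λ m h → ≤-÷ h1 (ℕP.≤-trans (*-monoʳ-≤ n h) (ℕP.≤-reflexive (trans (ℕP.*-comm n q) (sym e)))))

  w1≡V : w 1 ≡ V
  w1≡V = trans (sym (*-identityʳ (w 1))) (w-* (s≤s z≤n) (2^≥1 T))

  w-anti : ∀ {m n} → 1 ℕ.≤ m → m ℕ.≤ n → w n ≤ w m
  w-anti {m} {n} h1 h2 = +≤+ (subst₂ ℕ._≤_ (sym (w₀-def n)) (sym (w₀-def m)) (÷-antitone V₀ h1 h2))

  w-mul : ∀ {m n} → 1 ℕ.≤ m → 1 ℕ.≤ n → m ℕ.* n ℕ.≤ X → V * w (m ℕ.* n) ≡ w m * w n
  w-mul {m} {n} hm hn h = *-cancel-≡ {c = + m * + n} (subst (1ℤ ≤_) (pos-* m n) (+≤+ hmn)) (begin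
    + m * + n * (V * w (m ℕ.* n)) ≡⟨ cong (_* (V * w (m ℕ.* n))) (sym (pos-* m n)) ⟩
    + (m ℕ.* n) * (V * w (m ℕ.* n)) ≡⟨ lin 3 (λ a b c → a ⊗ (b ⊗ c) ≡' b ⊗ (c ⊗ a)) tt (+ (m ℕ.* n)) V (w (m ℕ.* n)) ⟩
    V * (w (m ℕ.* n) * + (m ℕ.* n)) ≡⟨ cong (V *_) (w-* hmn h) ⟩
    V * V ≡⟨ sym (cong₂ _*_ (w-* hm m≤X) (w-* hn n≤X)) ⟩
    (w m * + m) * (w n * + n) ≡⟨ lin 4 (λ a b c d → (a ⊗ b) ⊗ (c ⊗ d) ≡' b ⊗ d ⊗ (a ⊗ c)) tt (w m) (+ m) (w n) (+ n) ⟩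
    + m * + n * (w m * w n) ∎)
    where
    open ≡-Reasoning
    hmn : 1 ℕ.≤ m ℕ.* n
    hmn = *-mono-≤ hm hn
    m≤X : m ℕ.≤ X
    m≤X = ℕP.≤-trans (m≤m*n m n {{nz hn}}) h
    n≤X : n ℕ.≤ X
    n≤X = ℕP.≤-trans (m≤n*m n m {{nz hm}}) h

  opaque
    -- s · log₂ n up to rounding; unlike L it is monotone.
    ℓ : ℕ → ℕ
    ℓ n = lg (n ^ s)

    ℓ-mono : ∀ {m n} → m ℕ.≤ n → ℓ m ℕ.≤ ℓ n
    ℓ-mono h = lg-mono (^-monoˡ-≤ s h)

    ℓ-lower : ∀ {n} → 1 ℕ.≤ n → s ℕ.* lg n ℕ.≤ ℓ n
    ℓ-lower {n} h = ≤-lg (subst (ℕ._≤ n ^ s) (trans (^-*-assoc 2 (lg n) s) (cong (2 ^_) (ℕP.*-comm (lg n) s))) (^-monoˡ-≤ s (lg-lower h)))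

    ℓ-upper : ∀ n → ℓ n ℕ.≤ s ℕ.* suc (lg n)
    ℓ-upper n = lg-< (≤-<-trans (^-monoˡ-≤ s (<⇒≤ (lg-upper n)))
      (subst (_< 2 ^ suc (s ℕ.* suc (lg n))) (sym (trans (^-*-assoc 2 (suc (lg n)) s) (cong (2 ^_) (ℕP.*-comm (suc (lg n)) s))))
        (^-monoʳ-< 2 (s≤s (s≤s z≤n)) {s ℕ.* suc (lg n)} {suc (s ℕ.* suc (lg n))} ℕP.≤-refl)))

    ℓ-*-lower : ∀ {m n} → 1 ℕ.≤ m → 1 ℕ.≤ n → ℓ m ℕ.+ ℓ n ℕ.≤ ℓ (m ℕ.* n)
    ℓ-*-lower {m} {n} hm hn = subst (λ z → ℓ m ℕ.+ ℓ n ℕ.≤ lg z) (sym (^-*-distrib m n s))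
      (lg-*-≥ (m^n>0 m {{nz hm}} s) (m^n>0 n {{nz hn}} s))

    ℓ-*-upper : ∀ m n → ℓ (m ℕ.* n) ℕ.≤ suc (ℓ m ℕ.+ ℓ n)
    ℓ-*-upper m n = subst (λ z → lg z ℕ.≤ suc (ℓ m ℕ.+ ℓ n)) (sym (^-*-distrib m n s)) (lg-*-≤ (m ^ s) (n ^ s))

    ℓ-1 : ℓ 1 ≡ 0
    ℓ-1 = trans (cong lg (ℕP.^-zeroˡ s)) lg-1

  open Mangoldt ℓ public

  product-pos : ∀ {ps} → All Prime ps → 1 ℕ.≤ product ps
  product-pos [] = s≤s z≤n
  product-pos (pp ∷ h) = *-mono-≤ (prime≥1 pp) (product-pos h)

  logSum≤ℓ : ∀ {ps} → All Prime ps → logSum ps ≤ + ℓ (product ps)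
  logSum≤ℓ [] = pos≥0
  logSum≤ℓ {p ∷ ps} (pp ∷ h) = ≤-trans (+-monoʳ-≤ (+ ℓ p) (logSum≤ℓ h)) (+≤+ (ℓ-*-lower (prime≥1 pp) (product-pos h)))

  ℓ≤logSum : ∀ {ps} → All Prime ps → + ℓ (product ps) ≤ logSum ps + + length ps
  ℓ≤logSum [] = +≤+ (ℕP.≤-reflexive ℓ-1)
  ℓ≤logSum {p ∷ ps} (pp ∷ h) = lin 5 (λ a b c d e → a ≤' κ 1 ⊕ (b ⊕ c) ⇒ c ≤' d ⊕ e ⇒ a ≤' (b ⊕ d) ⊕ (κ 1 ⊕ e)) tt
    (+ ℓ (p ℕ.* product ps)) (+ ℓ p) (+ ℓ (product ps)) (logSum ps) (+ length ps) (+≤+ (ℓ-*-upper p (product ps))) (ℓ≤logSum h)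

  2^length : ∀ {ps} → All Prime ps → 2 ^ length ps ℕ.≤ product ps
  2^length [] = s≤s z≤n
  2^length (pp ∷ h) = *-mono-≤ (prime≥2 pp) (2^length h)

  L≤ℓ : ∀ {n} → 1 ℕ.≤ n → L n ≤ + ℓ n
  L≤ℓ {n} h = subst₂ (λ l k → l ≤ + ℓ k) (sym (L-def n)) (sym (factorsOf-product h)) (logSum≤ℓ (factorsOf-prime n))

  -- Each multiplication loses at most 1 by rounding, and n has at most `lg n` prime factors.
  ℓ≤L : ∀ {n} → 1 ℕ.≤ n → + ℓ n ≤ L n + + lg n
  ℓ≤L {n} h = ≤-trans (subst₂ (λ k l → + ℓ k ≤ l + + length (factorsOf n)) (sym (factorsOf-product h)) (sym (L-def n)) (ℓ≤logSum (factorsOf-prime n)))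
    (+-monoʳ-≤ (L n) (+≤+ (≤-lg (subst (2 ^ length (factorsOf n) ℕ.≤_) (sym (factorsOf-product h)) (2^length (factorsOf-prime n))))))

  L-upper : ∀ {n} → 1 ℕ.≤ n → L n ≤ S * (1ℤ + + lg n)
  L-upper {n} h = ≤-trans (L≤ℓ h) (subst (+ ℓ n ≤_) (pos-* s (suc (lg n))) (+≤+ (ℓ-upper n)))

  L-lower : ∀ {n} → 1 ℕ.≤ n → n ℕ.≤ X → S * + lg n ≤ L n + S
  L-lower {n} h hX = ≤-trans (subst (_≤ + ℓ n) (pos-* s (lg n)) (+≤+ (ℓ-lower h)))
    (≤-trans (ℓ≤L h) (+-monoʳ-≤ (L n) (≤-trans (+≤+ (lg-pred-2^ hX)) T≤S)))

  ∑L-upper : ∀ x → 1 ℕ.≤ x → ∑ x L ≤ S * (+ x * + lg x) + S * + x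
  ∑L-upper x hx = ≤-trans (∑-mono x λ n h1 _ → L-upper h1) (≤-trans (≤-reflexive (trans (∑-*ˡ x S (λ n → 1ℤ + + lg n))
    (cong (S *_) (trans (∑-+ x (λ _ → 1ℤ) (λ n → + lg n)) (cong (_+ ∑ x (λ n → + lg n)) (trans (∑-const x 1ℤ) (*-identityʳ (+ x))))))))
    (≤-trans (*-monoˡ {S} pos≥0 (+-monoʳ-≤ (+ x) (∑-lg-upper x hx)))
      (lin 3 (λ s x y → s ⊗ (x ⊕ y) ≤' s ⊗ y ⊕ s ⊗ x) tt S (+ x) (+ x * + lg x))))

  ∑L-lower : ∀ x → 1 ℕ.≤ x → x ℕ.≤ X → S * (+ x * + lg x) ≤ ∑ x L + + 3 * (S * + x)
  ∑L-lower x hx hX = lin 5 (λ s y G x A → s ⊗ y ≤' s ⊗ (G ⊕ κ 2 ⊗ x) ⇒ s ⊗ G ≤' A ⊕ x ⊗ s ⇒ s ⊗ y ≤' A ⊕ κ 3 ⊗ (s ⊗ x)) tt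
    S (+ x * + lg x) (∑ x (λ n → + lg n)) (+ x) (∑ x L) (*-monoˡ {S} pos≥0 (∑-lg-lower x hx))
    (subst₂ _≤_ (∑-*ˡ x S (λ n → + lg n)) (trans (∑-+ x L (λ _ → S)) (cong (λ z → ∑ x L + z) (∑-const x S)))
      (∑-mono x λ n h1 h2 → L-lower h1 (ℕP.≤-trans h2 hX)))

  ∑-Λ÷ : ∀ x → ∑ x (λ d → Λ d * + (x ÷ d)) ≡ ∑ x L
  ∑-Λ÷ x = trans (∑-ext x λ d → trans (*-comm (Λ d) (+ (x ÷ d))) (trans (sym (∑-const (x ÷ d) (Λ d))) (∑-ext (x ÷ d) λ _ → sym (*-identityʳ (Λ d)))))
    (trans (∑∑-Λ x (λ _ → 1ℤ)) (∑-ext x λ n → *-identityʳ (L n)))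

  -- With h = x ÷ 2, the coefficients x ÷ d - 2 (h ÷ d) are nonnegative and at least 1 for h < d ≤
  -- x. Hence the part of the sum beyond h is bounded by ∑ L up to x minus twice ∑ L up to h, where
  -- the main terms cancel.
  chebyshev : ∀ x → x ℕ.≤ X → ∑ x Λ ≤ + 14 * (S * + x)
  chebyshev = <-rec _ go
    where
    go : ∀ x → (∀ {y} → y < x → y ℕ.≤ X → ∑ y Λ ≤ + 14 * (S * + y)) → x ℕ.≤ X → ∑ x Λ ≤ + 14 * (S * + x)
    go zero rec hX = lin 1 (λ s → κ 0 ≤' κ 14 ⊗ (s ⊗ κ 0)) tt S
    go (suc zero) rec hX = subst (_≤ + 14 * (S * + 1)) (sym (trans (+-identityˡ _) Λ-1)) (*-nonneg (pos≥0 {14}) (*-nonneg (pos≥0 {s}) (pos≥0 {1})))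
    go x@(suc (suc x')) rec hX = lin 6 (λ A B s h x l → A ≤' B ⊕ (s ⊗ (x ⊗ l) ⊕ s ⊗ x ⊖ κ 2 ⊗ (s ⊗ (h ⊗ (l ⊖ κ 1)) ⊖ κ 3 ⊗ (s ⊗ h))) ⇒ B ≤' κ 14 ⊗ (s ⊗ h)
        ⇒ s ⊗ (κ 2 ⊗ h) ≤' s ⊗ x ⇒ s ⊗ (x ⊗ l) ≤' s ⊗ ((κ 2 ⊗ h ⊕ κ 1) ⊗ l) ⇒ s ⊗ l ≤' s ⊗ (h ⊕ κ 1) ⇒ s ⊗ κ 1 ≤' s ⊗ h ⇒ κ 0 ≤' s ⊗ x ⇒ A ≤' κ 14 ⊗ (s ⊗ x)) tt
      (∑ x Λ) (∑ h Λ) S (+ h) (+ x) (+ lg h + 1ℤ) main (rec h<x h≤X) (*-monoˡ {S} pos≥0 (subst (_≤ + x) (pos-* 2 h) (+≤+ 2h≤x)))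
      (*-monoˡ {S} pos≥0 (*-monoʳ {+ lg h + 1ℤ} pos≥0 (≤-trans (+≤+ x≤) (≤-reflexive (trans (cong (_+ 1ℤ) (pos-* 2 h)) refl)))))
      (*-monoˡ {S} pos≥0 (+-monoˡ-≤ 1ℤ (+≤+ (lg≤n h)))) (*-monoˡ {S} pos≥0 (+≤+ h≥1)) (*-nonneg (pos≥0 {s}) (pos≥0 {x}))
      where
      h : ℕ
      h = x ÷ 2
      h≥1 : 1 ℕ.≤ h
      h≥1 = ÷-pos {x} {2} (s≤s z≤n) (s≤s (s≤s z≤n))
      2h≤x : 2 ℕ.* h ℕ.≤ x
      2h≤x = ÷-≤ {x} {2} (s≤s z≤n) ℕP.≤-refl
      x≤ : x ℕ.≤ 2 ℕ.* h ℕ.+ 1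
      x≤ = linℕ 2 (λ x h → x <' κ 2 ⊗ (κ 1 ⊕ h) ⇒ x ≤' κ 2 ⊗ h ⊕ κ 1) tt x h (÷-lt x {2} (s≤s z≤n))
      h<x : h < x
      h<x = linℕ 2 (λ x h → κ 2 ⊗ h ≤' x ⇒ κ 1 ≤' h ⇒ κ 1 ⊕ h ≤' x) tt x h 2h≤x h≥1
      h≤X : h ℕ.≤ X
      h≤X = ℕP.≤-trans (<⇒≤ h<x) hX
      lgx : lg x ℕ.≤ lg h ℕ.+ 1
      lgx = lg-< (ℕP.≤-trans (÷-lt x {2} (s≤s z≤n)) (ℕP.≤-trans (*-monoʳ-≤ 2 (lg-upper h)) (ℕP.≤-reflexive (cong (λ k → 2 ^ suc k) (ℕP.+-comm 1 (lg h))))))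
      Th : ∑ x (λ d → Λ d * + (h ÷ d)) ≡ ∑ h L
      Th = trans (∑-extend (<⇒≤ h<x) λ n a b → trans (cong (λ z → Λ n * + z) (n≤0⇒n≡0 (≤-pred (≰⇒> λ k → ℕP.<⇒≱ a (subst (ℕ._≤ h) (ℕP.*-identityʳ n) (÷-≤ (ℕP.≤-trans (s≤s z≤n) a) k)))))) (*-zeroʳ (Λ n))) (∑-Λ÷ h)
      2Q≤ : ∀ d → 1 ℕ.≤ d → 2 ℕ.* (h ÷ d) ℕ.≤ x ÷ d
      2Q≤ d hd = ≤-÷ hd (ℕP.≤-trans (ℕP.≤-trans (ℕP.≤-reflexive (linℕ 2 (λ d q → d ⊗ (κ 2 ⊗ q) ≡' κ 2 ⊗ (d ⊗ q)) tt d (h ÷ d))) (*-monoʳ-≤ 2 (÷-≤ {h} hd ℕP.≤-refl))) 2h≤x)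
      pointwise : ∀ d → 1 ℕ.≤ d → d ℕ.≤ x → Λ d ≤ 𝟙 (d ℕ.≤? h) * Λ d + (Λ d * + (x ÷ d) - + 2 * (Λ d * + (h ÷ d)))
      pointwise d hd d≤x with 𝟙-case (d ℕ.≤? h)
      ... | inj₁ (_ , i) rewrite i = lin 3 (λ l a b → l ⊗ (κ 2 ⊗ b) ≤' l ⊗ a ⇒ l ≤' κ 1 ⊗ l ⊕ (l ⊗ a ⊖ κ 2 ⊗ (l ⊗ b))) tt (Λ d) (+ (x ÷ d)) (+ (h ÷ d))
              (*-monoˡ (Λ-nonneg d) (subst (_≤ + (x ÷ d)) (pos-* 2 (h ÷ d)) (+≤+ (2Q≤ d hd))))
      ... | inj₂ (np , i) rewrite i = lin 3 (λ l a b → l ⊗ κ 1 ≤' l ⊗ a ⇒ b ≡' κ 0 ⇒ l ⊗ b ≡' l ⊗ κ 0 ⇒ l ≤' κ 0 ⊗ l ⊕ (l ⊗ a ⊖ κ 2 ⊗ (l ⊗ b))) tt (Λ d) (+ (x ÷ d)) (+ (h ÷ d))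
              (*-monoˡ (Λ-nonneg d) (+≤+ (÷-pos hd d≤x))) z (cong (Λ d *_) z)
        where
        z : + (h ÷ d) ≡ 0ℤ
        z = cong +_ (n≤0⇒n≡0 (≤-pred (≰⇒> λ k → np (subst (ℕ._≤ h) (ℕP.*-identityʳ d) (÷-≤ hd k)))))
      main : ∑ x Λ ≤ ∑ h Λ + (S * (+ x * (+ lg h + 1ℤ)) + S * + x - + 2 * (S * (+ h * (+ lg h + 1ℤ - 1ℤ)) - + 3 * (S * + h)))
      main = lin 9 (λ A B C D E s x h l → A ≤' B ⊕ (C ⊖ κ 2 ⊗ D) ⇒ C ≤' s ⊗ (x ⊗ E) ⊕ s ⊗ x ⇒ s ⊗ (x ⊗ E) ≤' s ⊗ (x ⊗ (l ⊕ κ 1)) ⇒ s ⊗ (h ⊗ l) ≤' D ⊕ κ 3 ⊗ (s ⊗ h)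
          ⇒ A ≤' B ⊕ (s ⊗ (x ⊗ (l ⊕ κ 1)) ⊕ s ⊗ x ⊖ κ 2 ⊗ (s ⊗ (h ⊗ (l ⊕ κ 1 ⊖ κ 1)) ⊖ κ 3 ⊗ (s ⊗ h)))) tt
        (∑ x Λ) (∑ h Λ) (∑ x L) (∑ h L) (+ lg x) S (+ x) (+ h) (+ lg h) step (∑L-upper x (s≤s z≤n)) (*-monoˡ {S} pos≥0 (*-monoˡ {+ x} pos≥0 (+≤+ lgx))) (∑L-lower h h≥1 h≤X)
        where
        step : ∑ x Λ ≤ ∑ h Λ + (∑ x L - + 2 * ∑ h L)
        step = ≤-trans (∑-mono x pointwise) (≤-reflexive (trans (∑-+ x _ _) (cong₂ _+_
          (trans (∑-extend (<⇒≤ h<x) λ n a _ → trans (cong (_* Λ n) (𝟙-no (n ℕ.≤? h) (ℕP.<⇒≱ a))) (*-zeroˡ (Λ n)))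
            (∑-cong h λ n _ b → trans (cong (_* Λ n) (𝟙-yes (n ℕ.≤? h) b)) (*-identityˡ (Λ n))))
          (trans (∑-- x _ _) (cong₂ _-_ (∑-Λ÷ x) (trans (∑-*ˡ x (+ 2) _) (cong (+ 2 *_) Th)))))))

  m : ℕ → ℤ
  m x = ∑ x (λ n → Λ n * w n)

  w-÷ : ∀ {x n} → 1 ℕ.≤ n → n ℕ.≤ X → V * + (x ÷ n) ≤ + x * w n
  w-÷ {x} {n} h1 h2 = *-cancel {+ n} (+≤+ h1) (subst₂ _≤_
    (trans (cong (V *_) (pos-* n (x ÷ n))) (lin 3 (λ a b c → a ⊗ (b ⊗ c) ≡' b ⊗ (a ⊗ c)) tt V (+ n) (+ (x ÷ n))))
    (trans (cong (_* + x) (sym (w-* h1 h2))) (lin 3 (λ a b c → a ⊗ b ⊗ c ≡' b ⊗ (c ⊗ a)) tt (w n) (+ n) (+ x)))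
    (*-monoˡ {V} pos≥0 (+≤+ (÷-≤ {x} h1 ℕP.≤-refl))))

  ÷-w : ∀ {x n} → 1 ℕ.≤ n → n ℕ.≤ X → + x * w n ≤ V * (1ℤ + + (x ÷ n))
  ÷-w {x} {n} h1 h2 = *-cancel {+ n} (+≤+ h1) (subst₂ _≤_
    (trans (cong (_* + x) (sym (w-* h1 h2))) (lin 3 (λ a b c → a ⊗ b ⊗ c ≡' b ⊗ (c ⊗ a)) tt (w n) (+ n) (+ x)))
    (trans (cong (V *_) (pos-* n (suc (x ÷ n)))) (lin 3 (λ a b c → a ⊗ (b ⊗ c) ≡' b ⊗ (a ⊗ c)) tt V (+ n) (+ suc (x ÷ n))))
    (*-monoˡ {V} pos≥0 (+≤+ (<⇒≤ (÷-lt x h1)))))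

  mertens-lower : ∀ x → 1 ℕ.≤ x → x ℕ.≤ X → S * V * + lg x ≤ m x + + 3 * (S * V)
  mertens-lower x hx hX = *-cancel {+ x} (+≤+ hx) (lin 6 (λ s v x l A M → v ⊗ (s ⊗ (x ⊗ l)) ≤' v ⊗ (A ⊕ κ 3 ⊗ (s ⊗ x)) ⇒ v ⊗ A ≤' x ⊗ M
      ⇒ x ⊗ (s ⊗ v ⊗ l) ≤' x ⊗ (M ⊕ κ 3 ⊗ (s ⊗ v))) tt S V (+ x) (+ lg x) (∑ x L) (m x) (*-monoˡ {V} pos≥0 (∑L-lower x hx hX))
    (subst₂ _≤_ (trans (∑-*ˡ x V (λ d → Λ d * + (x ÷ d))) (cong (V *_) (∑-Λ÷ x))) (∑-*ˡ x (+ x) (λ n → Λ n * w n))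
      (∑-mono x λ d h1 h2 → subst₂ _≤_ (lin 3 (λ a b c → a ⊗ (b ⊗ c) ≡' b ⊗ (a ⊗ c)) tt (Λ d) V (+ (x ÷ d))) (lin 3 (λ a b c → a ⊗ (b ⊗ c) ≡' b ⊗ (a ⊗ c)) tt (Λ d) (+ x) (w d))
        (*-monoˡ (Λ-nonneg d) (w-÷ {x} h1 (ℕP.≤-trans h2 hX))))))

  -- Replacing x ÷ n by x / n costs at most Λ n per term, which `chebyshev` pays for. In the lower
  -- bound the rounding has the favourable direction.
  mertens-upper : ∀ x → 1 ℕ.≤ x → x ℕ.≤ X → m x ≤ S * V * + lg x + + 15 * (S * V)
  mertens-upper x hx hX = *-cancel {+ x} (+≤+ hx) (lin 7 (λ s v x l A M P → v ⊗ A ≤' v ⊗ (s ⊗ (x ⊗ l) ⊕ s ⊗ x) ⇒ x ⊗ M ≤' v ⊗ P ⊕ v ⊗ A ⇒ v ⊗ P ≤' v ⊗ (κ 14 ⊗ (s ⊗ x))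
      ⇒ x ⊗ M ≤' x ⊗ (s ⊗ v ⊗ l ⊕ κ 15 ⊗ (s ⊗ v))) tt S V (+ x) (+ lg x) (∑ x L) (m x) (∑ x Λ) (*-monoˡ {V} pos≥0 (∑L-upper x hx))
    (subst₂ _≤_ (∑-*ˡ x (+ x) (λ n → Λ n * w n)) (trans (∑-+ x _ _) (cong₂ _+_ (∑-*ˡ x V Λ) (trans (∑-*ˡ x V (λ d → Λ d * + (x ÷ d))) (cong (V *_) (∑-Λ÷ x)))))
      (∑-mono x λ d h1 h2 → subst₂ _≤_ (lin 3 (λ a b c → a ⊗ (b ⊗ c) ≡' b ⊗ (a ⊗ c)) tt (Λ d) (+ x) (w d))
         (lin 3 (λ a b c → a ⊗ (b ⊗ (κ 1 ⊕ c)) ≡' b ⊗ a ⊕ b ⊗ (a ⊗ c)) tt (Λ d) V (+ (x ÷ d)))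
        (*-monoˡ (Λ-nonneg d) (÷-w {x} h1 (ℕP.≤-trans h2 hX)))))
    (*-monoˡ {V} pos≥0 (chebyshev x hX)))

nonCoprime-prime : ∀ {n M} → 1 ℕ.≤ n → ¬ Coprime n M → ∃ λ p → Prime p × p ∣ n × p ∣ M
nonCoprime-prime {n} {M} hn nc = prime-divisor-of (prime-divisor
    (ℕP.≤∧≢⇒< (∣-pos hn (gcd[m,n]∣m n M)) (λ e → nc (Co.gcd≡1⇒coprime (sym e)))))
  where
  open import Data.Nat.GCD using (gcd; gcd[m,n]∣m; gcd[m,n]∣n)
  prime-divisor-of : (∃ λ p → Prime p × p ∣ gcd n M) → ∃ λ p → Prime p × p ∣ n × p ∣ M
  prime-divisor-of (p , pp , pd) = p , pp , Dv.∣-trans pd (gcd[m,n]∣m n M) , Dv.∣-trans pd (gcd[m,n]∣n n M)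

-- Oscillating sums and sums over prime powers

module Bounded (T : ℕ) where
  open Scaled T public

  w-scale : ∀ {k j} → 1 ℕ.≤ k → 1 ℕ.≤ j → k ℕ.* j ℕ.≤ X → + k * w (k ℕ.* j) ≡ w j
  w-scale {k} {j} hk hj h = *-cancel-≡ {+ j} (+≤+ hj) (begin
    + j * (+ k * w (k ℕ.* j)) ≡⟨ lin 3 (λ a b c → a ⊗ (b ⊗ c) ≡' c ⊗ (b ⊗ a)) tt (+ j) (+ k) (w (k ℕ.* j)) ⟩
    w (k ℕ.* j) * (+ k * + j) ≡⟨ cong (w (k ℕ.* j) *_) (sym (pos-* k j)) ⟩
    w (k ℕ.* j) * + (k ℕ.* j) ≡⟨ w-* (*-mono-≤ hk hj) h ⟩
    V ≡⟨ sym (w-* hj (ℕP.≤-trans (m≤n*m j k {{nz hk}}) h)) ⟩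
    w j * + j ≡⟨ *-comm (w j) (+ j) ⟩
    + j * w j ∎)
    where open ≡-Reasoning

  v : ℕ → ℤ
  v j = w (2 ^ j)

  v-half : ∀ j → suc j ℕ.≤ T → + 2 * v (suc j) ≡ v j
  v-half j h = w-scale {2} {2 ^ j} (s≤s z≤n) (2^≥1 j) (^-monoʳ-≤ 2 {suc j} {T} h)

  jump≤T : ∀ {y j} → suc y ≡ 2 ^ suc j → suc y ℕ.≤ X → suc j ℕ.≤ T
  jump≤T {y} {j} e h = ℕP.≤-trans (ℕP.≤-reflexive (sym (trans (cong lg e) (lg-2^ (suc j))))) (lg-pred-2^ h)

  -- ∑ (lg n + 1)² / n² converges: the weight (lg n + 1)² only changes at powers of 2.
  ∑-lg²-exact : ∀ y → y ℕ.≤ X →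
    ∑ y (λ n → (w n - w (suc n)) * ((1ℤ + + lg n) * (1ℤ + + lg n))) + w (suc y) * ((1ℤ + + lg y) * (1ℤ + + lg y))
      + (+ 5 + + 2 * + lg y) * v (lg y) ≡ + 6 * V
  ∑-lg²-exact zero _ rewrite lg-0 = lin 2 (λ w V → w ≡' V ⇒ κ 0 ⊕ w ⊗ (κ 1 ⊗ κ 1) ⊕ (κ 5 ⊕ κ 2 ⊗ κ 0) ⊗ w ≡' κ 6 ⊗ V) tt (w 1) V w1≡V
  ∑-lg²-exact (suc y) h with lg-step y | ∑-lg²-exact y (<⇒≤ h)
  ... | same e | ih rewrite e = trans (lin 5 (λ S l w' w'' v → S ⊕ (w' ⊖ w'') ⊗ ((κ 1 ⊕ l) ⊗ (κ 1 ⊕ l)) ⊕ w'' ⊗ ((κ 1 ⊕ l) ⊗ (κ 1 ⊕ l)) ⊕ v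
      ≡' S ⊕ w' ⊗ ((κ 1 ⊕ l) ⊗ (κ 1 ⊕ l)) ⊕ v) tt
      (∑ y (λ n → (w n - w (suc n)) * ((1ℤ + + lg n) * (1ℤ + + lg n)))) (+ lg y) (w (suc y)) (w (suc (suc y))) ((+ 5 + + 2 * + lg y) * v (lg y))) ih
  ... | jump e p | ih rewrite e = lin 7 (λ S l w' w'' a b V → S ⊕ w' ⊗ ((κ 1 ⊕ l) ⊗ (κ 1 ⊕ l)) ⊕ (κ 5 ⊕ κ 2 ⊗ l) ⊗ a ≡' κ 6 ⊗ V ⇒ w' ≡' b ⇒ l ⊗ w' ≡' l ⊗ b ⇒ κ 2 ⊗ b ≡' a ⇒ l ⊗ (κ 2 ⊗ b) ≡' l ⊗ a
      ⇒ S ⊕ (w' ⊖ w'') ⊗ ((κ 1 ⊕ (κ 1 ⊕ l)) ⊗ (κ 1 ⊕ (κ 1 ⊕ l))) ⊕ w'' ⊗ ((κ 1 ⊕ (κ 1 ⊕ l)) ⊗ (κ 1 ⊕ (κ 1 ⊕ l))) ⊕ (κ 5 ⊕ κ 2 ⊗ (κ 1 ⊕ l)) ⊗ b ≡' κ 6 ⊗ V) tt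
      (∑ y (λ n → (w n - w (suc n)) * ((1ℤ + + lg n) * (1ℤ + + lg n)))) (+ lg y) (w (suc y)) (w (suc (suc y))) (v (lg y)) (v (suc (lg y))) V
      ih (cong w p) (cong (λ z → + lg y * w z) p) half (cong (+ lg y *_) half)
    where
    half : + 2 * v (suc (lg y)) ≡ v (lg y)
    half = v-half (lg y) (jump≤T p h)

  ∑-lg² : ∀ y → y ℕ.≤ X →
    ∑ y (λ n → (w n - w (suc n)) * ((1ℤ + + lg n) * (1ℤ + + lg n))) + w (suc y) * ((1ℤ + + lg y) * (1ℤ + + lg y)) ≤ + 6 * V
  ∑-lg² y h = lin 3 (λ A B C → A ⊕ B ≡' C ⇒ κ 0 ≤' B ⇒ A ≤' C) tt _ _ _ (∑-lg²-exact y h)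
    (*-nonneg {+ 5 + + 2 * + lg y} (+-mono-≤ (pos≥0 {5}) (*-nonneg (pos≥0 {2}) (pos≥0 {lg y}))) (w-nonneg (2 ^ lg y)))

  -- Inside a dyadic block the right side grows by `v (lg y)` per term, which bounds the reciprocals
  -- there; a completed block has contributed exactly V.
  harmonic-block : ∀ y → 1 ℕ.≤ y → y ℕ.≤ X → ∑ y w ≤ V * + lg y + (1ℤ + + y - + (2 ^ lg y)) * v (lg y)
  harmonic-block (suc zero) _ _ rewrite lg-1 = lin 2 (λ V w → κ 0 ⊕ w ≤' V ⊗ κ 0 ⊕ (κ 1 ⊕ κ 1 ⊖ κ 1) ⊗ w) tt V (w 1)
  harmonic-block (suc (suc y)) _ h with lg-step (suc y) | harmonic-block (suc y) (s≤s z≤n) (<⇒≤ h)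
  ... | same e | ih rewrite e = lin 7 (λ A w' V l y t v → A ≤' V ⊗ l ⊕ (κ 1 ⊕ y ⊖ t) ⊗ v ⇒ w' ≤' v ⇒ A ⊕ w' ≤' V ⊗ l ⊕ (κ 1 ⊕ (κ 1 ⊕ y) ⊖ t) ⊗ v) tt
      (∑ (suc y) w) (w (suc (suc y))) V (+ lg (suc y)) (+ suc y) (+ (2 ^ lg (suc y))) (v (lg (suc y))) ih
      (w-anti (2^≥1 (lg (suc y))) (ℕP.≤-trans (lg-lower {suc y} (s≤s z≤n)) (n≤1+n (suc y))))
  ... | jump e p | ih rewrite e = lin 9 (λ A w' V l y t v t' v' → A ≤' V ⊗ l ⊕ (κ 1 ⊕ y ⊖ t) ⊗ v ⇒ w' ≡' v' ⇒ v ⊗ t ≡' V ⇒ κ 1 ⊕ y ≡' κ 2 ⊗ t ⇒ (κ 1 ⊕ y) ⊗ v ≡' (κ 2 ⊗ t) ⊗ v ⇒ (κ 1 ⊕ y) ≡' t' ⇒ (κ 1 ⊕ y) ⊗ v' ≡' t' ⊗ v'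
      ⇒ A ⊕ w' ≤' V ⊗ (κ 1 ⊕ l) ⊕ (κ 1 ⊕ (κ 1 ⊕ y) ⊖ t') ⊗ v') tt
      (∑ (suc y) w) (w (suc (suc y))) V (+ lg (suc y)) (+ suc y) (+ (2 ^ lg (suc y))) (v (lg (suc y))) (+ (2 ^ suc (lg (suc y)))) (v (suc (lg (suc y)))) ih
      (cong w p) (w-* (2^≥1 (lg (suc y))) (^-monoʳ-≤ 2 {lg (suc y)} {T} (<⇒≤ (jump≤T p h)))) p2 (cong (_* v (lg (suc y))) p2) (cong +_ p) (cong (λ z → + z * v (suc (lg (suc y)))) p)
    where
    p2 : 1ℤ + + suc y ≡ + 2 * + (2 ^ lg (suc y))
    p2 = trans (cong +_ p) (pos-* 2 (2 ^ lg (suc y)))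

  harmonic-upper : ∀ y → 1 ℕ.≤ y → y ℕ.≤ X → ∑ y w ≤ V * (1ℤ + + lg y)
  harmonic-upper y hy h = lin 6 (λ A V l y t v → A ≤' V ⊗ l ⊕ (κ 1 ⊕ y ⊖ t) ⊗ v ⇒ (κ 1 ⊕ y) ⊗ v ≤' (κ 2 ⊗ t) ⊗ v ⇒ v ⊗ t ≡' V ⇒ A ≤' V ⊗ (κ 1 ⊕ l)) tt
    (∑ y w) V (+ lg y) (+ y) (+ (2 ^ lg y)) (v (lg y)) (harmonic-block y hy h)
    (*-monoʳ (w-nonneg (2 ^ lg y)) (subst (1ℤ + + y ≤_) (pos-* 2 (2 ^ lg y)) (+≤+ (lg-upper y))))
    (w-* (2^≥1 (lg y)) (ℕP.≤-trans (lg-lower hy) h))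

  harmonic-T : ∀ y → y ℕ.≤ X → ∑ y w ≤ V * (1ℤ + + T)
  harmonic-T zero h = *-nonneg (pos≥0 {V₀}) (pos≥0 {suc T})
  harmonic-T (suc y) h = ≤-trans (harmonic-upper (suc y) (s≤s z≤n) h) (*-monoˡ {V} pos≥0 (+≤+ (s≤s (lg-pred-2^ h))))

  w-decr : ∀ n → 1 ℕ.≤ n → w (suc n) ≤ w n
  w-decr n h = w-anti h (n≤1+n n)

  ℓ₀ : ∀ {n} → + ℓ n ≤ S * (1ℤ + + lg n)
  ℓ₀ {n} = subst (+ ℓ n ≤_) (pos-* s (suc (lg n))) (+≤+ (ℓ-upper n))

  S-cube : + 2 * ((1ℤ + + T) * ((1ℤ + + T) * (1ℤ + + T))) ≡ S
  S-cube = sym (trans (cong +_ s-def) (trans (pos-* 2 (suc T ℕ.* (suc T ℕ.* suc T))) (cong (+ 2 *_) (trans (pos-* (suc T) (suc T ℕ.* suc T)) (cong (+ suc T *_) (pos-* (suc T) (suc T)))))))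

  -- Oscillating sums against L and L²: replace L by the monotone ℓ and sum by parts twice.
  module Oscillation {B c : ℤ} (u : ℕ → ℤ) (hB : ∀ m → ∑ m u ≲ B) (hc : ∀ m → u m ≲ c) where

    B≥0 : 0ℤ ≤ B
    B≥0 = ≲-bound (hB 0)

    c≥0 : 0ℤ ≤ c
    c≥0 = ≲-bound (hc 0)

    -- `abel-increasing` bounds the partial sums of u a by 2 B k (1 + lg m)². Summing by parts
    -- against w costs 6 V by `∑-lg²`, whence 12.
    weighted : ∀ (a : ℕ → ℤ) k → 0ℤ ≤ k → 0ℤ ≤ a 0 → (∀ m → a m ≤ a (suc m)) → (∀ m → a m ≤ k * ((1ℤ + + lg m) * (1ℤ + + lg m))) →
      ∀ y → y ℕ.≤ X → ∑ y (λ m → u m * a m * w m) ≲ + 12 * B * k * V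
    weighted a k hk h0 inc hak y hy = ≲-trans
      (abel-decreasing (λ m → u m * a m) w (λ m → + 2 * B * k * Q m) y
        (λ m _ → ≲-trans (abel-increasing u a m hB h0 λ n _ → inc n) (≤-trans (*-monoˡ 2B≥0 (hak m)) (≤-reflexive (sym (*-assoc (+ 2 * B) k (Q m))))))
        w-decr w-nonneg)
      (≤-trans (≤-reflexive (trans (cong₂ _+_
          (trans (∑-ext y λ n → lin 3 (λ w k q → w ⊗ (k ⊗ q) ≡' k ⊗ (w ⊗ q)) tt (w n - w (suc n)) (+ 2 * B * k) (Q n)) (∑-*ˡ y (+ 2 * B * k) _))
          (lin 3 (λ w k q → w ⊗ (k ⊗ q) ≡' k ⊗ (w ⊗ q)) tt (w (suc y)) (+ 2 * B * k) (Q y)))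
        (sym (*-distribˡ-+ (+ 2 * B * k) _ _))))
      (≤-trans (*-monoˡ (*-nonneg 2B≥0 hk) (∑-lg² y hy))
        (≤-reflexive (lin 3 (λ B k V → κ 2 ⊗ B ⊗ k ⊗ (κ 6 ⊗ V) ≡' κ 12 ⊗ B ⊗ k ⊗ V) tt B k V))))
      where
      Q : ℕ → ℤ
      Q m = (1ℤ + + lg m) * (1ℤ + + lg m)
      2B≥0 : 0ℤ ≤ + 2 * B
      2B≥0 = *-nonneg (pos≥0 {2}) B≥0

    -- For the rounding errors e, which have no monotonicity: they are so small that absolute values
    -- can be summed.
    tail : ∀ (e : ℕ → ℤ) K y → y ℕ.≤ X → (∀ m → 1 ℕ.≤ m → m ℕ.≤ y → 0ℤ ≤ e m) → (∀ m → 1 ℕ.≤ m → m ℕ.≤ y → e m ≤ K) → 0ℤ ≤ K →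
      ∑ y (λ m → u m * e m * w m) ≲ c * K * (V * (1ℤ + + T))
    tail e K y hy h0 hK K≥0 = ≲-trans (∑-≲ y {g = λ m → c * K * w m} λ m h1 h2 →
        ≲-* (≲-* (hc m) (≲-nonneg (h0 m h1 h2) (hK m h1 h2))) (≲-nonneg (w-nonneg m) ≤-refl))
      (≤-trans (≤-reflexive (∑-*ˡ y (c * K) w)) (*-monoˡ (*-nonneg c≥0 K≥0) (harmonic-T y hy)))

    ℓ-L≤T : ∀ m → 1 ℕ.≤ m → m ℕ.≤ X → + ℓ m - L m ≤ + T
    ℓ-L≤T m h1 h2 = lin 4 (λ a b l T → a ≤' b ⊕ l ⇒ l ≤' T ⇒ a ⊖ b ≤' T) tt (+ ℓ m) (L m) (+ lg m) (+ T) (ℓ≤L h1) (+≤+ (lg-pred-2^ h2))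

    ∑uLw : ∀ y → y ℕ.≤ X → ∑ y (λ m → u m * L m * w m) ≲ (+ 12 * B + c) * (S * V)
    ∑uLw y hy = subst₂ _≲_
      (trans (sym (∑-+ y _ _)) (∑-ext y λ m → lin 4 (λ u l L w → u ⊗ l ⊗ w ⊕ (κ 0 ⊖ u ⊗ (l ⊖ L) ⊗ w) ≡' u ⊗ L ⊗ w) tt (u m) (+ ℓ m) (L m) (w m)))
      (lin 4 (λ B s c V → κ 12 ⊗ B ⊗ s ⊗ V ⊕ c ⊗ (s ⊗ V) ≡' (κ 12 ⊗ B ⊕ c) ⊗ (s ⊗ V)) tt B S c V)
      (≲-+ (weighted (λ m → + ℓ m) S (pos≥0 {s}) pos≥0 (λ m → +≤+ (ℓ-mono (n≤1+n m)))
            (λ m → ≤-trans (ℓ₀ {m}) (*-monoˡ {S} pos≥0 (suc≤sq (lg m)))) y hy)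
        (subst₂ _≲_ (trans (sym (-1*i≡-i _)) (trans (sym (∑-*ˡ y (- 1ℤ) _)) (∑-ext y λ m → trans (-1*i≡-i _) (sym (+-identityˡ _))))) refl
          (≲-neg (≲-trans (tail (λ m → + ℓ m - L m) (+ T) y hy (λ m h1 _ → i≤j⇒0≤j-i (L≤ℓ h1)) (λ m h1 h2 → ℓ-L≤T m h1 (ℕP.≤-trans h2 hy)) pos≥0)
            (≤-trans (≤-reflexive (*-assoc c (+ T) _)) (*-monoˡ c≥0 (lin 3 (λ T V s → V ⊗ (T ⊗ (κ 1 ⊕ T)) ≤' V ⊗ s ⇒ T ⊗ (V ⊗ (κ 1 ⊕ T)) ≤' s ⊗ V) tt (+ T) V S
              (*-monoˡ {V} pos≥0 TT≤S))))))))
      where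
      TT≤S : + T * (1ℤ + + T) ≤ S
      TT≤S = subst (+ T * (1ℤ + + T) ≤_) S-cube (subst (_≤ + 2 * (+ suc T * (+ suc T * + suc T))) (pos-* T (suc T))
        (subst (+ (T ℕ.* suc T) ≤_) (trans (pos-* 2 (suc T ℕ.* (suc T ℕ.* suc T))) (cong (+ 2 *_) (trans (pos-* (suc T) (suc T ℕ.* suc T)) (cong (+ suc T *_) (pos-* (suc T) (suc T))))))
          (+≤+ (linℕ 1 (λ T → T ⊗ (κ 1 ⊕ T) ≤' κ 2 ⊗ ((κ 1 ⊕ T) ⊗ ((κ 1 ⊕ T) ⊗ (κ 1 ⊕ T)))) tt T))))

    ∑uL²w : ∀ y → y ℕ.≤ X → ∑ y (λ m → u m * (L m * L m) * w m) ≲ (+ 12 * B + c) * (S * S * V)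
    ∑uL²w y hy = subst₂ _≲_
      (trans (sym (∑-+ y _ _)) (∑-ext y λ m → lin 4 (λ u l L w → u ⊗ (l ⊗ l) ⊗ w ⊕ (κ 0 ⊖ u ⊗ (l ⊗ l ⊖ L ⊗ L) ⊗ w) ≡' u ⊗ (L ⊗ L) ⊗ w) tt (u m) (+ ℓ m) (L m) (w m)))
      (lin 4 (λ B s c V → κ 12 ⊗ B ⊗ (s ⊗ s) ⊗ V ⊕ c ⊗ (s ⊗ s ⊗ V) ≡' (κ 12 ⊗ B ⊕ c) ⊗ (s ⊗ s ⊗ V)) tt B S c V)
      (≲-+ (weighted (λ m → + ℓ m * + ℓ m) (S * S) (*-nonneg (pos≥0 {s}) (pos≥0 {s})) (*-nonneg (pos≥0 {ℓ 0}) (pos≥0 {ℓ 0}))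
            (λ m → *-mono {+ ℓ m} pos≥0 (+≤+ (ℓ-mono (n≤1+n m))) (pos≥0 {ℓ m}) (+≤+ (ℓ-mono (n≤1+n m))))
            (λ m → ≤-trans (*-mono {+ ℓ m} pos≥0 (ℓ₀ {m}) (pos≥0 {ℓ m}) (ℓ₀ {m})) (≤-reflexive (lin 2 (λ s q → s ⊗ q ⊗ (s ⊗ q) ≡' s ⊗ s ⊗ (q ⊗ q)) tt S (1ℤ + + lg m)))) y hy)
        (subst₂ _≲_ (trans (sym (-1*i≡-i _)) (trans (sym (∑-*ˡ y (- 1ℤ) _)) (∑-ext y λ m → trans (-1*i≡-i _) (sym (+-identityˡ _))))) refl
          (≲-neg (≲-trans (tail (λ m → + ℓ m * + ℓ m - L m * L m) (+ T * (+ 2 * (S * (1ℤ + + T)))) y hy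
              (λ m h1 _ → i≤j⇒0≤j-i (*-mono (L-nonneg m) (L≤ℓ h1) (L-nonneg m) (L≤ℓ h1)))
              (λ m h1 h2 → sq m h1 (ℕP.≤-trans h2 hy)) (*-nonneg (pos≥0 {T}) (*-nonneg (pos≥0 {2}) (*-nonneg (pos≥0 {s}) (pos≥0 {suc T})))))
            (≤-trans (≤-reflexive (*-assoc c _ _)) (*-monoˡ c≥0 TTT≤))))))
      where
      sq : ∀ m → 1 ℕ.≤ m → m ℕ.≤ X → + ℓ m * + ℓ m - L m * L m ≤ + T * (+ 2 * (S * (1ℤ + + T)))
      sq m h1 h2 = ≤-trans (≤-reflexive (lin 2 (λ l L → l ⊗ l ⊖ L ⊗ L ≡' (l ⊖ L) ⊗ (l ⊕ L)) tt (+ ℓ m) (L m)))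
        (*-mono (i≤j⇒0≤j-i (L≤ℓ h1)) (ℓ-L≤T m h1 h2) (+-mono-≤ (pos≥0 {ℓ m}) (L-nonneg m))
          (lin 4 (λ l L s t → L ≤' l ⇒ l ≤' s ⊗ t ⇒ l ⊕ L ≤' κ 2 ⊗ (s ⊗ t)) tt (+ ℓ m) (L m) S (1ℤ + + T) (L≤ℓ h1)
            (≤-trans (ℓ₀ {m}) (*-monoˡ {S} pos≥0 (+≤+ (s≤s (lg-pred-2^ h2)))))))
      TTT≤ : + T * (+ 2 * (S * (1ℤ + + T))) * (V * (1ℤ + + T)) ≤ S * S * V
      TTT≤ = lin 3 (λ T V s → (s ⊗ V) ⊗ (κ 2 ⊗ (T ⊗ ((κ 1 ⊕ T) ⊗ (κ 1 ⊕ T)))) ≤' (s ⊗ V) ⊗ s ⇒ T ⊗ (κ 2 ⊗ (s ⊗ (κ 1 ⊕ T))) ⊗ (V ⊗ (κ 1 ⊕ T)) ≤' s ⊗ s ⊗ V) tt (+ T) V S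
        (*-monoˡ SV≥0 (subst (+ 2 * (+ T * (+ suc T * + suc T)) ≤_) S-cube
          (*-monoˡ (pos≥0 {2}) (*-monoʳ {+ suc T * + suc T} (*-nonneg (pos≥0 {suc T}) (pos≥0 {suc T})) (+≤+ (n≤1+n T))))))

  module _ {p : ℕ} (pp : Prime p) where

    G : ℕ → ℤ
    G y = ∑ y (λ n → 𝟙 (p ∣? n) * (Λ n * w n))

    Λ-p* : ∀ j → 1 ℕ.≤ j → Λ (p ℕ.* j) ≤ 𝟙 (j ℕ.≟ 1) * + ℓ p + 𝟙 (p ∣? j) * Λ j
    Λ-p* j hj with stripPrime pp j hj
    ... | strip a (suc (suc e)) eq nd _ = ≤-trans (≤-reflexive (trans (cong Λ (trans (cong (p ℕ.*_) eq) (sym (ℕP.*-assoc p (p ^ a) (suc (suc e))))))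
          (Λ-mixed a (suc (suc e)) pp nd (s≤s (s≤s z≤n)))))
        (+-mono-≤ (*-nonneg (𝟙-nonneg (j ℕ.≟ 1)) (pos≥0 {ℓ p})) (*-nonneg (𝟙-nonneg (p ∣? j)) (Λ-nonneg j)))
    ... | strip zero (suc zero) eq nd _ = ≤-trans (≤-reflexive (trans (trans (cong Λ (trans (cong (p ℕ.*_) eq) (ℕP.*-identityʳ p))) (Λ-p pp))
          (sym (trans (cong (_* + ℓ p) (𝟙-yes (j ℕ.≟ 1) eq)) (*-identityˡ (+ ℓ p))))))
        (≤+ʳ (*-nonneg (𝟙-nonneg (p ∣? j)) (Λ-nonneg j)))
    ... | strip (suc a) (suc zero) eq nd _ = ≤-trans (≤-reflexive (trans (trans (cong Λ (cong (p ℕ.*_) eq')) (Λ-power (suc a) pp))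
          (sym (trans (cong₂ _*_ (𝟙-yes (p ∣? j) (subst (p ∣_) (sym eq') (Dv.m∣m*n (p ^ a)))) (trans (cong Λ eq') (Λ-power a pp))) (*-identityˡ (+ ℓ p))))))
        (≤+ˡ (*-nonneg (𝟙-nonneg (j ℕ.≟ 1)) (pos≥0 {ℓ p})))
      where
      eq' : j ≡ p ^ suc a
      eq' = trans eq (ℕP.*-identityʳ (p ^ suc a))

    p*term : ∀ y → y ℕ.≤ X → ∀ j → 1 ℕ.≤ j → j ℕ.≤ y ÷ p → + p * (Λ (p ℕ.* j) * w (p ℕ.* j)) ≤ 𝟙 (j ℕ.≟ 1) * (+ ℓ p * V) + 𝟙 (p ∣? j) * (Λ j * w j)
    p*term y hy j h1 h2 = ≤-trans (≤-reflexive (trans (lin 3 (λ p l w → p ⊗ (l ⊗ w) ≡' l ⊗ (p ⊗ w)) tt (+ p) (Λ (p ℕ.* j)) (w (p ℕ.* j)))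
        (cong (Λ (p ℕ.* j) *_) (w-scale (prime≥1 pp) h1 (ℕP.≤-trans (÷-≤ (prime≥1 pp) h2) hy)))))
      (≤-trans (*-monoʳ (w-nonneg j) (Λ-p* j h1)) (≤-reflexive (trans (*-distribʳ-+ (w j) (𝟙 (j ℕ.≟ 1) * + ℓ p) (𝟙 (p ∣? j) * Λ j)) (cong₂ _+_
        (trans (*-assoc (𝟙 (j ℕ.≟ 1)) (+ ℓ p) (w j)) (𝟙-* (j ℕ.≟ 1) λ { refl → cong (+ ℓ p *_) w1≡V })) (*-assoc (𝟙 (p ∣? j)) (Λ j) (w j))))))

    ∑-𝟙1 : ∀ y a → 0ℤ ≤ a → ∑ y (λ j → 𝟙 (j ℕ.≟ 1) * a) ≤ a
    ∑-𝟙1 zero a h = h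
    ∑-𝟙1 (suc y) a h = ≤-reflexive (trans (∑-single {suc y} {1} {λ j → 𝟙 (j ℕ.≟ 1) * a} (s≤s z≤n) (s≤s z≤n) λ n _ _ ne → trans (cong (_* a) (𝟙-no (n ℕ.≟ 1) ne)) (*-zeroˡ a))
      (trans (cong (_* a) (𝟙-yes (1 ℕ.≟ 1) refl)) (*-identityˡ a)))

    G-rec : ∀ y → y ℕ.≤ X → + p * G y ≤ + ℓ p * V + G (y ÷ p)
    G-rec y hy = ≤-trans (≤-reflexive (trans (cong (+ p *_) (sym (∑-multiples y (λ n → Λ n * w n) (prime≥1 pp)))) (sym (∑-*ˡ (y ÷ p) (+ p) _))))
      (≤-trans (∑-mono (y ÷ p) (p*term y hy)) (≤-trans (≤-reflexive (∑-+ (y ÷ p) _ _)) (+-monoˡ-≤ _ (∑-𝟙1 (y ÷ p) (+ ℓ p * V) (*-nonneg (pos≥0 {ℓ p}) (pos≥0 {V₀}))))))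

    -- If p j is a power of a prime, then j is 1 or again a power of p. So `G-rec` gives a geometric
    -- series of ratio 1/p ≤ 1/2, and the sum is at most twice its leading term.
    G-bound : p ℕ.≤ X → ∀ y → y ℕ.≤ X → G y ≤ + 2 * (+ ℓ p * w p)
    G-bound hp = <-rec _ go
      where
      go : ∀ y → (∀ {z} → z < y → z ℕ.≤ X → G z ≤ + 2 * (+ ℓ p * w p)) → y ℕ.≤ X → G y ≤ + 2 * (+ ℓ p * w p)
      go zero rec hy = *-nonneg (pos≥0 {2}) (*-nonneg (pos≥0 {ℓ p}) (w-nonneg p))
      go (suc y) rec hy = *-cancel {+ p} (+≤+ (prime≥1 pp)) (lin 6 (λ p l w V G G' → p ⊗ G ≤' l ⊗ V ⊕ G' ⇒ G' ≤' κ 2 ⊗ (l ⊗ w) ⇒ l ⊗ (w ⊗ κ 2) ≤' l ⊗ (w ⊗ p) ⇒ l ⊗ (w ⊗ p) ≡' l ⊗ V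
          ⇒ p ⊗ G ≤' p ⊗ (κ 2 ⊗ (l ⊗ w))) tt
        (+ p) (+ ℓ p) (w p) V (G (suc y)) (G (suc y ÷ p)) (G-rec (suc y) hy) (rec lt (ℕP.≤-trans (<⇒≤ lt) hy))
        (*-monoˡ {+ ℓ p} pos≥0 (*-monoˡ (w-nonneg p) (+≤+ (prime≥2 pp)))) (cong (+ ℓ p *_) (w-* (prime≥1 pp) hp)))
        where
        lt : suc y ÷ p < suc y
        lt = ℕP.*-cancelˡ-< p (suc y ÷ p) (suc y) (≤-<-trans (÷-≤ (prime≥1 pp) ℕP.≤-refl) (ℕP.<-≤-trans (ℕP.m<m*n (suc y) 2 (s≤s (s≤s z≤n))) (ℕP.≤-trans (*-monoʳ-≤ (suc y) (prime≥2 pp)) (ℕP.≤-reflexive (ℕP.*-comm (suc y) p)))))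

    R : ℕ → ℤ
    R y = ∑ y (λ n → 𝟙 (p ∣? n) * (𝟙 (¬? (n ℕ.≟ p)) * (Λ n * w n)))

    -- Omitting p itself, every remaining power of p is p times another one; the extra factor 1/p
    -- leaves a sum of order (log p) / p².
    R-bound : ∀ y → y ℕ.≤ X → p ℕ.≤ X → + p * R y ≤ + 2 * (+ ℓ p * w p)
    R-bound y hy hp = ≤-trans (≤-reflexive (trans (cong (+ p *_) (sym (∑-multiples y (λ n → 𝟙 (¬? (n ℕ.≟ p)) * (Λ n * w n)) (prime≥1 pp)))) (sym (∑-*ˡ (y ÷ p) (+ p) _))))
      (≤-trans (∑-mono (y ÷ p) pointwise) (G-bound hp (y ÷ p) (ℕP.≤-trans (÷-≤x y p) hy)))
      where
      pointwise : ∀ j → 1 ℕ.≤ j → j ℕ.≤ y ÷ p → + p * (𝟙 (¬? (p ℕ.* j ℕ.≟ p)) * (Λ (p ℕ.* j) * w (p ℕ.* j))) ≤ 𝟙 (p ∣? j) * (Λ j * w j)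
      pointwise j h1 h2 with 𝟙-case (¬? (p ℕ.* j ℕ.≟ p))
      ... | inj₂ (_ , i) rewrite i = ≤-trans (≤-reflexive (trans (cong (+ p *_) (*-zeroˡ (Λ (p ℕ.* j) * w (p ℕ.* j)))) (*-zeroʳ (+ p)))) (*-nonneg (𝟙-nonneg (p ∣? j)) (*-nonneg (Λ-nonneg j) (w-nonneg j)))
      ... | inj₁ (ne , i) rewrite i = ≤-trans (≤-reflexive (cong (+ p *_) (*-identityˡ (Λ (p ℕ.* j) * w (p ℕ.* j)))))
          (≤-trans (p*term y hy j h1 h2) (≤-reflexive (trans (cong (λ z → z * (+ ℓ p * V) + 𝟙 (p ∣? j) * (Λ j * w j)) (𝟙-no (j ℕ.≟ 1) λ { refl → ne (ℕP.*-identityʳ p) })) (trans (cong (_+ 𝟙 (p ∣? j) * (Λ j * w j)) (*-zeroˡ (+ ℓ p * V))) (+-identityˡ _)))))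

  primePowers-pointwise : ∀ y n → 1 ℕ.≤ n → n ℕ.≤ y → 𝟙 (¬? (prime? n)) * (Λ n * w n) ≤ ∑ y (λ p → 𝟙 (prime? p) * (𝟙 (p ∣? n) * (𝟙 (¬? (n ℕ.≟ p)) * (Λ n * w n))))
  primePowers-pointwise y n h1 h2 with 𝟙-case (¬? (prime? n))
  ... | inj₂ (_ , i) rewrite i = ≤-trans (≤-reflexive (*-zeroˡ (Λ n * w n))) (∑-nonneg y λ p _ _ → *-nonneg (𝟙-nonneg (prime? p)) (*-nonneg (𝟙-nonneg (p ∣? n)) (*-nonneg (𝟙-nonneg (¬? (n ℕ.≟ p))) (*-nonneg (Λ-nonneg n) (w-nonneg n)))))
  primePowers-pointwise y (suc zero) h1 h2 | inj₁ (_ , i) = ≤-trans (≤-reflexive (trans (cong (λ z → 𝟙 (¬? (prime? 1)) * (z * w 1)) Λ-1) (trans (cong (𝟙 (¬? (prime? 1)) *_) (*-zeroˡ (w 1))) (*-zeroʳ (𝟙 (¬? (prime? 1)))))))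
    (∑-nonneg y λ p _ _ → *-nonneg (𝟙-nonneg (prime? p)) (*-nonneg (𝟙-nonneg (p ∣? 1)) (*-nonneg (𝟙-nonneg (¬? (1 ℕ.≟ p))) (*-nonneg (Λ-nonneg 1) (w-nonneg 1)))))
  primePowers-pointwise y n@(suc (suc _)) h1 h2 | inj₁ (np , i) with prime-divisor {n} (s≤s (s≤s z≤n))
  ... | p , pp , pn rewrite i = ≤-trans (≤-reflexive (sym (cong₂ _*_ (𝟙-yes (prime? p) pp) (trans (cong₂ _*_ (𝟙-yes (p ∣? n) pn) (trans (cong (_* (Λ n * w n)) (𝟙-yes (¬? (n ℕ.≟ p)) λ { refl → np pp })) (*-identityˡ _))) (*-identityˡ _)))))
      (∑-term {y} {p} {λ p → 𝟙 (prime? p) * (𝟙 (p ∣? n) * (𝟙 (¬? (n ℕ.≟ p)) * (Λ n * w n)))} (prime≥1 pp) (ℕP.≤-trans (Dv.∣⇒≤ pn) h2) λ p _ _ → *-nonneg (𝟙-nonneg (prime? p)) (*-nonneg (𝟙-nonneg (p ∣? n)) (*-nonneg (𝟙-nonneg (¬? (n ℕ.≟ p))) (*-nonneg (Λ-nonneg n) (w-nonneg n)))))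

  -- The contribution of p is of order (log p) / p² and is compared with (1/p - 1/(p + 1)) (1 + lg
  -- p)², whose sum `∑-lg²` bounds. The hypothesis `suc y ≤ X` keeps `w (suc p)` an exact
  -- reciprocal.
  primePowers-bound : ∀ y → suc y ℕ.≤ X → ∑ y (λ n → 𝟙 (¬? (prime? n)) * (Λ n * w n)) ≤ + 24 * (S * V)
  primePowers-bound y hy = ≤-trans (∑-mono y (primePowers-pointwise y)) (≤-trans (≤-reflexive (∑-swap y y _))
    (≤-trans (∑-mono y each) (≤-trans (≤-reflexive (∑-*ˡ y (+ 4 * S) _))
      (lin 4 (λ s A B V → s ⊗ (A ⊕ B) ≤' s ⊗ (κ 6 ⊗ V) ⇒ κ 0 ≤' s ⊗ B ⇒ κ 4 ⊗ s ⊗ A ≤' κ 24 ⊗ (s ⊗ V)) tt S _ _ V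
        (*-monoˡ {S} pos≥0 (∑-lg² y (<⇒≤ hy))) (*-nonneg {S} pos≥0 (*-nonneg (w-nonneg (suc y)) (*-nonneg (pos≥0 {suc (lg y)}) (pos≥0 {suc (lg y)}))))))))
    where
    each : ∀ p → 1 ℕ.≤ p → p ℕ.≤ y → ∑ y (λ n → 𝟙 (prime? p) * (𝟙 (p ∣? n) * (𝟙 (¬? (n ℕ.≟ p)) * (Λ n * w n)))) ≤ + 4 * S * ((w p - w (suc p)) * ((1ℤ + + lg p) * (1ℤ + + lg p)))
    each p hp1 hp with 𝟙-case (prime? p)
    ... | inj₂ (_ , i) rewrite i = ≤-trans (≤-reflexive (∑-zero y λ n _ _ → *-zeroˡ (𝟙 (p ∣? n) * (𝟙 (¬? (n ℕ.≟ p)) * (Λ n * w n))))) (*-nonneg (*-nonneg (pos≥0 {4}) (pos≥0 {s})) (*-nonneg (i≤j⇒0≤j-i (w-decr p hp1)) (*-nonneg (pos≥0 {suc (lg p)}) (pos≥0 {suc (lg p)}))))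
    ... | inj₁ (pp , i) rewrite i = ≤-trans (≤-reflexive (∑-ext y λ n → *-identityˡ _)) (*-cancel {+ p * + p * (1ℤ + + p)} (subst (1ℤ ≤_) (trans (pos-* (p ℕ.* p) (suc p)) (cong (_* + suc p) (pos-* p p))) (+≤+ (*-mono-≤ (*-mono-≤ hp1 hp1) (s≤s (z≤n {p})))))
        (lin 10 (λ p R l s k w w' V kk k1 → (κ 1 ⊕ p) ⊗ (p ⊗ (p ⊗ R)) ≤' (κ 1 ⊕ p) ⊗ (p ⊗ (κ 2 ⊗ (l ⊗ w))) ⇒ (κ 1 ⊕ p) ⊗ (l ⊗ (w ⊗ p)) ≡' (κ 1 ⊕ p) ⊗ (l ⊗ V) ⇒ (κ 1 ⊕ p) ⊗ V ⊗ l ≤' (κ 1 ⊕ p) ⊗ V ⊗ (s ⊗ k)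
            ⇒ (p ⊗ V ⊗ s) ⊗ k ≤' (p ⊗ V ⊗ s) ⊗ kk ⇒ V ⊗ s ⊗ k ≤' (p ⊗ V ⊗ s) ⊗ kk
            ⇒ (p ⊗ (κ 1 ⊕ p) ⊗ s ⊗ kk) ⊗ (w ⊗ p) ≡' (p ⊗ (κ 1 ⊕ p) ⊗ s ⊗ kk) ⊗ V ⇒ (p ⊗ p ⊗ s ⊗ kk) ⊗ (w' ⊗ (κ 1 ⊕ p)) ≡' (p ⊗ p ⊗ s ⊗ kk) ⊗ V
            ⇒ p ⊗ p ⊗ (κ 1 ⊕ p) ⊗ R ≤' p ⊗ p ⊗ (κ 1 ⊕ p) ⊗ (κ 4 ⊗ s ⊗ ((w ⊖ w') ⊗ kk))) tt
          (+ p) (R pp y) (+ ℓ p) S (1ℤ + + lg p) (w p) (w (suc p)) V ((1ℤ + + lg p) * (1ℤ + + lg p)) 1ℤ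
          (*-monoˡ (pos≥0 {suc p}) (*-monoˡ (pos≥0 {p}) (R-bound pp y (<⇒≤ hy) hp'))) (cong (λ z → + suc p * (+ ℓ p * z)) (w-* hp1 hp'))
          (*-monoˡ (*-nonneg (pos≥0 {suc p}) (pos≥0 {V₀})) (ℓ₀ {p})) (*-monoˡ (*-nonneg (*-nonneg (pos≥0 {p}) (pos≥0 {V₀})) (pos≥0 {s})) k≤kk)
          (≤-trans (*-monoˡ (*-nonneg (pos≥0 {V₀}) (pos≥0 {s})) k≤kk) (*-monoʳ (*-nonneg (pos≥0 {suc (lg p)}) (pos≥0 {suc (lg p)})) (*-monoʳ (pos≥0 {s}) (lin 2 (λ p V → V ⊗ κ 1 ≤' V ⊗ p ⇒ V ≤' p ⊗ V) tt (+ p) V (*-monoˡ {V} pos≥0 (+≤+ hp1))))))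
          (cong (+ p * (1ℤ + + p) * S * ((1ℤ + + lg p) * (1ℤ + + lg p)) *_) (w-* hp1 hp')) (cong (+ p * + p * S * ((1ℤ + + lg p) * (1ℤ + + lg p)) *_) (w-* (s≤s z≤n) (ℕP.≤-trans (s≤s hp) hy)))))
      where
      hp' : p ℕ.≤ X
      hp' = ℕP.≤-trans hp (<⇒≤ hy)
      k≤kk : 1ℤ + + lg p ≤ (1ℤ + + lg p) * (1ℤ + + lg p)
      k≤kk = suc≤sq (lg p)

-- Residue classes

coprime-* : ∀ {a b M} → Coprime a M → Coprime b M → Coprime (a ℕ.* b) M
coprime-* {a} {b} {M} ca cb {d} (dab , dM) = cb (Co.coprime-divisor (λ { (e1 , e2) → ca (e2 , Dv.∣-trans e1 dM) }) dab , dM)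

coprime-factorˡ : ∀ {a M} b → Coprime (a ℕ.* b) M → Coprime a M
coprime-factorˡ b c (h , k) = c (Dv.∣-trans h (Dv.m∣m*n b) , k)

coprime-factorʳ : ∀ a {b M} → Coprime (a ℕ.* b) M → Coprime b M
coprime-factorʳ a c (h , k) = c (Dv.∣-trans h (Dv.n∣m*n a) , k)

module Residues (M : ℕ) (hM : 1 ℕ.≤ M) where

  instance
    M≢0 : ℕ.NonZero M
    M≢0 = nz hM

  infix 4 _~_ _~?_
  record _~_ (a b : ℕ) : Set where
    constructor cong-mod
    field residue-≡ : a ℕ.% M ≡ b ℕ.% M
  open _~_

  _~?_ : ∀ a b → Dec (a ~ b)
  a ~? b with a ℕ.% M ℕ.≟ b ℕ.% M
  ... | yes e = yes (cong-mod e)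
  ... | no ne = no λ e → ne (residue-≡ e)

  ~-refl : ∀ {a} → a ~ a
  ~-refl = cong-mod refl

  ~-sym : ∀ {a b} → a ~ b → b ~ a
  ~-sym (cong-mod e) = cong-mod (sym e)

  ~-trans : ∀ {a b c} → a ~ b → b ~ c → a ~ c
  ~-trans (cong-mod e) (cong-mod f) = cong-mod (trans e f)

  ~-reflexive : ∀ {a b} → a ≡ b → a ~ b
  ~-reflexive refl = ~-refl

  ~-* : ∀ {a b c d} → a ~ b → c ~ d → a ℕ.* c ~ b ℕ.* d
  ~-* {a} {b} {c} {d} (cong-mod e) (cong-mod f) = cong-mod (trans (DM.%-distribˡ-* a c M) (trans (cong₂ (λ x y → (x ℕ.* y) ℕ.% M) e f) (sym (DM.%-distribˡ-* b d M))))

  ~-intro : ∀ {a b} k l → a ℕ.+ k ℕ.* M ≡ b ℕ.+ l ℕ.* M → a ~ b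
  ~-intro {a} {b} k l e = cong-mod (trans (sym (DM.[m+kn]%n≡m%n a k M)) (trans (cong (ℕ._% M) e) (DM.[m+kn]%n≡m%n b l M)))

  ~-period : ∀ n → M ℕ.+ n ~ n
  ~-period n = ~-intro 0 1 (linℕ 2 (λ M n → M ⊕ n ⊕ κ 0 ≡' n ⊕ (M ⊕ κ 0)) tt M n)

  ~-small : ∀ {a b} → a < M → b < M → a ~ b → a ≡ b
  ~-small ha hb (cong-mod e) = trans (sym (DM.m<n⇒m%n≡m ha)) (trans e (DM.m<n⇒m%n≡m hb))

  M~0 : M ~ 0
  M~0 = ~-intro 0 1 refl

  ~-unique : ∀ {a b} → 1 ℕ.≤ a → a ℕ.≤ M → 1 ℕ.≤ b → b ℕ.≤ M → a ~ b → a ≡ b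
  ~-unique {a} {b} a1 aM b1 bM e with a ℕ.≟ M | b ℕ.≟ M
  ... | yes refl | yes refl = refl
  ... | yes refl | no nb = contradiction (~-small (ℕP.≤∧≢⇒< bM nb) hM (~-trans (~-sym e) M~0)) λ { refl → contradiction b1 λ () }
  ... | no na | yes refl = contradiction (~-small (ℕP.≤∧≢⇒< aM na) hM (~-trans e M~0)) λ { refl → contradiction a1 λ () }
  ... | no na | no nb = ~-small (ℕP.≤∧≢⇒< aM na) (ℕP.≤∧≢⇒< bM nb) e

  ~-coprime : ∀ {a b} → a ~ b → Coprime a M → Coprime b M
  ~-coprime {a} {b} (cong-mod e) c {d} (db , dM) = c (Dv.∣n∣m%n⇒∣m dM (subst (d ∣_) (sym e) (Dv.%-presˡ-∣ db dM)) , dM)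

  representative : ∀ n → ∃ λ c → 1 ℕ.≤ c × c ℕ.≤ M × c ~ n
  representative n with n ℕ.% M in eq
  ... | zero = M , hM , ℕP.≤-refl , cong-mod (trans (DM.n%n≡0 M) (sym eq))
  ... | suc k = suc k , s≤s z≤n , <⇒≤ k<M , cong-mod (trans (DM.m<n⇒m%n≡m k<M) (sym eq))
    where
    k<M : suc k < M
    k<M = subst (_< M) eq (DM.m%n<n n M)

  inverse : ∀ {a} → Coprime a M → ∃ λ i → a ℕ.* i ~ 1
  inverse {a} c with Co.coprime-Bézout c
  ... | Bézout.Identity.+- x y eq = x , ~-intro 0 y (trans (ℕP.+-identityʳ (a ℕ.* x)) (trans (ℕP.*-comm a x) (sym eq)))
  ... | Bézout.Identity.-+ x y eq = x ℕ.* (x ℕ.* a) , ~-intro y (y ℕ.* (x ℕ.* a))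
    (linℕ 4 (λ a x y M → κ 1 ⊕ x ⊗ a ≡' y ⊗ M ⇒ (κ 1 ⊕ x ⊗ a) ⊗ (x ⊗ a) ≡' (y ⊗ M) ⊗ (x ⊗ a) ⇒ a ⊗ (x ⊗ (x ⊗ a)) ⊕ y ⊗ M ≡' κ 1 ⊕ y ⊗ (x ⊗ a) ⊗ M) tt a x y M eq (cong (ℕ._* (x ℕ.* a)) eq))

  ~-cancel : ∀ {a x y} → Coprime a M → a ℕ.* x ~ a ℕ.* y → x ~ y
  ~-cancel {a} {x} {y} c e with inverse c
  ... | i , h = ~-trans (~-sym (unit x)) (~-trans (~-* (~-refl {i}) e) (unit y))
    where
    unit : ∀ z → i ℕ.* (a ℕ.* z) ~ z
    unit z = ~-trans (~-reflexive (linℕ 3 (λ i a z → i ⊗ (a ⊗ z) ≡' a ⊗ i ⊗ z) tt i a z)) (~-trans (~-* h (~-refl {z})) (~-reflexive (ℕP.*-identityˡ z)))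

  cop? : ∀ n → Dec (Coprime n M)
  cop? n = coprime? n M

  φ : ℤ
  φ = ∑ M (λ n → 𝟙 (cop? n))

  ∑-class : ∀ {a} → Coprime a M → ∀ g → ∑ M (λ c → 𝟙 (a ℕ.* c ~? g)) ≡ 1ℤ
  ∑-class {a} ca g with inverse ca
  ... | i , h with representative (i ℕ.* g)
  ...   | c , c1 , cM , e = trans (∑-single c1 cM λ n n1 nM ne → 𝟙-no (a ℕ.* n ~? g) λ k → ne (~-unique n1 nM c1 cM (~-cancel ca (~-trans k (~-sym ac~g))))) (𝟙-yes (a ℕ.* c ~? g) ac~g)
    where
    ac~g : a ℕ.* c ~ g
    ac~g = ~-trans (~-* (~-refl {a}) e) (~-trans (~-reflexive (sym (ℕP.*-assoc a i g))) (~-trans (~-* h (~-refl {g})) (~-reflexive (ℕP.*-identityˡ g))))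

  ∑-class₁ : ∀ n → ∑ M (λ c → 𝟙 (n ~? c)) ≡ 1ℤ
  ∑-class₁ n = trans (∑-ext M λ c → 𝟙-cong (n ~? c) (1 ℕ.* c ~? n) (λ e → ~-trans (~-reflexive (ℕP.*-identityˡ c)) (~-sym e)) (λ e → ~-sym (~-trans (~-reflexive (sym (ℕP.*-identityˡ c))) e)))
    (∑-class (Co.1-coprimeTo M) n)

  φ≤M : φ ≤ + M
  φ≤M = ≤-trans (∑-mono M λ n _ _ → 𝟙≤1 (cop? n)) (≤-reflexive (trans (∑-const M 1ℤ) (*-identityʳ (+ M))))

  φ≥1 : 1ℤ ≤ φ
  φ≥1 = ≤-trans (≤-reflexive (sym (𝟙-yes (cop? 1) (Co.1-coprimeTo M)))) (∑-term {M} {1} (s≤s z≤n) hM λ n _ _ → 𝟙-nonneg (cop? n))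

  -- φ times the class of g / a minus the uniform measure on the reduced classes.
  balance : ℕ → ℕ → ℕ → ℤ
  balance g a m = φ * 𝟙 (a ℕ.* m ~? g) - 𝟙 (cop? (a ℕ.* m))

  balance-trivial : ∀ {g a} → Coprime g M → ¬ Coprime a M → ∀ m → balance g a m ≡ 0ℤ
  balance-trivial {g} {a} cg na m = trans (cong₂ (λ x y → φ * x - y)
    (𝟙-no (a ℕ.* m ~? g) λ e → na (λ {d} → coprime-factorˡ m (~-coprime (~-sym e) cg) {d})) (𝟙-no (cop? (a ℕ.* m)) λ c → na λ {d} → coprime-factorˡ m c {d}))
    (lin 1 (λ p → p ⊗ κ 0 ⊖ κ 0 ≡' κ 0) tt φ)

  balance-period : ∀ g a m → balance g a (M ℕ.+ m) ≡ balance g a m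
  balance-period g a m = cong₂ (λ x y → φ * x - y)
    (𝟙-cong (a ℕ.* (M ℕ.+ m) ~? g) (a ℕ.* m ~? g) (~-trans (~-sym p)) (~-trans p))
    (𝟙-cong (cop? (a ℕ.* (M ℕ.+ m))) (cop? (a ℕ.* m)) (λ c {d} → ~-coprime p c {d}) (λ c {d} → ~-coprime (~-sym p) c {d}))
    where
    p : a ℕ.* (M ℕ.+ m) ~ a ℕ.* m
    p = ~-* (~-refl {a}) (~-period m)

  -- For a prime to M, multiplication by a permutes the classes, and each of the two terms sums to
  -- φ; otherwise both vanish identically because g is a reduced class.
  balance-sum : ∀ {g} a → Coprime g M → ∑ M (balance g a) ≡ 0ℤ
  balance-sum {g} a cg with cop? a
  ... | no na = ∑-zero M λ m _ _ → balance-trivial cg na m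
  ... | yes ca = trans (∑-- M _ _) (trans (cong₂ _-_ (trans (∑-*ˡ M φ _) (cong (φ *_) (∑-class ca g)))
    (∑-ext M λ m → 𝟙-cong (cop? (a ℕ.* m)) (cop? m) (λ c {d} → coprime-factorʳ a c {d}) (λ c {d} → coprime-* ca c {d})))
    (lin 1 (λ p → p ⊗ κ 1 ⊖ p ≡' κ 0) tt φ))

  c₀ B₀ : ℤ
  c₀ = + M + 1ℤ
  B₀ = + M * c₀

  balance-≲ : ∀ g a m → balance g a m ≲ c₀
  balance-≲ g a m = ≲-+ (≲-trans (≲-nonneg (*-nonneg φ≥0 (𝟙-nonneg (a ℕ.* m ~? g))) (≤-trans (*-monoˡ φ≥0 (𝟙≤1 (a ℕ.* m ~? g))) (≤-reflexive (*-identityʳ φ)))) φ≤M)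
    (≲-neg (≲-nonneg (𝟙-nonneg (cop? (a ℕ.* m))) (𝟙≤1 (cop? (a ℕ.* m)))))
    where
    φ≥0 : 0ℤ ≤ φ
    φ≥0 = ≤-trans pos≥0 φ≥1

  balance-bounded : ∀ {g} a → Coprime g M → ∀ m → ∑ m (balance g a) ≲ B₀
  balance-bounded {g} a cg = periodic-bounded (balance g a) hM (balance-period g a) (balance-sum a cg) (balance-≲ g a)

*-assoc₃ : ∀ (a b c : ℤ) → a * (b * c) ≡ b * (a * c)
*-assoc₃ = lin 3 (λ a b c → a ⊗ (b ⊗ c) ≡' b ⊗ (a ⊗ c)) tt

-- Selberg's formula in residue classes

module Convolution (T : ℕ) where
  open Bounded T public

  ∑∑-cong : ∀ x {f g : ℕ → ℕ → ℤ} → (∀ d m → 1 ℕ.≤ d → d ℕ.≤ x → 1 ℕ.≤ m → m ℕ.≤ x ÷ d → f d m ≡ g d m) → ∑ x (λ d → ∑ (x ÷ d) (f d)) ≡ ∑ x (λ d → ∑ (x ÷ d) (g d))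
  ∑∑-cong x h = ∑-cong x λ d a b → ∑-cong (x ÷ d) λ m → h d m a b

  L²-expand : ∀ x (G : ℕ → ℤ) → ∑ x (λ n → L n * L n * G n) ≡
    ∑ x (λ k → Λ k * L k * ∑ (x ÷ k) (λ j → G (k ℕ.* j))) + ∑ x (λ k → Λ k * ∑ (x ÷ k) (λ e → Λ e * ∑ (x ÷ k ÷ e) (λ i → G (k ℕ.* (e ℕ.* i)))))
  L²-expand x G = begin
    ∑ x (λ n → L n * L n * G n) ≡⟨ ∑-ext x (λ n → *-assoc (L n) (L n) (G n)) ⟩
    ∑ x (λ n → L n * (L n * G n)) ≡⟨ sym (∑∑-Λ x (λ n → L n * G n)) ⟩
    ∑ x (λ k → ∑ (x ÷ k) (λ j → Λ k * (L (k ℕ.* j) * G (k ℕ.* j)))) ≡⟨ ∑-cong x inner ⟩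
    ∑ x (λ k → Λ k * L k * ∑ (x ÷ k) (λ j → G (k ℕ.* j)) + Λ k * ∑ (x ÷ k) (λ e → Λ e * ∑ (x ÷ k ÷ e) (λ i → G (k ℕ.* (e ℕ.* i))))) ≡⟨ ∑-+ x _ _ ⟩
    _ ∎
    where
    open ≡-Reasoning
    inner : ∀ k → 1 ℕ.≤ k → k ℕ.≤ x → ∑ (x ÷ k) (λ j → Λ k * (L (k ℕ.* j) * G (k ℕ.* j))) ≡
      Λ k * L k * ∑ (x ÷ k) (λ j → G (k ℕ.* j)) + Λ k * ∑ (x ÷ k) (λ e → Λ e * ∑ (x ÷ k ÷ e) (λ i → G (k ℕ.* (e ℕ.* i))))
    inner k hk _ = begin
      ∑ (x ÷ k) (λ j → Λ k * (L (k ℕ.* j) * G (k ℕ.* j))) ≡⟨ ∑-cong (x ÷ k) (λ j hj _ → trans (cong (λ z → Λ k * (z * G (k ℕ.* j))) (L-* hk hj))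
          (lin 4 (λ a b c d → a ⊗ ((b ⊕ c) ⊗ d) ≡' a ⊗ b ⊗ d ⊕ a ⊗ (c ⊗ d)) tt (Λ k) (L k) (L j) (G (k ℕ.* j)))) ⟩
      ∑ (x ÷ k) (λ j → Λ k * L k * G (k ℕ.* j) + Λ k * (L j * G (k ℕ.* j))) ≡⟨ ∑-+ (x ÷ k) _ _ ⟩
      ∑ (x ÷ k) (λ j → Λ k * L k * G (k ℕ.* j)) + ∑ (x ÷ k) (λ j → Λ k * (L j * G (k ℕ.* j))) ≡⟨ cong₂ _+_ (∑-*ˡ (x ÷ k) (Λ k * L k) _)
          (trans (∑-*ˡ (x ÷ k) (Λ k) _) (cong (Λ k *_) (trans (sym (∑∑-Λ (x ÷ k) (λ j → G (k ℕ.* j)))) (∑-ext (x ÷ k) λ e → ∑-*ˡ (x ÷ k ÷ e) (Λ e) _)))) ⟩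
      _ ∎

  -- ∑ F · Λ₂ for Λ₂ = Λ · log + Λ ∗ Λ.
  Sel : (ℕ → ℤ) → ℕ → ℤ
  Sel F y = ∑ y (λ n → F n * (Λ n * L n)) + ∑ y (λ d → ∑ (y ÷ d) (λ e → F (d ℕ.* e) * (Λ d * Λ e)))

  -- Applying σ Λ = L twice gives L² = (Λ L + Λ ∗ Λ) ∗ 1, by the complete additivity of L; summing
  -- against μ removes the convolution with 1.
  selberg-identity : ∀ F y → Sel F y ≡ ∑ y (λ d → ∑ (y ÷ d) (λ m → μ d * (L m * L m * F (d ℕ.* m))))
  selberg-identity F y = sym (begin
    ∑ y (λ d → ∑ (y ÷ d) (λ m → μ d * (L m * L m * F (d ℕ.* m)))) ≡⟨ ∑-ext y (λ d → trans (∑-*ˡ (y ÷ d) (μ d) _) (trans (cong (μ d *_) (L²-expand (y ÷ d) (λ n → F (d ℕ.* n)))) (*-distribˡ-+ (μ d) _ _))) ⟩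
    ∑ y (λ d → μ d * ∑ (y ÷ d) (λ k → Λ k * L k * ∑ (y ÷ d ÷ k) (λ j → F (d ℕ.* (k ℕ.* j))))
      + μ d * ∑ (y ÷ d) (λ k → Λ k * ∑ (y ÷ d ÷ k) (λ e → Λ e * ∑ (y ÷ d ÷ k ÷ e) (λ i → F (d ℕ.* (k ℕ.* (e ℕ.* i))))))) ≡⟨ ∑-+ y _ _ ⟩
    ∑ y (λ d → μ d * ∑ (y ÷ d) (λ k → Λ k * L k * ∑ (y ÷ d ÷ k) (λ j → F (d ℕ.* (k ℕ.* j)))))
      + ∑ y (λ d → μ d * ∑ (y ÷ d) (λ k → Λ k * ∑ (y ÷ d ÷ k) (λ e → Λ e * ∑ (y ÷ d ÷ k ÷ e) (λ i → F (d ℕ.* (k ℕ.* (e ℕ.* i))))))) ≡⟨ cong₂ _+_ first second ⟩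
    Sel F y ∎)
    where
    open ≡-Reasoning
    -- Moving the μ-variable inwards past a factor k.
    push : ∀ y (c : ℕ → ℤ) (H : ℕ → ℕ → ℕ → ℤ) → ∑ y (λ d → μ d * ∑ (y ÷ d) (λ k → c k * H d k (y ÷ d ÷ k))) ≡ ∑ y (λ k → c k * ∑ (y ÷ k) (λ d → μ d * H d k (y ÷ k ÷ d)))
    push y c H = trans (∑-ext y λ d → sym (∑-*ˡ (y ÷ d) (μ d) _)) (trans (∑∑-swap y _) (trans
      (∑∑-cong y λ k d hk _ hd _ → trans (cong (λ z → μ d * (c k * H d k z)) (÷-comm y hd hk)) (*-assoc₃ (μ d) (c k) _))
      (∑-ext y λ k → ∑-*ˡ (y ÷ k) (c k) _)))
    invert : ∀ y (G : ℕ → ℤ) → 1 ℕ.≤ y → ∑ y (λ d → μ d * ∑ (y ÷ d) (λ j → G (d ℕ.* j))) ≡ G 1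
    invert y G hy = trans (∑-ext y λ d → sym (∑-*ˡ (y ÷ d) (μ d) _)) (μ-inversion y G hy)
    comm₃ : ∀ d k j → d ℕ.* (k ℕ.* j) ≡ k ℕ.* (d ℕ.* j)
    comm₃ = linℕ 3 (λ d k j → d ⊗ (k ⊗ j) ≡' k ⊗ (d ⊗ j)) tt
    first : ∑ y (λ d → μ d * ∑ (y ÷ d) (λ k → Λ k * L k * ∑ (y ÷ d ÷ k) (λ j → F (d ℕ.* (k ℕ.* j))))) ≡ ∑ y (λ n → F n * (Λ n * L n))
    first = trans (push y (λ k → Λ k * L k) (λ d k z → ∑ z (λ j → F (d ℕ.* (k ℕ.* j))))) (∑-cong y λ k hk hky →
      trans (cong (Λ k * L k *_) (trans (∑-ext (y ÷ k) λ d → cong (μ d *_) (∑-ext (y ÷ k ÷ d) λ j → cong F (comm₃ d k j)))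
        (trans (invert (y ÷ k) (λ n → F (k ℕ.* n)) (÷-pos hk hky)) (cong F (ℕP.*-identityʳ k))))) (*-comm (Λ k * L k) (F k)))
    second : ∑ y (λ d → μ d * ∑ (y ÷ d) (λ k → Λ k * ∑ (y ÷ d ÷ k) (λ e → Λ e * ∑ (y ÷ d ÷ k ÷ e) (λ i → F (d ℕ.* (k ℕ.* (e ℕ.* i))))))) ≡ ∑ y (λ d → ∑ (y ÷ d) (λ e → F (d ℕ.* e) * (Λ d * Λ e)))
    second = trans (push y Λ (λ d k z → ∑ z (λ e → Λ e * ∑ (z ÷ e) (λ i → F (d ℕ.* (k ℕ.* (e ℕ.* i))))))) (∑-cong y λ k hk hky →
      trans (cong (Λ k *_) (trans (push (y ÷ k) Λ (λ d e z → ∑ z (λ i → F (d ℕ.* (k ℕ.* (e ℕ.* i)))))) (∑-cong (y ÷ k) λ e he hey →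
          cong (Λ e *_) (trans (∑-ext (y ÷ k ÷ e) λ d → cong (μ d *_) (∑-ext (y ÷ k ÷ e ÷ d) λ i → cong F (trans (comm₃ d k (e ℕ.* i)) (cong (k ℕ.*_) (comm₃ d e i)))))
            (trans (invert (y ÷ k ÷ e) (λ n → F (k ℕ.* (e ℕ.* n))) (÷-pos he hey)) (cong (λ z → F (k ℕ.* z)) (ℕP.*-identityʳ e)))))))
        (trans (sym (∑-*ˡ (y ÷ k) (Λ k) _)) (∑-ext (y ÷ k) λ e → lin 3 (λ a b c → a ⊗ (b ⊗ c) ≡' c ⊗ (a ⊗ b)) tt (Λ k) (Λ e) (F (k ℕ.* e)))))

  Λ₂ : ℕ → ℤ
  Λ₂ n = Λ n * L n + ∑ n (λ d → 𝟙 (d ∣? n) * (Λ d * Λ (n ÷ d)))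

  Λ₂-nonneg : ∀ n → 0ℤ ≤ Λ₂ n
  Λ₂-nonneg n = +-mono-≤ (*-nonneg (Λ-nonneg n) (L-nonneg n)) (∑-nonneg n λ d _ _ → *-nonneg (𝟙-nonneg (d ∣? n)) (*-nonneg (Λ-nonneg d) (Λ-nonneg (n ÷ d))))

  *-÷ : ∀ {d} e → 1 ℕ.≤ d → (d ℕ.* e) ÷ d ≡ e
  *-÷ {d} e hd = ≤-ext (λ m h → *-cancelˡ-≤ d {{nz hd}} (÷-≤ hd h)) (λ m h → ≤-÷ hd (*-monoʳ-≤ d h))

  Sel-Λ₂ : ∀ F y → Sel F y ≡ ∑ y (λ n → F n * Λ₂ n)
  Sel-Λ₂ F y = sym (trans (∑-ext y λ n → *-distribˡ-+ (F n) _ _) (trans (∑-+ y _ _) (cong (λ z → ∑ y (λ n → F n * (Λ n * L n)) + z) (sym conv))))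
    where
    open ≡-Reasoning
    conv : ∑ y (λ d → ∑ (y ÷ d) (λ e → F (d ℕ.* e) * (Λ d * Λ e))) ≡ ∑ y (λ n → F n * ∑ n (λ d → 𝟙 (d ∣? n) * (Λ d * Λ (n ÷ d))))
    conv = begin
      ∑ y (λ d → ∑ (y ÷ d) (λ e → F (d ℕ.* e) * (Λ d * Λ e))) ≡⟨ ∑∑-cong y (λ d e hd _ _ _ → cong (λ z → F (d ℕ.* e) * (Λ d * Λ z)) (sym (*-÷ e hd))) ⟩
      ∑ y (λ d → ∑ (y ÷ d) (λ e → F (d ℕ.* e) * (Λ d * Λ ((d ℕ.* e) ÷ d)))) ≡⟨ ∑-cong y (λ d hd _ → ∑-multiples y (λ n → F n * (Λ d * Λ (n ÷ d))) hd) ⟩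
      ∑ y (λ d → ∑ y (λ n → 𝟙 (d ∣? n) * (F n * (Λ d * Λ (n ÷ d))))) ≡⟨ ∑-swap y y _ ⟩
      ∑ y (λ n → ∑ y (λ d → 𝟙 (d ∣? n) * (F n * (Λ d * Λ (n ÷ d))))) ≡⟨ ∑-cong y (λ n hn hny → trans (σ-extend (λ d → F n * (Λ d * Λ (n ÷ d))) hn hny)
          (trans (∑-ext n λ d → *-assoc₃ (𝟙 (d ∣? n)) (F n) _) (∑-*ˡ n (F n) _))) ⟩
      _ ∎

  lg-indicator : ∀ {t n} → 1 ℕ.≤ n → lg n ℕ.≤ t → ∀ (c : ℕ → ℤ) → ∑ t (λ j → 𝟙 (2 ^ j ℕ.≤? n) * c j) ≡ ∑ (lg n) c
  lg-indicator {t} {n} hn h c = trans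
    (∑-extend h λ j a _ → trans (cong (_* c j) (𝟙-no (2 ^ j ℕ.≤? n) λ k → ℕP.<⇒≱ a (≤-lg k))) (*-zeroˡ (c j)))
    (∑-cong (lg n) λ j _ b → trans (cong (_* c j) (𝟙-yes (2 ^ j ℕ.≤? n) (ℕP.≤-trans (^-monoʳ-≤ 2 b) (lg-lower hn)))) (*-identityˡ (c j)))

  ∑-odd : ∀ l → ∑ l (λ j → + 2 * + j - 1ℤ) ≡ + l * + l
  ∑-odd zero = sym (*-zeroˡ 0ℤ)
  ∑-odd (suc l) = trans (cong (_+ (+ 2 * + suc l - 1ℤ)) (∑-odd l)) (lin 1 (λ l → l ⊗ l ⊕ (κ 2 ⊗ (κ 1 ⊕ l) ⊖ κ 1) ≡' (κ 1 ⊕ l) ⊗ (κ 1 ⊕ l)) tt (+ l))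

  -- `lg n` counts the j ≥ 1 with 2^j ≤ n. In this way partial summation against a logarithm becomes
  -- a sum over dyadic levels.
  lg-layers : ∀ t (f : ℕ → ℤ) → ∑ (2 ^ t) (λ n → f n * + lg n) ≡ ∑ t (λ j → ∑ (2 ^ t) f - ∑ (2 ^ j ℕ.∸ 1) f)
  lg-layers t f = begin
    ∑ x (λ n → f n * + lg n) ≡⟨ ∑-cong x (λ n hn hx → trans (cong (f n *_) (sym (trans (lg-indicator hn (subst (lg n ℕ.≤_) (lg-2^ t) (lg-mono hx)) (λ _ → 1ℤ)) (trans (∑-const (lg n) 1ℤ) (*-identityʳ (+ lg n))))))
        (trans (sym (∑-*ˡ t (f n) _)) (∑-ext t λ j → lin 2 (λ f i → f ⊗ (i ⊗ κ 1) ≡' i ⊗ f) tt (f n) (𝟙 (2 ^ j ℕ.≤? n))))) ⟩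
    ∑ x (λ n → ∑ t (λ j → 𝟙 (2 ^ j ℕ.≤? n) * f n)) ≡⟨ ∑-swap x t _ ⟩
    ∑ t (λ j → ∑ x (λ n → 𝟙 (2 ^ j ℕ.≤? n) * f n)) ≡⟨ ∑-cong t cut ⟩
    _ ∎
    where
    open ≡-Reasoning
    x : ℕ
    x = 2 ^ t
    cut : ∀ j → 1 ℕ.≤ j → j ℕ.≤ t → ∑ x (λ n → 𝟙 (2 ^ j ℕ.≤? n) * f n) ≡ ∑ x f - ∑ (2 ^ j ℕ.∸ 1) f
    cut j hj ht = lin 3 (λ A B C → A ⊕ B ≡' C ⇒ A ≡' C ⊖ B) tt _ _ _ (begin
      ∑ x (λ n → 𝟙 (2 ^ j ℕ.≤? n) * f n) + ∑ (2 ^ j ℕ.∸ 1) f ≡⟨ cong (λ z → ∑ x (λ n → 𝟙 (2 ^ j ℕ.≤? n) * f n) + z) (sym (trans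
          (∑-extend (ℕP.≤-trans (m∸n≤m (2 ^ j) 1) (^-monoʳ-≤ 2 ht)) λ n a _ → trans (cong (_* f n) (𝟙-no (suc n ℕ.≤? 2 ^ j) λ k → ℕP.<⇒≱ k (subst (ℕ._≤ n) (m+[n∸m]≡n (2^≥1 j)) a))) (*-zeroˡ (f n)))
          (∑-cong (2 ^ j ℕ.∸ 1) λ n _ b → trans (cong (_* f n) (𝟙-yes (suc n ℕ.≤? 2 ^ j) (subst (suc n ℕ.≤_) (m+[n∸m]≡n (2^≥1 j)) (s≤s b)))) (*-identityˡ (f n))))) ⟩
      ∑ x (λ n → 𝟙 (2 ^ j ℕ.≤? n) * f n) + ∑ x (λ n → 𝟙 (suc n ℕ.≤? 2 ^ j) * f n) ≡⟨ sym (∑-+ x _ _) ⟩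
      ∑ x (λ n → 𝟙 (2 ^ j ℕ.≤? n) * f n + 𝟙 (suc n ℕ.≤? 2 ^ j) * f n) ≡⟨ ∑-ext x (λ n → one n) ⟩
      ∑ x f ∎)
      where
      one : ∀ n → 𝟙 (2 ^ j ℕ.≤? n) * f n + 𝟙 (suc n ℕ.≤? 2 ^ j) * f n ≡ f n
      one n with 𝟙-case (2 ^ j ℕ.≤? n) | 𝟙-case (suc n ℕ.≤? 2 ^ j)
      ... | inj₁ (p , _) | inj₁ (q , _) = contradiction p (ℕP.<⇒≱ q)
      ... | inj₂ (p , _) | inj₂ (q , _) = contradiction (≰⇒> p) q
      ... | inj₁ (_ , i) | inj₂ (_ , k) rewrite i | k = lin 1 (λ f → κ 1 ⊗ f ⊕ κ 0 ⊗ f ≡' f) tt (f n)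
      ... | inj₂ (_ , i) | inj₁ (_ , k) rewrite i | k = lin 1 (λ f → κ 0 ⊗ f ⊕ κ 1 ⊗ f ≡' f) tt (f n)

  -- Here l² is the sum of the odd numbers 2 j - 1 with j ≤ l. Since the height is a power of 2, the
  -- condition 2^j ≤ 2^t ÷ d becomes d ≤ 2^(t - j) exactly.
  lg²-layers : ∀ t (f : ℕ → ℤ) → ∑ (2 ^ t) (λ d → f d * (+ lg (2 ^ t ÷ d) * + lg (2 ^ t ÷ d))) ≡ ∑ t (λ j → (+ 2 * + j - 1ℤ) * ∑ (2 ^ (t ℕ.∸ j)) f)
  lg²-layers t f = begin
    ∑ x (λ d → f d * (+ lg (x ÷ d) * + lg (x ÷ d))) ≡⟨ ∑-cong x (λ d hd hx → trans (cong (f d *_) (trans (sym (∑-odd (lg (x ÷ d)))) (sym (lg-indicator (÷-pos hd hx) (subst (lg (x ÷ d) ℕ.≤_) (lg-2^ t) (lg-mono (÷-≤x x d))) (λ j → + 2 * + j - 1ℤ)))))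
        (sym (∑-*ˡ t (f d) _))) ⟩
    ∑ x (λ d → ∑ t (λ j → f d * (𝟙 (2 ^ j ℕ.≤? x ÷ d) * (+ 2 * + j - 1ℤ)))) ≡⟨ ∑-swap x t _ ⟩
    ∑ t (λ j → ∑ x (λ d → f d * (𝟙 (2 ^ j ℕ.≤? x ÷ d) * (+ 2 * + j - 1ℤ)))) ≡⟨ ∑-cong t cut ⟩
    _ ∎
    where
    open ≡-Reasoning
    x : ℕ
    x = 2 ^ t
    cut : ∀ j → 1 ℕ.≤ j → j ℕ.≤ t → ∑ x (λ d → f d * (𝟙 (2 ^ j ℕ.≤? x ÷ d) * (+ 2 * + j - 1ℤ))) ≡ (+ 2 * + j - 1ℤ) * ∑ (2 ^ (t ℕ.∸ j)) f
    cut j hj ht = trans (∑-cong x λ d hd _ → trans (lin 3 (λ f i c → f ⊗ (i ⊗ c) ≡' c ⊗ (i ⊗ f)) tt (f d) (𝟙 (2 ^ j ℕ.≤? x ÷ d)) (+ 2 * + j - 1ℤ))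
          (cong (λ z → (+ 2 * + j - 1ℤ) * (z * f d)) (𝟙-cong (2 ^ j ℕ.≤? x ÷ d) (d ℕ.≤? 2 ^ (t ℕ.∸ j))
            (λ h → ℕP.*-cancelʳ-≤ d (2 ^ (t ℕ.∸ j)) (2 ^ j) {{nz (2^≥1 j)}} (subst (d ℕ.* 2 ^ j ℕ.≤_) split (÷-≤ hd h)))
            (λ h → ≤-÷ hd (subst (d ℕ.* 2 ^ j ℕ.≤_) (sym split) (*-monoˡ-≤ (2 ^ j) h))))))
      (trans (∑-*ˡ x (+ 2 * + j - 1ℤ) _) (cong ((+ 2 * + j - 1ℤ) *_) (trans
        (∑-extend (^-monoʳ-≤ 2 (m∸n≤m t j)) λ d a _ → trans (cong (_* f d) (𝟙-no (d ℕ.≤? 2 ^ (t ℕ.∸ j)) (ℕP.<⇒≱ a))) (*-zeroˡ (f d)))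
        (∑-cong (2 ^ (t ℕ.∸ j)) λ d _ b → trans (cong (_* f d) (𝟙-yes (d ℕ.≤? 2 ^ (t ℕ.∸ j)) b)) (*-identityˡ (f d))))))
      where
      split : x ≡ 2 ^ (t ℕ.∸ j) ℕ.* 2 ^ j
      split = trans (cong (2 ^_) (sym (m∸n+n≡m ht))) (^-distribˡ-+-* 2 (t ℕ.∸ j) j)

module InClasses (M : ℕ) (hM : 1 ℕ.≤ M) (T : ℕ) (M≤X : M ℕ.≤ 2 ^ T) where
  open Convolution T public
  open Residues M hM public

  m′ : ℕ → ℤ
  m′ y = ∑ y (λ n → 𝟙 (cop? n) * (Λ n * w n))

  Cm : ℤ
  Cm = + 15 + + 2 * + M * (1ℤ + + lg M)

  M≥0 : 0ℤ ≤ + 2 * + M * (1ℤ + + lg M)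
  M≥0 = *-nonneg (*-nonneg (pos≥0 {2}) (pos≥0 {M})) (pos≥0 {suc (lg M)})

  Λw-nonneg : ∀ n → 0ℤ ≤ Λ n * w n
  Λw-nonneg n = *-nonneg (Λ-nonneg n) (w-nonneg n)

  -- Each n not prime to M is divisible by a prime p ∣ M, and `G-bound` bounds the multiples of p.
  -- The count of such p is crude; what matters is a multiple of S V independent of T.
  nonCoprime-bound : ∀ y → y ℕ.≤ X → m y ≤ m′ y + + 2 * + M * (1ℤ + + lg M) * (S * V)
  nonCoprime-bound y hy = ≤-trans (∑-mono y pointwise) (≤-trans (≤-reflexive (trans (∑-+ y _ _) (cong (λ z → m′ y + z) (∑-swap y M _))))
    (+-monoʳ-≤ (m′ y) (≤-trans (∑-mono M each) (≤-reflexive (trans (∑-const M _) (lin 4 (λ m l s v → m ⊗ (κ 2 ⊗ (s ⊗ l ⊗ v)) ≡' κ 2 ⊗ m ⊗ l ⊗ (s ⊗ v)) tt (+ M) (1ℤ + + lg M) S V))))))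
    where
    I : ℕ → ℕ → ℤ
    I n p = 𝟙 (prime? p ×-dec p ∣? M) * (𝟙 (p ∣? n) * (Λ n * w n))
    I≥0 : ∀ n p → 0ℤ ≤ I n p
    I≥0 n p = *-nonneg (𝟙-nonneg (prime? p ×-dec p ∣? M)) (*-nonneg (𝟙-nonneg (p ∣? n)) (Λw-nonneg n))
    pointwise : ∀ n → 1 ℕ.≤ n → n ℕ.≤ y → Λ n * w n ≤ 𝟙 (cop? n) * (Λ n * w n) + ∑ M (I n)
    pointwise n hn _ with 𝟙-case (cop? n)
    ... | inj₁ (_ , i) rewrite i = ≤-trans (≤+ʳ (∑-nonneg M λ p _ _ → I≥0 n p)) (≤-reflexive (cong (_+ ∑ M (I n)) (sym (*-identityˡ (Λ n * w n)))))
    ... | inj₂ (nc , i) rewrite i with nonCoprime-prime hn (λ c → nc λ {d} → c {d})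
    ...   | p , pp , pn , pM = ≤-trans (≤-reflexive (sym (trans (cong₂ _*_ (𝟙-yes (prime? p ×-dec p ∣? M) (pp , pM)) (trans (cong (_* (Λ n * w n)) (𝟙-yes (p ∣? n) pn)) (*-identityˡ _))) (*-identityˡ _))))
            (≤-trans (∑-term {M} {p} {I n} (prime≥1 pp) (Dv.∣⇒≤ pM) λ q _ _ → I≥0 n q) (≤+ˡ (≤-reflexive (sym (*-zeroˡ (Λ n * w n))))))
    each : ∀ p → 1 ℕ.≤ p → p ℕ.≤ M → ∑ y (λ n → I n p) ≤ + 2 * (S * (1ℤ + + lg M) * V)
    each p hp hpM with 𝟙-case (prime? p ×-dec p ∣? M)
    ... | inj₂ (_ , i) rewrite i = ≤-trans (≤-reflexive (∑-zero y λ n _ _ → *-zeroˡ (𝟙 (p ∣? n) * (Λ n * w n)))) (*-nonneg (pos≥0 {2}) (*-nonneg (*-nonneg (pos≥0 {s}) (pos≥0 {suc (lg M)})) (pos≥0 {V₀})))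
    ... | inj₁ ((pp , _) , i) rewrite i = ≤-trans (≤-reflexive (∑-ext y λ n → *-identityˡ _)) (≤-trans (G-bound pp (ℕP.≤-trans hpM M≤X) y hy)
          (*-monoˡ (pos≥0 {2}) (*-mono (pos≥0 {ℓ p}) (≤-trans (ℓ₀ {p}) (*-monoˡ {S} pos≥0 (+≤+ (s≤s (lg-mono hpM))))) (w-nonneg p)
            (≤-trans (w-anti (s≤s z≤n) hp) (≤-reflexive w1≡V)))))

  m′≤m : ∀ y → m′ y ≤ m y
  m′≤m y = ∑-mono y λ n _ _ → ≤-trans (*-monoʳ (Λw-nonneg n) (𝟙≤1 (cop? n))) (≤-reflexive (*-identityˡ _))

  m′-upper : ∀ y → 1 ℕ.≤ y → y ℕ.≤ X → m′ y ≤ S * V * (+ lg y + Cm)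
  m′-upper y h1 h2 = lin 5 (λ a b u l c → a ≤' b ⇒ b ≤' u ⊗ l ⊕ κ 15 ⊗ u ⇒ κ 0 ≤' c ⊗ u ⇒ a ≤' u ⊗ (l ⊕ (κ 15 ⊕ c))) tt (m′ y) (m y) (S * V) (+ lg y) (+ 2 * + M * (1ℤ + + lg M))
    (m′≤m y) (mertens-upper y h1 h2) (*-nonneg M≥0 SV≥0)

  m′-lower : ∀ y → 1 ℕ.≤ y → y ℕ.≤ X → S * V * (+ lg y - Cm) ≤ m′ y
  m′-lower y h1 h2 = lin 5 (λ a b u l c → u ⊗ l ≤' b ⊕ κ 3 ⊗ u ⇒ b ≤' a ⊕ c ⊗ u ⇒ κ 0 ≤' u ⇒ u ⊗ (l ⊖ (κ 15 ⊕ c)) ≤' a) tt (m′ y) (m y) (S * V) (+ lg y) (+ 2 * + M * (1ℤ + + lg M))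
    (mertens-lower y h1 h2) (nonCoprime-bound y h2) SV≥0

  K₁ K₂ K : ℤ
  K₁ = + 12 * B₀ + c₀
  K₂ = (Cm + + 2) * (Cm + + 2)
  K = K₁ + K₂

  Cm≥0 : 0ℤ ≤ Cm
  Cm≥0 = +-mono-≤ (pos≥0 {15}) M≥0

  K₁≥0 : 0ℤ ≤ K₁
  K₁≥0 = +-mono-≤ (*-nonneg (pos≥0 {12}) (*-nonneg (pos≥0 {M}) (+-mono-≤ (pos≥0 {M}) pos≥0))) (+-mono-≤ (pos≥0 {M}) pos≥0)

  K₂≥0 : 0ℤ ≤ K₂
  K₂≥0 = *-nonneg (+-mono-≤ Cm≥0 (pos≥0 {2})) (+-mono-≤ Cm≥0 (pos≥0 {2}))

  K≥0 : 0ℤ ≤ K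
  K≥0 = +-mono-≤ K₁≥0 K₂≥0

  lg-split : ∀ y d → 1 ℕ.≤ d → d ℕ.≤ y → lg d ℕ.+ lg (y ÷ d) ℕ.≤ lg y × lg y ℕ.≤ suc (lg d ℕ.+ lg (y ÷ d))
  lg-split y d hd hy = ℕP.≤-trans (lg-*-≥ hd (÷-pos hd hy)) (lg-mono (÷-≤ hd ℕP.≤-refl))
    , lg-< (ℕP.<-≤-trans (÷-lt y hd) (ℕP.≤-trans (*-mono-≤ (<⇒≤ (lg-upper d)) (lg-upper (y ÷ d))) (ℕP.≤-reflexive
        (trans (sym (^-distribˡ-+-* 2 (suc (lg d)) (suc (lg (y ÷ d))))) (cong (λ k → 2 ^ suc k) (+-suc (lg d) (lg (y ÷ d))))))))

  F₀ : ℕ → ℤ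
  F₀ n = 𝟙 (cop? n) * w n

  cop-* : ∀ d e → 𝟙 (cop? (d ℕ.* e)) ≡ 𝟙 (cop? d) * 𝟙 (cop? e)
  cop-* d e with 𝟙-case (cop? d) | 𝟙-case (cop? e)
  ... | inj₁ (p , i) | inj₁ (q , k) rewrite i | k = trans (𝟙-yes (cop? (d ℕ.* e)) λ {x} → coprime-* p q {x}) (sym (*-identityʳ 1ℤ))
  ... | inj₂ (p , i) | _ rewrite i = trans (𝟙-no (cop? (d ℕ.* e)) λ c → p λ {x} → coprime-factorˡ e c {x}) (sym (*-zeroˡ (𝟙 (cop? e))))
  ... | inj₁ (p , i) | inj₂ (q , k) rewrite i | k = trans (𝟙-no (cop? (d ℕ.* e)) λ c → q λ {x} → coprime-factorʳ d c {x}) (sym (*-zeroʳ 1ℤ))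

  de≤X : ∀ {y d e} → y ℕ.≤ X → 1 ℕ.≤ d → e ℕ.≤ y ÷ d → d ℕ.* e ℕ.≤ X
  de≤X hy hd he = ℕP.≤-trans (÷-≤ hd he) hy

  total-form : ∀ y → y ℕ.≤ X → V * Sel F₀ y ≡ ∑ y (λ d → 𝟙 (cop? d) * (Λ d * w d) * (V * L d + m′ (y ÷ d)))
  total-form y hy = begin
    V * Sel F₀ y ≡⟨ *-distribˡ-+ V _ _ ⟩
    V * ∑ y (λ n → F₀ n * (Λ n * L n)) + V * ∑ y (λ d → ∑ (y ÷ d) (λ e → F₀ (d ℕ.* e) * (Λ d * Λ e))) ≡⟨ cong₂ _+_
        (trans (sym (∑-*ˡ y V _)) (∑-ext y λ n → lin 5 (λ v c w l L → v ⊗ (c ⊗ w ⊗ (l ⊗ L)) ≡' c ⊗ (l ⊗ w) ⊗ (v ⊗ L)) tt V (𝟙 (cop? n)) (w n) (Λ n) (L n)))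
        (trans (sym (∑-*ˡ y V _)) (∑-cong y λ d hd hdy → trans (sym (∑-*ˡ (y ÷ d) V _)) (trans (∑-cong (y ÷ d) λ e he hey → term d e hd he (de≤X hy hd hey)) (∑-*ˡ (y ÷ d) (𝟙 (cop? d) * (Λ d * w d)) _)))) ⟩
    ∑ y (λ n → 𝟙 (cop? n) * (Λ n * w n) * (V * L n)) + ∑ y (λ d → 𝟙 (cop? d) * (Λ d * w d) * m′ (y ÷ d)) ≡⟨ sym (trans (∑-ext y λ d → *-distribˡ-+ (𝟙 (cop? d) * (Λ d * w d)) (V * L d) (m′ (y ÷ d))) (∑-+ y _ _)) ⟩
    _ ∎
    where
    open ≡-Reasoning
    term : ∀ d e → 1 ℕ.≤ d → 1 ℕ.≤ e → d ℕ.* e ℕ.≤ X → V * (F₀ (d ℕ.* e) * (Λ d * Λ e)) ≡ 𝟙 (cop? d) * (Λ d * w d) * (𝟙 (cop? e) * (Λ e * w e))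
    term d e hd he h = trans (lin 5 (λ v c w a b → v ⊗ (c ⊗ w ⊗ (a ⊗ b)) ≡' c ⊗ (v ⊗ w) ⊗ (a ⊗ b)) tt V (𝟙 (cop? (d ℕ.* e))) (w (d ℕ.* e)) (Λ d) (Λ e))
      (trans (cong₂ (λ x y → x * y * (Λ d * Λ e)) (cop-* d e) (w-mul hd he h))
        (lin 6 (λ a b c d e f → a ⊗ b ⊗ (c ⊗ d) ⊗ (e ⊗ f) ≡' a ⊗ (e ⊗ c) ⊗ (b ⊗ (f ⊗ d))) tt (𝟙 (cop? d)) (𝟙 (cop? e)) (w d) (w e) (Λ d) (Λ e)))

  -- For every d ≤ y, log d plus ∑ Λ(e)/e over the e ≤ y / d prime to M is log y + O(1), by Mertens.
  -- So the total is log y times `m′ y`, up to O(`m′ y`), which is (log y)² + O(log y).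
  total-bounds : ∀ y → 1 ℕ.≤ y → y ℕ.≤ X → V * Sel F₀ y - (S * V) * (S * V) * (+ lg y * + lg y) ≲ K₂ * ((S * V) * (S * V)) * (1ℤ + + lg y)
  total-bounds y h1 hy = lower , upper
    where
    SV l : ℤ
    SV = S * V
    l = + lg y
    bracket : ∀ d → 1 ℕ.≤ d → d ℕ.≤ y → (V * L d + m′ (y ÷ d)) - SV * l ≲ SV * (Cm + + 2)
    bracket d hd hdy = neg-≤ (lin 9 (λ v s L a q l c m' u → v ⊗ L ≤' v ⊗ (s ⊗ (κ 1 ⊕ a)) ⇒ v ⊗ (s ⊗ a) ≤' v ⊗ (L ⊕ s) ⇒ m' ≤' s ⊗ v ⊗ (q ⊕ c) ⇒ s ⊗ v ⊗ (q ⊖ c) ≤' m'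
          ⇒ s ⊗ v ⊗ (a ⊕ q) ≤' s ⊗ v ⊗ l ⇒ s ⊗ v ⊗ l ≤' s ⊗ v ⊗ (κ 1 ⊕ (a ⊕ q)) ⇒ κ 0 ≤' s ⊗ v ⇒ κ 0 ⊖ s ⊗ v ⊗ (c ⊕ κ 2) ≤' (v ⊗ L ⊕ m') ⊖ s ⊗ v ⊗ l) tt
          V S (L d) (+ lg d) (+ lg (y ÷ d)) l Cm (m′ (y ÷ d)) SV a1 a2 a3 a4 a5 a6 SV≥0)
      , lin 9 (λ v s L a q l c m' u → v ⊗ L ≤' v ⊗ (s ⊗ (κ 1 ⊕ a)) ⇒ v ⊗ (s ⊗ a) ≤' v ⊗ (L ⊕ s) ⇒ m' ≤' s ⊗ v ⊗ (q ⊕ c) ⇒ s ⊗ v ⊗ (q ⊖ c) ≤' m'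
          ⇒ s ⊗ v ⊗ (a ⊕ q) ≤' s ⊗ v ⊗ l ⇒ s ⊗ v ⊗ l ≤' s ⊗ v ⊗ (κ 1 ⊕ (a ⊕ q)) ⇒ κ 0 ≤' s ⊗ v ⇒ (v ⊗ L ⊕ m') ⊖ s ⊗ v ⊗ l ≤' s ⊗ v ⊗ (c ⊕ κ 2)) tt
          V S (L d) (+ lg d) (+ lg (y ÷ d)) l Cm (m′ (y ÷ d)) SV a1 a2 a3 a4 a5 a6 SV≥0
      where
      q≤X : y ÷ d ℕ.≤ X
      q≤X = ℕP.≤-trans (÷-≤x y d) hy
      a1 = *-monoˡ {V} pos≥0 (L-upper hd)
      a2 = *-monoˡ {V} pos≥0 (L-lower hd (ℕP.≤-trans hdy hy))
      a3 = m′-upper (y ÷ d) (÷-pos hd hdy) q≤X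
      a4 = m′-lower (y ÷ d) (÷-pos hd hdy) q≤X
      a5 = *-monoˡ SV≥0 (+≤+ (proj₁ (lg-split y d hd hdy)))
      a6 = *-monoˡ SV≥0 (+≤+ (proj₂ (lg-split y d hd hdy)))
    c : ℕ → ℤ
    c d = 𝟙 (cop? d) * (Λ d * w d)
    dev : V * Sel F₀ y - m′ y * (SV * l) ≲ m′ y * (SV * (Cm + + 2))
    dev = subst₂ _≲_ (trans (∑-ext y λ d → lin 3 (λ c a b → c ⊗ (a ⊖ b) ≡' c ⊗ a ⊖ c ⊗ b) tt (c d) (V * L d + m′ (y ÷ d)) (SV * l)) (trans (∑-- y _ _) (cong₂ _-_ (sym (total-form y hy)) (∑-*ʳ y (SV * l) c))))
      (∑-*ʳ y (SV * (Cm + + 2)) c) (∑-≲ y {g = λ d → c d * (SV * (Cm + + 2))} λ d hd hdy → ≲-*ˡ (*-nonneg (𝟙-nonneg (cop? d)) (Λw-nonneg d)) (bracket d hd hdy))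
    l≥0 : 0ℤ ≤ l
    l≥0 = pos≥0
    Q≥0 : 0ℤ ≤ SV * SV
    Q≥0 = *-nonneg SV≥0 SV≥0
    pc : 0ℤ ≤ SV * (Cm + + 2)
    pc = *-nonneg SV≥0 (+-mono-≤ Cm≥0 (pos≥0 {2}))
    upper : V * Sel F₀ y - SV * SV * (l * l) ≤ K₂ * (SV * SV) * (1ℤ + l)
    upper = lin 5 (λ A m u l c → A ⊖ m ⊗ (u ⊗ l) ≤' m ⊗ (u ⊗ (c ⊕ κ 2)) ⇒ m ⊗ (u ⊗ l) ≤' u ⊗ (l ⊕ c) ⊗ (u ⊗ l) ⇒ m ⊗ (u ⊗ (c ⊕ κ 2)) ≤' u ⊗ (l ⊕ c) ⊗ (u ⊗ (c ⊕ κ 2))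
        ⇒ κ 0 ≤' u ⊗ u ⊗ l ⊗ (c ⊗ c ⊕ κ 2 ⊗ c ⊕ κ 2) ⇒ κ 0 ≤' u ⊗ u ⊗ (κ 2 ⊗ c ⊕ κ 4)
        ⇒ A ⊖ u ⊗ u ⊗ (l ⊗ l) ≤' (c ⊕ κ 2) ⊗ (c ⊕ κ 2) ⊗ (u ⊗ u) ⊗ (κ 1 ⊕ l)) tt
      (V * Sel F₀ y) (m′ y) SV l Cm (proj₂ dev) (*-monoʳ (*-nonneg SV≥0 l≥0) (m′-upper y h1 hy)) (*-monoʳ pc (m′-upper y h1 hy))
      (*-nonneg (*-nonneg Q≥0 l≥0) (+-mono-≤ (+-mono-≤ (*-nonneg Cm≥0 Cm≥0) (*-nonneg (pos≥0 {2}) Cm≥0)) (pos≥0 {2}))) (*-nonneg Q≥0 (+-mono-≤ (*-nonneg (pos≥0 {2}) Cm≥0) (pos≥0 {4})))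
    lower : - (K₂ * (SV * SV) * (1ℤ + l)) ≤ V * Sel F₀ y - SV * SV * (l * l)
    lower = neg-≤ (lin 5 (λ A m u l c → κ 0 ⊖ m ⊗ (u ⊗ (c ⊕ κ 2)) ≤' A ⊖ m ⊗ (u ⊗ l) ⇒ u ⊗ (l ⊖ c) ⊗ (u ⊗ l) ≤' m ⊗ (u ⊗ l) ⇒ m ⊗ (u ⊗ (c ⊕ κ 2)) ≤' u ⊗ (l ⊕ c) ⊗ (u ⊗ (c ⊕ κ 2))
        ⇒ κ 0 ≤' u ⊗ u ⊗ l ⊗ (c ⊗ c ⊕ κ 2 ⊗ c ⊕ κ 2) ⇒ κ 0 ≤' u ⊗ u ⊗ (κ 2 ⊗ c ⊕ κ 4)
        ⇒ κ 0 ⊖ (c ⊕ κ 2) ⊗ (c ⊕ κ 2) ⊗ (u ⊗ u) ⊗ (κ 1 ⊕ l) ≤' A ⊖ u ⊗ u ⊗ (l ⊗ l)) tt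
      (V * Sel F₀ y) (m′ y) SV l Cm (neg-≤⁻¹ (proj₁ dev)) (*-monoʳ (*-nonneg SV≥0 l≥0) (m′-lower y h1 hy)) (*-monoʳ pc (m′-upper y h1 hy))
      (*-nonneg (*-nonneg Q≥0 l≥0) (+-mono-≤ (+-mono-≤ (*-nonneg Cm≥0 Cm≥0) (*-nonneg (pos≥0 {2}) Cm≥0)) (pos≥0 {2}))) (*-nonneg Q≥0 (+-mono-≤ (*-nonneg (pos≥0 {2}) Cm≥0) (pos≥0 {4}))))

  -- Selberg's sum for the class g / a, with the condition a n ≡ g in place of an inverse of a,
  -- since a will be a summation variable.
  Wg : ℕ → ℕ → ℕ → ℤ
  Wg a g y = Sel (λ n → 𝟙 (a ℕ.* n ~? g) * w n) y

  -- The class is compared with the average over all reduced classes. After `selberg-identity` the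
  -- inner sums run over the periodic mean-zero function `balance`, so they stay bounded even
  -- against L²; with |μ| ≤ 1 the outer sum is harmonic and costs one log y.
  selberg-formula : ∀ {a g} → Coprime a M → Coprime g M → ∀ y → 1 ℕ.≤ y → y ℕ.≤ X →
    φ * (V * Wg a g y) - (S * V) * (S * V) * (+ lg y * + lg y) ≲ K * ((S * V) * (S * V)) * (1ℤ + + lg y)
  selberg-formula {a} {g} ca cg y h1 hy = subst₂ _≲_
    (lin 4 (λ p W T l → (p ⊗ W ⊖ T) ⊕ (T ⊖ l) ≡' p ⊗ W ⊖ l) tt φ (V * Wg a g y) (V * Sel F₀ y) ((S * V) * (S * V) * (+ lg y * + lg y)))
    (sym (lin 4 (λ a b u t → (a ⊕ b) ⊗ u ⊗ t ≡' a ⊗ u ⊗ t ⊕ b ⊗ u ⊗ t) tt K₁ K₂ ((S * V) * (S * V)) (1ℤ + + lg y)))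
    (≲-+ diff-bound (total-bounds y h1 hy))
    where
    open ≡-Reasoning
    F₁ : ℕ → ℤ
    F₁ n = 𝟙 (a ℕ.* n ~? g) * w n
    inner : ℕ → ℤ
    inner d = ∑ (y ÷ d) (λ k → balance g (a ℕ.* d) k * (L k * L k) * w k)
    term : ∀ d k → 1 ℕ.≤ d → 1 ℕ.≤ k → d ℕ.* k ℕ.≤ X →
      φ * (V * (μ d * (L k * L k * F₁ (d ℕ.* k)))) - V * (μ d * (L k * L k * F₀ (d ℕ.* k))) ≡ μ d * w d * (balance g (a ℕ.* d) k * (L k * L k) * w k)
    term d k hd hk h = trans (lin 7 (λ p v u q a w b → p ⊗ (v ⊗ (u ⊗ (q ⊗ (a ⊗ w)))) ⊖ v ⊗ (u ⊗ (q ⊗ (b ⊗ w))) ≡' u ⊗ ((p ⊗ a ⊖ b) ⊗ q) ⊗ (v ⊗ w)) tt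
        φ V (μ d) (L k * L k) (𝟙 (a ℕ.* (d ℕ.* k) ~? g)) (w (d ℕ.* k)) (𝟙 (cop? (d ℕ.* k))))
      (trans (cong₂ (λ x z → μ d * (x * (L k * L k)) * z) bal (w-mul hd hk h))
        (lin 5 (λ u b q w1 w2 → u ⊗ (b ⊗ q) ⊗ (w1 ⊗ w2) ≡' u ⊗ w1 ⊗ (b ⊗ q ⊗ w2)) tt (μ d) (balance g (a ℕ.* d) k) (L k * L k) (w d) (w k)))
      where
      bal : φ * 𝟙 (a ℕ.* (d ℕ.* k) ~? g) - 𝟙 (cop? (d ℕ.* k)) ≡ balance g (a ℕ.* d) k
      bal = cong₂ (λ x z → φ * x - z)
        (𝟙-cong (a ℕ.* (d ℕ.* k) ~? g) (a ℕ.* d ℕ.* k ~? g) (subst (_~ g) (sym (ℕP.*-assoc a d k))) (subst (_~ g) (ℕP.*-assoc a d k)))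
        (𝟙-cong (cop? (d ℕ.* k)) (cop? (a ℕ.* d ℕ.* k)) (λ c {x} → subst (λ z → Coprime z M) (sym (ℕP.*-assoc a d k)) (λ {x} → coprime-* ca c {x}) {x})
          (λ c {x} → coprime-factorʳ a (λ {x} → subst (λ z → Coprime z M) (ℕP.*-assoc a d k) c {x}) {x}))
    diff-eq : φ * (V * Wg a g y) - V * Sel F₀ y ≡ ∑ y (λ d → μ d * w d * inner d)
    diff-eq = begin
      φ * (V * Wg a g y) - V * Sel F₀ y ≡⟨ cong₂ (λ x z → φ * (V * x) - V * z) (selberg-identity F₁ y) (selberg-identity F₀ y) ⟩
      φ * (V * ∑ y (λ d → ∑ (y ÷ d) (λ k → μ d * (L k * L k * F₁ (d ℕ.* k))))) - V * ∑ y (λ d → ∑ (y ÷ d) (λ k → μ d * (L k * L k * F₀ (d ℕ.* k)))) ≡⟨ cong₂ _-_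
          (trans (cong (φ *_) (trans (sym (∑-*ˡ y V _)) (∑-ext y λ d → sym (∑-*ˡ (y ÷ d) V _)))) (trans (sym (∑-*ˡ y φ _)) (∑-ext y λ d → sym (∑-*ˡ (y ÷ d) φ _))))
          (trans (sym (∑-*ˡ y V _)) (∑-ext y λ d → sym (∑-*ˡ (y ÷ d) V _))) ⟩
      ∑ y (λ d → ∑ (y ÷ d) (λ k → φ * (V * (μ d * (L k * L k * F₁ (d ℕ.* k)))))) - ∑ y (λ d → ∑ (y ÷ d) (λ k → V * (μ d * (L k * L k * F₀ (d ℕ.* k))))) ≡⟨ sym (trans (∑-ext y λ d → ∑-- (y ÷ d) _ _) (∑-- y _ _)) ⟩
      ∑ y (λ d → ∑ (y ÷ d) (λ k → φ * (V * (μ d * (L k * L k * F₁ (d ℕ.* k)))) - V * (μ d * (L k * L k * F₀ (d ℕ.* k))))) ≡⟨ ∑-cong y (λ d hd _ → trans (∑-cong (y ÷ d) λ k hk hky → term d k hd hk (de≤X hy hd hky)) (∑-*ˡ (y ÷ d) (μ d * w d) _)) ⟩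
      ∑ y (λ d → μ d * w d * inner d) ∎
    diff-bound : φ * (V * Wg a g y) - V * Sel F₀ y ≲ K₁ * ((S * V) * (S * V)) * (1ℤ + + lg y)
    diff-bound = subst (_≲ K₁ * ((S * V) * (S * V)) * (1ℤ + + lg y)) (sym diff-eq) (≲-trans
      (∑-≲ y {g = λ d → 1ℤ * w d * (K₁ * (S * S * V))} λ d hd hdy → ≲-* (≲-* (μ-≲ d) (≲-nonneg (w-nonneg d) ≤-refl))
        (Oscillation.∑uL²w (balance g (a ℕ.* d)) (balance-bounded (a ℕ.* d) cg) (balance-≲ g (a ℕ.* d)) (y ÷ d) (ℕP.≤-trans (÷-≤x y d) hy)))
      (≤-trans (≤-reflexive (trans (∑-*ʳ y (K₁ * (S * S * V)) _) (cong (_* (K₁ * (S * S * V))) (∑-ext y λ d → *-identityˡ (w d)))))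
        (≤-trans (*-monoʳ (*-nonneg K₁≥0 (*-nonneg (*-nonneg (pos≥0 {s}) (pos≥0 {s})) (pos≥0 {V₀}))) (harmonic-upper y h1 hy))
          (≤-reflexive (lin 4 (λ v l k s → v ⊗ l ⊗ (k ⊗ (s ⊗ s ⊗ v)) ≡' k ⊗ (s ⊗ v ⊗ (s ⊗ v)) ⊗ l) tt V (1ℤ + + lg y) K₁ S)))))

poly-layers : ∀ J T → + 2 * ∑ J (λ j → + 2 * ((+ 2 * + j - 1ℤ) * (T - + j)) - (T * T - + j * + j)) ≡
  + 4 * T * + J * (+ J + 1ℤ) - + J * (+ J + 1ℤ) * (+ 2 * + J + 1ℤ) - + 4 * T * + J + + 2 * + J * (+ J + 1ℤ) - + 2 * T * T * + J
poly-layers zero T = lin 1 (λ T → κ 2 ⊗ κ 0 ≡' κ 4 ⊗ T ⊗ κ 0 ⊗ (κ 0 ⊕ κ 1) ⊖ κ 0 ⊗ (κ 0 ⊕ κ 1) ⊗ (κ 2 ⊗ κ 0 ⊕ κ 1) ⊖ κ 4 ⊗ T ⊗ κ 0 ⊕ κ 2 ⊗ κ 0 ⊗ (κ 0 ⊕ κ 1) ⊖ κ 2 ⊗ T ⊗ T ⊗ κ 0) tt T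
poly-layers (suc J) T = lin 3 (λ J T A → κ 2 ⊗ A ≡' κ 4 ⊗ T ⊗ J ⊗ (J ⊕ κ 1) ⊖ J ⊗ (J ⊕ κ 1) ⊗ (κ 2 ⊗ J ⊕ κ 1) ⊖ κ 4 ⊗ T ⊗ J ⊕ κ 2 ⊗ J ⊗ (J ⊕ κ 1) ⊖ κ 2 ⊗ T ⊗ T ⊗ J
    ⇒ κ 2 ⊗ (A ⊕ (κ 2 ⊗ ((κ 2 ⊗ (κ 1 ⊕ J) ⊖ κ 1) ⊗ (T ⊖ (κ 1 ⊕ J))) ⊖ (T ⊗ T ⊖ (κ 1 ⊕ J) ⊗ (κ 1 ⊕ J)))) ≡' κ 4 ⊗ T ⊗ (κ 1 ⊕ J) ⊗ (κ 1 ⊕ J ⊕ κ 1) ⊖ (κ 1 ⊕ J) ⊗ (κ 1 ⊕ J ⊕ κ 1) ⊗ (κ 2 ⊗ (κ 1 ⊕ J) ⊕ κ 1) ⊖ κ 4 ⊗ T ⊗ (κ 1 ⊕ J) ⊕ κ 2 ⊗ (κ 1 ⊕ J) ⊗ (κ 1 ⊕ J ⊕ κ 1) ⊖ κ 2 ⊗ T ⊗ T ⊗ (κ 1 ⊕ J)) tt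
  (+ J) T (∑ J (λ j → + 2 * ((+ 2 * + j - 1ℤ) * (T - + j)) - (T * T - + j * + j))) (poly-layers J T)

-- Both sides are 2 t³ / 3 to leading order. This agreement cancels the cubic main terms in
-- `triple-bound`.
poly-main : ∀ t → + 2 * ∑ t (λ j → (+ 2 * + j - 1ℤ) * (+ t - + j)) ≤ ∑ t (λ j → + t * + t - + j * + j)
poly-main t = lin 4 (λ A B C t → C ≡' κ 2 ⊗ A ⊖ B ⇒ κ 2 ⊗ C ≡' κ 4 ⊗ t ⊗ t ⊗ (t ⊕ κ 1) ⊖ t ⊗ (t ⊕ κ 1) ⊗ (κ 2 ⊗ t ⊕ κ 1) ⊖ κ 4 ⊗ t ⊗ t ⊕ κ 2 ⊗ t ⊗ (t ⊕ κ 1) ⊖ κ 2 ⊗ t ⊗ t ⊗ t ⇒ t ≤' t ⊗ t ⇒ κ 2 ⊗ A ≤' B) tt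
  (∑ t (λ j → (+ 2 * + j - 1ℤ) * (+ t - + j))) (∑ t (λ j → + t * + t - + j * + j)) _ (+ t)
  (trans (∑-- t _ _) (cong (_- ∑ t (λ j → + t * + t - + j * + j)) (∑-*ˡ t (+ 2) _))) (poly-layers t (+ t)) (t≤tt t)
  where
  t≤tt : ∀ t → + t ≤ + t * + t
  t≤tt zero = ≤-reflexive (sym (*-zeroˡ 0ℤ))
  t≤tt (suc t) = suc≤sq t

pos-∸ : ∀ {t j} → j ℕ.≤ t → + (t ℕ.∸ j) ≡ + t - + j
pos-∸ {t} {j} h = lin 3 (λ a t j → a ⊕ j ≡' t ⇒ a ≡' t ⊖ j) tt (+ (t ℕ.∸ j)) (+ t) (+ j) (cong +_ (m∸n+n≡m h))

-- Triple products in a residue class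

module Triples (M : ℕ) (hM : 1 ℕ.≤ M) (T : ℕ) (M≤X : M ℕ.≤ 2 ^ T) where
  open InClasses M hM T M≤X public

  F : ℕ → ℕ → ℤ
  F g n = 𝟙 (1 ℕ.* n ~? g) * w n

  F-nonneg : ∀ g n → 0ℤ ≤ F g n
  F-nonneg g n = *-nonneg (𝟙-nonneg (1 ℕ.* n ~? g)) (w-nonneg n)

  Tri : ℕ → ℕ → ℤ
  Tri g x = ∑ x (λ d → ∑ (x ÷ d) (λ e → ∑ (x ÷ d ÷ e) (λ f → F g (d ℕ.* (e ℕ.* f)) * (Λ d * (Λ e * Λ f)))))

  -- ∑ Λ log² / n over the class of g.
  D² : ℕ → ℕ → ℤ
  D² g x = ∑ x (λ n → F g n * (Λ n * (L n * L n)))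

  P : ℕ → ℕ → ℤ
  P g x = ∑ x (λ d → ∑ (x ÷ d) (λ n → F g (d ℕ.* n) * (Λ d * (Λ n * L n))))

  SV Q : ℤ
  SV = S * V
  Q = SV * SV

  Q≥0 : 0ℤ ≤ Q
  Q≥0 = *-nonneg SV≥0 SV≥0

  φ≥0 : 0ℤ ≤ φ
  φ≥0 = ≤-trans pos≥0 φ≥1

  V≥0 : 0ℤ ≤ V
  V≥0 = pos≥0

  K₃ : ℤ
  K₃ = + 2 * Cm + + 2 * K * (1ℤ + Cm) + + 2 * K + 1ℤ + K

  module _ {g : ℕ} (cg : Coprime g M) where

    V*F : ∀ d n → 1 ℕ.≤ d → 1 ℕ.≤ n → d ℕ.* n ℕ.≤ X → w d * (𝟙 (d ℕ.* n ~? g) * w n) ≡ V * F g (d ℕ.* n)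
    V*F d n hd hn h = trans (*-assoc₃ (w d) (𝟙 (d ℕ.* n ~? g)) (w n)) (trans (cong₂ _*_
      (𝟙-cong (d ℕ.* n ~? g) (1 ℕ.* (d ℕ.* n) ~? g) (subst (_~ g) (sym (ℕP.*-identityˡ (d ℕ.* n)))) (subst (_~ g) (ℕP.*-identityˡ (d ℕ.* n)))) (sym (w-mul hd hn h)))
      (*-assoc₃ (𝟙 (1 ℕ.* (d ℕ.* n) ~? g)) V (w (d ℕ.* n))))

    -- Selberg's formula for the classes g / d, summed over d with the weight Λ(d)/d.
    P+Tri : ∀ x → x ℕ.≤ X → V * (P g x + Tri g x) ≡ ∑ x (λ d → Λ d * w d * Wg d g (x ÷ d))
    P+Tri x hx = sym (begin
      ∑ x (λ d → Λ d * w d * Wg d g (x ÷ d)) ≡⟨ ∑-cong x each ⟩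
      ∑ x (λ d → V * (∑ (x ÷ d) (λ n → F g (d ℕ.* n) * (Λ d * (Λ n * L n))) + ∑ (x ÷ d) (λ e → ∑ (x ÷ d ÷ e) (λ f → F g (d ℕ.* (e ℕ.* f)) * (Λ d * (Λ e * Λ f)))))) ≡⟨ ∑-*ˡ x V _ ⟩
      V * _ ≡⟨ cong (V *_) (∑-+ x _ _) ⟩
      V * (P g x + Tri g x) ∎)
      where
      open ≡-Reasoning
      each : ∀ d → 1 ℕ.≤ d → d ℕ.≤ x → Λ d * w d * Wg d g (x ÷ d) ≡
        V * (∑ (x ÷ d) (λ n → F g (d ℕ.* n) * (Λ d * (Λ n * L n))) + ∑ (x ÷ d) (λ e → ∑ (x ÷ d ÷ e) (λ f → F g (d ℕ.* (e ℕ.* f)) * (Λ d * (Λ e * Λ f)))))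
      each d hd hdx = trans (*-distribˡ-+ (Λ d * w d) _ _) (trans (cong₂ _+_
          (trans (sym (∑-*ˡ z (Λ d * w d) _)) (trans (∑-cong z λ n hn hnz → tm n (Λ n * L n) hn (de≤X hx hd hnz)) (∑-*ˡ z V _)))
          (trans (sym (∑-*ˡ z (Λ d * w d) _)) (trans (∑-cong z λ e he hez → trans (sym (∑-*ˡ (z ÷ e) (Λ d * w d) _)) (trans (∑-cong (z ÷ e) λ f hf hfz →
              tm (e ℕ.* f) (Λ e * Λ f) (*-mono-≤ he hf) (de≤X hx hd (÷-≤ he hfz))) (∑-*ˡ (z ÷ e) V _))) (∑-*ˡ z V _))))
        (sym (*-distribˡ-+ V _ _)))
        where
        z : ℕ
        z = x ÷ d
        tm : ∀ n c → 1 ℕ.≤ n → d ℕ.* n ℕ.≤ X → Λ d * w d * (𝟙 (d ℕ.* n ~? g) * w n * c) ≡ V * (F g (d ℕ.* n) * (Λ d * c))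
        tm n c hn h = trans (lin 5 (λ l w i u c → l ⊗ w ⊗ (i ⊗ u ⊗ c) ≡' w ⊗ (i ⊗ u) ⊗ (l ⊗ c)) tt (Λ d) (w d) (𝟙 (d ℕ.* n ~? g)) (w n) c)
          (trans (cong (_* (Λ d * c)) (V*F d n hd hn h)) (*-assoc V (F g (d ℕ.* n)) (Λ d * c)))

    FL : ℕ → ℤ
    FL n = F g n * L n

    -- Selberg's sum for g with one more logarithm. As L (d e) = L d + L e, the symmetry of the two
    -- factors produces the same mixed sum `P` twice.
    2P : ∀ x → Sel FL x ≡ D² g x + + 2 * P g x
    2P x = cong₂ _+_ (∑-ext x λ n → lin 3 (λ f l L → f ⊗ L ⊗ (l ⊗ L) ≡' f ⊗ (l ⊗ (L ⊗ L))) tt (F g n) (Λ n) (L n))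
      (trans (∑∑-cong x λ d e hd _ he _ → trans (cong (λ z → F g (d ℕ.* e) * z * (Λ d * Λ e)) (L-* hd he))
          (lin 5 (λ f a b l m → f ⊗ (a ⊕ b) ⊗ (l ⊗ m) ≡' f ⊗ (l ⊗ (m ⊗ b)) ⊕ f ⊗ (m ⊗ (l ⊗ a))) tt (F g (d ℕ.* e)) (L d) (L e) (Λ d) (Λ e)))
        (trans (trans (∑-ext x λ d → ∑-+ (x ÷ d) _ _) (∑-+ x _ _)) (trans (cong (λ z → P g x + z) (trans (∑∑-swap x _)
          (∑-ext x λ e → ∑-ext (x ÷ e) λ d → cong (λ z → F g z * (Λ e * (Λ d * L d))) (ℕP.*-comm d e))))
          (lin 1 (λ p → p ⊕ p ≡' κ 2 ⊗ p) tt (P g x)))))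

    module _ (t : ℕ) (ht : t ℕ.≤ T) where

      x : ℕ
      x = 2 ^ t

      x≤X : x ℕ.≤ X
      x≤X = ^-monoʳ-≤ 2 ht

      W : ℕ → ℤ
      W y = φ * (V * Wg 1 g y)

      τ : ℤ
      τ = 1ℤ + + t

      W-lower : Q * (+ t * + t) ≤ W x + K * Q * τ
      W-lower = lin 3 (λ W q k → κ 0 ⊖ k ≤' W ⊖ q ⇒ q ≤' W ⊕ k) tt (W x) (Q * (+ t * + t)) (K * Q * τ)
        (neg-≤⁻¹ (subst (λ l → - (K * Q * (1ℤ + + l)) ≤ W x - Q * (+ l * + l)) (lg-2^ t) (proj₁ (selberg-formula (Co.1-coprimeTo M) cg x (2^≥1 t) x≤X))))

      W-upper : W x ≤ Q * (+ t * + t) + K * Q * τ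
      W-upper = lin 3 (λ W q k → W ⊖ q ≤' k ⇒ W ≤' q ⊕ k) tt (W x) (Q * (+ t * + t)) (K * Q * τ)
        (subst (λ l → W x - Q * (+ l * + l) ≤ K * Q * (1ℤ + + l)) (lg-2^ t) (proj₂ (selberg-formula (Co.1-coprimeTo M) cg x (2^≥1 t) x≤X)))

      KQ≥0 : 0ℤ ≤ K * Q
      KQ≥0 = *-nonneg K≥0 Q≥0

      W-upper-at : ∀ {a} → Coprime a M → ∀ y {j} → 1 ℕ.≤ y → y ℕ.≤ X → lg y ℕ.≤ j → j ℕ.≤ t → φ * (V * Wg a g y) ≤ Q * (+ j * + j) + K * Q * τ
      W-upper-at {a} ca y {j} h1 hy hj hjt = lin 5 (λ W q k q' k' → W ⊖ q ≤' k ⇒ q ≤' q' ⇒ k ≤' k' ⇒ W ≤' q' ⊕ k') tt (φ * (V * Wg a g y)) _ _ (Q * (+ j * + j)) (K * Q * τ)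
        (proj₂ (selberg-formula ca cg y h1 hy)) (*-monoˡ Q≥0 (*-mono (pos≥0 {lg y}) (+≤+ hj) (pos≥0 {lg y}) (+≤+ hj))) (*-monoˡ KQ≥0 (+≤+ (s≤s (ℕP.≤-trans hj hjt))))

      pred-2^ : ∀ j → 1 ℕ.≤ j → j ℕ.≤ t → 1 ℕ.≤ 2 ^ j ℕ.∸ 1 × 2 ^ j ℕ.∸ 1 ℕ.≤ X × lg (2 ^ j ℕ.∸ 1) ℕ.≤ j
      pred-2^ j hj hjt = ℕP.∸-monoˡ-≤ 1 (^-monoʳ-≤ 2 hj) , ℕP.≤-trans z≤2^ (ℕP.≤-trans (^-monoʳ-≤ 2 hjt) x≤X) , lg-pred-2^ z≤2^
        where
        z≤2^ : 2 ^ j ℕ.∸ 1 ℕ.≤ 2 ^ j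
        z≤2^ = m∸n≤m (2 ^ j) 1

      layers-lower : Q * ∑ t (λ j → + t * + t - + j * + j) ≤ φ * (V * ∑ x (λ n → F g n * Λ₂ n * + lg n)) + + 2 * (K * Q) * τ * + t
      layers-lower = ≤-trans (≤-reflexive (sym (∑-*ˡ t Q _))) (≤-trans (∑-mono t each)
        (≤-reflexive (trans (∑-+ t _ _) (cong₂ _+_ eq (trans (∑-const t _) (*-comm (+ t) _))))))
        where
        f : ℕ → ℤ
        f n = F g n * Λ₂ n
        eq : ∑ t (λ j → φ * (V * (∑ x f - ∑ (2 ^ j ℕ.∸ 1) f))) ≡ φ * (V * ∑ x (λ n → f n * + lg n))
        eq = trans (∑-*ˡ t φ _) (cong (φ *_) (trans (∑-*ˡ t V _) (cong (V *_) (sym (lg-layers t f)))))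
        each : ∀ j → 1 ℕ.≤ j → j ℕ.≤ t → Q * (+ t * + t - + j * + j) ≤ φ * (V * (∑ x f - ∑ (2 ^ j ℕ.∸ 1) f)) + + 2 * (K * Q) * τ
        each j hj hjt with pred-2^ j hj hjt
        ... | z1 , zX , zl = lin 9 (λ p v A B q t2 j2 k τ → q ⊗ t2 ≤' p ⊗ (v ⊗ A) ⊕ k ⊗ q ⊗ τ ⇒ p ⊗ (v ⊗ B) ≤' q ⊗ j2 ⊕ k ⊗ q ⊗ τ ⇒ q ⊗ (t2 ⊖ j2) ≤' p ⊗ (v ⊗ (A ⊖ B)) ⊕ κ 2 ⊗ (k ⊗ q) ⊗ τ) tt
              φ V (∑ x f) (∑ (2 ^ j ℕ.∸ 1) f) Q (+ t * + t) (+ j * + j) K τ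
              (subst (λ z → Q * (+ t * + t) ≤ φ * (V * z) + K * Q * τ) (Sel-Λ₂ (F g) x) W-lower)
              (subst (λ z → φ * (V * z) ≤ Q * (+ j * + j) + K * Q * τ) (Sel-Λ₂ (F g) (2 ^ j ℕ.∸ 1)) (W-upper-at (Co.1-coprimeTo M) _ z1 zX zl hjt))

      FL-lower : S * ∑ x (λ n → F g n * Λ₂ n * + lg n) ≤ Sel FL x + S * Wg 1 g x
      FL-lower = subst₂ _≤_ (∑-*ˡ x S _) (trans (∑-+ x _ _) (cong₂ _+_ (sym (Sel-Λ₂ FL x)) (trans (∑-*ˡ x S _) (cong (S *_) (sym (Sel-Λ₂ (F g) x))))))
        (∑-mono x λ n hn hnx → lin 5 (λ f l s k L → f ⊗ l ⊗ (s ⊗ k) ≤' f ⊗ l ⊗ (L ⊕ s) ⇒ s ⊗ (f ⊗ l ⊗ k) ≤' f ⊗ L ⊗ l ⊕ s ⊗ (f ⊗ l)) tt (F g n) (Λ₂ n) S (+ lg n) (L n)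
          (*-monoˡ (*-nonneg (F-nonneg g n) (Λ₂-nonneg n)) (L-lower hn (ℕP.≤-trans hnx x≤X))))

      A-upper : φ * (V * ∑ x (λ d → Λ d * w d * Wg d g (x ÷ d))) ≤ SV * Q * (∑ t (λ j → (+ 2 * + j - 1ℤ) * (+ t - + j)) + Cm * (+ t * + t) + K * τ * (+ t + Cm))
      A-upper = ≤-trans (≤-reflexive (trans (cong (φ *_) (sym (∑-*ˡ x V _))) (sym (∑-*ˡ x φ _))))
        (≤-trans (∑-mono x each) (≤-trans (≤-reflexive (trans (∑-+ x _ _) (cong₂ _+_ (trans (∑-*ˡ x Q _) (cong (Q *_) (lg²-layers t c))) (∑-*ʳ x (K * Q * τ) c))))
          (≤-trans (+-mono-≤ (*-monoˡ Q≥0 layers) (*-monoʳ (*-nonneg KQ≥0 (pos≥0 {suc t})) (m′-up t ℕP.≤-refl)))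
            (≤-reflexive (lin 8 (λ u A c t2 k τ t q → q ⊗ (u ⊗ (A ⊕ c ⊗ t2)) ⊕ u ⊗ (t ⊕ c) ⊗ (k ⊗ q ⊗ τ) ≡' u ⊗ q ⊗ (A ⊕ c ⊗ t2 ⊕ k ⊗ τ ⊗ (t ⊕ c))) tt
              SV (∑ t (λ j → (+ 2 * + j - 1ℤ) * (+ t - + j))) Cm (+ t * + t) K τ (+ t) Q)))))
        where
        c : ℕ → ℤ
        c d = 𝟙 (cop? d) * (Λ d * w d)
        m′-up : ∀ j → j ℕ.≤ t → m′ (2 ^ j) ≤ SV * (+ j + Cm)
        m′-up j hj = subst (λ l → m′ (2 ^ j) ≤ SV * (+ l + Cm)) (lg-2^ j) (m′-upper (2 ^ j) (2^≥1 j) (ℕP.≤-trans (^-monoʳ-≤ 2 hj) x≤X))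
        layers : ∑ t (λ j → (+ 2 * + j - 1ℤ) * m′ (2 ^ (t ℕ.∸ j))) ≤ SV * (∑ t (λ j → (+ 2 * + j - 1ℤ) * (+ t - + j)) + Cm * (+ t * + t))
        layers = ≤-trans (∑-mono t λ j hj hjt → *-monoˡ (odd≥0 j hj) (≤-trans (m′-up (t ℕ.∸ j) (m∸n≤m t j)) (≤-reflexive (cong (λ z → SV * (z + Cm)) (pos-∸ hjt)))))
          (≤-reflexive (trans (∑-ext t λ j → lin 4 (λ o u d c → o ⊗ (u ⊗ (d ⊕ c)) ≡' u ⊗ (o ⊗ d ⊕ c ⊗ o)) tt (+ 2 * + j - 1ℤ) SV (+ t - + j) Cm)
            (trans (∑-*ˡ t SV _) (cong (SV *_) (trans (∑-+ t _ _) (cong (λ z → ∑ t (λ j → (+ 2 * + j - 1ℤ) * (+ t - + j)) + z) (trans (∑-*ˡ t Cm _) (cong (Cm *_) (∑-odd t)))))))))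
          where
          odd≥0 : ∀ j → 1 ℕ.≤ j → 0ℤ ≤ + 2 * + j - 1ℤ
          odd≥0 j hj = lin 1 (λ j → κ 1 ≤' j ⇒ κ 0 ≤' κ 2 ⊗ j ⊖ κ 1) tt (+ j) (+≤+ hj)
        each : ∀ d → 1 ℕ.≤ d → d ℕ.≤ x → φ * (V * (Λ d * w d * Wg d g (x ÷ d))) ≤ Q * (c d * (+ lg (x ÷ d) * + lg (x ÷ d))) + c d * (K * Q * τ)
        each d hd hdx with 𝟙-case (cop? d)
        ... | inj₁ (cd , i) rewrite i = ≤-trans (≤-reflexive (lin 4 (λ p v l W → p ⊗ (v ⊗ (l ⊗ W)) ≡' l ⊗ (p ⊗ (v ⊗ W))) tt φ V (Λ d * w d) (Wg d g (x ÷ d))))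
              (≤-trans (*-monoˡ (Λw-nonneg d) (W-upper-at cd (x ÷ d) (÷-pos hd hdx) (ℕP.≤-trans (÷-≤x x d) x≤X) ℕP.≤-refl (subst (lg (x ÷ d) ℕ.≤_) (lg-2^ t) (lg-mono (÷-≤x x d)))))
                (≤-reflexive (lin 4 (λ l q a b → l ⊗ (q ⊗ a ⊕ b) ≡' q ⊗ (κ 1 ⊗ l ⊗ a) ⊕ κ 1 ⊗ l ⊗ b) tt (Λ d * w d) Q (+ lg (x ÷ d) * + lg (x ÷ d)) (K * Q * τ))))
        ... | inj₂ (nc , i) rewrite i = ≤-trans (≤-reflexive (trans (cong (λ z → φ * (V * (Λ d * w d * z))) W0) (lin 3 (λ p v l → p ⊗ (v ⊗ (l ⊗ κ 0)) ≡' κ 0) tt φ V (Λ d * w d))))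
              (≤-reflexive (lin 4 (λ l q a b → κ 0 ≡' q ⊗ (κ 0 ⊗ l ⊗ a) ⊕ κ 0 ⊗ l ⊗ b) tt (Λ d * w d) Q (+ lg (x ÷ d) * + lg (x ÷ d)) (K * Q * τ)))
          where
          z0 : ∀ n → 𝟙 (d ℕ.* n ~? g) ≡ 0ℤ
          z0 n = 𝟙-no (d ℕ.* n ~? g) λ e → nc λ {k} → coprime-factorˡ n (λ {k} → ~-coprime (~-sym e) cg {k}) {k}
          W0 : Wg d g (x ÷ d) ≡ 0ℤ
          W0 = trans (Sel-Λ₂ (λ n → 𝟙 (d ℕ.* n ~? g) * w n) (x ÷ d)) (∑-zero (x ÷ d) λ n _ _ → trans (cong (λ z → z * w n * Λ₂ n) (z0 n)) (lin 2 (λ a b → κ 0 ⊗ a ⊗ b ≡' κ 0) tt (w n) (Λ₂ n)))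

      error-bound : + 2 * (Cm * (+ t * + t)) + + 2 * (K * τ * (+ t + Cm)) + + 2 * K * τ * + t + + t * + t + K * τ ≤ K₃ * (τ * τ)
      error-bound = lin 3 (λ c k t → κ 0 ≤' c ⇒ κ 0 ≤' k ⇒ κ 0 ≤' t ⇒ κ 0 ≤' c ⊗ t ⇒ κ 0 ≤' k ⊗ t ⇒ κ 0 ≤' k ⊗ c ⊗ t ⇒ κ 0 ≤' k ⊗ c ⊗ (t ⊗ t) ⇒ κ 0 ≤' k ⊗ (t ⊗ t)
          ⇒ κ 2 ⊗ (c ⊗ (t ⊗ t)) ⊕ κ 2 ⊗ (k ⊗ (κ 1 ⊕ t) ⊗ (t ⊕ c)) ⊕ κ 2 ⊗ k ⊗ (κ 1 ⊕ t) ⊗ t ⊕ t ⊗ t ⊕ k ⊗ (κ 1 ⊕ t) ≤' (κ 2 ⊗ c ⊕ κ 2 ⊗ k ⊗ (κ 1 ⊕ c) ⊕ κ 2 ⊗ k ⊕ κ 1 ⊕ k) ⊗ ((κ 1 ⊕ t) ⊗ (κ 1 ⊕ t))) tt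
        Cm K (+ t) Cm≥0 K≥0 t≥0 (*-nonneg Cm≥0 t≥0) (*-nonneg K≥0 t≥0) (*-nonneg (*-nonneg K≥0 Cm≥0) t≥0) (*-nonneg (*-nonneg K≥0 Cm≥0) (*-nonneg t≥0 t≥0)) (*-nonneg K≥0 (*-nonneg t≥0 t≥0))
        where
        t≥0 : 0ℤ ≤ + t
        t≥0 = pos≥0

      -- `P` is eliminated between `P+Tri` and `2P`: 2 Tri = D² + 2 (P + Tri) - Sel FL. Selberg's
      -- formula evaluates the last two terms, their cubic main parts cancel by `poly-main`, and an
      -- error of order τ² remains. A triple sum of order τ³ therefore forces primes into the class
      -- g.
      triple-bound : + 2 * (φ * (V * V) * Tri g x) ≤ φ * (V * V) * D² g x + SV * Q * (K₃ * (τ * τ))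
      triple-bound = ≤-trans (lin 10 (λ p v s tri P D F Wx G A → 
            F ≡' D ⊕ κ 2 ⊗ P ⇒ p ⊗ (v ⊗ v) ⊗ F ≡' p ⊗ (v ⊗ v) ⊗ (D ⊕ κ 2 ⊗ P) ⇒ p ⊗ v ⊗ v ⊗ (s ⊗ G) ≤' p ⊗ v ⊗ v ⊗ (F ⊕ s ⊗ Wx) ⇒ p ⊗ (v ⊗ (v ⊗ (P ⊕ tri))) ≡' p ⊗ (v ⊗ A)
            ⇒ κ 2 ⊗ (p ⊗ (v ⊗ v) ⊗ tri) ≤' p ⊗ (v ⊗ v) ⊗ D ⊕ (κ 2 ⊗ (p ⊗ (v ⊗ A)) ⊖ s ⊗ v ⊗ (p ⊗ (v ⊗ G)) ⊕ s ⊗ v ⊗ (p ⊗ (v ⊗ Wx)))) tt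
          φ V S (Tri g x) (P g x) (D² g x) (Sel FL x) (Wg 1 g x) G₁ A₁ (2P x) (cong (φ * (V * V) *_) (2P x)) (*-monoˡ (*-nonneg (*-nonneg φ≥0 V≥0) V≥0) FL-lower) (cong (λ z → φ * (V * z)) (P+Tri x x≤X)))
        (+-monoʳ-≤ (φ * (V * V) * D² g x) (lin 12 (λ A G W u q B C c k τ t k3 →
            A ≤' u ⊗ q ⊗ (B ⊕ c ⊗ (t ⊗ t) ⊕ k ⊗ τ ⊗ (t ⊕ c)) ⇒ u ⊗ (q ⊗ C) ≤' u ⊗ (G ⊕ κ 2 ⊗ (k ⊗ q) ⊗ τ ⊗ t) ⇒ u ⊗ W ≤' u ⊗ (q ⊗ (t ⊗ t) ⊕ k ⊗ q ⊗ τ)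
            ⇒ u ⊗ q ⊗ (κ 2 ⊗ B) ≤' u ⊗ q ⊗ C ⇒ u ⊗ q ⊗ (κ 2 ⊗ (c ⊗ (t ⊗ t)) ⊕ κ 2 ⊗ (k ⊗ τ ⊗ (t ⊕ c)) ⊕ κ 2 ⊗ k ⊗ τ ⊗ t ⊕ t ⊗ t ⊕ k ⊗ τ) ≤' u ⊗ q ⊗ k3
            ⇒ κ 2 ⊗ A ⊖ u ⊗ G ⊕ u ⊗ W ≤' u ⊗ q ⊗ k3) tt
          (φ * (V * A₁)) (φ * (V * G₁)) (W x) SV Q (∑ t (λ j → (+ 2 * + j - 1ℤ) * (+ t - + j))) (∑ t (λ j → + t * + t - + j * + j)) Cm K τ (+ t) (K₃ * (τ * τ))
          A-upper (*-monoˡ SV≥0 layers-lower) (*-monoˡ SV≥0 W-upper) (*-monoˡ (*-nonneg SV≥0 Q≥0) (poly-main t)) (*-monoˡ (*-nonneg SV≥0 Q≥0) error-bound)))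
        where
        A₁ G₁ : ℤ
        A₁ = ∑ x (λ d → Λ d * w d * Wg d g (x ÷ d))
        G₁ = ∑ x (λ n → F g n * Λ₂ n * + lg n)

-- Real characters

data Sign3 (c : ℤ) : Set where
  plus : c ≡ 1ℤ → Sign3 c
  null : c ≡ 0ℤ → Sign3 c
  minus : c ≡ - 1ℤ → Sign3 c

∑-squares : ∀ z x → + 6 * ∑ z (λ m → x - + m * + m) ≡ + 6 * x * + z - + z * (+ z + 1ℤ) * (+ 2 * + z + 1ℤ)
∑-squares zero x = lin 1 (λ x → κ 6 ⊗ κ 0 ≡' κ 6 ⊗ x ⊗ κ 0 ⊖ κ 0 ⊗ (κ 0 ⊕ κ 1) ⊗ (κ 2 ⊗ κ 0 ⊕ κ 1)) tt x
∑-squares (suc z) x = lin 3 (λ A x z → κ 6 ⊗ A ≡' κ 6 ⊗ x ⊗ z ⊖ z ⊗ (z ⊕ κ 1) ⊗ (κ 2 ⊗ z ⊕ κ 1) ⇒ κ 6 ⊗ (A ⊕ (x ⊖ (κ 1 ⊕ z) ⊗ (κ 1 ⊕ z))) ≡' κ 6 ⊗ x ⊗ (κ 1 ⊕ z) ⊖ (κ 1 ⊕ z) ⊗ (κ 1 ⊕ z ⊕ κ 1) ⊗ (κ 2 ⊗ (κ 1 ⊕ z) ⊕ κ 1)) tt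
  (∑ z (λ m → x - + m * + m)) x (+ z) (∑-squares z x)

∑-linear : ∀ q x d → + 2 * ∑ q (λ e → x - d * + e) ≡ + 2 * + q * x - d * + q * (+ q + 1ℤ)
∑-linear zero x d = lin 2 (λ x d → κ 2 ⊗ κ 0 ≡' κ 2 ⊗ κ 0 ⊗ x ⊖ d ⊗ κ 0 ⊗ (κ 0 ⊕ κ 1)) tt x d
∑-linear (suc q) x d = lin 4 (λ A x d q → κ 2 ⊗ A ≡' κ 2 ⊗ q ⊗ x ⊖ d ⊗ q ⊗ (q ⊕ κ 1) ⇒ κ 2 ⊗ (A ⊕ (x ⊖ d ⊗ (κ 1 ⊕ q))) ≡' κ 2 ⊗ (κ 1 ⊕ q) ⊗ x ⊖ d ⊗ (κ 1 ⊕ q) ⊗ (κ 1 ⊕ q ⊕ κ 1)) tt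
  (∑ q (λ e → x - d * + e)) x d (+ q) (∑-linear q x d)

module RealCharacter (M : ℕ) (hM : 1 ℕ.≤ M) (χ : ℕ → ℤ) (χ-* : ∀ a b → χ (a ℕ.* b) ≡ χ a * χ b)
  (χ-sign : ∀ n → Sign3 (χ n)) (χ-1 : χ 1 ≡ 1ℤ) (χ-period : ∀ n → χ (M ℕ.+ n) ≡ χ n) (χ-sum : ∑ M χ ≡ 0ℤ) where

  χ-≲ : ∀ n → χ n ≲ 1ℤ
  χ-≲ n with χ-sign n
  ... | plus e rewrite e = ≲-nonneg pos≥0 ≤-refl
  ... | null e rewrite e = ≲-zero pos≥0
  ... | minus e rewrite e = ≲-neg (≲-nonneg pos≥0 ≤-refl)

  χ-partial : ∀ m → ∑ m χ ≲ + M
  χ-partial m = subst (∑ m χ ≲_) (*-identityʳ (+ M)) (periodic-bounded χ hM χ-period χ-sum χ-≲ m)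

  geo : ℕ → ℕ → ℤ
  geo p zero = 1ℤ
  geo p (suc a) = geo p a + χ (p ^ suc a)

  σχ-power : ∀ {p m} a → Prime p → ¬ p ∣ m → 1 ℕ.≤ m → σ χ (p ^ a ℕ.* m) ≡ geo p a * σ χ m
  σχ-power {p} {m} zero pp nd hm = trans (cong (σ χ) (ℕP.*-identityˡ m)) (sym (*-identityˡ _))
  σχ-power {p} {m} (suc a) pp nd hm = trans (σ-prime-power χ a pp nd hm) (trans (cong₂ _+_ (σχ-power a pp nd hm)
    (trans (∑-ext m λ e → trans (cong (𝟙 (e ∣? m) *_) (χ-* (p ^ suc a) e)) (*-assoc₃ (𝟙 (e ∣? m)) (χ (p ^ suc a)) (χ e))) (∑-*ˡ m (χ (p ^ suc a)) _)))
    (sym (*-distribʳ-+ (σ χ m) (geo p a) (χ (p ^ suc a)))))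

  -- The sum is χ(p^c)² (χ(p) + χ(p)²), and the last factor is 2 or 0. Pairing the terms this way
  -- shows that 1 ∗ χ is nonnegative and is at least 1 at squares.
  two-steps : ∀ p c → 0ℤ ≤ χ (p ^ suc (c ℕ.+ c)) + χ (p ^ suc (suc (c ℕ.+ c)))
  two-steps p c = subst (0ℤ ≤_) (sym eq) (*-nonneg (sq (χ-sign (p ^ c))) (pair (χ-sign p)))
    where
    sq : ∀ {a} → Sign3 a → 0ℤ ≤ a * a
    sq (plus refl) = *-nonneg pos≥0 pos≥0
    sq (null refl) = *-nonneg pos≥0 pos≥0
    sq (minus refl) = subst (0ℤ ≤_) (sym (*-def (- 1ℤ) (- 1ℤ))) pos≥0
    pair : ∀ {a} → Sign3 a → 0ℤ ≤ a + a * a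
    pair (plus refl) = +-mono-≤ (pos≥0 {1}) (*-nonneg pos≥0 pos≥0)
    pair (null refl) = +-mono-≤ (pos≥0 {0}) (*-nonneg pos≥0 pos≥0)
    pair (minus refl) = subst (λ z → 0ℤ ≤ - 1ℤ + z) (sym (*-def (- 1ℤ) (- 1ℤ))) pos≥0
    pc : χ (p ^ (c ℕ.+ c)) ≡ χ (p ^ c) * χ (p ^ c)
    pc = trans (cong χ (^-distribˡ-+-* p c c)) (χ-* (p ^ c) (p ^ c))
    eq : χ (p ^ suc (c ℕ.+ c)) + χ (p ^ suc (suc (c ℕ.+ c))) ≡ χ (p ^ c) * χ (p ^ c) * (χ p + χ p * χ p)
    eq = trans (cong₂ _+_ (trans (χ-* p _) (cong (χ p *_) pc)) (trans (χ-* p _) (cong (χ p *_) (trans (χ-* p _) (cong (χ p *_) pc)))))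
      (lin 2 (λ a b → a ⊗ (b ⊗ b) ⊕ a ⊗ (a ⊗ (b ⊗ b)) ≡' b ⊗ b ⊗ (a ⊕ a ⊗ a)) tt (χ p) (χ (p ^ c)))

  geo-even : ∀ p c → 1ℤ ≤ geo p (c ℕ.+ c)
  geo-even p zero = ≤-refl
  geo-even p (suc c) rewrite +-suc c c = lin 3 (λ g a b → κ 1 ≤' g ⇒ κ 0 ≤' a ⊕ b ⇒ κ 1 ≤' g ⊕ a ⊕ b) tt (geo p (c ℕ.+ c)) (χ (p ^ suc (c ℕ.+ c))) (χ (p ^ suc (suc (c ℕ.+ c)))) (geo-even p c) (two-steps p c)

  even-odd : ∀ a → ∃ λ c → a ≡ c ℕ.+ c ⊎ a ≡ suc (c ℕ.+ c)
  even-odd zero = 0 , inj₁ refl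
  even-odd (suc a) with even-odd a
  ... | c , inj₁ refl = c , inj₂ refl
  ... | c , inj₂ refl = suc c , inj₁ (cong suc (sym (+-suc c c)))

  geo-nonneg : ∀ p a → 0ℤ ≤ geo p a
  geo-nonneg p a with even-odd a
  ... | c , inj₁ refl = ≤-trans pos≥0 (geo-even p c)
  ... | c , inj₂ refl = lin 2 (λ g a → κ 1 ≤' g ⇒ κ 0 ⊖ κ 1 ≤' a ⇒ κ 0 ≤' g ⊕ a) tt (geo p (c ℕ.+ c)) (χ (p ^ suc (c ℕ.+ c))) (geo-even p c) (proj₁ (χ-≲ (p ^ suc (c ℕ.+ c))))

  σχ-1 : σ χ 1 ≡ 1ℤ
  σχ-1 = trans (+-identityˡ _) (trans (cong₂ _*_ (𝟙-yes (1 ∣? 1) (Dv.1∣ 1)) χ-1) (*-identityʳ 1ℤ))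

  σχ-nonneg : ∀ n → 1 ℕ.≤ n → 0ℤ ≤ σ χ n
  σχ-nonneg = prime-power-ind (λ n → 0ℤ ≤ σ χ n) (subst (0ℤ ≤_) (sym σχ-1) pos≥0)
    λ p a m pp nd hm ih → subst (0ℤ ≤_) (sym (σχ-power (suc a) pp nd hm)) (*-nonneg (geo-nonneg p (suc a)) ih)

  σχ-square : ∀ k → 1 ℕ.≤ k → 1ℤ ≤ σ χ (k ℕ.* k)
  σχ-square = prime-power-ind (λ k → 1ℤ ≤ σ χ (k ℕ.* k)) (≤-reflexive (sym σχ-1)) step
    where
    step : ∀ p a m → Prime p → ¬ p ∣ m → 1 ℕ.≤ m → 1ℤ ≤ σ χ (m ℕ.* m) → 1ℤ ≤ σ χ (p ^ suc a ℕ.* m ℕ.* (p ^ suc a ℕ.* m))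
    step p a m pp nd hm ih = subst (1ℤ ≤_) (sym (trans (cong (σ χ) eq) (σχ-power (suc a ℕ.+ suc a) pp nd2 (*-mono-≤ hm hm)))) (*-≥1 (geo-even p (suc a)) ih)
      where
      eq : p ^ suc a ℕ.* m ℕ.* (p ^ suc a ℕ.* m) ≡ p ^ (suc a ℕ.+ suc a) ℕ.* (m ℕ.* m)
      eq = trans (linℕ 2 (λ P m → P ⊗ m ⊗ (P ⊗ m) ≡' P ⊗ P ⊗ (m ⊗ m)) tt (p ^ suc a) m) (cong (ℕ._* (m ℕ.* m)) (sym (^-distribˡ-+-* p (suc a) (suc a))))
      nd2 : ¬ p ∣ m ℕ.* m
      nd2 h with euclidsLemma m m pp h
      ... | inj₁ d = nd d
      ... | inj₂ d = nd d

  opaque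
    -- The hyperbola sum runs up to z₀² and is cut at d = y₀. A = 8 M makes the part d > y₀ at most
    -- a quarter of z₀³, against about 2 z₀³ / 3 from the squares; z₀ is six times 2 + M + A² so
    -- that the errors z₀² M and y₀² = A² z₀² stay small. Beyond y₀ the series L(1, χ) changes by at
    -- most 2 M / y₀ = 1 / (4 z₀). All depend on M alone.
    A z₀ y₀ : ℕ
    A = 8 ℕ.* M
    z₀ = 6 ℕ.* (2 ℕ.+ M ℕ.+ A ℕ.* A)
    y₀ = A ℕ.* z₀

    A-def : A ≡ 8 ℕ.* M
    A-def = refl

    z₀-def : z₀ ≡ 6 ℕ.* (2 ℕ.+ M ℕ.+ A ℕ.* A)
    z₀-def = refl

    y₀-def : y₀ ≡ A ℕ.* z₀
    y₀-def = refl

  A≥1 : 1 ℕ.≤ A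
  A≥1 = subst (1 ℕ.≤_) (sym A-def) (ℕP.≤-trans hM (m≤n*m M 8))

  module _ (T : ℕ) (y₀≤X : y₀ ℕ.≤ 2 ^ T) where
    open Bounded T hiding (v; R)

    𝓛 : ℕ → ℤ
    𝓛 y = ∑ y (λ d → χ d * w d)

    w*≤V : ∀ n → 1 ℕ.≤ n → + n * w n ≤ V
    w*≤V n hn = subst (_≤ V) (pos-* n (w₀ n)) (+≤+ (÷-≤ hn (ℕP.≤-reflexive (w₀-def n))))

    shifted : ∀ y m → ∑ m (λ n → χ (y ℕ.+ n)) ≲ + 2 * + M
    shifted y m = subst₂ _≲_ (lin 3 (λ a b c → a ≡' b ⊕ c ⇒ a ⊖ b ≡' c) tt (∑ (y ℕ.+ m) χ) (∑ y χ) (∑ m (λ n → χ (y ℕ.+ n))) (∑-split y m χ)) (lin 1 (λ M → M ⊕ M ≡' κ 2 ⊗ M) tt (+ M))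
      (≲-+ (χ-partial (y ℕ.+ m)) (≲-neg (χ-partial y)))

    𝓛-tail : ∀ {y D} → y ℕ.≤ D → 𝓛 D - 𝓛 y ≲ w (suc y) * (+ 2 * + M)
    𝓛-tail {y} {D} h with m≤n⇒∃[o]m+o≡n h
    ... | o , refl = subst₂ _≲_ (lin 3 (λ a b c → a ≡' b ⊕ c ⇒ c ≡' a ⊖ b) tt (𝓛 (y ℕ.+ o)) (𝓛 y) _ (∑-split y o (λ d → χ d * w d))) (cong (λ k → w k * (+ 2 * + M)) (ℕP.+-comm y 1))
      (abel-bounded (λ n → χ (y ℕ.+ n)) (λ n → w (y ℕ.+ n)) o (shifted y) (λ n hn → w-anti (ℕP.≤-trans hn (m≤n+m n y)) (ℕP.+-monoʳ-≤ y (n≤1+n n))) (λ n → w-nonneg (y ℕ.+ n)))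

    private
      z x y : ℕ
      z = z₀
      x = z ℕ.* z
      y = y₀
      X₂ : ℤ
      X₂ = + x

    zM : M ℕ.≤ z₀
    zM = subst (M ℕ.≤_) (sym z₀-def) (linℕ 2 (λ M A → M ≤' κ 6 ⊗ (κ 2 ⊕ M ⊕ A ⊗ A)) tt M A)

    z≥1 : 1 ℕ.≤ z₀
    z≥1 = ℕP.≤-trans hM zM

    A≤z : A ℕ.≤ z₀
    A≤z = ℕP.≤-trans (m≤m*n A A {{nz A≥1}}) (subst (A ℕ.* A ℕ.≤_) (sym z₀-def) (linℕ 2 (λ M A → A ⊗ A ≤' κ 6 ⊗ (κ 2 ⊕ M ⊕ A ⊗ A)) tt M A))

    y≤x : y ℕ.≤ x
    y≤x = subst (ℕ._≤ x) (sym y₀-def) (*-monoˡ-≤ z A≤z)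

    y≥1 : 1 ℕ.≤ y
    y≥1 = subst (1 ℕ.≤_) (sym y₀-def) (*-mono-≤ A≥1 z≥1)

    A≡ : + A ≡ + 8 * + M
    A≡ = trans (cong +_ A-def) (pos-* 8 M)

    y≡ : + y ≡ + A * + z
    y≡ = trans (cong +_ y₀-def) (pos-* A z)

    squares-≤ : ∀ n → 1 ℕ.≤ n → ∑ z (λ m → 𝟙 (m ℕ.* m ℕ.≟ n)) ≤ σ χ n
    squares-≤ n hn with anyUpTo? (λ m → m ℕ.* m ℕ.≟ n) (suc z)
    ... | no nx = ≤-trans (≤-reflexive (∑-zero z λ m _ hm → 𝟙-no (m ℕ.* m ℕ.≟ n) λ e → nx (m , s≤s hm , e))) (σχ-nonneg n hn)
    ... | yes (m , s≤s hm , refl) = ≤-trans (≤-reflexive (trans (∑-single {z} {m} {λ k → 𝟙 (k ℕ.* k ℕ.≟ m ℕ.* m)} hm1 hm λ k _ _ ne → 𝟙-no (k ℕ.* k ℕ.≟ m ℕ.* m) λ e → ne (sq-inj e)) (𝟙-yes (m ℕ.* m ℕ.≟ m ℕ.* m) refl))) (σχ-square m hm1)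
      where
      hm1 : 1 ℕ.≤ m
      hm1 = *-pos⁻ʳ m hn
      sq-inj : ∀ {k} → k ℕ.* k ≡ m ℕ.* m → k ≡ m
      sq-inj {k} e with ℕP.<-cmp k m
      ... | tri< a _ _ = contradiction e (<⇒≢ (*-mono-< a a))
      ... | tri≈ _ b _ = b
      ... | tri> _ _ c = contradiction (sym e) (<⇒≢ (*-mono-< c c))

    S₀ : ℤ
    S₀ = ∑ x (λ d → ∑ (x ÷ d) (λ e → χ d * (X₂ - + (d ℕ.* e))))

    -- `S₀` is ∑ (x - n) (1 ∗ χ)(n); by nonnegativity the squares alone can be kept.
    S₀-lower : ∑ z (λ m → X₂ - + m * + m) ≤ S₀
    S₀-lower = ≤-trans (≤-reflexive (trans (∑-cong z λ m hm hmz → sym (trans (∑-single {x} {m ℕ.* m} {λ n → 𝟙 (m ℕ.* m ℕ.≟ n) * (X₂ - + n)} (*-mono-≤ hm hm) (*-mono-≤ hmz hmz) (λ n _ _ ne → trans (cong (_* (X₂ - + n)) (𝟙-no (m ℕ.* m ℕ.≟ n) (ne ∘ sym))) (*-zeroˡ (X₂ - + n))))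
          (trans (cong (_* (X₂ - + (m ℕ.* m))) (𝟙-yes (m ℕ.* m ℕ.≟ m ℕ.* m) refl)) (trans (*-identityˡ _) (cong (λ k → X₂ - k) (pos-* m m))))))
        (trans (∑-swap z x _) (∑-ext x λ n → ∑-*ʳ z (X₂ - + n) _))))
      (≤-trans (∑-mono x λ n hn hnx → *-monoʳ (i≤j⇒0≤j-i (+≤+ hnx)) (squares-≤ n hn)) (≤-reflexive (sym (∑∑-σ x χ (λ n → X₂ - + n)))))

    v : ℕ → ℤ
    v d = 𝟙 (suc y ℕ.≤? d) * χ d

    v-partial : ∀ m → ∑ m v ≲ + 2 * + M
    v-partial m with m ℕ.≤? y
    ... | yes h = subst (_≲ + 2 * + M) (sym (∑-zero m λ d _ hd → trans (cong (_* χ d) (𝟙-no (suc y ℕ.≤? d) (ℕP.≤⇒≯ (ℕP.≤-trans hd h)))) (*-zeroˡ (χ d)))) (≲-zero (*-nonneg (pos≥0 {2}) (pos≥0 {M})))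
    ... | no h with m≤n⇒∃[o]m+o≡n (<⇒≤ (≰⇒> h))
    ...   | o , refl = subst (_≲ + 2 * + M) (sym (trans (∑-split y o v) (trans (cong₂ _+_
            (∑-zero y λ d _ hd → trans (cong (_* χ d) (𝟙-no (suc y ℕ.≤? d) (ℕP.≤⇒≯ hd))) (*-zeroˡ (χ d)))
            (∑-cong o λ n hn _ → trans (cong (_* χ (y ℕ.+ n)) (𝟙-yes (suc y ℕ.≤? y ℕ.+ n) (subst (ℕ._≤ y ℕ.+ n) (ℕP.+-comm y 1) (ℕP.+-monoʳ-≤ y hn)))) (*-identityˡ _)))
            (+-identityˡ _)))) (shifted y o)

    tailSum headSum : ℤ
    tailSum = ∑ x (λ d → ∑ (x ÷ d) (λ e → v d * (X₂ - + (d ℕ.* e))))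
    headSum = ∑ y (λ d → χ d * ∑ (x ÷ d) (λ e → X₂ - + d * + e))

    S₀-split : S₀ ≡ headSum + tailSum
    S₀-split = trans (∑-cong x λ d _ _ → trans (∑-ext (x ÷ d) λ e → dec d (X₂ - + (d ℕ.* e))) (∑-+ (x ÷ d) _ _)) (trans (∑-+ x _ _) (cong (_+ tailSum) (trans
      (∑-extend y≤x λ d a _ → ∑-zero (x ÷ d) λ e _ _ → trans (cong (λ i → i * χ d * (X₂ - + (d ℕ.* e))) (𝟙-no (d ℕ.≤? y) (ℕP.<⇒≱ a))) (trans (cong (_* (X₂ - + (d ℕ.* e))) (*-zeroˡ (χ d))) (*-zeroˡ (X₂ - + (d ℕ.* e)))))
      (∑-cong y λ d _ b → trans (∑-ext (x ÷ d) λ e → cong₂ _*_ (trans (cong (_* χ d) (𝟙-yes (d ℕ.≤? y) b)) (*-identityˡ (χ d))) (cong (λ k → X₂ - k) (pos-* d e))) (∑-*ˡ (x ÷ d) (χ d) _)))))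
      where
      dec : ∀ d c → χ d * c ≡ 𝟙 (d ℕ.≤? y) * χ d * c + v d * c
      dec d c with 𝟙-case (d ℕ.≤? y) | 𝟙-case (suc y ℕ.≤? d)
      ... | inj₁ (p , _) | inj₁ (q , _) = contradiction p (ℕP.<⇒≱ q)
      ... | inj₂ (p , _) | inj₂ (q , _) = contradiction (≰⇒> p) q
      ... | inj₁ (_ , i) | inj₂ (_ , k) rewrite i | k = lin 2 (λ u c → u ⊗ c ≡' κ 1 ⊗ u ⊗ c ⊕ κ 0 ⊗ u ⊗ c) tt (χ d) c
      ... | inj₂ (_ , i) | inj₁ (_ , k) rewrite i | k = lin 2 (λ u c → u ⊗ c ≡' κ 0 ⊗ u ⊗ c ⊕ κ 1 ⊗ u ⊗ c) tt (χ d) c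

    -- For d > y the cofactor e is at most x / y = z / A. For fixed e the values of χ are summed by
    -- parts against x - d e, which decreases in d and is at most x.
    tail-bound : + 4 * tailSum ≤ X₂ * + z
    tail-bound = lin 5 (λ t q M x z → t ≤' q ⊗ (x ⊗ (κ 2 ⊗ M)) ⇒ x ⊗ (κ 8 ⊗ M ⊗ q) ≤' x ⊗ z ⇒ κ 4 ⊗ t ≤' x ⊗ z) tt tailSum (+ (x ÷ y)) (+ M) X₂ (+ z) t≤ (*-monoˡ {X₂} pos≥0 8Mq≤z)
      where
      8Mq≤z : + 8 * + M * + (x ÷ y) ≤ + z
      8Mq≤z = subst (_≤ + z) (trans (pos-* A (x ÷ y)) (cong (_* + (x ÷ y)) A≡)) (+≤+ (*-cancelˡ-≤ z {{nz z≥1}} (subst (ℕ._≤ x)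
        (trans (cong (ℕ._* (x ÷ y)) y₀-def) (linℕ 3 (λ A z q → A ⊗ z ⊗ q ≡' z ⊗ (A ⊗ q)) tt A z (x ÷ y))) (÷-≤ {x} {y} y≥1 ℕP.≤-refl))))
      inner : ∀ e → 1 ℕ.≤ e → ∑ (x ÷ e) (λ d → v d * (X₂ - + (d ℕ.* e))) ≲ X₂ * (+ 2 * + M)
      inner e he = subst (_≲ X₂ * (+ 2 * + M)) (∑-cong (x ÷ e) λ d _ hd → cong (v d *_) (pos-∸′ (subst (ℕ._≤ x) (ℕP.*-comm e d) (÷-≤ he hd))))
        (≲-trans (abel-bounded v (λ d → + (x ℕ.∸ d ℕ.* e)) (x ÷ e) v-partial (λ d _ → +≤+ (ℕP.∸-monoʳ-≤ x (*-monoˡ-≤ e (n≤1+n d)))) (λ _ → pos≥0))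
          (*-monoʳ (*-nonneg (pos≥0 {2}) (pos≥0 {M})) (+≤+ (m∸n≤m x (1 ℕ.* e)))))
        where
        pos-∸′ : ∀ {t j} → j ℕ.≤ t → + (t ℕ.∸ j) ≡ + t - + j
        pos-∸′ {t} {j} h = lin 3 (λ a t j → a ⊕ j ≡' t ⇒ a ≡' t ⊖ j) tt (+ (t ℕ.∸ j)) (+ t) (+ j) (cong +_ (m∸n+n≡m h))
      t≤ : tailSum ≤ + (x ÷ y) * (X₂ * (+ 2 * + M))
      t≤ = ≤-trans (≤-reflexive (trans (∑∑-swap x _) (∑-extend (÷-≤x x y) λ e a _ → ∑-zero (x ÷ e) λ d _ hd →
            trans (cong (λ i → i * χ d * (X₂ - + (d ℕ.* e))) (𝟙-no (suc y ℕ.≤? d) λ k → ℕP.<⇒≱ a (≤-÷ y≥1 (ℕP.≤-trans (*-monoˡ-≤ e (<⇒≤ k)) (subst (ℕ._≤ x) (ℕP.*-comm e d) (÷-≤ (ℕP.≤-trans (s≤s z≤n) a) hd))))))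
              (lin 2 (λ u c → κ 0 ⊗ u ⊗ c ≡' κ 0) tt (χ d) (X₂ - + (d ℕ.* e))))))
        (≤-trans (∑-mono (x ÷ y) λ e he _ → proj₂ (inner e he)) (≤-reflexive (∑-const (x ÷ y) _)))

    -- With ρ = x - d (x ÷ d), 2 d times the inner sum is x² - x d + ρ (d - ρ). Divided by d, the
    -- leading term gives L(1, χ), the second one a bounded character sum, and the third at most y
    -- for each d. The smooth weight x - n is what keeps the effect of rounding x / d this small.
    head-bound : + 2 * V * headSum ≤ X₂ * X₂ * 𝓛 y + X₂ * V * + M + V * (+ y * + y)
    head-bound = ≤-trans (≤-reflexive (trans (sym (∑-*ˡ y (+ 2 * V) _)) (∑-cong y term)))
      (≤-trans (≤-reflexive (trans (∑-+ y _ _) (cong (_+ ∑ y rest) (trans (∑-- y _ _) (cong₂ _-_ (∑-*ˡ y (X₂ * X₂) _) (∑-*ˡ y (X₂ * V) χ))))))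
        (lin 5 (λ a b s R c → κ 0 ⊖ b ≤' s ⇒ R ≤' c ⇒ a ⊖ s ⊕ R ≤' a ⊕ b ⊕ c) tt (X₂ * X₂ * 𝓛 y) (X₂ * V * + M) (X₂ * V * ∑ y χ) (∑ y rest) (V * (+ y * + y))
          (neg-≤⁻¹ (proj₁ (≲-*ˡ (*-nonneg (pos≥0 {x}) (pos≥0 {V₀})) (χ-partial y)))) rest-bound))
      where
      ρ : ℕ → ℤ
      ρ d = X₂ - + d * + (x ÷ d)
      rest : ℕ → ℤ
      rest d = χ d * w d * (ρ d * (+ d - ρ d))
      term : ∀ d → 1 ℕ.≤ d → d ℕ.≤ y → + 2 * V * (χ d * ∑ (x ÷ d) (λ e → X₂ - + d * + e)) ≡ (X₂ * X₂ * (χ d * w d) - X₂ * V * χ d) + rest d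
      term d hd hdy = lin 7 (λ v c G x d q w → κ 2 ⊗ G ≡' κ 2 ⊗ q ⊗ x ⊖ d ⊗ q ⊗ (q ⊕ κ 1) ⇒ v ⊗ c ⊗ (κ 2 ⊗ G) ≡' v ⊗ c ⊗ (κ 2 ⊗ q ⊗ x ⊖ d ⊗ q ⊗ (q ⊕ κ 1))
          ⇒ (c ⊗ (κ 2 ⊗ q ⊗ x ⊖ d ⊗ q ⊗ (q ⊕ κ 1))) ⊗ (w ⊗ d) ≡' (c ⊗ (κ 2 ⊗ q ⊗ x ⊖ d ⊗ q ⊗ (q ⊕ κ 1))) ⊗ v ⇒ (x ⊗ c) ⊗ (w ⊗ d) ≡' (x ⊗ c) ⊗ v
          ⇒ κ 2 ⊗ v ⊗ (c ⊗ G) ≡' (x ⊗ x ⊗ (c ⊗ w) ⊖ x ⊗ v ⊗ c) ⊕ c ⊗ w ⊗ ((x ⊖ d ⊗ q) ⊗ (d ⊖ (x ⊖ d ⊗ q)))) tt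
        V (χ d) (∑ (x ÷ d) (λ e → X₂ - + d * + e)) X₂ (+ d) (+ (x ÷ d)) (w d) (∑-linear (x ÷ d) X₂ (+ d)) (cong (V * χ d *_) (∑-linear (x ÷ d) X₂ (+ d)))
        (cong (χ d * (+ 2 * + (x ÷ d) * X₂ - + d * + (x ÷ d) * (+ (x ÷ d) + 1ℤ)) *_) wd) (cong (X₂ * χ d *_) wd)
        where
        wd : w d * + d ≡ V
        wd = w-* hd (ℕP.≤-trans hdy y₀≤X)
      ρ-bounds : ∀ d → 1 ℕ.≤ d → 0ℤ ≤ ρ d × 0ℤ ≤ + d - ρ d
      ρ-bounds d hd = i≤j⇒0≤j-i (subst (_≤ X₂) (pos-* d (x ÷ d)) (+≤+ (÷-≤ {x} hd ℕP.≤-refl)))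
        , lin 4 (λ x d q D → κ 1 ⊕ x ≤' D ⇒ D ≡' d ⊗ (κ 1 ⊕ q) ⇒ κ 0 ≤' d ⊖ (x ⊖ d ⊗ q)) tt X₂ (+ d) (+ (x ÷ d)) (+ (d ℕ.* suc (x ÷ d))) (+≤+ (÷-lt x hd)) (pos-* d (suc (x ÷ d)))
      rest-bound : ∑ y rest ≤ V * (+ y * + y)
      rest-bound = ≤-trans (∑-mono y λ d hd hdy → each d hd hdy) (≤-reflexive (trans (∑-const y _) (*-assoc₃ (+ y) V (+ y))))
        where
        each : ∀ d → 1 ℕ.≤ d → d ℕ.≤ y → rest d ≤ V * + y
        each d hd hdy with ρ-bounds d hd
        ... | r1 , r2 = ≤-trans (≤-reflexive (*-assoc (χ d) (w d) (ρ d * (+ d - ρ d)))) (≤-trans (*-monoʳ {w d * (ρ d * (+ d - ρ d))} {χ d} {1ℤ} (*-nonneg (w-nonneg d) (*-nonneg {ρ d} {+ d - ρ d} r1 r2)) (proj₂ (χ-≲ d)))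
              (≤-trans (≤-reflexive (*-identityˡ (w d * (ρ d * (+ d - ρ d))))) (≤-trans (*-monoˡ {w d} {ρ d * (+ d - ρ d)} {+ d * + y} (w-nonneg d) (*-mono {ρ d} {+ d} {+ d - ρ d} {+ y} r1 (ρ≤d r2) r2 (≤-trans (lin 2 (λ d r → κ 0 ≤' r ⇒ d ⊖ r ≤' d) tt (+ d) (ρ d) r1) (+≤+ hdy))))
                (≤-trans (≤-reflexive (sym (*-assoc (w d) (+ d) (+ y)))) (≤-reflexive (cong (_* + y) (w-* hd (ℕP.≤-trans hdy y₀≤X))))))))
          where
          ρ≤d : 0ℤ ≤ + d - ρ d → ρ d ≤ + d
          ρ≤d h = lin 2 (λ d r → κ 0 ≤' d ⊖ r ⇒ r ≤' d) tt (+ d) (ρ d) h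

    𝓛-y₀ : V ≤ + 2 * + z * 𝓛 y
    𝓛-y₀ = *-cancel {+ z * (+ z * + z)} z3≥1 (lin 8 (λ v L z S H T M A →
          κ 6 ⊗ v ⊗ S ≤' κ 6 ⊗ v ⊗ (H ⊕ T) ⇒ v ⊗ (κ 6 ⊗ S) ≡' v ⊗ (κ 6 ⊗ (z ⊗ z) ⊗ z ⊖ z ⊗ (z ⊕ κ 1) ⊗ (κ 2 ⊗ z ⊕ κ 1))
          ⇒ v ⊗ (κ 4 ⊗ T) ≤' v ⊗ (z ⊗ z ⊗ z) ⇒ κ 2 ⊗ v ⊗ H ≤' z ⊗ z ⊗ (z ⊗ z) ⊗ L ⊕ z ⊗ z ⊗ v ⊗ M ⊕ v ⊗ (A ⊗ z ⊗ (A ⊗ z))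
          ⇒ v ⊗ (z ⊗ z) ⊗ z ≡' v ⊗ (z ⊗ z) ⊗ (κ 6 ⊗ (κ 2 ⊕ M ⊕ A ⊗ A)) ⇒ v ⊗ z ≤' v ⊗ (z ⊗ z) ⇒ κ 0 ≤' v ⊗ (z ⊗ z) ⇒ κ 0 ≤' v ⊗ (z ⊗ (z ⊗ z))
          ⇒ z ⊗ (z ⊗ z) ⊗ v ≤' z ⊗ (z ⊗ z) ⊗ (κ 2 ⊗ z ⊗ L)) tt
        V (𝓛 y) Z (∑ z (λ m → X₂ - + m * + m)) headSum tailSum (+ M) (+ A)
        (*-monoˡ (*-nonneg (pos≥0 {6}) (pos≥0 {V₀})) (≤-trans S₀-lower (≤-reflexive S₀-split)))
        (cong (V *_) (trans (∑-squares z X₂) (cong (λ k → + 6 * k * Z - Z * (Z + 1ℤ) * (+ 2 * Z + 1ℤ)) xz)))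
        (*-monoˡ {V} pos≥0 (subst (λ k → + 4 * tailSum ≤ k * Z) xz tail-bound))
        (subst₂ (λ k l → + 2 * V * headSum ≤ k * k * 𝓛 y + k * V * + M + V * (l * l)) xz y≡ head-bound)
        (cong (V * (Z * Z) *_) zdef) (*-monoˡ {V} pos≥0 (subst (Z ≤_) (pos-* z z) (+≤+ (m≤m*n z z {{nz z≥1}})))) (*-nonneg (pos≥0 {V₀}) (*-nonneg (pos≥0 {z}) (pos≥0 {z}))) (*-nonneg (pos≥0 {V₀}) (*-nonneg (pos≥0 {z}) (*-nonneg (pos≥0 {z}) (pos≥0 {z})))))
      where
      Z : ℤ
      Z = + z
      xz : X₂ ≡ Z * Z
      xz = pos-* z z
      z3≥1 : 1ℤ ≤ Z * (Z * Z)
      z3≥1 = subst (1ℤ ≤_) (trans (pos-* z (z ℕ.* z)) (cong (Z *_) (pos-* z z))) (+≤+ (*-mono-≤ z≥1 (*-mono-≤ z≥1 z≥1)))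
      zdef : Z ≡ + 6 * (+ 2 + + M + + A * + A)
      zdef = trans (trans (cong +_ z₀-def) (pos-* 6 (2 ℕ.+ M ℕ.+ A ℕ.* A))) (cong (λ k → + 6 * (+ 2 + + M + k)) (pos-* A A))

    𝓛-lower : ∀ D → y₀ ℕ.≤ D → V ≤ + 4 * + z₀ * 𝓛 D
    𝓛-lower D h = lin 7 (λ v z L LD w w1 M → v ≤' κ 2 ⊗ z ⊗ L ⇒ z ⊗ (κ 0 ⊖ w1 ⊗ (κ 2 ⊗ M)) ≤' z ⊗ (LD ⊖ L) ⇒ z ⊗ M ⊗ w1 ≤' z ⊗ M ⊗ w ⇒ w ⊗ (κ 8 ⊗ M ⊗ z) ≡' v ⇒ v ≤' κ 4 ⊗ z ⊗ LD) tt
      V (+ z) (𝓛 y) (𝓛 D) (w y) (w (suc y)) (+ M) 𝓛-y₀ (*-monoˡ {+ z} pos≥0 (neg-≤⁻¹ (proj₁ (𝓛-tail h)))) (*-monoˡ (*-nonneg (pos≥0 {z}) (pos≥0 {M})) (w-decr y y≥1))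
      (trans (cong (w y *_) (sym (trans y≡ (cong (_* + z) A≡)))) (w-* y≥1 y₀≤X))

    R : ℕ → ℤ
    R x = ∑ x (λ n → χ n * (Λ n * w n))

    Cχ : ℤ
    Cχ = + 12 * + M + 1ℤ + + 28 * + M

    -- By L = 1 ∗ Λ, ∑ χ(n) L(n)/n is the sum of χ(d) Λ(d)/d · 𝓛(x ÷ d). Here 𝓛(x ÷ d) = 𝓛(x) + O(d
    -- / x), and `chebyshev` sums the error; the left side is bounded because χ has bounded partial
    -- sums.
    𝓛R-bound : ∀ x → 1 ℕ.≤ x → x ℕ.≤ X → 𝓛 x * R x ≲ Cχ * (S * V * V)
    𝓛R-bound x hx hX = cancel-≲ {+ x} (+≤+ hx) (subst₂ _≲_
        (trans (cong₂ _-_ eq-total refl) (lin 3 (λ a b c → (b ⊕ c) ⊖ c ≡' b) tt 0ℤ (+ x * (𝓛 x * R x)) err))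
        (lin 4 (λ x M s v → x ⊗ (v ⊗ ((κ 12 ⊗ M ⊕ κ 1) ⊗ (s ⊗ v))) ⊕ (κ 28 ⊗ M ⊗ (s ⊗ x) ⊗ (v ⊗ v)) ≡' x ⊗ ((κ 12 ⊗ M ⊕ κ 1 ⊕ κ 28 ⊗ M) ⊗ (s ⊗ v ⊗ v))) tt (+ x) (+ M) S V)
        (≲-+ (≲-*ˡ {+ x} pos≥0 (≲-*ˡ {V} pos≥0 (Oscillation.∑uLw χ χ-partial χ-≲ x hX))) (≲-neg err-bound)))
      where
      cancel-≲ : ∀ {c a b} → 1ℤ ≤ c → c * a ≲ c * b → a ≲ b
      cancel-≲ {c} {a} {b} hc (p , q) = *-cancel hc (subst (_≤ c * a) (neg-distribʳ-* c b) p) , *-cancel hc q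
      c : ℕ → ℤ
      c d = χ d * (Λ d * w d)
      err : ℤ
      err = ∑ x (λ d → c d * (+ x * (𝓛 (x ÷ d) - 𝓛 x)))
      total : V * ∑ x (λ n → χ n * L n * w n) ≡ ∑ x (λ d → c d * 𝓛 (x ÷ d))
      total = trans (cong (V *_) (trans (∑-ext x λ n → lin 3 (λ a l w → a ⊗ l ⊗ w ≡' l ⊗ (a ⊗ w)) tt (χ n) (L n) (w n)) (sym (∑∑-Λ x (λ n → χ n * w n)))))
        (trans (sym (∑-*ˡ x V _)) (∑-cong x λ d hd hdx → trans (sym (∑-*ˡ (x ÷ d) V _)) (trans (∑-cong (x ÷ d) λ k hk hkx →
          trans (cong (λ z → V * (Λ d * (z * w (d ℕ.* k)))) (χ-* d k)) (trans (lin 5 (λ v l a b w → v ⊗ (l ⊗ (a ⊗ b ⊗ w)) ≡' a ⊗ b ⊗ l ⊗ (v ⊗ w)) tt V (Λ d) (χ d) (χ k) (w (d ℕ.* k)))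
            (trans (cong (χ d * χ k * Λ d *_) (w-mul hd hk (ℕP.≤-trans (÷-≤ hd hkx) hX))) (lin 5 (λ a b l w u → a ⊗ b ⊗ l ⊗ (w ⊗ u) ≡' a ⊗ (l ⊗ w) ⊗ (b ⊗ u)) tt (χ d) (χ k) (Λ d) (w d) (w k)))))
          (∑-*ˡ (x ÷ d) (c d) _))))
      eq-total : + x * (V * ∑ x (λ n → χ n * L n * w n)) ≡ + x * (𝓛 x * R x) + err
      eq-total = trans (cong (+ x *_) total) (trans (sym (∑-*ˡ x (+ x) _)) (trans (∑-ext x λ d → lin 4 (λ x c l l' → x ⊗ (c ⊗ l) ≡' (x ⊗ l') ⊗ c ⊕ c ⊗ (x ⊗ (l ⊖ l'))) tt (+ x) (c d) (𝓛 (x ÷ d)) (𝓛 x))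
        (trans (∑-+ x _ _) (cong (_+ err) (trans (∑-*ˡ x (+ x * 𝓛 x) c) (*-assoc (+ x) (𝓛 x) (R x)))))))
      err-bound : err ≲ + 28 * + M * (S * + x) * (V * V)
      err-bound = ≲-trans (∑-≲ x {g = λ d → + 2 * + M * (V * V) * Λ d} each) (≤-trans (≤-reflexive (∑-*ˡ x (+ 2 * + M * (V * V)) Λ))
          (≤-trans (*-monoˡ (*-nonneg (*-nonneg (pos≥0 {2}) (pos≥0 {M})) (*-nonneg (pos≥0 {V₀}) (pos≥0 {V₀}))) (chebyshev x hX))
            (≤-reflexive (lin 3 (λ m v s → κ 2 ⊗ m ⊗ v ⊗ (κ 14 ⊗ s) ≡' κ 28 ⊗ m ⊗ s ⊗ v) tt (+ M) (V * V) (S * + x)))))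
        where
        each : ∀ d → 1 ℕ.≤ d → d ℕ.≤ x → c d * (+ x * (𝓛 (x ÷ d) - 𝓛 x)) ≲ + 2 * + M * (V * V) * Λ d
        each d hd hdx = ≲-trans (≲-* (≲-* (χ-≲ d) (≲-nonneg (*-nonneg (Λ-nonneg d) (w-nonneg d)) ≤-refl)) (≲-*ˡ {+ x} pos≥0 (subst (_≲ w (suc q) * (+ 2 * + M)) flip (≲-neg (𝓛-tail (÷-≤x x d))))))
          (lin 7 (λ l w x u M v d → l ⊗ w ⊗ M ⊗ (x ⊗ u) ≤' l ⊗ w ⊗ M ⊗ (d ⊗ v) ⇒ l ⊗ M ⊗ v ⊗ (w ⊗ d) ≡' l ⊗ M ⊗ v ⊗ v ⇒ κ 1 ⊗ (l ⊗ w) ⊗ (x ⊗ (u ⊗ (κ 2 ⊗ M))) ≤' κ 2 ⊗ M ⊗ (v ⊗ v) ⊗ l) tt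
             (Λ d) (w d) (+ x) (w (suc q)) (+ M) V (+ d) (*-monoˡ (*-nonneg (*-nonneg (Λ-nonneg d) (w-nonneg d)) (pos≥0 {M})) xw≤dV) (cong (Λ d * + M * V *_) (w-* hd (ℕP.≤-trans hdx hX))))
          where
          q : ℕ
          q = x ÷ d
          xw≤dV : + x * w (suc q) ≤ + d * V
          xw≤dV = ≤-trans (*-monoʳ (w-nonneg (suc q)) (≤-trans (+≤+ (<⇒≤ (÷-lt x hd))) (≤-reflexive (pos-* d (suc q)))))
            (≤-trans (≤-reflexive (*-assoc (+ d) (+ suc q) (w (suc q)))) (*-monoˡ {+ d} pos≥0 (w*≤V (suc q) (s≤s z≤n))))
          flip : - (𝓛 x - 𝓛 q) ≡ 𝓛 q - 𝓛 x
          flip = lin 3 (λ a b n → n ⊕ (a ⊖ b) ≡' κ 0 ⇒ n ≡' b ⊖ a) tt (𝓛 x) (𝓛 q) (- (𝓛 x - 𝓛 q)) (+-inverseˡ (𝓛 x - 𝓛 q))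

    char-mertens : ∀ x → y₀ ℕ.≤ x → x ℕ.≤ X → - (+ 4 * + z₀ * Cχ * (S * V)) ≤ R x
    char-mertens x h hX with ≤-total 0ℤ (R x)
    ... | inj₁ hR = ≤-trans (neg-mono-≤ (*-nonneg (*-nonneg (*-nonneg (pos≥0 {4}) (pos≥0 {z₀})) Cχ≥0) SV≥0)) hR
      where
      Cχ≥0 : 0ℤ ≤ Cχ
      Cχ≥0 = +-mono-≤ (+-mono-≤ (*-nonneg (pos≥0 {12}) (pos≥0 {M})) pos≥0) (*-nonneg (pos≥0 {28}) (pos≥0 {M}))
    ... | inj₂ hR = neg-≤ (*-cancel V≥1 (lin 7 (λ v z L R c s n → κ 0 ⊖ c ⊗ (s ⊗ v ⊗ v) ≤' L ⊗ R ⇒ z ⊗ (κ 0 ⊖ c ⊗ (s ⊗ v ⊗ v)) ≤' z ⊗ (L ⊗ R) ⇒ n ⊗ v ≤' n ⊗ (κ 4 ⊗ z ⊗ L) ⇒ n ≡' κ 0 ⊖ R ⇒ n ⊗ v ≡' (κ 0 ⊖ R) ⊗ v ⇒ n ⊗ (κ 4 ⊗ z ⊗ L) ≡' (κ 0 ⊖ R) ⊗ (κ 4 ⊗ z ⊗ L)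
          ⇒ v ⊗ (κ 0 ⊖ κ 4 ⊗ z ⊗ c ⊗ (s ⊗ v)) ≤' v ⊗ R) tt
        V (+ z₀) (𝓛 x) (R x) Cχ S (0ℤ - R x) b1 (*-monoˡ {+ z₀} pos≥0 b1) (*-monoˡ (i≤j⇒0≤j-i hR) (𝓛-lower x h)) refl refl refl))
      where
      b1 : 0ℤ - Cχ * (S * V * V) ≤ 𝓛 x * R x
      b1 = neg-≤⁻¹ (proj₁ (𝓛R-bound x (ℕP.≤-trans y≥1 h) hX))

-- Large classes

closed-arith : ∀ (u t D φ k τ m tri D² v s m₁ m₂ m₃ : ℤ) → 1ℤ ≤ u → u ≡ s * v → 0ℤ ≤ v → 1ℤ ≤ φ → 1ℤ ≤ t → 0ℤ ≤ D → 0ℤ ≤ k → 0ℤ ≤ m → 0ℤ ≤ τ → τ ≤ + 4 * t →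
  + 16 * k * (D * (D * D)) + 1ℤ ≤ t → u * t ≤ D * m₁ → u * t ≤ D * m₂ → u * t ≤ D * m₃ → m₁ * (m₂ * m₃) ≤ v * v * tri →
  + 2 * (φ * (v * v) * tri) ≤ φ * (v * v) * D² + u * (u * u) * (k * (τ * τ)) → D² ≤ s * s * (τ * τ) * m → u * (+ 3 * t) ≤ + 48 * (D * (D * D)) * m
closed-arith u t D φ k τ m tri D² v s m₁ m₂ m₃ hu ue hv hφ ht hD hk hm hτ hτt big l1 l2 l3 hm3 htri hD² with ≤-total (u * (+ 3 * t)) (+ 48 * (D * (D * D)) * m)
... | inj₁ h = h
... | inj₂ h = contradiction (*-cancel {u * u * u * (t * t)} c≥1 small) (<⇒≱ φt>)
  where
  d : ℤ
  d = D * (D * D)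
  d≥0 : 0ℤ ≤ d
  d≥0 = *-nonneg hD (*-nonneg hD hD)
  u≥0 : 0ℤ ≤ u
  u≥0 = ≤-trans pos≥0 hu
  t≥0 : 0ℤ ≤ t
  t≥0 = ≤-trans pos≥0 ht
  φ≥0 : 0ℤ ≤ φ
  φ≥0 = ≤-trans pos≥0 hφ
  ut≥0 : 0ℤ ≤ u * t
  ut≥0 = *-nonneg u≥0 t≥0
  c≥1 : 1ℤ ≤ u * u * u * (t * t)
  c≥1 = *-≥1 (*-≥1 (*-≥1 hu hu) hu) (*-≥1 ht ht)
  ττ≤ : τ * τ ≤ + 16 * (t * t)
  ττ≤ = ≤-trans (*-mono hτ hτt hτ hτt) (≤-reflexive (lin 1 (λ t → κ 4 ⊗ t ⊗ (κ 4 ⊗ t) ≡' κ 16 ⊗ (t ⊗ t)) tt t))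
  cube : u * t * (u * t * (u * t)) ≤ d * (v * v * tri)
  cube = ≤-trans (*-mono ut≥0 l1 (*-nonneg ut≥0 ut≥0) (*-mono ut≥0 l2 ut≥0 l3))
    (≤-trans (≤-reflexive (lin 4 (λ d a b c → d ⊗ a ⊗ (d ⊗ b ⊗ (d ⊗ c)) ≡' d ⊗ (d ⊗ d) ⊗ (a ⊗ (b ⊗ c))) tt D m₁ m₂ m₃)) (*-monoˡ d≥0 hm3))
  step : + 2 * φ * (u * u * u * (t * t * t)) ≤ d * (φ * (u * u) * (τ * τ) * m + u * u * u * (k * (τ * τ)))
  step = lin 11 (λ p u t d w tri D2 s τ mg k → p ⊗ (u ⊗ t ⊗ (u ⊗ t ⊗ (u ⊗ t))) ≤' p ⊗ (d ⊗ (w ⊗ tri)) ⇒ d ⊗ (κ 2 ⊗ (p ⊗ w ⊗ tri)) ≤' d ⊗ (p ⊗ w ⊗ D2 ⊕ u ⊗ (u ⊗ u) ⊗ (k ⊗ τ)) ⇒ d ⊗ p ⊗ w ⊗ D2 ≤' d ⊗ p ⊗ w ⊗ (s ⊗ τ ⊗ mg) ⇒ d ⊗ p ⊗ τ ⊗ mg ⊗ (w ⊗ s) ≡' d ⊗ p ⊗ τ ⊗ mg ⊗ (u ⊗ u)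
      ⇒ κ 2 ⊗ p ⊗ (u ⊗ u ⊗ u ⊗ (t ⊗ t ⊗ t)) ≤' d ⊗ (p ⊗ (u ⊗ u) ⊗ τ ⊗ mg ⊕ u ⊗ u ⊗ u ⊗ (k ⊗ τ))) tt
    φ u t d (v * v) tri D² (s * s) (τ * τ) m k
    (*-monoˡ φ≥0 cube) (*-monoˡ d≥0 htri) (*-monoˡ (*-nonneg (*-nonneg d≥0 φ≥0) (*-nonneg hv hv)) hD²)
    (cong (d * φ * (τ * τ) * m *_) (trans (lin 2 (λ s v → v ⊗ v ⊗ (s ⊗ s) ≡' s ⊗ v ⊗ (s ⊗ v)) tt s v) (cong (λ z → z * z) (sym ue))))
  -- If the conclusion fails, then 16 D³ m < u t. With τ² ≤ 16 t² the first term on the right of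
  -- `step` is at most half of the left side, and φ t ≤ 16 k D³ remains. So 48 = 3 · 16, where 3
  -- comes from the tripled exponent and 16 from τ ≤ 4 t.
  small : u * u * u * (t * t) * (φ * t) ≤ u * u * u * (t * t) * (+ 16 * k * d)
  small = lin 7 (λ p u t d q m k → κ 2 ⊗ p ⊗ (u ⊗ u ⊗ u ⊗ (t ⊗ t ⊗ t)) ≤' d ⊗ (p ⊗ (u ⊗ u) ⊗ q ⊗ m ⊕ u ⊗ u ⊗ u ⊗ (k ⊗ q))
      ⇒ d ⊗ p ⊗ (u ⊗ u) ⊗ m ⊗ q ≤' d ⊗ p ⊗ (u ⊗ u) ⊗ m ⊗ (κ 16 ⊗ (t ⊗ t)) ⇒ d ⊗ (u ⊗ u ⊗ u) ⊗ k ⊗ q ≤' d ⊗ (u ⊗ u ⊗ u) ⊗ k ⊗ (κ 16 ⊗ (t ⊗ t))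
      ⇒ p ⊗ (u ⊗ u) ⊗ (t ⊗ t) ⊗ (κ 48 ⊗ d ⊗ m) ≤' p ⊗ (u ⊗ u) ⊗ (t ⊗ t) ⊗ (u ⊗ (κ 3 ⊗ t))
      ⇒ u ⊗ u ⊗ u ⊗ (t ⊗ t) ⊗ (p ⊗ t) ≤' u ⊗ u ⊗ u ⊗ (t ⊗ t) ⊗ (κ 16 ⊗ k ⊗ d)) tt
    φ u t d (τ * τ) m k step (*-monoˡ (*-nonneg (*-nonneg (*-nonneg d≥0 φ≥0) (*-nonneg u≥0 u≥0)) hm) ττ≤) (*-monoˡ (*-nonneg (*-nonneg d≥0 (*-nonneg (*-nonneg u≥0 u≥0) u≥0)) hk) ττ≤)
    (*-monoˡ (*-nonneg (*-nonneg φ≥0 (*-nonneg u≥0 u≥0)) (*-nonneg t≥0 t≥0)) h)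
  φt> : + 16 * k * d ℤ.< φ * t
  φt> = <-≤-trans (suc[i]≤j⇒i<j (≤-trans (≤-reflexive (+-comm 1ℤ (+ 16 * k * d))) big)) (≤-trans (≤-reflexive (sym (*-identityˡ t))) (*-monoʳ t≥0 hφ))

-- After division by u² t the hypotheses read D t ≤ 2 D k + M (1 + t) + M² (t + c).
cover-arith : ∀ (u t D φ k M c W : ℤ) → 1ℤ ≤ u → 1ℤ ≤ t → 0ℤ ≤ φ → φ ≤ M → 0ℤ ≤ k → 0ℤ ≤ c → 1ℤ ≤ M → + 8 * (M * M) ≤ D → + 3 * k + + 2 + c ≤ t →
  D * W ≤ u * (1ℤ + t) * (u * t) + M * (u * t * (u * (t + c))) → u * u * (t * t) ≤ φ * W + k * (u * u) * (1ℤ + t) → ⊥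
cover-arith u t D φ k M c W hu ht hφ φ≤M hk hc hM hD big upper lower = <⇒≱ big' absurd
  where
  u≥0 : 0ℤ ≤ u
  u≥0 = ≤-trans pos≥0 hu
  t≥0 : 0ℤ ≤ t
  t≥0 = ≤-trans pos≥0 ht
  M≥0 : 0ℤ ≤ M
  M≥0 = ≤-trans pos≥0 hM
  D≥0 : 0ℤ ≤ D
  D≥0 = ≤-trans (*-nonneg (pos≥0 {8}) (*-nonneg M≥0 M≥0)) hD
  D≥1 : 1ℤ ≤ D
  D≥1 = ≤-trans (*-≥1 {+ 8} (+≤+ (s≤s z≤n)) (*-≥1 hM hM)) hD
  φDW : φ * (D * W) ≤ M * (u * (1ℤ + t) * (u * t) + M * (u * t * (u * (t + c))))
  φDW = ≤-trans (*-monoˡ hφ upper) (*-monoʳ (+-mono-≤ (*-nonneg (*-nonneg u≥0 (+-mono-≤ pos≥0 t≥0)) (*-nonneg u≥0 t≥0)) (*-nonneg M≥0 (*-nonneg (*-nonneg u≥0 t≥0) (*-nonneg u≥0 (+-mono-≤ t≥0 hc))))) φ≤M)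
  poly : u * u * t * (D * t) ≤ u * u * t * (+ 2 * D * k + (M * (1ℤ + t) + M * M * (t + c)))
  poly = lin 8 (λ d u t p W k M c → d ⊗ (u ⊗ u ⊗ (t ⊗ t)) ≤' d ⊗ (p ⊗ W ⊕ k ⊗ (u ⊗ u) ⊗ (κ 1 ⊕ t)) ⇒ d ⊗ k ⊗ (u ⊗ u) ⊗ κ 1 ≤' d ⊗ k ⊗ (u ⊗ u) ⊗ t ⇒ p ⊗ (d ⊗ W) ≤' M ⊗ (u ⊗ (κ 1 ⊕ t) ⊗ (u ⊗ t) ⊕ M ⊗ (u ⊗ t ⊗ (u ⊗ (t ⊕ c))))
      ⇒ u ⊗ u ⊗ t ⊗ (d ⊗ t) ≤' u ⊗ u ⊗ t ⊗ (κ 2 ⊗ d ⊗ k ⊕ (M ⊗ (κ 1 ⊕ t) ⊕ M ⊗ M ⊗ (t ⊕ c)))) tt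
    D u t φ W k M c (*-monoˡ D≥0 lower) (*-monoˡ (*-nonneg (*-nonneg D≥0 hk) (*-nonneg u≥0 u≥0)) ht) φDW
  divided : D * t ≤ + 2 * D * k + (M * (1ℤ + t) + M * M * (t + c))
  divided = *-cancel {u * u * t} (*-≥1 (*-≥1 hu hu) ht) poly
  MM : M ≤ M * M
  MM = ≤-trans (≤-reflexive (sym (*-identityˡ M))) (*-monoʳ M≥0 hM)
  absurd : t ≤ + 3 * k + 1ℤ + c
  absurd = *-cancel {D} D≥1 (lin 6 (λ d t k M q c → d ⊗ t ≤' κ 2 ⊗ d ⊗ k ⊕ (M ⊗ (κ 1 ⊕ t) ⊕ q ⊗ (t ⊕ c)) ⇒ κ 8 ⊗ q ⊗ t ≤' d ⊗ t ⇒ κ 8 ⊗ q ⊗ c ≤' d ⊗ c ⇒ κ 8 ⊗ q ≤' d ⇒ M ≤' q ⇒ M ⊗ t ≤' q ⊗ t ⇒ κ 0 ≤' d ⊗ k ⇒ κ 0 ≤' d ⊗ c ⇒ κ 0 ≤' d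
      ⇒ d ⊗ t ≤' d ⊗ (κ 3 ⊗ k ⊕ κ 1 ⊕ c)) tt
    D t k M (M * M) c divided (*-monoʳ t≥0 hD) (*-monoʳ hc hD) hD MM (*-monoʳ t≥0 MM) (*-nonneg D≥0 hk) (*-nonneg D≥0 hc) D≥0)
  big' : + 3 * k + 1ℤ + c ℤ.< t
  big' = suc[i]≤j⇒i<j (≤-trans (≤-reflexive (lin 2 (λ k c → κ 1 ⊕ (κ 3 ⊗ k ⊕ κ 1 ⊕ c) ≡' κ 3 ⊗ k ⊕ κ 2 ⊕ c) tt k c)) big)

module AtScale (M : ℕ) (hM : 1 ℕ.≤ M) (T : ℕ) (M≤X : M ℕ.≤ 2 ^ T) where
  open Triples M hM T M≤X public hiding (x; τ)

  mass : ℕ → ℕ → ℤ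
  mass c t = ∑ (2 ^ t) (λ n → F c n * Λ n)

  FΛ-nonneg : ∀ c n → 0ℤ ≤ F c n * Λ n
  FΛ-nonneg c n = *-nonneg (F-nonneg c n) (Λ-nonneg n)

  mass-nonneg : ∀ c t → 0ℤ ≤ mass c t
  mass-nonneg c t = ∑-nonneg (2 ^ t) λ n _ _ → FΛ-nonneg c n

  mass-mono : ∀ c {t t'} → t ℕ.≤ t' → mass c t ≤ mass c t'
  mass-mono c h = ∑-range (^-monoʳ-≤ 2 h) λ n _ _ → FΛ-nonneg c n

  F-~ : ∀ {c c'} → c ~ c' → ∀ n → F c n ≡ F c' n
  F-~ {c} {c'} e n = cong (_* w n) (𝟙-cong (1 ℕ.* n ~? c) (1 ℕ.* n ~? c') (λ k → ~-trans k e) (λ k → ~-trans k (~-sym e)))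

  mass-~ : ∀ {c c'} → c ~ c' → ∀ t → mass c t ≡ mass c' t
  mass-~ e t = ∑-ext (2 ^ t) λ n → cong (_* Λ n) (F-~ e n)

  2^t≤X : ∀ {t} → t ℕ.≤ T → 2 ^ t ℕ.≤ X
  2^t≤X = ^-monoʳ-≤ 2

  mass-upper : ∀ {c} → Coprime c M → ∀ t → t ℕ.≤ T → mass c t ≤ SV * (+ t + Cm)
  mass-upper {c} cc t ht = ≤-trans (∑-mono (2 ^ t) λ n _ _ → each n)
    (subst (λ l → m′ (2 ^ t) ≤ SV * (+ l + Cm)) (lg-2^ t) (m′-upper (2 ^ t) (2^≥1 t) (2^t≤X ht)))
    where
    each : ∀ n → F c n * Λ n ≤ 𝟙 (cop? n) * (Λ n * w n)
    each n = ≤-trans (≤-reflexive (trans (*-assoc (𝟙 (1 ℕ.* n ~? c)) (w n) (Λ n)) (cong (𝟙 (1 ℕ.* n ~? c) *_) (*-comm (w n) (Λ n)))))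
      (*-monoʳ (Λw-nonneg n) 𝟙≤)
      where
      𝟙≤ : 𝟙 (1 ℕ.* n ~? c) ≤ 𝟙 (cop? n)
      𝟙≤ with 𝟙-case (1 ℕ.* n ~? c)
      ... | inj₂ (_ , i) rewrite i = 𝟙-nonneg (cop? n)
      ... | inj₁ (e , i) rewrite i = ≤-reflexive (sym (𝟙-yes (cop? n) λ {k} → coprime-factorʳ 1 (λ {k} → ~-coprime (~-sym e) cc {k}) {k}))

  F-pos : ∀ {c n} → 1 ℕ.* n ~ c → F c n ≡ w n
  F-pos {c} {n} e = trans (cong (_* w n) (𝟙-yes (1 ℕ.* n ~? c) e)) (*-identityˡ (w n))

  one* : ∀ {n c} → 1 ℕ.* n ~ c → n ~ c
  one* {n} e = ~-trans (~-reflexive (sym (ℕP.*-identityˡ n))) e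

  *one : ∀ {n c} → n ~ c → 1 ℕ.* n ~ c
  *one {n} e = ~-trans (~-reflexive (ℕP.*-identityˡ n)) e

  triple-product : ∀ {c₁ c₂ c₃ g} → c₁ ℕ.* (c₂ ℕ.* c₃) ~ g → ∀ t → 3 ℕ.* t ℕ.≤ T →
    mass c₁ t * (mass c₂ t * mass c₃ t) ≤ V * V * Tri g (2 ^ (3 ℕ.* t))
  triple-product {c₁} {c₂} {c₃} {g} e t ht = ≤-trans (≤-reflexive
      (trans (cong (mass c₁ t *_) (∑-* y y _ _)) (trans (∑-* y y _ _) (∑-ext y λ d → ∑-ext y λ e → sym (∑-*ˡ y (F c₁ d * Λ d) _)))))
    (≤-trans (∑-mono y λ d hd hdy → ∑-mono y λ e he hey → ∑-mono y λ f hf hfy → pointwise d e f hd he hf (prod hdy hey hfy))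
      (≤-trans (≤-reflexive (trans (∑-ext y λ d → trans (∑-ext y λ e → ∑-*ˡ y (V * V) _) (∑-*ˡ y (V * V) _)) (∑-*ˡ y (V * V) _)))
        (*-monoˡ (*-nonneg V≥0 V≥0) enlarge)))
    where
    y x : ℕ
    y = 2 ^ t
    x = 2 ^ (3 ℕ.* t)
    x≡ : x ≡ y ℕ.* (y ℕ.* y)
    x≡ = trans (cong (2 ^_) (linℕ 1 (λ t → κ 3 ⊗ t ≡' t ⊕ (t ⊕ t)) tt t)) (trans (^-distribˡ-+-* 2 t (t ℕ.+ t)) (cong (y ℕ.*_) (^-distribˡ-+-* 2 t t)))
    prod : ∀ {d e f} → d ℕ.≤ y → e ℕ.≤ y → f ℕ.≤ y → d ℕ.* (e ℕ.* f) ℕ.≤ x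
    prod a b c = ℕP.≤-trans (*-mono-≤ a (*-mono-≤ b c)) (ℕP.≤-reflexive (sym x≡))
    term : ℕ → ℕ → ℕ → ℤ
    term d e f = F g (d ℕ.* (e ℕ.* f)) * (Λ d * (Λ e * Λ f))
    term≥0 : ∀ d e f → 0ℤ ≤ term d e f
    term≥0 d e f = *-nonneg (F-nonneg g (d ℕ.* (e ℕ.* f))) (*-nonneg (Λ-nonneg d) (*-nonneg (Λ-nonneg e) (Λ-nonneg f)))
    enlarge : ∑ y (λ d → ∑ y (λ e → ∑ y (term d e))) ≤ Tri g x
    enlarge = ≤-trans (∑-mono y λ d hd hdy → ≤-trans (∑-mono y λ e he hey → ∑-range
            (≤-÷ he (≤-÷ hd (prod hdy hey ℕP.≤-refl))) λ f _ _ → term≥0 d e f)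
          (∑-range (≤-÷ hd (ℕP.≤-trans (ℕP.≤-reflexive (cong (d ℕ.*_) (sym (ℕP.*-identityʳ y)))) (prod hdy ℕP.≤-refl (2^≥1 t)))) λ e _ _ → ∑-nonneg (x ÷ d ÷ e) λ f _ _ → term≥0 d e f))
        (∑-range (^-monoʳ-≤ 2 (m≤n*m t 3)) λ d _ _ → ∑-nonneg (x ÷ d) λ e _ _ → ∑-nonneg (x ÷ d ÷ e) λ f _ _ → term≥0 d e f)
    pointwise : ∀ d e f → 1 ℕ.≤ d → 1 ℕ.≤ e → 1 ℕ.≤ f → d ℕ.* (e ℕ.* f) ℕ.≤ x → F c₁ d * Λ d * (F c₂ e * Λ e * (F c₃ f * Λ f)) ≤ V * V * term d e f
    pointwise d e' f hd he hf h with 𝟙-case (1 ℕ.* d ~? c₁) | 𝟙-case (1 ℕ.* e' ~? c₂) | 𝟙-case (1 ℕ.* f ~? c₃)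
    ... | inj₂ (_ , i) | _ | _ rewrite i = ≤-trans (≤-reflexive (lin 3 (λ w l r → κ 0 ⊗ w ⊗ l ⊗ r ≡' κ 0) tt (w d) (Λ d) _)) (*-nonneg (*-nonneg V≥0 V≥0) (term≥0 d e' f))
    ... | inj₁ _ | inj₂ (_ , i) | _ rewrite i = ≤-trans (≤-reflexive (lin 4 (λ a w l r → a ⊗ (κ 0 ⊗ w ⊗ l ⊗ r) ≡' κ 0) tt _ (w e') (Λ e') _)) (*-nonneg (*-nonneg V≥0 V≥0) (term≥0 d e' f))
    ... | inj₁ _ | inj₁ _ | inj₂ (_ , i) rewrite i = ≤-trans (≤-reflexive (lin 4 (λ a b w l → a ⊗ (b ⊗ (κ 0 ⊗ w ⊗ l)) ≡' κ 0) tt _ _ (w f) (Λ f))) (*-nonneg (*-nonneg V≥0 V≥0) (term≥0 d e' f))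
    ... | inj₁ (p , i) | inj₁ (q , j) | inj₁ (r , k) rewrite i | j | k = ≤-reflexive (trans
          (lin 6 (λ a b c l m n → κ 1 ⊗ a ⊗ l ⊗ (κ 1 ⊗ b ⊗ m ⊗ (κ 1 ⊗ c ⊗ n)) ≡' a ⊗ (b ⊗ c) ⊗ (l ⊗ (m ⊗ n))) tt (w d) (w e') (w f) (Λ d) (Λ e') (Λ f))
          (trans (cong (_* (Λ d * (Λ e' * Λ f))) ww) (*-assoc (V * V) (F g (d ℕ.* (e' ℕ.* f))) _)))
      where
      x≤X′ : d ℕ.* (e' ℕ.* f) ℕ.≤ X
      x≤X′ = ℕP.≤-trans h (2^t≤X ht)
      ww : w d * (w e' * w f) ≡ V * V * F g (d ℕ.* (e' ℕ.* f))
      ww = trans (cong (w d *_) (sym (w-mul he hf (ℕP.≤-trans (m≤n*m (e' ℕ.* f) d {{nz hd}}) x≤X′))))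
        (trans (*-assoc₃ (w d) V _) (trans (cong (V *_) (sym (w-mul hd (*-mono-≤ he hf) x≤X′))) (trans (sym (*-assoc V V _))
          (cong (V * V *_) (sym (F-pos (*one (~-trans (~-* (one* p) (~-* (one* q) (one* r))) e))))))))

  L-upper-T : ∀ {n t} → 1 ℕ.≤ n → n ℕ.≤ 2 ^ t → L n ≤ S * (1ℤ + + t)
  L-upper-T hn h = ≤-trans (L-upper hn) (*-monoˡ {S} pos≥0 (+≤+ (s≤s (lg-pred-2^ h))))

  D²-upper : ∀ g t → D² g (2 ^ t) ≤ S * S * ((1ℤ + + t) * (1ℤ + + t)) * mass g t
  D²-upper g t = ≤-trans (∑-mono (2 ^ t) λ n hn hnx → ≤-trans (≤-reflexive (sym (*-assoc (F g n) (Λ n) (L n * L n))))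
      (≤-trans (*-monoˡ (FΛ-nonneg g n) (*-mono (L-nonneg n) (L-upper-T hn hnx) (L-nonneg n) (L-upper-T hn hnx)))
        (≤-reflexive (lin 3 (λ f s τ → f ⊗ (s ⊗ τ ⊗ (s ⊗ τ)) ≡' s ⊗ s ⊗ (τ ⊗ τ) ⊗ f) tt (F g n * Λ n) S (1ℤ + + t)))))
    (≤-reflexive (∑-*ˡ (2 ^ t) _ _))

  -- The default 0 does no harm: each use is accompanied by the coprimality of c or by the factor
  -- `𝟙 (cop? c)`.
  inv : ℕ → ℕ
  inv c with cop? c
  ... | yes cc = proj₁ (inverse cc)
  ... | no _ = 0

  inv-~ : ∀ {c} → Coprime c M → c ℕ.* inv c ~ 1
  inv-~ {c} cc with cop? c
  ... | yes cc' = proj₂ (inverse cc')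
  ... | no nc = contradiction (λ {k} → cc {k}) nc

  pair-upper : ∀ {g} → Coprime g M → ∀ t → t ℕ.≤ T →
    V * Wg 1 g (2 ^ t) ≤ SV * (1ℤ + + t) * mass g t + ∑ M (λ c → 𝟙 (cop? c) * (mass c t * mass (inv c ℕ.* g) t))
  pair-upper {g} cg t ht = ≤-trans (≤-reflexive (*-distribˡ-+ V _ _)) (+-mono-≤ first second)
    where
    x : ℕ
    x = 2 ^ t
    first : V * ∑ x (λ n → F g n * (Λ n * L n)) ≤ SV * (1ℤ + + t) * mass g t
    first = ≤-trans (*-monoˡ V≥0 (≤-trans (∑-mono x λ n hn hnx → ≤-trans (≤-reflexive (sym (*-assoc (F g n) (Λ n) (L n))))
        (*-monoˡ (FΛ-nonneg g n) (L-upper-T hn hnx))) (≤-reflexive (∑-*ʳ x (S * (1ℤ + + t)) _))))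
      (≤-reflexive (lin 4 (λ v m s τ → v ⊗ (m ⊗ (s ⊗ τ)) ≡' s ⊗ v ⊗ τ ⊗ m) tt V (mass g t) S (1ℤ + + t)))
    a b : ℕ → ℕ → ℤ
    a c d = F c d * Λ d
    b c e = F (inv c ℕ.* g) e * Λ e
    ab≥0 : ∀ c d e → 0ℤ ≤ 𝟙 (cop? c) * (a c d * b c e)
    ab≥0 c d e = *-nonneg (𝟙-nonneg (cop? c)) (*-nonneg (FΛ-nonneg c d) (FΛ-nonneg (inv c ℕ.* g) e))
    pointwise : ∀ d e → 1 ℕ.≤ d → 1 ℕ.≤ e → d ℕ.* e ℕ.≤ X → V * (F g (d ℕ.* e) * (Λ d * Λ e)) ≤ ∑ M (λ c → 𝟙 (cop? c) * (a c d * b c e))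
    pointwise d e hd he h with 𝟙-case (1 ℕ.* (d ℕ.* e) ~? g)
    ... | inj₂ (_ , i) rewrite i = ≤-trans (≤-reflexive (lin 3 (λ v w l → v ⊗ (κ 0 ⊗ w ⊗ l) ≡' κ 0) tt V (w (d ℕ.* e)) (Λ d * Λ e))) (∑-nonneg M λ c _ _ → ab≥0 c d e)
    ... | inj₁ (p , i) rewrite i with representative d
    ...   | c , c1 , cM , cd = ≤-trans (≤-reflexive (trans (lin 4 (λ v w l m → v ⊗ (κ 1 ⊗ w ⊗ (l ⊗ m)) ≡' v ⊗ w ⊗ (l ⊗ m)) tt V (w (d ℕ.* e)) (Λ d) (Λ e))
            (trans (cong (_* (Λ d * Λ e)) (w-mul hd he h)) (sym (trans (cong₂ (λ i q → i * q) (𝟙-yes (cop? c) λ {k} → cc {k}) (cong₂ (λ u z → u * Λ d * (z * Λ e)) (F-pos (*one (~-sym cd))) (F-pos (*one e~))))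
              (lin 4 (λ u z l m → κ 1 ⊗ (u ⊗ l ⊗ (z ⊗ m)) ≡' u ⊗ z ⊗ (l ⊗ m)) tt (w d) (w e) (Λ d) (Λ e)))))))
          (∑-term {M} {c} {λ c → 𝟙 (cop? c) * (a c d * b c e)} c1 cM λ c _ _ → ab≥0 c d e)
      where
      cc : Coprime c M
      cc {k} = ~-coprime (~-sym cd) (λ {k} → coprime-factorˡ e (λ {k} → ~-coprime (~-sym (one* p)) cg {k}) {k}) {k}
      e~ : e ~ inv c ℕ.* g
      e~ = ~-trans (~-sym (~-trans (~-* (~-trans (~-reflexive (ℕP.*-comm (inv c) c)) (inv-~ (λ {k} → cc {k}))) (~-refl {e})) (~-reflexive (ℕP.*-identityˡ e))))
        (~-trans (~-reflexive (ℕP.*-assoc (inv c) c e)) (~-* (~-refl {inv c}) (~-trans (~-* cd (~-refl {e})) (one* p))))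
    second : V * ∑ x (λ d → ∑ (x ÷ d) (λ e → F g (d ℕ.* e) * (Λ d * Λ e))) ≤ ∑ M (λ c → 𝟙 (cop? c) * (mass c t * mass (inv c ℕ.* g) t))
    second = ≤-trans (≤-reflexive (trans (sym (∑-*ˡ x V _)) (∑-ext x λ d → sym (∑-*ˡ (x ÷ d) V _))))
      (≤-trans (∑-mono x λ d hd hdx → ≤-trans (∑-mono (x ÷ d) λ e he hex → pointwise d e hd he (ℕP.≤-trans (÷-≤ hd hex) (2^t≤X ht)))
          (∑-range (÷-≤x x d) λ e _ _ → ∑-nonneg M λ c _ _ → ab≥0 c d e))
        (≤-reflexive (trans (∑-ext x λ d → ∑-swap x M _) (trans (∑-swap x M _) (∑-ext M λ c →
          trans (trans (∑-ext x λ d → ∑-*ˡ x (𝟙 (cop? c)) _) (∑-*ˡ x (𝟙 (cop? c)) _)) (cong (𝟙 (cop? c) *_) (sym (∑-* x x (a c) (b c)))))))))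

  -- Up to 2^t the sum of all Λ(n)/n is about t after scaling, so the class has a share of at least
  -- about 1 / D.
  Large : ℕ → ℕ → ℕ → Set
  Large D t c = Coprime c M × SV * + t ≤ + D * mass c t

  large? : ∀ D t c → Dec (Large D t c)
  large? D t c = cop? c ×-dec (SV * + t ℤP.≤? + D * mass c t)

  large-~ : ∀ {D t c c'} → c ~ c' → Large D t c → Large D t c'
  large-~ {D} {t} e (cc , h) = (λ {k} → ~-coprime e cc {k}) , subst (λ m → SV * + t ≤ + D * m) (mass-~ e t) h

  SV≥1 : 1ℤ ≤ SV
  SV≥1 = *-≥1 S≥1 V≥1

  large-closed : ∀ {D t c₁ c₂ c₃ g} → 1 ℕ.≤ D → 3 ℕ.* t ℕ.≤ T → 1 ℕ.≤ t → + 16 * K₃ * (+ D * (+ D * + D)) + 1ℤ ≤ + t →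
    Large D t c₁ → Large D t c₂ → Large D t c₃ → c₁ ℕ.* (c₂ ℕ.* c₃) ~ g → Large (48 ℕ.* (D ℕ.* (D ℕ.* D))) (3 ℕ.* t) g
  large-closed {D} {t} {c₁} {c₂} {c₃} {g} hD h3 ht big (n1 , l1) (n2 , l2) (n3 , l3) e = (λ {k} → cg {k}) , ok
    where
    cg : Coprime g M
    cg {k} = ~-coprime e (λ {k} → coprime-* n1 (λ {k} → coprime-* n2 n3 {k}) {k}) {k}
    K₃≥0 : 0ℤ ≤ K₃
    K₃≥0 = +-mono-≤ (+-mono-≤ (+-mono-≤ (+-mono-≤ (*-nonneg (pos≥0 {2}) Cm≥0) (*-nonneg (*-nonneg (pos≥0 {2}) K≥0) (+-mono-≤ pos≥0 Cm≥0))) (*-nonneg (pos≥0 {2}) K≥0)) pos≥0) K≥0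
    τ≤ : 1ℤ + + (3 ℕ.* t) ≤ + 4 * + t
    τ≤ = lin 2 (λ t3 t → t3 ≡' κ 3 ⊗ t ⇒ κ 1 ≤' t ⇒ κ 1 ⊕ t3 ≤' κ 4 ⊗ t) tt (+ (3 ℕ.* t)) (+ t) (pos-* 3 t) (+≤+ ht)
    ok : SV * + (3 ℕ.* t) ≤ + (48 ℕ.* (D ℕ.* (D ℕ.* D))) * mass g (3 ℕ.* t)
    ok = subst₂ (λ a b → SV * a ≤ b * mass g (3 ℕ.* t)) (sym (pos-* 3 t)) (sym (trans (pos-* 48 (D ℕ.* (D ℕ.* D))) (cong (+ 48 *_) (trans (pos-* D (D ℕ.* D)) (cong (+ D *_) (pos-* D D))))))
      (closed-arith SV (+ t) (+ D) φ K₃ (1ℤ + + (3 ℕ.* t)) (mass g (3 ℕ.* t)) (Tri g (2 ^ (3 ℕ.* t))) (D² g (2 ^ (3 ℕ.* t))) V S (mass c₁ t) (mass c₂ t) (mass c₃ t)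
        SV≥1 refl V≥0 φ≥1 (+≤+ ht) pos≥0 K₃≥0 (mass-nonneg g (3 ℕ.* t)) pos≥0 τ≤ big l1 l2 l3 (triple-product e t h3) (triple-bound (λ {k} → cg {k}) (3 ℕ.* t) h3) (D²-upper g (3 ℕ.* t)))

  -- Otherwise each product of two masses in `pair-upper` has a factor below t / D, and so has the
  -- term of g itself. For D ≥ 8 M² this makes Selberg's sum smaller than its value t² / φ.
  cover : ∀ {D t g} → Coprime g M → t ℕ.≤ T → 1 ℕ.≤ t → 8 ℕ.* (M ℕ.* M) ℕ.≤ D → + 3 * K + + 2 + Cm ≤ + t →
    Large D t g ⊎ ∃ λ c → Large D t c × Large D t (inv c ℕ.* g)
  cover {D} {t} {g} cg hT ht hD big with large? D t g | anyUpTo? (λ c → large? D t c ×-dec large? D t (inv c ℕ.* g)) (suc M)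
  ... | yes lg | _ = inj₁ lg
  ... | no _ | yes (c , _ , h) = inj₂ (c , h)
  ... | no ng | no nc = ⊥-elim (cover-arith SV (+ t) (+ D) φ K (+ M) Cm (V * Wg 1 g (2 ^ t)) SV≥1 (+≤+ ht) φ≥0 φ≤M K≥0 Cm≥0 (+≤+ hM) hD' big DW (W-lower cg t hT))
    where
    small : ∀ {c} → Coprime c M → ¬ Large D t c → + D * mass c t ≤ SV * + t
    small {c} cc nl with ≤-total (SV * + t) (+ D * mass c t)
    ... | inj₁ h = contradiction ((λ {k} → cc {k}) , h) nl
    ... | inj₂ h = h
    D≥0 : 0ℤ ≤ + D
    D≥0 = pos≥0
    ub : ℤ
    ub = SV * + t * (SV * (+ t + Cm))
    tC≥0 : 0ℤ ≤ + t + Cm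
    tC≥0 = +-mono-≤ (pos≥0 {t}) Cm≥0
    icop : ∀ {c} → Coprime c M → Coprime (inv c ℕ.* g) M
    icop {c} cc {k} = coprime-* (λ {k} → coprime-factorʳ c (λ {k} → ~-coprime (~-sym (inv-~ (λ {k} → cc {k}))) (Co.1-coprimeTo M) {k}) {k}) cg {k}
    product-≤ : ∀ d a b p q → 0ℤ ≤ d → 0ℤ ≤ a → 0ℤ ≤ b → d * a ≤ p → b ≤ q → d * (1ℤ * (a * b)) ≤ p * q
    product-≤ d a b p q hd ha hb h k = ≤-trans (≤-reflexive (lin 3 (λ d a b → d ⊗ (κ 1 ⊗ (a ⊗ b)) ≡' d ⊗ a ⊗ b) tt d a b)) (*-mono (*-nonneg hd ha) h hb k)
    each : ∀ c → 1 ℕ.≤ c → c ℕ.≤ M → + D * (𝟙 (cop? c) * (mass c t * mass (inv c ℕ.* g) t)) ≤ ub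
    each c _ hcM with 𝟙-case (cop? c)
    ... | inj₂ (_ , i) rewrite i = ≤-trans (≤-reflexive (trans (cong (+ D *_) (*-zeroˡ (mass c t * mass (inv c ℕ.* g) t))) (*-zeroʳ (+ D)))) (*-nonneg (*-nonneg SV≥0 (pos≥0 {t})) (*-nonneg SV≥0 tC≥0))
    ... | inj₁ (cc , i) rewrite i with large? D t c | large? D t (inv c ℕ.* g)
    ...   | yes p | yes q = contradiction (c , s≤s hcM , p , q) nc
    ...   | no p | _ = product-≤ (+ D) (mass c t) (mass (inv c ℕ.* g) t) (SV * + t) (SV * (+ t + Cm)) D≥0 (mass-nonneg c t) (mass-nonneg (inv c ℕ.* g) t)
              (small (λ {k} → cc {k}) p) (mass-upper (λ {k} → icop (λ {k} → cc {k}) {k}) t hT)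
    ...   | yes _ | no q = subst (λ z → + D * (1ℤ * z) ≤ ub) (*-comm (mass (inv c ℕ.* g) t) (mass c t)) (product-≤ (+ D) (mass (inv c ℕ.* g) t) (mass c t) (SV * + t) (SV * (+ t + Cm)) D≥0 (mass-nonneg (inv c ℕ.* g) t) (mass-nonneg c t)
              (small (λ {k} → icop (λ {k} → cc {k}) {k}) q) (mass-upper (λ {k} → cc {k}) t hT))
    DW : + D * (V * Wg 1 g (2 ^ t)) ≤ SV * (1ℤ + + t) * (SV * + t) + + M * ub
    DW = ≤-trans (*-monoˡ D≥0 (pair-upper cg t hT)) (≤-trans (≤-reflexive (trans (*-distribˡ-+ (+ D) _ _) (cong₂ _+_ (*-assoc₃ (+ D) (SV * (1ℤ + + t)) (mass g t)) (sym (∑-*ˡ M (+ D) _)))))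
      (+-mono-≤ (*-monoˡ (*-nonneg SV≥0 (pos≥0 {suc t})) (small cg ng)) (≤-trans (∑-mono M each) (≤-reflexive (∑-const M ub)))))
    hD' : + 8 * (+ M * + M) ≤ + D
    hD' = subst (_≤ + D) (trans (pos-* 8 (M ℕ.* M)) (cong (+ 8 *_) (pos-* M M))) (+≤+ hD)

-- The character sum is twice the mass of the classes that are not large minus the whole mass, hence
-- at most (2 M / D) t - (t - C) ≤ C - t / 2. The lower bound -Cr contradicts this for large t.
final-arith : ∀ (u t D M C Cr m R : ℤ) → 1ℤ ≤ u → 0ℤ ≤ t → + 4 * M ≤ D → 1ℤ ≤ D → u * (t - C) ≤ m → D * R ≤ + 2 * M * (u * t) - D * m → - (Cr * u) ≤ R → + 2 * (C + Cr) + 1ℤ ≤ t → ⊥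
final-arith u t D M C Cr m R hu ht hM hD hm hR hCr big = <⇒≱ lt (*-cancel {u * D} (*-≥1 hu hD) (lin 8 (λ u t D M C c m R → κ 4 ⊗ M ⊗ (u ⊗ t) ≤' D ⊗ (u ⊗ t) ⇒ D ⊗ (u ⊗ (t ⊖ C)) ≤' D ⊗ m ⇒ D ⊗ R ≤' κ 2 ⊗ M ⊗ (u ⊗ t) ⊖ D ⊗ m ⇒ D ⊗ (κ 0 ⊖ c ⊗ u) ≤' D ⊗ R ⇒ u ⊗ D ⊗ t ≤' u ⊗ D ⊗ (κ 2 ⊗ (C ⊕ c))) tt
    u t D M C Cr m R (*-monoʳ (*-nonneg (≤-trans pos≥0 hu) ht) hM) (*-monoˡ D≥0 hm) hR (*-monoˡ D≥0 (neg-≤⁻¹ hCr))))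
  where
  D≥0 : 0ℤ ≤ D
  D≥0 = ≤-trans pos≥0 hD
  lt : + 2 * (C + Cr) ℤ.< t
  lt = suc[i]≤j⇒i<j (≤-trans (≤-reflexive (+-comm 1ℤ (+ 2 * (C + Cr)))) big)

-- The real character of a set closed under triple products

module FromClosed (M : ℕ) (hM : 1 ℕ.≤ M) (T : ℕ) (M≤X : M ℕ.≤ 2 ^ T) (D t : ℕ)
  (hD : 8 ℕ.* (M ℕ.* M) ℕ.≤ D) (ht : 1 ℕ.≤ t) (htT : t ℕ.≤ T) where
  open AtScale M hM T M≤X

  Sel₃ : ℕ → Set
  Sel₃ = Large D t

  module _ (closed : ∀ {a b c g} → Sel₃ a → Sel₃ b → Sel₃ c → a ℕ.* (b ℕ.* c) ~ g → Sel₃ g)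
    (covers : ∀ {g} → Coprime g M → Sel₃ g ⊎ ∃ λ a → Sel₃ a × Sel₃ (inv a ℕ.* g))
    {b₀ : ℕ} (cb : Coprime b₀ M) (nb : ¬ Sel₃ b₀) where

    pair-~ : ∀ {a g} → Sel₃ a → a ℕ.* (inv a ℕ.* g) ~ g
    pair-~ {a} {g} (ca , _) = ~-trans (~-reflexive (sym (ℕP.*-assoc a (inv a) g))) (~-trans (~-* (inv-~ (λ {k} → ca {k})) (~-refl {g})) (~-reflexive (ℕP.*-identityˡ g)))

    N : ℕ → Set
    N c = Coprime c M × ¬ Sel₃ c

    factors-N : ∀ {c} → N c → ∃ λ a → ∃ λ b → Sel₃ a × Sel₃ b × a ℕ.* b ~ c
    factors-N (cc , nc) with covers (λ {k} → cc {k})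
    ... | inj₁ s = contradiction s nc
    ... | inj₂ (a , sa , sb) = a , _ , sa , sb , pair-~ sa

    -- With 1 large, triple products a b 1 would make all pair products large, in particular b₀,
    -- which is covered by a pair.
    ¬S1 : ¬ Sel₃ 1
    ¬S1 s1 with factors-N ((λ {k} → cb {k}) , nb)
    ... | a , b , sa , sb , e = nb (closed sa sb s1 (~-trans (~-reflexive (cong (a ℕ.*_) (ℕP.*-identityʳ b))) e))

    -- If a b = c with all three large, then 1 is a large triple product: it is a b c⁻¹ when c⁻¹ is
    -- large, and otherwise c times the two large factors of c⁻¹.
    disjoint : ∀ {a b c} → Sel₃ a → Sel₃ b → Sel₃ c → a ℕ.* b ~ c → ⊥
    disjoint {a} {b} {c} sa sb sc e with covers {inv c} (λ {k} → cv {k})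
      where
      cv : Coprime (inv c) M
      cv {k} = coprime-factorʳ c (λ {k} → ~-coprime (~-sym (inv-~ (proj₁ sc))) (Co.1-coprimeTo M) {k}) {k}
    ... | inj₁ sv = ¬S1 (closed sa sb sv (~-trans (~-reflexive (sym (ℕP.*-assoc a b (inv c)))) (~-trans (~-* e (~-refl {inv c})) (inv-~ (proj₁ sc)))))
    ... | inj₂ (v₁ , s₁ , s₂) = ¬S1 (closed sc s₁ s₂ (~-trans (~-* (~-refl {c}) (pair-~ s₁)) (inv-~ (proj₁ sc))))

    SS : ∀ {a b} → Sel₃ a → Sel₃ b → N (a ℕ.* b)
    SS sa sb = (λ {k} → coprime-* (proj₁ sa) (proj₁ sb) {k}) , λ s → disjoint sa sb s ~-refl

    SN : ∀ {a b} → Sel₃ a → N b → Sel₃ (a ℕ.* b)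
    SN {a} sa nb' with factors-N nb'
    ... | c , d , sc , sd , e = closed sa sc sd (~-* (~-refl {a}) e)

    NN : ∀ {a b} → N a → N b → N (a ℕ.* b)
    NN {a} {b} na@(ca , _) nb'@(cb' , _) = (λ {k} → coprime-* ca cb' {k}) , λ s → bad s
      where
      bad : ¬ Sel₃ (a ℕ.* b)
      bad s with factors-N na
      ... | c , d , sc , sd , e = disjoint sc (SN sd nb') s (~-trans (~-reflexive (sym (ℕP.*-assoc c d b))) (~-* e (~-refl {b})))

    -- -1 on the large classes, 1 on the other reduced ones, 0 elsewhere. By `SS`, `SN` and `NN` the
    -- large classes form the nontrivial coset of a subgroup of index 2.
    χ : ℕ → ℤ
    χ n = 𝟙 (cop? n) - + 2 * 𝟙 (large? D t n)

    χ-S : ∀ {n} → Sel₃ n → χ n ≡ - 1ℤ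
    χ-S {n} s = trans (cong₂ (λ a b → a - + 2 * b) (𝟙-yes (cop? n) (proj₁ s)) (𝟙-yes (large? D t n) s)) (cong (λ z → 1ℤ - z) (*-identityʳ (+ 2)))

    χ-N : ∀ {n} → N n → χ n ≡ 1ℤ
    χ-N {n} (c , ns) = trans (cong₂ (λ a b → a - + 2 * b) (𝟙-yes (cop? n) c) (𝟙-no (large? D t n) ns)) (cong (λ z → 1ℤ - z) (*-zeroʳ (+ 2)))

    χ-0 : ∀ {n} → ¬ Coprime n M → χ n ≡ 0ℤ
    χ-0 {n} nc = trans (cong₂ (λ a b → a - + 2 * b) (𝟙-no (cop? n) nc) (𝟙-no (large? D t n) λ s → nc (proj₁ s))) (cong (λ z → 0ℤ - z) (*-zeroʳ (+ 2)))

    data Kind (n : ℕ) : Set where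
      isS : Sel₃ n → Kind n
      isN : N n → Kind n
      is0 : ¬ Coprime n M → Kind n

    kind : ∀ n → Kind n
    kind n with cop? n | large? D t n
    ... | no nc | _ = is0 nc
    ... | yes _ | yes s = isS s
    ... | yes c | no ns = isN ((λ {k} → c {k}) , ns)

    χ-sign : ∀ n → Sign3 (χ n)
    χ-sign n with kind n
    ... | isS s = minus (χ-S s)
    ... | isN s = plus (χ-N s)
    ... | is0 s = null (χ-0 s)

    χ-* : ∀ a b → χ (a ℕ.* b) ≡ χ a * χ b
    χ-* a b with kind a | kind b
    ... | is0 na | _ = trans (χ-0 {a ℕ.* b} λ c → na λ {k} → coprime-factorˡ b c {k}) (sym (trans (cong (_* χ b) (χ-0 na)) (*-zeroˡ (χ b))))
    ... | isS sa | is0 nb' = trans (χ-0 {a ℕ.* b} λ c → nb' λ {k} → coprime-factorʳ a c {k}) (sym (trans (cong (χ a *_) (χ-0 nb')) (*-zeroʳ (χ a))))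
    ... | isN na | is0 nb' = trans (χ-0 {a ℕ.* b} λ c → nb' λ {k} → coprime-factorʳ a c {k}) (sym (trans (cong (χ a *_) (χ-0 nb')) (*-zeroʳ (χ a))))
    ... | isS sa | isS sb = trans (χ-N (SS sa sb)) (sym (trans (cong₂ _*_ (χ-S sa) (χ-S sb)) (*-def (- 1ℤ) (- 1ℤ))))
    ... | isS sa | isN nb' = trans (χ-S (SN sa nb')) (sym (trans (cong₂ _*_ (χ-S sa) (χ-N nb')) (*-identityʳ (- 1ℤ))))
    ... | isN na | isS sb = trans (χ-S (subst Sel₃ (ℕP.*-comm b a) (SN sb na))) (sym (trans (cong₂ _*_ (χ-N na) (χ-S sb)) (*-identityˡ (- 1ℤ))))
    ... | isN na | isN nb' = trans (χ-N (NN na nb')) (sym (trans (cong₂ _*_ (χ-N na) (χ-N nb')) (*-identityʳ 1ℤ)))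

    χ-~ : ∀ {a b} → a ~ b → χ a ≡ χ b
    χ-~ {a} {b} e = cong₂ (λ x y → x - + 2 * y)
      (𝟙-cong (cop? a) (cop? b) (λ c {k} → ~-coprime e c {k}) (λ c {k} → ~-coprime (~-sym e) c {k}))
      (𝟙-cong (large? D t a) (large? D t b) (large-~ e) (large-~ (~-sym e)))

    ∑-permute : ∀ {s} → Coprime s M → ∑ M (λ n → χ (s ℕ.* n)) ≡ ∑ M χ
    ∑-permute {s} cs = trans (∑-ext M λ n → sym (pick (s ℕ.* n))) (trans (∑-swap M M _) (∑-ext M λ c → trans (∑-*ʳ M (χ c) _) (trans (cong (_* χ c) (∑-class cs c)) (*-identityˡ (χ c)))))
      where
      pick : ∀ x → ∑ M (λ c → 𝟙 (x ~? c) * χ c) ≡ χ x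
      pick x = trans (∑-ext M λ c → 𝟙-* (x ~? c) λ e → χ-~ (~-sym e)) (trans (∑-*ʳ M (χ x) _) (trans (cong (_* χ x) (∑-class₁ x)) (*-identityˡ (χ x))))

    -- Multiplication by a large class permutes the residues and reverses the sign of χ.
    χ-sum : ∑ M χ ≡ 0ℤ
    χ-sum with factors-N ((λ {k} → cb {k}) , nb)
    ... | s , _ , ss , _ , _ = lin 2 (λ a b → a ≡' b ⇒ b ≡' κ 0 ⊖ a ⇒ a ≡' κ 0) tt (∑ M χ) (∑ M (λ n → χ (s ℕ.* n))) (sym (∑-permute (λ {k} → proj₁ ss {k})))
      (trans (∑-ext M λ n → trans (χ-* s n) (trans (cong (_* χ n) (χ-S ss)) refl)) (trans (∑-*ˡ M (- 1ℤ) χ) (trans (-1*i≡-i (∑ M χ)) (sym (+-identityˡ _)))))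

    module RC = RealCharacter M hM χ χ-* χ-sign (χ-N ((λ {k} → Co.1-coprimeTo M {k}) , ¬S1)) (λ n → χ-~ (~-period n)) χ-sum

    N? : ∀ c → Dec (N c)
    N? c = cop? c ×-dec ¬? (large? D t c)

    D≥0 : 0ℤ ≤ + D
    D≥0 = pos≥0

    N-mass : ∑ (2 ^ t) (λ n → 𝟙 (N? n) * (Λ n * w n)) ≤ ∑ M (λ c → 𝟙 (N? c) * mass c t)
    N-mass = ≤-trans (∑-mono (2 ^ t) λ n _ _ → pointwise n) (≤-reflexive (trans (∑-swap (2 ^ t) M _) (∑-ext M λ c → ∑-*ˡ (2 ^ t) (𝟙 (N? c)) _)))
      where
      nn : ∀ n c → 0ℤ ≤ 𝟙 (N? c) * (F c n * Λ n)
      nn n c = *-nonneg (𝟙-nonneg (N? c)) (FΛ-nonneg c n)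
      pointwise : ∀ n → 𝟙 (N? n) * (Λ n * w n) ≤ ∑ M (λ c → 𝟙 (N? c) * (F c n * Λ n))
      pointwise n with 𝟙-case (N? n)
      ... | inj₂ (_ , i) rewrite i = ≤-trans (≤-reflexive (*-zeroˡ (Λ n * w n))) (∑-nonneg M λ c _ _ → nn n c)
      ... | inj₁ ((cn , ns) , i) rewrite i with representative n
      ...   | c , c1 , cM , e = ≤-trans (≤-reflexive (trans (cong (1ℤ *_) (trans (*-comm (Λ n) (w n)) (cong (_* Λ n) (sym (F-pos (*one (~-sym e)))))))
              (cong (_* (F c n * Λ n)) (sym (𝟙-yes (N? c) ((λ {k} → ~-coprime (~-sym e) cn {k}) , λ s → ns (large-~ e s)))))))
            (∑-term {M} {c} {λ c → 𝟙 (N? c) * (F c n * Λ n)} c1 cM λ c _ _ → nn n c)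

    N-bound : + D * ∑ M (λ c → 𝟙 (N? c) * mass c t) ≤ + M * (SV * + t)
    N-bound = ≤-trans (≤-reflexive (sym (∑-*ˡ M (+ D) _))) (≤-trans (∑-mono M λ c _ _ → each c) (≤-reflexive (∑-const M (SV * + t))))
      where
      each : ∀ c → + D * (𝟙 (N? c) * mass c t) ≤ SV * + t
      each c with 𝟙-case (N? c)
      ... | inj₂ (_ , i) rewrite i = ≤-trans (≤-reflexive (trans (cong (+ D *_) (*-zeroˡ (mass c t))) (*-zeroʳ (+ D)))) (*-nonneg SV≥0 (pos≥0 {t}))
      ... | inj₁ ((cc , ns) , i) rewrite i with ≤-total (SV * + t) (+ D * mass c t)
      ...   | inj₁ h = contradiction ((λ {k} → cc {k}) , h) ns
      ...   | inj₂ h = ≤-trans (≤-reflexive (cong (+ D *_) (*-identityˡ (mass c t)))) h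

    R-upper : + D * ∑ (2 ^ t) (λ n → χ n * (Λ n * w n)) ≤ + 2 * + M * (SV * + t) - + D * m′ (2 ^ t)
    R-upper = ≤-trans (≤-reflexive (cong (+ D *_) (trans (∑-ext (2 ^ t) each) (trans (∑-- (2 ^ t) _ _) (cong (_- m′ (2 ^ t)) (∑-*ˡ (2 ^ t) (+ 2) _))))))
      (lin 6 (λ d A B m M q → d ⊗ A ≤' d ⊗ B ⇒ d ⊗ B ≤' M ⊗ q ⇒ d ⊗ (κ 2 ⊗ A ⊖ m) ≤' κ 2 ⊗ M ⊗ q ⊖ d ⊗ m) tt (+ D) (∑ (2 ^ t) (λ n → 𝟙 (N? n) * (Λ n * w n))) (∑ M (λ c → 𝟙 (N? c) * mass c t)) (m′ (2 ^ t)) (+ M) (SV * + t) (*-monoˡ D≥0 N-mass) N-bound)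
      where
      each : ∀ n → χ n * (Λ n * w n) ≡ + 2 * (𝟙 (N? n) * (Λ n * w n)) - 𝟙 (cop? n) * (Λ n * w n)
      each n with kind n
      ... | isS s = trans (cong (_* (Λ n * w n)) (χ-S s)) (trans (lin 2 (λ l c → c ≡' κ 0 ⊖ κ 1 ⇒ c ⊗ l ≡' c ⊗ l) tt (Λ n * w n) (- 1ℤ) refl) (sym (trans (cong₂ (λ a b → + 2 * (a * (Λ n * w n)) - b * (Λ n * w n)) (𝟙-no (N? n) λ k → proj₂ k s) (𝟙-yes (cop? n) (proj₁ s)))
            (trans (lin 1 (λ l → κ 2 ⊗ (κ 0 ⊗ l) ⊖ κ 1 ⊗ l ≡' κ 0 ⊖ l) tt (Λ n * w n)) (trans (+-identityˡ _) (sym (-1*i≡-i (Λ n * w n))))))))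
      ... | isN s = trans (cong (_* (Λ n * w n)) (χ-N s)) (sym (trans (cong₂ (λ a b → + 2 * (a * (Λ n * w n)) - b * (Λ n * w n)) (𝟙-yes (N? n) s) (𝟙-yes (cop? n) (proj₁ s)))
            (lin 1 (λ l → κ 2 ⊗ (κ 1 ⊗ l) ⊖ κ 1 ⊗ l ≡' κ 1 ⊗ l) tt (Λ n * w n))))
      ... | is0 s = trans (cong (_* (Λ n * w n)) (χ-0 s)) (sym (trans (cong₂ (λ a b → + 2 * (a * (Λ n * w n)) - b * (Λ n * w n)) (𝟙-no (N? n) λ k → s (proj₁ k)) (𝟙-no (cop? n) s))
            (lin 1 (λ l → κ 2 ⊗ (κ 0 ⊗ l) ⊖ κ 0 ⊗ l ≡' κ 0 ⊗ l) tt (Λ n * w n))))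

    MM≥ : 4 ℕ.* M ℕ.≤ D
    MM≥ = ℕP.≤-trans (*-mono-≤ {4} {8} (s≤s (s≤s (s≤s (s≤s z≤n)))) (m≤m*n M M {{nz hM}})) hD

    -- The bounds for t are written out in terms of M, because t has to be chosen before χ, and with
    -- it the opaque constants of `RC`, exists.
    absurd : 8 ℕ.* M ℕ.* (6 ℕ.* (2 ℕ.+ M ℕ.+ 8 ℕ.* M ℕ.* (8 ℕ.* M))) ℕ.≤ 2 ^ t →
      + 2 * (Cm + + 4 * + (6 ℕ.* (2 ℕ.+ M ℕ.+ 8 ℕ.* M ℕ.* (8 ℕ.* M))) * (+ 12 * + M + 1ℤ + + 28 * + M)) + 1ℤ ≤ + t → ⊥
    absurd hy big = final-arith SV (+ t) (+ D) (+ M) Cm (+ 4 * + z * (+ 12 * + M + 1ℤ + + 28 * + M)) (m′ (2 ^ t)) (∑ (2 ^ t) (λ n → χ n * (Λ n * w n)))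
        SV≥1 pos≥0 (subst (_≤ + D) (pos-* 4 M) (+≤+ MM≥)) (+≤+ (ℕP.≤-trans (ℕP.≤-trans hM (m≤n*m M 4)) MM≥))
        (subst (λ l → SV * (+ l - Cm) ≤ m′ (2 ^ t)) (lg-2^ t) (m′-lower (2 ^ t) (2^≥1 t) (2^t≤X htT)))
        R-upper (subst (λ k → - (+ 4 * + k * (+ 12 * + M + 1ℤ + + 28 * + M) * SV) ≤ ∑ (2 ^ t) (λ n → χ n * (Λ n * w n))) z₀≡ (RC.char-mertens T (ℕP.≤-trans y₀≤ (2^t≤X htT)) (2 ^ t) y₀≤ (2^t≤X htT))) big
      where
      z : ℕ
      z = 6 ℕ.* (2 ℕ.+ M ℕ.+ 8 ℕ.* M ℕ.* (8 ℕ.* M))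
      z₀≡ : RC.z₀ ≡ z
      z₀≡ = trans RC.z₀-def (cong (λ k → 6 ℕ.* (2 ℕ.+ M ℕ.+ k ℕ.* k)) RC.A-def)
      y₀≤ : RC.y₀ ℕ.≤ 2 ^ t
      y₀≤ = subst (ℕ._≤ 2 ^ t) (sym (trans RC.y₀-def (cong₂ ℕ._*_ RC.A-def z₀≡))) hy

-- Primes in residue classes

∣∣-upper : ∀ a → a ≤ + ℤ.∣ a ∣
∣∣-upper (+ n) = ≤-refl
∣∣-upper (ℤ.-[1+ n ]) = ℤ.-≤+

sumUpTo : (ℕ → ℕ) → ℕ → ℕ
sumUpTo f zero = f 0
sumUpTo f (suc n) = sumUpTo f n ℕ.+ f (suc n)

≤-sumUpTo : ∀ f {n i} → i ℕ.≤ n → f i ℕ.≤ sumUpTo f n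
≤-sumUpTo f {zero} z≤n = ℕP.≤-refl
≤-sumUpTo f {suc n} {i} h with i ℕ.≟ suc n
... | yes refl = m≤n+m (f (suc n)) (sumUpTo f n)
... | no ne = ℕP.≤-trans (≤-sumUpTo f (≤-pred (ℕP.≤∧≢⇒< h ne))) (m≤m+n (sumUpTo f n) (f (suc n)))

stabilises : ∀ (f : ℕ → ℤ) k → 0ℤ ≤ f 0 → (∃ λ i → i < k × f (suc i) ≤ f i) ⊎ + k ≤ f k
stabilises f zero h = inj₂ h
stabilises f (suc k) h with stabilises f k h
... | inj₁ (i , a , b) = inj₁ (i , m≤n⇒m≤1+n a , b)
... | inj₂ hk with ≤-total (f (suc k)) (f k)
...   | inj₁ le = inj₁ (k , ℕP.≤-refl , le)
...   | inj₂ ge with f (suc k) ℤP.≟ f k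
...     | yes e = inj₁ (k , ℕP.≤-refl , ≤-reflexive e)
...     | no ne = inj₂ (≤-trans (+-monoʳ-≤ 1ℤ hk) (i<j⇒suc[i]≤j (≤∧≢⇒< ge (ne ∘ sym))))

-- A triple product of classes that are large at one scale is large at the next one, and the
-- number of large classes cannot grow M + 1 times.
thresholds : ℕ → ℕ → ℕ
thresholds M zero = 8 ℕ.* (M ℕ.* M)
thresholds M (suc i) = 48 ℕ.* (thresholds M i ℕ.* (thresholds M i ℕ.* thresholds M i))

scales : ℕ → ℕ → ℕ
scales t zero = t
scales t (suc i) = 3 ℕ.* scales t i

scales-mono : ∀ t {i j} → i ℕ.≤ j → scales t i ℕ.≤ scales t j
scales-mono t {i} {j} h with m≤n⇒∃[o]m+o≡n h
... | o , refl = go o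
  where
  go : ∀ o → scales t i ℕ.≤ scales t (i ℕ.+ o)
  go zero = ℕP.≤-reflexive (cong (scales t) (sym (ℕP.+-identityʳ i)))
  go (suc o) = ℕP.≤-trans (go o) (subst (λ k → scales t (i ℕ.+ o) ℕ.≤ scales t k) (sym (+-suc i o)) (m≤n*m (scales t (i ℕ.+ o)) 3))

module _ (M : ℕ) (hM : 1 ℕ.≤ M) where

  -- The primes congruent to b have relative logarithmic density zero.
  Sparse : ℕ → Set
  Sparse b = ∀ D → ∃ λ N → ∀ T (M≤X : M ℕ.≤ 2 ^ T) t → N ℕ.≤ t → suc t ℕ.≤ T →
    + D * AtScale.mass M hM T M≤X b t ℤ.< AtScale.SV M hM T M≤X * + t

  no-sparse-class : ∀ {b} → Coprime b M → ¬ Sparse b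
  no-sparse-class {b} cb sp = conclude (stabilises count (suc M) (count≥0 0))
    where
    D : ℕ → ℕ
    D = thresholds M
    -- `K`, `K₃` and `Cm` depend on M alone but live in modules with a parameter T. The value T = M,
    -- for which M ≤ 2^M, allows them to be named before T is fixed.
    module C₀ = AtScale M hM M (<⇒≤ (n<2^n M))
    N : ℕ → ℕ
    N i = proj₁ (sp (D i))
    z y c₅ : ℕ
    z = 6 ℕ.* (2 ℕ.+ M ℕ.+ 8 ℕ.* M ℕ.* (8 ℕ.* M))
    y = 8 ℕ.* M ℕ.* z
    e₁ : ℕ → ℤ
    e₁ i = + 16 * C₀.K₃ * (+ D i * (+ D i * + D i)) + 1ℤ
    e₂ e₃ : ℤ
    e₂ = + 3 * C₀.K + + 2 + C₀.Cm
    e₃ = + 2 * (C₀.Cm + + 4 * + z * (+ 12 * + M + 1ℤ + + 28 * + M)) + 1ℤ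
    c₅ = suc (sumUpTo N M ℕ.+ sumUpTo (λ i → ℤ.∣ e₁ i ∣) M ℕ.+ ℤ.∣ e₂ ∣ ℕ.+ ℤ.∣ e₃ ∣ ℕ.+ y ℕ.+ M)
    -- A sum of all lower bounds exceeds each of them; opacity keeps it from being unfolded.
    opaque
      t₀ : ℕ
      t₀ = c₅
      t₀-def : t₀ ≡ suc (sumUpTo N M ℕ.+ sumUpTo (λ i → ℤ.∣ e₁ i ∣) M ℕ.+ ℤ.∣ e₂ ∣ ℕ.+ ℤ.∣ e₃ ∣ ℕ.+ y ℕ.+ M)
      t₀-def = refl
    part : ∀ {k} → k ℕ.≤ suc (sumUpTo N M ℕ.+ sumUpTo (λ i → ℤ.∣ e₁ i ∣) M ℕ.+ ℤ.∣ e₂ ∣ ℕ.+ ℤ.∣ e₃ ∣ ℕ.+ y ℕ.+ M) → k ℕ.≤ t₀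
    part {k} = subst (k ℕ.≤_) (sym t₀-def)
    pick : ∀ a b c d e f → (a ℕ.≤ suc (a ℕ.+ b ℕ.+ c ℕ.+ d ℕ.+ e ℕ.+ f)) × (b ℕ.≤ suc (a ℕ.+ b ℕ.+ c ℕ.+ d ℕ.+ e ℕ.+ f)) × (c ℕ.≤ suc (a ℕ.+ b ℕ.+ c ℕ.+ d ℕ.+ e ℕ.+ f)) × (d ℕ.≤ suc (a ℕ.+ b ℕ.+ c ℕ.+ d ℕ.+ e ℕ.+ f)) × (e ℕ.≤ suc (a ℕ.+ b ℕ.+ c ℕ.+ d ℕ.+ e ℕ.+ f)) × (f ℕ.≤ suc (a ℕ.+ b ℕ.+ c ℕ.+ d ℕ.+ e ℕ.+ f)) × (1 ℕ.≤ suc (a ℕ.+ b ℕ.+ c ℕ.+ d ℕ.+ e ℕ.+ f))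
    pick a b c d e f = linℕ 6 (λ a b c d e f → a ≤' κ 1 ⊕ (a ⊕ b ⊕ c ⊕ d ⊕ e ⊕ f)) tt a b c d e f , linℕ 6 (λ a b c d e f → b ≤' κ 1 ⊕ (a ⊕ b ⊕ c ⊕ d ⊕ e ⊕ f)) tt a b c d e f
      , linℕ 6 (λ a b c d e f → c ≤' κ 1 ⊕ (a ⊕ b ⊕ c ⊕ d ⊕ e ⊕ f)) tt a b c d e f , linℕ 6 (λ a b c d e f → d ≤' κ 1 ⊕ (a ⊕ b ⊕ c ⊕ d ⊕ e ⊕ f)) tt a b c d e f
      , linℕ 6 (λ a b c d e f → e ≤' κ 1 ⊕ (a ⊕ b ⊕ c ⊕ d ⊕ e ⊕ f)) tt a b c d e f , linℕ 6 (λ a b c d e f → f ≤' κ 1 ⊕ (a ⊕ b ⊕ c ⊕ d ⊕ e ⊕ f)) tt a b c d e f , s≤s z≤n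
    parts = pick (sumUpTo N M) (sumUpTo (λ i → ℤ.∣ e₁ i ∣) M) ℤ.∣ e₂ ∣ ℤ.∣ e₃ ∣ y M
    t₀-N : sumUpTo N M ℕ.≤ t₀
    t₀-N = part (proj₁ parts)
    t₀-e₁ : sumUpTo (λ i → ℤ.∣ e₁ i ∣) M ℕ.≤ t₀
    t₀-e₁ = part (proj₁ (proj₂ parts))
    t₀-e₂ : ℤ.∣ e₂ ∣ ℕ.≤ t₀
    t₀-e₂ = part (proj₁ (proj₂ (proj₂ parts)))
    t₀-e₃ : ℤ.∣ e₃ ∣ ℕ.≤ t₀
    t₀-e₃ = part (proj₁ (proj₂ (proj₂ (proj₂ parts))))
    t₀-y : y ℕ.≤ t₀
    t₀-y = part (proj₁ (proj₂ (proj₂ (proj₂ (proj₂ parts)))))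
    t₀-M : M ℕ.≤ t₀
    t₀-M = part (proj₁ (proj₂ (proj₂ (proj₂ (proj₂ (proj₂ parts))))))
    t₀-1 : 1 ℕ.≤ t₀
    t₀-1 = part (proj₂ (proj₂ (proj₂ (proj₂ (proj₂ (proj₂ parts))))))
    t : ℕ → ℕ
    t = scales t₀
    T₁ : ℕ
    T₁ = suc (t (suc M))
    t₀≤t : ∀ i → t₀ ℕ.≤ t i
    t₀≤t i = scales-mono t₀ (z≤n {i})
    t<T : ∀ {i} → i ℕ.≤ suc M → suc (t i) ℕ.≤ T₁
    t<T h = s≤s (scales-mono t₀ h)
    M≤X : M ℕ.≤ 2 ^ T₁
    M≤X = ℕP.≤-trans (ℕP.≤-trans t₀-M (ℕP.≤-trans (t₀≤t (suc M)) (n≤1+n (t (suc M))))) (<⇒≤ (n<2^n T₁))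
    open AtScale M hM T₁ M≤X hiding (P)
    D≥ : ∀ i → 8 ℕ.* (M ℕ.* M) ℕ.≤ D i
    D≥ zero = ℕP.≤-refl
    D≥ (suc i) = ℕP.≤-trans (D≥ i) (ℕP.≤-trans (m≤m*n (D i) (D i ℕ.* D i) {{nz (*-mono-≤ (D≥1 i) (D≥1 i))}}) (m≤n*m (D i ℕ.* (D i ℕ.* D i)) 48))
      where
      D≥1 : ∀ i → 1 ℕ.≤ D i
      D≥1 zero = *-mono-≤ {1} {8} (s≤s z≤n) (*-mono-≤ hM hM)
      D≥1 (suc i) = *-mono-≤ {1} {48} (s≤s z≤n) (*-mono-≤ (D≥1 i) (*-mono-≤ (D≥1 i) (D≥1 i)))
    D≥1 : ∀ i → 1 ℕ.≤ D i
    D≥1 i = ℕP.≤-trans (*-mono-≤ {1} {8} (s≤s z≤n) (*-mono-≤ hM hM)) (D≥ i)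
    S₃ : ℕ → ℕ → Set
    S₃ i = Large (D i) (t i)
    count : ℕ → ℤ
    count i = ∑ M (λ c → 𝟙 (large? (D i) (t i) c))
    count≥0 : ∀ i → 0ℤ ≤ count i
    count≥0 i = ∑-nonneg M λ c _ _ → 𝟙-nonneg (large? (D i) (t i) c)
    grow : ∀ i {c} → S₃ i c → S₃ (suc i) c
    grow i {c} (cc , h) = (λ {k} → cc {k}) , subst₂ _≤_ (cong (SV *_) (sym (pos-* 3 (t i)))) refl (≤-trans
        (lin 4 (λ u τ d m → u ⊗ τ ≤' d ⊗ m ⇒ u ⊗ (κ 3 ⊗ τ) ≤' κ 3 ⊗ d ⊗ m) tt SV (+ t i) (+ D i) (mass c (t i)) h)
        (*-mono (*-nonneg (pos≥0 {3}) (pos≥0 {D i})) (subst (_≤ + D (suc i)) (pos-* 3 (D i)) (+≤+ (*-mono-≤ {3} {48} (s≤s (s≤s (s≤s z≤n))) (m≤m*n (D i) (D i ℕ.* D i) {{nz (*-mono-≤ (D≥1 i) (D≥1 i))}}))))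
          (mass-nonneg c (t i)) (mass-mono c (m≤n*m (t i) 3))))
    -- By `grow` the sets of large classes increase with i. At an index where the count does not
    -- grow, a new class would make the difference of the counts at least 1.
    shrink : ∀ i → count (suc i) ≤ count i → ∀ {c} → S₃ (suc i) c → S₃ i c
    shrink i le {c} s with representative c
    ... | r , r1 , rM , e with large? (D i) (t i) r
    ...   | yes q = large-~ e q
    ...   | no nq = contradiction (≤-trans (≤-trans (≤-reflexive (sym (cong₂ _-_ (𝟙-yes (large? (D (suc i)) (t (suc i)) r) (large-~ (~-sym e) s)) (𝟙-no (large? (D i) (t i) r) nq))))
              (≤-trans (∑-term {M} {r} {λ c → 𝟙 (large? (D (suc i)) (t (suc i)) c) - 𝟙 (large? (D i) (t i) c)} r1 rM λ c _ _ → i≤j⇒0≤j-i (inc c)) (≤-reflexive (∑-- M _ _))))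
            (i≤j⇒i-j≤0 le)) λ { (+≤+ ()) }
      where
      inc : ∀ c → 𝟙 (large? (D i) (t i) c) ≤ 𝟙 (large? (D (suc i)) (t (suc i)) c)
      inc c with 𝟙-case (large? (D i) (t i) c)
      ... | inj₂ (_ , k) rewrite k = 𝟙-nonneg (large? (D (suc i)) (t (suc i)) c)
      ... | inj₁ (p , k) rewrite k = ≤-reflexive (sym (𝟙-yes (large? (D (suc i)) (t (suc i)) c) (grow i p)))
    conclude : (∃ λ i → i < suc M × count (suc i) ≤ count i) ⊎ + suc M ≤ count (suc M) → ⊥
    conclude (inj₂ h) = contradiction (≤-trans h (≤-trans (∑-mono M λ c _ _ → 𝟙≤1 (large? (D (suc M)) (t (suc M)) c)) (≤-reflexive (trans (∑-const M 1ℤ) (*-identityʳ (+ M)))))) λ { (+≤+ k) → ℕP.<⇒≱ ℕP.≤-refl k }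
    conclude (inj₁ (i , s≤s i≤M , le)) = FromClosed.absurd M hM T₁ M≤X (D i) (t i) (D≥ i) ht htT closed covers (λ {k} → cb {k}) nb
        (ℕP.≤-trans (ℕP.≤-trans t₀-y (t₀≤t i)) (<⇒≤ (n<2^n (t i)))) (≤-trans (∣∣-upper e₃) (+≤+ (ℕP.≤-trans t₀-e₃ (t₀≤t i))))
      where
      ht : 1 ℕ.≤ t i
      ht = ℕP.≤-trans t₀-1 (t₀≤t i)
      htT : t i ℕ.≤ T₁
      htT = <⇒≤ (t<T (m≤n⇒m≤1+n i≤M))
      closed : ∀ {a b c g} → S₃ i a → S₃ i b → S₃ i c → a ℕ.* (b ℕ.* c) ~ g → S₃ i g
      closed sa sb sc e = shrink i le (large-closed (D≥1 i) (<⇒≤ (t<T (s≤s i≤M))) ht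
        (≤-trans (∣∣-upper (e₁ i)) (+≤+ (ℕP.≤-trans (≤-sumUpTo (λ i → ℤ.∣ e₁ i ∣) i≤M) (ℕP.≤-trans t₀-e₁ (t₀≤t i))))) sa sb sc e)
      covers : ∀ {g} → Coprime g M → S₃ i g ⊎ ∃ λ a → S₃ i a × S₃ i (inv a ℕ.* g)
      covers cg = cover cg htT ht (D≥ i) (≤-trans (∣∣-upper e₂) (+≤+ (ℕP.≤-trans t₀-e₂ (t₀≤t i))))
      nb : ¬ S₃ i b
      nb (_ , h) = <⇒≱ (proj₂ (sp (D i)) T₁ M≤X (t i) (ℕP.≤-trans (≤-sumUpTo N i≤M) (ℕP.≤-trans t₀-N (t₀≤t i))) (t<T (m≤n⇒m≤1+n i≤M))) h

-- Selberg's sieve for pairs of primes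

Per : ℕ → (ℕ → ℤ) → Set
Per q f = ∀ n → f (q ℕ.+ n) ≡ f n

Per-*ˡ : ∀ {q f} → Per q f → ∀ k → Per (k ℕ.* q) f
Per-*ˡ h zero n = refl
Per-*ˡ {q} {f} h (suc k) n = trans (cong f (ℕP.+-assoc q (k ℕ.* q) n)) (trans (h (k ℕ.* q ℕ.+ n)) (Per-*ˡ h k n))

Per-*ʳ : ∀ {q f} → Per q f → ∀ k → Per (q ℕ.* k) f
Per-*ʳ {q} {f} h k = subst (λ z → Per z f) (ℕP.*-comm k q) (Per-*ˡ h k)

∑-Per : ∀ {q f} → Per q f → ∀ k → ∑ (k ℕ.* q) f ≡ + k * ∑ q f
∑-Per {q} {f} h zero = sym (*-zeroˡ _)
∑-Per {q} {f} h (suc k) = trans (∑-split q (k ℕ.* q) f) (trans (cong (λ z → ∑ q f + z) (trans (∑-ext (k ℕ.* q) h) (∑-Per h k)))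
  (lin 2 (λ k s → s ⊕ k ⊗ s ≡' (κ 1 ⊕ k) ⊗ s) tt (+ k) (∑ q f)))

∑-shift : ∀ {q f} → Per q f → ∀ c → ∑ q (λ n → f (c ℕ.+ n)) ≡ ∑ q f
∑-shift h zero = refl
∑-shift {q} {f} h (suc c) = trans (shift₁ (λ n → f (c ℕ.+ n)) λ n → trans (cong f (linℕ 3 (λ c q n → c ⊕ (q ⊕ n) ≡' q ⊕ (c ⊕ n)) tt c q n)) (h (c ℕ.+ n))) (∑-shift h c)
  where
  shift₁ : ∀ g → Per q g → ∑ q (λ n → f (suc c ℕ.+ n)) ≡ ∑ q (λ n → f (c ℕ.+ n))
  shift₁ g _ = lin 4 (λ A B a b → A ⊕ a ≡' b ⊕ B ⇒ a ≡' b ⇒ B ≡' A) tt (∑ q (λ n → f (c ℕ.+ n))) (∑ q (λ n → f (suc c ℕ.+ n))) (f (c ℕ.+ suc q)) (f (c ℕ.+ 1))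
    (trans (∑-split 1 q (λ n → f (c ℕ.+ n))) (cong₂ _+_ (+-identityˡ (f (c ℕ.+ 1))) (∑-ext q λ n → cong f (+-suc c n))))
    (trans (cong f (linℕ 2 (λ c q → c ⊕ (κ 1 ⊕ q) ≡' q ⊕ (c ⊕ κ 1)) tt c q)) (h (c ℕ.+ 1)))

∑-dilate : ∀ {p q f} → 1 ℕ.≤ q → Coprime p q → Per q f → ∑ q (λ n → f (p ℕ.* n)) ≡ ∑ q f
∑-dilate {p} {q} {f} hq cp per = trans (∑-ext q λ n → sym (pick (p ℕ.* n))) (trans (∑-swap q q _) (∑-ext q λ c → trans (∑-*ʳ q (f c) _) (trans (cong (_* f c) (∑-class cp c)) (*-identityˡ (f c)))))
  where
  open Residues q hq
  reduce : ∀ n → f n ≡ f (n ℕ.% q)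
  reduce n = trans (cong f (trans (DM.m≡m%n+[m/n]*n n q) (ℕP.+-comm (n ℕ.% q) _))) (Per-*ˡ per (n ℕ./ q) (n ℕ.% q))
  invariant : ∀ {a b} → a ~ b → f a ≡ f b
  invariant {a} {b} (cong-mod e) = trans (reduce a) (trans (cong f e) (sym (reduce b)))
  pick : ∀ x → ∑ q (λ c → 𝟙 (x ~? c) * f c) ≡ f x
  pick x = trans (∑-ext q λ c → 𝟙-* (x ~? c) λ e → invariant (~-sym e)) (trans (∑-*ʳ q (f x) _) (trans (cong (_* f x) (∑-class₁ x)) (*-identityˡ (f x))))

-- Π ∑_{n ≤ x} f is approximated by x ∑_{n ≤ Π} f.
Approx : ℕ → ℤ → (ℕ → ℤ) → Set
Approx Π E f = ∀ x → + Π * ∑ x f - + x * ∑ Π f ≲ + Π * E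

Approx-+ : ∀ {Π E E' f g} → Approx Π E f → Approx Π E' g → Approx Π (E + E') (λ n → f n + g n)
Approx-+ {Π} {E} {E'} {f} {g} a b x = subst₂ _≲_
  (trans (lin 6 (λ p x A B C D → (p ⊗ A ⊖ x ⊗ B) ⊕ (p ⊗ C ⊖ x ⊗ D) ≡' p ⊗ (A ⊕ C) ⊖ x ⊗ (B ⊕ D)) tt (+ Π) (+ x) (∑ x f) (∑ Π f) (∑ x g) (∑ Π g))
    (cong₂ (λ u v → + Π * u - + x * v) (sym (∑-+ x f g)) (sym (∑-+ Π f g))))
  (sym (*-distribˡ-+ (+ Π) E E')) (≲-+ (a x) (b x))

Approx-* : ∀ {Π E f} c → 0ℤ ≤ c → Approx Π E f → Approx Π (c * E) (λ n → c * f n)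
Approx-* {Π} {E} {f} c hc a x = subst₂ _≲_
  (trans (lin 5 (λ c p x A B → c ⊗ (p ⊗ A ⊖ x ⊗ B) ≡' p ⊗ (c ⊗ A) ⊖ x ⊗ (c ⊗ B)) tt c (+ Π) (+ x) (∑ x f) (∑ Π f))
    (cong₂ (λ u v → + Π * u - + x * v) (sym (∑-*ˡ x c f)) (sym (∑-*ˡ Π c f))))
  (*-assoc₃ c (+ Π) E) (≲-*ˡ hc (a x))

Approx-≤ : ∀ {Π E E' f} → E ≤ E' → Approx Π E f → Approx Π E' f
Approx-≤ h a x = ≲-trans (a x) (*-monoˡ pos≥0 h)

Approx-ext : ∀ {Π E f g} → (∀ n → f n ≡ g n) → Approx Π E f → Approx Π E g
Approx-ext {Π} {E} e a x = subst (_≲ + Π * E) (cong₂ (λ u v → + Π * u - + x * v) (∑-ext x e) (∑-ext Π e)) (a x)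

Approx-periodic : ∀ {Π q B f} → 1 ℕ.≤ q → q ∣ Π → Per q f → (∀ n → f n ≲ B) → Approx Π (+ 2 * (+ q * B)) f
Approx-periodic {Π} {q} {B} {f} hq (divides k refl) per hB x = subst₂ _≲_ eq (lin 3 (λ p q B → p ⊗ (q ⊗ B) ⊕ p ⊗ (q ⊗ B) ≡' p ⊗ (κ 2 ⊗ (q ⊗ B))) tt (+ (k ℕ.* q)) (+ q) B)
    (≲-+ (≲-*ˡ pos≥0 (≲-trans (partial r) (*-monoʳ B≥0 (+≤+ (<⇒≤ r<q))))) (≲-neg second))
  where
  instance
    q≢0 : ℕ.NonZero q
    q≢0 = nz hq
  r a : ℕ
  r = x ℕ.% q
  a = x ℕ./ q
  r<q : r < q
  r<q = DM.m%n<n x q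
  B≥0 : 0ℤ ≤ B
  B≥0 = ≲-bound (hB 0)
  partial : ∀ m → ∑ m f ≲ + m * B
  partial m = subst (∑ m f ≲_) (∑-const m B) (∑-≲ m λ n _ _ → hB n)
  second : + r * (+ k * ∑ q f) ≲ + (k ℕ.* q) * (+ q * B)
  second = ≲-trans (≲-*ˡ pos≥0 (≲-*ˡ pos≥0 (partial q))) (≤-trans (*-monoʳ {+ k * (+ q * B)} (*-nonneg pos≥0 (*-nonneg pos≥0 B≥0)) (+≤+ (<⇒≤ r<q)))
    (≤-reflexive (trans (lin 3 (λ q k B → q ⊗ (k ⊗ (q ⊗ B)) ≡' k ⊗ q ⊗ (q ⊗ B)) tt (+ q) (+ k) B) (cong (_* (+ q * B)) (sym (pos-* k q))))))
  x≡ : x ≡ a ℕ.* q ℕ.+ r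
  x≡ = trans (DM.m≡m%n+[m/n]*n x q) (ℕP.+-comm r (a ℕ.* q))
  eq : + (k ℕ.* q) * ∑ r f + - (+ r * (+ k * ∑ q f)) ≡ + (k ℕ.* q) * ∑ x f - + x * ∑ (k ℕ.* q) f
  eq = trans (lin 8 (λ P k q S R a r x → P ≡' k ⊗ q ⇒ P ⊗ (a ⊗ S) ≡' (k ⊗ q) ⊗ (a ⊗ S) ⇒ x ≡' a ⊗ q ⊕ r ⇒ x ⊗ (k ⊗ S) ≡' (a ⊗ q ⊕ r) ⊗ (k ⊗ S) ⇒ P ⊗ R ⊖ r ⊗ (k ⊗ S) ≡' P ⊗ (a ⊗ S ⊕ R) ⊖ x ⊗ (k ⊗ S)) tt
      (+ (k ℕ.* q)) (+ k) (+ q) (∑ q f) (∑ r f) (+ a) (+ r) (+ x) (pos-* k q) (cong (_* (+ a * ∑ q f)) (pos-* k q)) xz (cong (_* (+ k * ∑ q f)) xz))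
    (cong₂ (λ u v → + (k ℕ.* q) * u - + x * v) (sym (trans (cong (λ z → ∑ z f) x≡) (trans (∑-split (a ℕ.* q) r f) (cong₂ _+_ (∑-Per per a) (∑-ext r (Per-*ˡ per a)))))) (sym (∑-Per per k)))
    where
    xz : + x ≡ + a * + q + + r
    xz = trans (cong +_ x≡) (cong (_+ + r) (pos-* a q))

module Selection (h : ℕ) where

  -- p times the deviation of the indicator of the excluded classes 0 and -h from its mean 2/p, with
  -- reversed sign. It has mean 0 for a good p, where p ∤ h keeps the two classes apart, and the
  -- value 2 at sifted n.
  ψ : ℕ → ℕ → ℤ
  ψ p n = + 2 - + p * (𝟙 (p ∣? n) + 𝟙 (p ∣? n ℕ.+ h))

  Good : ℕ → Set
  Good p = Prime p × 3 ℕ.≤ p × ¬ p ∣ h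

  -- Selberg's weights, scaled to be integral: W P y n expands over the d ≤ y dividing ∏ P, and
  -- J P y is its value on sifted n, which up to the factor Q P is also the mean of its square.
  W J : List ℕ → ℕ → ℕ → ℤ
  W [] zero n = 0ℤ
  W [] (suc _) n = 1ℤ
  W (p ∷ P) y n = (+ p - + 2) * W P y n + ψ p n * W P (y ÷ p) n
  J [] zero _ = 0ℤ
  J [] (suc _) _ = 1ℤ
  J (p ∷ P) y n = (+ p - + 2) * J P y n + + 2 * J P (y ÷ p) n

  J₀ : List ℕ → ℕ → ℤ
  J₀ P y = J P y 0

  Q : List ℕ → ℤ
  Q [] = 1ℤ
  Q (p ∷ P) = (+ p - + 2) * Q P

  -- A factor ψ p multiplies both the period and the bound of a term by p, hence p². For the square
  -- of ψ p the cost is p³ ≤ p⁴, so the error for a product of two weights is a product of two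
  -- values of `err`.
  err : List ℕ → ℕ → ℤ
  err [] zero = 0ℤ
  err [] (suc _) = 1ℤ
  err (p ∷ P) y = (+ p - + 2) * err P y + + p * + p * err P (y ÷ p)

  p-2≥1 : ∀ {p} → Good p → 1ℤ ≤ + p - + 2
  p-2≥1 {p} (_ , h3 , _) = lin 1 (λ p → κ 3 ≤' p ⇒ κ 1 ≤' p ⊖ κ 2) tt (+ p) (+≤+ h3)

  p-2≥0 : ∀ {p} → Good p → 0ℤ ≤ + p - + 2
  p-2≥0 g = ≤-trans pos≥0 (p-2≥1 g)

  not-both : ∀ {p} → Good p → ∀ n → 𝟙 (p ∣? n) * 𝟙 (p ∣? n ℕ.+ h) ≡ 0ℤ
  not-both {p} (_ , _ , nh) n with 𝟙-case (p ∣? n) | 𝟙-case (p ∣? n ℕ.+ h)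
  ... | inj₂ (_ , i) | _ rewrite i = *-zeroˡ _
  ... | inj₁ _ | inj₂ (_ , i) rewrite i = *-zeroʳ _
  ... | inj₁ (a , _) | inj₁ (b , _) = contradiction (Dv.∣m+n∣m⇒∣n b a) nh

  𝟙-sq : ∀ {P : Set} (d : Dec P) → 𝟙 d * 𝟙 d ≡ 𝟙 d
  𝟙-sq d with 𝟙-case d
  ... | inj₁ (_ , i) rewrite i = *-identityˡ 1ℤ
  ... | inj₂ (_ , i) rewrite i = *-zeroˡ 0ℤ

  ψ-≲ : ∀ {p} → Good p → ∀ n → ψ p n ≲ + p
  ψ-≲ {p} g@(_ , h3 , _) n = neg-≤ (lin 3 (λ p a b → p ⊗ (a ⊕ b) ≤' p ⊗ κ 1 ⇒ κ 0 ⊖ p ≤' κ 2 ⊖ p ⊗ (a ⊕ b)) tt (+ p) (𝟙 (p ∣? n)) (𝟙 (p ∣? n ℕ.+ h)) (*-monoˡ pos≥0 le1))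
      , lin 3 (λ p a b → κ 0 ≤' p ⊗ (a ⊕ b) ⇒ κ 3 ≤' p ⇒ κ 2 ⊖ p ⊗ (a ⊕ b) ≤' p) tt (+ p) (𝟙 (p ∣? n)) (𝟙 (p ∣? n ℕ.+ h)) (*-nonneg pos≥0 (+-mono-≤ (𝟙-nonneg (p ∣? n)) (𝟙-nonneg (p ∣? n ℕ.+ h)))) (+≤+ h3)
    where
    le1 : 𝟙 (p ∣? n) + 𝟙 (p ∣? n ℕ.+ h) ≤ 1ℤ
    le1 with 𝟙-case (p ∣? n) | 𝟙-case (p ∣? n ℕ.+ h)
    ... | inj₂ (_ , i) | _ rewrite i = subst (_≤ 1ℤ) (sym (+-identityˡ _)) (𝟙≤1 (p ∣? n ℕ.+ h))
    ... | inj₁ (_ , j) | inj₂ (_ , i) rewrite i | j = ≤-refl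
    ... | inj₁ (a , i) | inj₁ (b , j) = contradiction (Dv.∣m+n∣m⇒∣n b a) (proj₂ (proj₂ g))

  ∣-period : ∀ p n → 𝟙 (p ∣? p ℕ.+ n) ≡ 𝟙 (p ∣? n)
  ∣-period p n = 𝟙-cong (p ∣? p ℕ.+ n) (p ∣? n) (λ d → Dv.∣m+n∣m⇒∣n d Dv.∣-refl) (λ d → Dv.∣m∣n⇒∣m+n Dv.∣-refl d)

  ψ-Per : ∀ p → Per p (ψ p)
  ψ-Per p n = cong₂ (λ a b → + 2 - + p * (a + b)) (∣-period p n) (trans (cong (λ k → 𝟙 (p ∣? k)) (ℕP.+-assoc p n h)) (∣-period p (n ℕ.+ h)))

  W-Per : ∀ P y → Per (product P) (W P y)
  W-Per [] zero n = refl
  W-Per [] (suc y) n = refl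
  W-Per (p ∷ P) y n = cong₂ _+_ (cong ((+ p - + 2) *_) (Per-*ˡ (W-Per P y) p n)) (cong₂ _*_ (Per-*ʳ (ψ-Per p) (product P) n) (Per-*ˡ (W-Per P (y ÷ p)) p n))

  module Mean {p a : ℕ} (gp : Good p) (ha : 1 ℕ.≤ a) (cpa : Coprime p a) where

    hp : 1 ℕ.≤ p
    hp = prime≥1 (proj₁ gp)

    mean-∣ : ∀ {g} → Per a g → ∑ (p ℕ.* a) (λ n → 𝟙 (p ∣? n) * g n) ≡ ∑ a g
    mean-∣ {g} per = trans (sym (∑-multiples (p ℕ.* a) g hp)) (trans (cong (λ z → ∑ z (λ j → g (p ℕ.* j))) pa÷p) (∑-dilate ha cpa per))
      where
      pa÷p : (p ℕ.* a) ÷ p ≡ a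
      pa÷p = ≤-ext (λ m k → *-cancelˡ-≤ p {{nz hp}} (÷-≤ hp k)) (λ m k → ≤-÷ hp (*-monoʳ-≤ p k))

    mean-∣+h : ∀ {g} → Per a g → ∑ (p ℕ.* a) (λ n → 𝟙 (p ∣? n ℕ.+ h) * g n) ≡ ∑ a g
    mean-∣+h {g} per = trans (∑-ext (p ℕ.* a) λ n → cong₂ _*_ (cong (λ k → 𝟙 (p ∣? k)) (ℕP.+-comm n h)) (back n))
        (trans (∑-shift G-Per h) (trans (mean-∣ g'-Per) (∑-shift per ((a ℕ.∸ 1) ℕ.* h))))
      where
      g' G : ℕ → ℤ
      g' n = g ((a ℕ.∸ 1) ℕ.* h ℕ.+ n)
      G n = 𝟙 (p ∣? n) * g' n
      g'-Per : Per a g'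
      g'-Per n = trans (cong g (linℕ 3 (λ c a n → c ⊕ (a ⊕ n) ≡' a ⊕ (c ⊕ n)) tt ((a ℕ.∸ 1) ℕ.* h) a n)) (per ((a ℕ.∸ 1) ℕ.* h ℕ.+ n))
      G-Per : Per (p ℕ.* a) G
      G-Per n = cong₂ _*_ (Per-*ʳ {f = λ n → 𝟙 (p ∣? n)} (∣-period p) a n) (Per-*ˡ g'-Per p n)
      back : ∀ n → g n ≡ g' (h ℕ.+ n)
      back n = sym (trans (cong g (linℕ 4 (λ a b h n → a ≡' κ 1 ⊕ b ⇒ a ⊗ h ≡' (κ 1 ⊕ b) ⊗ h ⇒ b ⊗ h ⊕ (h ⊕ n) ≡' a ⊗ h ⊕ n) tt a (a ℕ.∸ 1) h n a≡ (cong (ℕ._* h) a≡))) (Per-*ʳ per h n))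
        where
        a≡ : a ≡ suc (a ℕ.∸ 1)
        a≡ = sym (m+[n∸m]≡n ha)

    mean-1 : ∀ {g} → Per a g → ∑ (p ℕ.* a) g ≡ + p * ∑ a g
    mean-1 per = ∑-Per per p

    mean-ψ : ∀ {g} → Per a g → ∑ (p ℕ.* a) (λ n → ψ p n * g n) ≡ 0ℤ
    mean-ψ {g} per = trans (∑-ext (p ℕ.* a) λ n → lin 4 (λ p i j g → (κ 2 ⊖ p ⊗ (i ⊕ j)) ⊗ g ≡' κ 2 ⊗ g ⊖ (p ⊗ (i ⊗ g) ⊕ p ⊗ (j ⊗ g))) tt (+ p) (𝟙 (p ∣? n)) (𝟙 (p ∣? n ℕ.+ h)) (g n))
      (trans (∑-- (p ℕ.* a) _ _) (trans (cong₂ _-_ (trans (∑-*ˡ (p ℕ.* a) (+ 2) g) (cong (+ 2 *_) (mean-1 per)))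
        (trans (∑-+ (p ℕ.* a) _ _) (cong₂ _+_ (trans (∑-*ˡ (p ℕ.* a) (+ p) _) (cong (+ p *_) (mean-∣ per))) (trans (∑-*ˡ (p ℕ.* a) (+ p) _) (cong (+ p *_) (mean-∣+h per))))))
        (lin 2 (λ p s → κ 2 ⊗ (p ⊗ s) ⊖ (p ⊗ s ⊕ p ⊗ s) ≡' κ 0) tt (+ p) (∑ a g))))

    mean-ψψ : ∀ {g} → Per a g → ∑ (p ℕ.* a) (λ n → ψ p n * ψ p n * g n) ≡ + p * (+ 2 * (+ p - + 2) * ∑ a g)
    mean-ψψ {g} per = trans (∑-ext (p ℕ.* a) λ n → lin 4 (λ p i j g → i ⊗ j ≡' κ 0 ⇒ i ⊗ i ≡' i ⇒ j ⊗ j ≡' j ⇒ p ⊗ p ⊗ g ⊗ (i ⊗ j) ≡' p ⊗ p ⊗ g ⊗ κ 0 ⇒ p ⊗ p ⊗ g ⊗ (i ⊗ i) ≡' p ⊗ p ⊗ g ⊗ i ⇒ p ⊗ p ⊗ g ⊗ (j ⊗ j) ≡' p ⊗ p ⊗ g ⊗ j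
          ⇒ (κ 2 ⊖ p ⊗ (i ⊕ j)) ⊗ (κ 2 ⊖ p ⊗ (i ⊕ j)) ⊗ g ≡' κ 4 ⊗ g ⊕ (p ⊗ p ⊖ κ 4 ⊗ p) ⊗ (i ⊗ g ⊕ j ⊗ g)) tt (+ p) (𝟙 (p ∣? n)) (𝟙 (p ∣? n ℕ.+ h)) (g n)
          (not-both gp n) (𝟙-sq (p ∣? n)) (𝟙-sq (p ∣? n ℕ.+ h)) (cong (+ p * + p * g n *_) (not-both gp n)) (cong (+ p * + p * g n *_) (𝟙-sq (p ∣? n))) (cong (+ p * + p * g n *_) (𝟙-sq (p ∣? n ℕ.+ h))))
      (trans (∑-+ (p ℕ.* a) _ _) (trans (cong₂ _+_ (trans (∑-*ˡ (p ℕ.* a) (+ 4) g) (cong (+ 4 *_) (mean-1 per)))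
        (trans (∑-*ˡ (p ℕ.* a) (+ p * + p - + 4 * + p) _) (cong ((+ p * + p - + 4 * + p) *_) (trans (∑-+ (p ℕ.* a) _ _) (cong₂ _+_ (mean-∣ per) (mean-∣+h per))))))
        (lin 2 (λ p s → κ 4 ⊗ (p ⊗ s) ⊕ (p ⊗ p ⊖ κ 4 ⊗ p) ⊗ (s ⊕ s) ≡' p ⊗ (κ 2 ⊗ (p ⊖ κ 2) ⊗ s)) tt (+ p) (∑ a g))))

  data Distinct : List ℕ → Set where
    [] : Distinct []
    _∷_ : ∀ {p P} → All (λ q → p ≢ q) P → Distinct P → Distinct (p ∷ P)

  coprime-product : ∀ {p P} → Prime p → All (λ q → p ≢ q) P → All Good P → Coprime p (product P)
  coprime-product pp [] [] (_ , d1) = Dv.∣1⇒≡1 d1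
  coprime-product {p} {q ∷ P} pp (ne ∷ nes) ((pq , _) ∷ gs) = Co.sym (coprime-* (λ {k} → Co.sym (coprime-prime pq nd) {k}) (λ {k} → Co.sym (coprime-product pp nes gs) {k}))
    where
    nd : ¬ q ∣ p
    nd d = ne (sym (prime-∣-prime pq pp d))

  good-product : ∀ {P} → All Good P → 1 ℕ.≤ product P
  good-product [] = s≤s z≤n
  good-product ((pp , _) ∷ gs) = *-mono-≤ (prime≥1 pp) (good-product gs)

  -- The ψ p are orthogonal: by `mean-ψ` the mixed terms have mean 0, and by `mean-ψψ` the square of
  -- ψ p has mean 2 (p - 2). This exact evaluation takes the place of optimising a quadratic form.
  mean-WW : ∀ {P} → All Good P → Distinct P → ∀ {y y'} → y ℕ.≤ y' → ∑ (product P) (λ n → W P y n * W P y' n) ≡ + product P * (Q P * J₀ P y)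
  mean-WW [] [] {zero} {y'} _ = trans (+-identityˡ _) (trans (*-zeroˡ (W [] y' 1)) (sym (trans (cong (1ℤ *_) (*-zeroʳ 1ℤ)) (*-zeroʳ 1ℤ))))
  mean-WW [] [] {suc y} {suc y'} _ = trans (+-identityˡ _) (sym (*-identityˡ (1ℤ * 1ℤ)))
  mean-WW {p ∷ P} (gp ∷ gs) (ne ∷ ds) {y} {y'} h = trans (∑-ext (p ℕ.* a) λ n →
      lin 6 (λ c s w w' v v' → (c ⊗ w ⊕ s ⊗ v) ⊗ (c ⊗ w' ⊕ s ⊗ v') ≡' c ⊗ c ⊗ (w ⊗ w') ⊕ (c ⊗ (s ⊗ (w ⊗ v' ⊕ v ⊗ w')) ⊕ s ⊗ s ⊗ (v ⊗ v'))) tt (+ p - + 2) (ψ p n) (W P y n) (W P y' n) (W P (y ÷ p) n) (W P (y' ÷ p) n))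
    (trans (∑-+ (p ℕ.* a) _ _) (trans (cong₂ _+_ (trans (∑-*ˡ (p ℕ.* a) c² _) (cong (c² *_) (trans (mean-1 (Per₂ y y')) (cong (+ p *_) (mean-WW gs ds h)))))
        (trans (∑-+ (p ℕ.* a) _ _) (cong₂ _+_ (trans (∑-*ˡ (p ℕ.* a) (+ p - + 2) _) (cong ((+ p - + 2) *_) (mean-ψ λ n → cong₂ _+_ (Per₂ y (y' ÷ p) n) (Per₂ (y ÷ p) y' n))))
          (trans (mean-ψψ (Per₂ (y ÷ p) (y' ÷ p))) (cong (λ z → + p * (+ 2 * (+ p - + 2) * z)) (mean-WW gs ds (÷-mono (prime≥1 (proj₁ gp)) h)))))))
      (trans (lin 6 (λ p c a q j j' → c ⊗ c ⊗ (p ⊗ (a ⊗ (q ⊗ j))) ⊕ (c ⊗ κ 0 ⊕ p ⊗ (κ 2 ⊗ c ⊗ (a ⊗ (q ⊗ j')))) ≡' p ⊗ a ⊗ (c ⊗ q ⊗ (c ⊗ j ⊕ κ 2 ⊗ j'))) tt (+ p) (+ p - + 2) (+ a) (Q P) (J₀ P y) (J₀ P (y ÷ p)))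
        (cong (_* ((+ p - + 2) * Q P * ((+ p - + 2) * J₀ P y + + 2 * J₀ P (y ÷ p)))) (sym (pos-* p a))))))
    where
    a : ℕ
    a = product P
    c² : ℤ
    c² = (+ p - + 2) * (+ p - + 2)
    open Mean gp (good-product gs) (λ {k} → coprime-product (proj₁ gp) ne gs {k})
    Per₂ : ∀ y y' → Per a (λ n → W P y n * W P y' n)
    Per₂ y y' n = cong₂ _*_ (W-Per P y n) (W-Per P y' n)

  err-nonneg : ∀ {P} → All Good P → ∀ y → 0ℤ ≤ err P y
  err-nonneg [] zero = ≤-refl
  err-nonneg [] (suc y) = pos≥0
  err-nonneg (gp ∷ gs) y = +-mono-≤ (*-nonneg (p-2≥0 gp) (err-nonneg gs y)) (*-nonneg (*-nonneg pos≥0 pos≥0) (err-nonneg gs _))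

  -- The factor g collects the ψ already split off, with its period q and its bound B; when no prime
  -- is left, the summand is periodic and `Approx-periodic` applies.
  approx-WW : ∀ {Π P} → All Good P → ∀ y y' {q B} (g : ℕ → ℤ) → 1 ℕ.≤ q → q ℕ.* product P ∣ Π → Per q g → (∀ n → g n ≲ B) →
    Approx Π (+ 2 * (+ q * B) * (err P y * err P y')) (λ n → g n * (W P y n * W P y' n))
  approx-WW {Π} [] zero y' {q} {B} g hq qd per hB = Approx-ext (λ n → sym (trans (cong (g n *_) (*-zeroˡ (W [] y' n))) (*-zeroʳ (g n))))
    (subst (λ E → Approx Π E (λ _ → 0ℤ)) (sym (trans (cong (+ 2 * (+ q * B) *_) (*-zeroˡ (err [] y'))) (*-zeroʳ _))) zero-approx)
    where
    zero-approx : Approx Π 0ℤ (λ _ → 0ℤ)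
    zero-approx x = subst₂ _≲_ (sym (cong₂ (λ a b → + Π * a - + x * b) (∑-zero x λ _ _ _ → refl) (∑-zero Π λ _ _ _ → refl)) |> trans (lin 2 (λ p x → κ 0 ≡' p ⊗ κ 0 ⊖ x ⊗ κ 0) tt (+ Π) (+ x))) (sym (*-zeroʳ (+ Π))) (≲-zero ≤-refl)
      where
      infixl 1 _|>_
      _|>_ : ∀ {A B : Set} → A → (A → B) → B
      x |> f = f x
  approx-WW {Π} [] (suc y) zero {q} {B} g hq qd per hB = Approx-ext (λ n → cong (g n *_) (*-comm 0ℤ 1ℤ)) (subst (λ z → Approx Π (+ 2 * (+ q * B) * z) (λ n → g n * (0ℤ * 1ℤ))) (*-comm 0ℤ 1ℤ) (approx-WW {Π} [] zero (suc y) g hq qd per hB))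
  approx-WW {Π} [] (suc y) (suc y') {q} {B} g hq qd per hB = Approx-ext (λ n → sym (trans (cong (g n *_) (*-identityˡ 1ℤ)) (*-identityʳ (g n))))
    (subst (λ E → Approx Π E g) (sym (trans (cong (+ 2 * (+ q * B) *_) (*-identityˡ 1ℤ)) (*-identityʳ _))) (Approx-periodic hq (subst (_∣ Π) (ℕP.*-identityʳ q) qd) per hB))
  approx-WW {Π} {p ∷ P} (gp ∷ gs) y y' {q} {B} g hq qd per hB = Approx-ext expand (Approx-≤ bound
      (Approx-+ (Approx-* c² (*-nonneg c≥0 c≥0) (approx-WW gs y y' g hq (Dv.∣-trans (Dv.*-monoʳ-∣ q (Dv.n∣m*n p)) qd) per hB))
        (Approx-+ (Approx-* c c≥0 (Approx-+ (approx-WW gs y (y' ÷ p) gψ hqp qd' gψ-Per gψ-≲) (approx-WW gs (y ÷ p) y' gψ hqp qd' gψ-Per gψ-≲)))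
          (approx-WW gs (y ÷ p) (y' ÷ p) gψψ hqp qd' gψψ-Per gψψ-≲))))
    where
    c c² : ℤ
    c = + p - + 2
    c² = c * c
    c≥0 : 0ℤ ≤ c
    c≥0 = p-2≥0 gp
    gψ gψψ : ℕ → ℤ
    gψ n = g n * ψ p n
    gψψ n = g n * ψ p n * ψ p n
    hqp : 1 ℕ.≤ q ℕ.* p
    hqp = *-mono-≤ hq (prime≥1 (proj₁ gp))
    qd' : q ℕ.* p ℕ.* product P ∣ Π
    qd' = subst (_∣ Π) (sym (ℕP.*-assoc q p (product P))) qd
    gψ-Per : Per (q ℕ.* p) gψ
    gψ-Per n = cong₂ _*_ (Per-*ʳ per p n) (Per-*ˡ (ψ-Per p) q n)
    gψψ-Per : Per (q ℕ.* p) gψψ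
    gψψ-Per n = cong₂ _*_ (gψ-Per n) (Per-*ˡ (ψ-Per p) q n)
    gψ-≲ : ∀ n → gψ n ≲ B * + p
    gψ-≲ n = ≲-* (hB n) (ψ-≲ gp n)
    gψψ-≲ : ∀ n → gψψ n ≲ B * + p * + p
    gψψ-≲ n = ≲-* (gψ-≲ n) (ψ-≲ gp n)
    expand : ∀ n → c² * (g n * (W P y n * W P y' n)) + (c * (gψ n * (W P y n * W P (y' ÷ p) n) + gψ n * (W P (y ÷ p) n * W P y' n)) + gψψ n * (W P (y ÷ p) n * W P (y' ÷ p) n)) ≡ g n * (W (p ∷ P) y n * W (p ∷ P) y' n)
    expand n = lin 7 (λ c s w w' v v' g → c ⊗ c ⊗ (g ⊗ (w ⊗ w')) ⊕ (c ⊗ (g ⊗ s ⊗ (w ⊗ v') ⊕ g ⊗ s ⊗ (v ⊗ w')) ⊕ g ⊗ s ⊗ s ⊗ (v ⊗ v')) ≡' g ⊗ ((c ⊗ w ⊕ s ⊗ v) ⊗ (c ⊗ w' ⊕ s ⊗ v'))) tt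
      c (ψ p n) (W P y n) (W P y' n) (W P (y ÷ p) n) (W P (y' ÷ p) n) (g n)
    E₁ E₂ E₃ E₄ : ℤ
    E₁ = err P y
    E₂ = err P y'
    E₃ = err P (y ÷ p)
    E₄ = err P (y' ÷ p)
    bound : c² * (+ 2 * (+ q * B) * (E₁ * E₂)) + (c * (+ 2 * (+ (q ℕ.* p) * (B * + p)) * (E₁ * E₄) + + 2 * (+ (q ℕ.* p) * (B * + p)) * (E₃ * E₂)) + + 2 * (+ (q ℕ.* p) * (B * + p * + p)) * (E₃ * E₄))
      ≤ + 2 * (+ q * B) * ((c * E₁ + + p * + p * E₃) * (c * E₂ + + p * + p * E₄))
    bound = subst (λ z → c² * (+ 2 * (+ q * B) * (E₁ * E₂)) + (c * (+ 2 * (z * (B * + p)) * (E₁ * E₄) + + 2 * (z * (B * + p)) * (E₃ * E₂)) + + 2 * (z * (B * + p * + p)) * (E₃ * E₄)) ≤ + 2 * (+ q * B) * ((c * E₁ + + p * + p * E₃) * (c * E₂ + + p * + p * E₄))) (sym (pos-* q p))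
      (lin 8 (λ c q B p a b d e → q ⊗ B ⊗ (d ⊗ e) ⊗ (p ⊗ p ⊗ p) ⊗ κ 1 ≤' q ⊗ B ⊗ (d ⊗ e) ⊗ (p ⊗ p ⊗ p) ⊗ p ⇒ c ⊗ c ⊗ (κ 2 ⊗ (q ⊗ B) ⊗ (a ⊗ b)) ⊕ (c ⊗ (κ 2 ⊗ (q ⊗ p ⊗ (B ⊗ p)) ⊗ (a ⊗ e) ⊕ κ 2 ⊗ (q ⊗ p ⊗ (B ⊗ p)) ⊗ (d ⊗ b)) ⊕ κ 2 ⊗ (q ⊗ p ⊗ (B ⊗ p ⊗ p)) ⊗ (d ⊗ e))
          ≤' κ 2 ⊗ (q ⊗ B) ⊗ ((c ⊗ a ⊕ p ⊗ p ⊗ d) ⊗ (c ⊗ b ⊕ p ⊗ p ⊗ e))) tt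
        c (+ q) B (+ p) E₁ E₂ E₃ E₄ (*-monoˡ (*-nonneg (*-nonneg (*-nonneg (pos≥0 {q}) (≲-bound (hB 0))) (*-nonneg (err-nonneg gs (y ÷ p)) (err-nonneg gs (y' ÷ p)))) (*-nonneg (*-nonneg (pos≥0 {p}) (pos≥0 {p})) (pos≥0 {p}))) (+≤+ (prime≥1 (proj₁ gp)))))

  Sifted : List ℕ → ℕ → Set
  Sifted P n = All (λ p → ¬ p ∣ n × ¬ p ∣ n ℕ.+ h) P

  sifted? : ∀ P n → Dec (Sifted P n)
  sifted? P n = All.all? (λ p → ¬? (p ∣? n) ×-dec ¬? (p ∣? n ℕ.+ h)) P

  W-sifted : ∀ {P n} → Sifted P n → ∀ y → W P y n ≡ J₀ P y
  W-sifted [] zero = refl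
  W-sifted [] (suc y) = refl
  W-sifted {p ∷ P} {n} ((a , b) ∷ s) y = cong₂ _+_ (cong ((+ p - + 2) *_) (W-sifted s y)) (cong₂ _*_ ψ2 (W-sifted s (y ÷ p)))
    where
    ψ2 : ψ p n ≡ + 2
    ψ2 = trans (cong₂ (λ i j → + 2 - + p * (i + j)) (𝟙-no (p ∣? n) a) (𝟙-no (p ∣? n ℕ.+ h) b)) (lin 1 (λ p → κ 2 ⊖ p ⊗ (κ 0 ⊕ κ 0) ≡' κ 2) tt (+ p))

  square≥0 : ∀ a → 0ℤ ≤ a * a
  square≥0 a with ≤-total 0ℤ a
  ... | inj₁ h = *-nonneg h h
  ... | inj₂ h = lin 2 (λ a b → κ 0 ≤' b ⊗ b ⇒ b ⊗ b ≡' a ⊗ a ⇒ κ 0 ≤' a ⊗ a) tt a (0ℤ - a) (*-nonneg (i≤j⇒0≤j-i h) (i≤j⇒0≤j-i h)) (lin 2 (λ a b → b ≡' κ 0 ⊖ a ⇒ b ⊗ b ≡' (κ 0 ⊖ a) ⊗ b ⇒ a ⊗ b ≡' a ⊗ (κ 0 ⊖ a) ⇒ b ⊗ b ≡' a ⊗ a) tt a (0ℤ - a) refl refl refl)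

  Z : List ℕ → ℕ → ℤ
  Z P x = ∑ x (λ n → 𝟙 (sifted? P n))

  -- A square of W equals J₀² at sifted n and is nonnegative elsewhere, so its mean value bounds the
  -- count by about x Q / J₀.
  selberg-upper : ∀ {P} → All Good P → Distinct P → ∀ x y → Z P x * (J₀ P y * J₀ P y) ≤ + x * (Q P * J₀ P y) + + 2 * (err P y * err P y)
  selberg-upper {P} gs ds x y = ≤-trans lower (*-cancel {+ Π} (+≤+ (good-product gs)) (lin 6 (λ p A x M q e → p ⊗ A ⊖ x ⊗ M ≤' p ⊗ (κ 2 ⊗ (κ 1 ⊗ κ 1) ⊗ e) ⇒ M ≡' p ⊗ q ⇒ x ⊗ M ≡' x ⊗ (p ⊗ q) ⇒ p ⊗ A ≤' p ⊗ (x ⊗ q ⊕ κ 2 ⊗ e)) tt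
      (+ Π) (∑ x (λ n → W P y n * W P y n)) (+ x) (∑ Π (λ n → W P y n * W P y n)) (Q P * J₀ P y) (err P y * err P y) (proj₂ (ap x)) mw (cong (+ x *_) mw)))
    where
    Π : ℕ
    Π = product P
    mw : ∑ Π (λ n → W P y n * W P y n) ≡ + Π * (Q P * J₀ P y)
    mw = mean-WW gs ds ℕP.≤-refl
    ap : Approx Π (+ 2 * (+ 1 * 1ℤ) * (err P y * err P y)) (λ n → W P y n * W P y n)
    ap = Approx-ext (λ n → *-identityˡ _) (approx-WW gs y y (λ _ → 1ℤ) (s≤s z≤n) (subst (_∣ Π) (sym (ℕP.*-identityˡ Π)) Dv.∣-refl) (λ _ → refl) (λ _ → ≲-nonneg pos≥0 ≤-refl))
    lower : Z P x * (J₀ P y * J₀ P y) ≤ ∑ x (λ n → W P y n * W P y n)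
    lower = ≤-trans (≤-reflexive (sym (∑-*ʳ x (J₀ P y * J₀ P y) _))) (∑-mono x λ n _ _ → each n)
      where
      each : ∀ n → 𝟙 (sifted? P n) * (J₀ P y * J₀ P y) ≤ W P y n * W P y n
      each n with 𝟙-case (sifted? P n)
      ... | inj₁ (s , i) rewrite i = ≤-reflexive (trans (*-identityˡ _) (sym (cong₂ _*_ (W-sifted s y) (W-sifted s y))))
      ... | inj₂ (_ , i) rewrite i = ≤-trans (≤-reflexive (*-zeroˡ (J₀ P y * J₀ P y))) (square≥0 (W P y n))

-- Products over odd primes and rough numbers

OddPrime : ℕ → Set
OddPrime p = Prime p × 3 ℕ.≤ p

oddPrime? : ∀ p → Dec (OddPrime p)
oddPrime? p = prime? p ×-dec (3 ℕ.≤? p)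

keep : ∀ {P : Set} → Dec P → ℕ → List ℕ → List ℕ
keep (yes _) p P = p ∷ P
keep (no _) p P = P

oddPrimes : ℕ → List ℕ
oddPrimes zero = []
oddPrimes (suc n) = keep (oddPrime? (suc n)) (suc n) (oddPrimes n)

oddPrimes-odd : ∀ R → All OddPrime (oddPrimes R)
oddPrimes-odd zero = []
oddPrimes-odd (suc n) with oddPrime? (suc n)
... | yes o = o ∷ oddPrimes-odd n
... | no _ = oddPrimes-odd n

∏ : List ℕ → (ℕ → ℤ) → ℤ
∏ [] f = 1ℤ
∏ (p ∷ P) f = f p * ∏ P f

plain : ℕ → ℤ
plain q = + q

-- q (1 + 6/q) if q ∣ h, and q otherwise. The 6 suffices for (q / (q - 1))² ≤ 1 + 6/q when q ≥ 3, as
-- used in `Πb-Qb`.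
raised : ℕ → ℕ → ℤ
raised h q = + q + + 6 * 𝟙 (q ∣? h)

raised≥ : ∀ h q → + q ≤ raised h q
raised≥ h q = ≤+ʳ (*-nonneg pos≥0 (𝟙-nonneg (q ∣? h)))

∏-nonneg : ∀ P {f} → (∀ q → 0ℤ ≤ f q) → 0ℤ ≤ ∏ P f
∏-nonneg [] h = pos≥0
∏-nonneg (p ∷ P) h = *-nonneg (h p) (∏-nonneg P h)

∏-pos : ∀ {P f} → All (λ q → 1ℤ ≤ f q) P → 1ℤ ≤ ∏ P f
∏-pos [] = ≤-refl
∏-pos (h ∷ hs) = *-≥1 h (∏-pos hs)

raised-nonneg : ∀ h q → 0ℤ ≤ raised h q
raised-nonneg h q = ≤-trans pos≥0 (raised≥ h q)

Rough : List ℕ → ℕ → Set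
Rough Rs n = All (λ p → ¬ p ∣ n) Rs

rough? : ∀ Rs n → Dec (Rough Rs n)
rough? Rs n = All.all? (λ p → ¬? (p ∣? n)) Rs

cast≥ : ∀ {p k} → k ℕ.≤ p → + k ≤ + p
cast≥ = +≤+

÷-< : ∀ {y p} → 2 ℕ.≤ p → 1 ℕ.≤ y → y ÷ p < y
÷-< {y} {p} hp hy = linℕ 2 (λ q y → q ⊕ q ≤' y ⇒ κ 1 ≤' y ⇒ κ 1 ⊕ q ≤' y) tt (y ÷ p) y
  (ℕP.≤-trans (ℕP.≤-reflexive (linℕ 1 (λ q → q ⊕ q ≡' κ 2 ⊗ q) tt (y ÷ p))) (ℕP.≤-trans (*-monoˡ-≤ (y ÷ p) hp) (÷-≤ (ℕP.≤-trans (s≤s z≤n) hp) ℕP.≤-refl))) hy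

module RoughSums (T : ℕ) where

  open Bounded T

  A : List ℕ → ℕ → ℤ
  A Rs y = ∑ y (λ n → 𝟙 (rough? Rs n) * w n)

  term≥0 : ∀ Rs n → 0ℤ ≤ 𝟙 (rough? Rs n) * w n
  term≥0 Rs n = *-nonneg (𝟙-nonneg (rough? Rs n)) (w-nonneg n)

  A-mono : ∀ Rs {y z} → y ℕ.≤ z → A Rs y ≤ A Rs z
  A-mono Rs h = ∑-range h λ n _ _ → term≥0 Rs n

  A-split : ∀ {p} Rs y → Prime p → y ℕ.≤ X → + p * A Rs y ≤ + p * A (p ∷ Rs) y + A Rs (y ÷ p)
  A-split {p} Rs y pp hy = ≤-trans (*-monoˡ pos≥0 (≤-trans (∑-mono y λ n _ _ → each n) (≤-reflexive (∑-+ y _ _))))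
    (lin 4 (λ p a b c → p ⊗ b ≤' c ⇒ p ⊗ (a ⊕ b) ≤' p ⊗ a ⊕ c) tt (+ p) (A (p ∷ Rs) y) (∑ y (λ n → 𝟙 (p ∣? n) * (𝟙 (rough? Rs n) * w n))) (A Rs (y ÷ p)) multiples)
    where
    hp : 1 ℕ.≤ p
    hp = prime≥1 pp
    each : ∀ n → 𝟙 (rough? Rs n) * w n ≤ 𝟙 (rough? (p ∷ Rs) n) * w n + 𝟙 (p ∣? n) * (𝟙 (rough? Rs n) * w n)
    each n with 𝟙-case (p ∣? n) | 𝟙-case (rough? Rs n)
    ... | inj₁ (_ , i) | _ rewrite i = ≤-trans (≤-reflexive (sym (*-identityˡ (𝟙 (rough? Rs n) * w n)))) (≤+ˡ (term≥0 (p ∷ Rs) n))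
    ... | inj₂ (nd , i) | inj₁ (r , j) rewrite i | j | 𝟙-yes (rough? (p ∷ Rs) n) (nd ∷ r) = ≤+ʳ (*-nonneg pos≥0 (*-nonneg pos≥0 (w-nonneg n)))
    ... | inj₂ (nd , i) | inj₂ (_ , j) rewrite i | j = ≤-trans (≤-reflexive (*-zeroˡ (w n))) (+-mono-≤ (term≥0 (p ∷ Rs) n) (*-nonneg (≤-refl {0ℤ}) (*-nonneg (≤-refl {0ℤ}) (w-nonneg n))))
    multiples : + p * ∑ y (λ n → 𝟙 (p ∣? n) * (𝟙 (rough? Rs n) * w n)) ≤ A Rs (y ÷ p)
    multiples = ≤-trans (≤-reflexive (trans (cong (+ p *_) (sym (∑-multiples y (λ n → 𝟙 (rough? Rs n) * w n) hp))) (sym (∑-*ˡ (y ÷ p) (+ p) _))))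
      (∑-mono (y ÷ p) λ j a b → ≤-trans (≤-reflexive (trans (lin 3 (λ p i w → p ⊗ (i ⊗ w) ≡' i ⊗ (p ⊗ w)) tt (+ p) (𝟙 (rough? Rs (p ℕ.* j))) (w (p ℕ.* j)))
        (cong (𝟙 (rough? Rs (p ℕ.* j)) *_) (w-scale hp a (ℕP.≤-trans (÷-≤ hp b) hy))))) (*-monoʳ (w-nonneg j) (shrink j)))
      where
      shrink : ∀ j → 𝟙 (rough? Rs (p ℕ.* j)) ≤ 𝟙 (rough? Rs j)
      shrink j with 𝟙-case (rough? Rs (p ℕ.* j))
      ... | inj₁ (r , i) rewrite i = ≤-reflexive (sym (𝟙-yes (rough? Rs j) (All.map (λ nd d → nd (Dv.∣-trans d (Dv.n∣m*n p))) r)))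
      ... | inj₂ (_ , i) rewrite i = 𝟙-nonneg (rough? Rs j)

  A-good-step : ∀ {p} Rs y → Prime p → y ℕ.≤ X → (+ p - 1ℤ) * A Rs (y ÷ p) ≤ + p * A (p ∷ Rs) (y ÷ p) → (+ p - 1ℤ) * A Rs y ≤ (+ p - 1ℤ) * A (p ∷ Rs) y + A (p ∷ Rs) (y ÷ p)
  A-good-step {p} Rs y pp hy ih = *-cancel {+ p} (cast≥ (prime≥1 pp)) (lin 5 (λ p a b a' b' → (p ⊖ κ 1) ⊗ (p ⊗ a) ≤' (p ⊖ κ 1) ⊗ (p ⊗ a' ⊕ b) ⇒ (p ⊖ κ 1) ⊗ b ≤' p ⊗ b' ⇒ p ⊗ ((p ⊖ κ 1) ⊗ a) ≤' p ⊗ ((p ⊖ κ 1) ⊗ a' ⊕ b')) tt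
    (+ p) (A Rs y) (A Rs (y ÷ p)) (A (p ∷ Rs) y) (A (p ∷ Rs) (y ÷ p)) (*-monoˡ (i≤j⇒0≤j-i (cast≥ (prime≥1 pp))) (A-split Rs y pp hy)) ih)

  -- The multiples of p contribute at most 1/p of the sum up to y / p; iterating `A-split` shows
  -- that removing them costs at most the factor 1 - 1/p.
  A-bad : ∀ {p} Rs → Prime p → ∀ y → y ℕ.≤ X → (+ p - 1ℤ) * A Rs y ≤ + p * A (p ∷ Rs) y
  A-bad {p} Rs pp = <-rec (λ y → y ℕ.≤ X → (+ p - 1ℤ) * A Rs y ≤ + p * A (p ∷ Rs) y) go
    where
    go : ∀ y → (∀ {z} → z < y → z ℕ.≤ X → (+ p - 1ℤ) * A Rs z ≤ + p * A (p ∷ Rs) z) → y ℕ.≤ X → (+ p - 1ℤ) * A Rs y ≤ + p * A (p ∷ Rs) y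
    go zero _ _ = lin 1 (λ p → (p ⊖ κ 1) ⊗ κ 0 ≤' p ⊗ κ 0) tt (+ p)
    go (suc y) ih hy = ≤-trans (A-good-step Rs (suc y) pp hy (ih lt (ℕP.≤-trans (<⇒≤ lt) hy)))
      (lin 3 (λ p a b → b ≤' a ⇒ (p ⊖ κ 1) ⊗ a ⊕ b ≤' p ⊗ a) tt (+ p) (A (p ∷ Rs) (suc y)) (A (p ∷ Rs) (suc y ÷ p)) (A-mono (p ∷ Rs) (÷-≤x (suc y) p)))
      where
      lt : suc y ÷ p < suc y
      lt = ÷-< (prime≥2 pp) (s≤s z≤n)

  -- The finer form, which keeps the cut-off `y ÷ p` and so matches the recursion of `J₁`.
  A-good : ∀ {p} Rs → Prime p → ∀ y → y ℕ.≤ X → (+ p - 1ℤ) * A Rs y ≤ (+ p - 1ℤ) * A (p ∷ Rs) y + A (p ∷ Rs) (y ÷ p)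
  A-good {p} Rs pp y hy = A-good-step Rs y pp hy (A-bad Rs pp (y ÷ p) (ℕP.≤-trans (÷-≤x y p) hy))

  harmonic-lower : ∀ j → j ℕ.≤ T → V * (1ℤ + + j) ≤ + 2 * ∑ (2 ^ j) w
  harmonic-lower zero _ = lin 2 (λ v a → a ≡' v ⇒ κ 0 ≤' v ⇒ v ⊗ (κ 1 ⊕ κ 0) ≤' κ 2 ⊗ (κ 0 ⊕ a)) tt V (w 1) w1≡V (≤-trans pos≥0 V≥1)
  harmonic-lower (suc j) hj = lin 5 (λ v j a b c → v ⊗ (κ 1 ⊕ j) ≤' κ 2 ⊗ a ⇒ b ≡' a ⊕ c ⇒ v ≤' κ 2 ⊗ c ⇒ v ⊗ (κ 1 ⊕ (κ 1 ⊕ j)) ≤' κ 2 ⊗ b) tt V (+ j) (∑ (2 ^ j) w) (∑ (2 ^ suc j) w) (∑ (2 ^ j) (λ n → w (2 ^ j ℕ.+ n)))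
    (harmonic-lower j (<⇒≤ hj)) (trans (cong (λ z → ∑ z w) double) (∑-split (2 ^ j) (2 ^ j) w)) half
    where
    double : 2 ^ suc j ≡ 2 ^ j ℕ.+ 2 ^ j
    double = linℕ 1 (λ a → κ 2 ⊗ a ≡' a ⊕ a) tt (2 ^ j)
    half : V ≤ + 2 * ∑ (2 ^ j) (λ n → w (2 ^ j ℕ.+ n))
    half = ≤-trans (≤-reflexive (sym (trans (cong (+ 2 *_) (∑-const (2 ^ j) (w (2 ^ suc j)))) (trans (lin 4 (λ a w b v → b ≡' κ 2 ⊗ a ⇒ w ⊗ b ≡' w ⊗ (κ 2 ⊗ a) ⇒ w ⊗ b ≡' v ⇒ κ 2 ⊗ (a ⊗ w) ≡' v) tt (+ (2 ^ j)) (w (2 ^ suc j)) (+ (2 ^ suc j)) V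
      (pos-* 2 (2 ^ j)) (cong (w (2 ^ suc j) *_) (pos-* 2 (2 ^ j))) (w-* (2^≥1 (suc j)) (^-monoʳ-≤ 2 hj))) refl))))
      (*-monoˡ pos≥0 (∑-mono (2 ^ j) λ n a b → w-anti (ℕP.≤-trans (2^≥1 j) (m≤m+n _ n)) (ℕP.≤-trans (ℕP.+-monoʳ-≤ (2 ^ j) b) (ℕP.≤-reflexive (sym double)))))

-- A lower bound for the sieve sum

module Range (h : ℕ) where

  open Selection h

  pick : ∀ {p} → Dec (OddPrime p) → Dec (p ∣ h) → List ℕ → List ℕ
  pick {p} (yes _) (no _) P = p ∷ P
  pick (yes _) (yes _) P = P
  pick (no _) _ P = P

  good : ℕ → List ℕ
  good zero = []
  good (suc n) = pick (oddPrime? (suc n)) (suc n ∣? h) (good n)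

  factor : ∀ {p} → Dec (OddPrime p) → Dec (p ∣ h) → ℤ → ℤ → ℤ
  factor (yes _) (yes _) c a = c * a
  factor (yes _) (no _) c a = a
  factor (no _) _ c a = a

  -- Products of p and of p - 1 over the odd primes p ∣ h up to R, which the sieve has to leave out.
  Πb Qb : ℕ → ℤ
  Πb zero = 1ℤ
  Πb (suc n) = factor (oddPrime? (suc n)) (suc n ∣? h) (+ suc n) (Πb n)
  Qb zero = 1ℤ
  Qb (suc n) = factor (oddPrime? (suc n)) (suc n ∣? h) (+ suc n - 1ℤ) (Qb n)

  good-Good : ∀ R → All Good (good R)
  good-Good zero = []
  good-Good (suc n) with oddPrime? (suc n) | suc n ∣? h
  ... | yes (pp , h3) | no nd = (pp , h3 , nd) ∷ good-Good n
  ... | yes _ | yes _ = good-Good n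
  ... | no _ | _ = good-Good n

  good-≤ : ∀ R → All (ℕ._≤ R) (good R)
  good-≤ zero = []
  good-≤ (suc n) with oddPrime? (suc n) | suc n ∣? h
  ... | yes _ | no _ = ℕP.≤-refl ∷ All.map m≤n⇒m≤1+n (good-≤ n)
  ... | yes _ | yes _ = All.map m≤n⇒m≤1+n (good-≤ n)
  ... | no _ | _ = All.map m≤n⇒m≤1+n (good-≤ n)

  good-Distinct : ∀ R → Distinct (good R)
  good-Distinct zero = []
  good-Distinct (suc n) with oddPrime? (suc n) | suc n ∣? h
  ... | yes _ | no _ = All.map (λ { le refl → ℕP.<⇒≱ ℕP.≤-refl le }) (good-≤ n) ∷ good-Distinct n
  ... | yes _ | yes _ = good-Distinct n
  ... | no _ | _ = good-Distinct n

  Q≥1 : ∀ {P} → All Good P → 1ℤ ≤ Q P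
  Q≥1 [] = ≤-refl
  Q≥1 (g ∷ gs) = *-≥1 (p-2≥1 g) (Q≥1 gs)

  J-nonneg : ∀ {P} → All Good P → ∀ y n → 0ℤ ≤ J P y n
  J-nonneg [] zero n = ≤-refl
  J-nonneg [] (suc y) n = pos≥0
  J-nonneg (g ∷ gs) y n = +-mono-≤ (*-nonneg (p-2≥0 g) (J-nonneg gs y n)) (*-nonneg pos≥0 (J-nonneg gs _ n))

  J-mono : ∀ {P} → All Good P → ∀ {y z} n → y ℕ.≤ z → J P y n ≤ J P z n
  J-mono [] {zero} {z} n h = J-nonneg [] z n
  J-mono [] {suc y} {suc z} n h = ≤-refl
  J-mono (g ∷ gs) n h = +-mono-≤ (*-monoˡ (p-2≥0 g) (J-mono gs n h)) (*-monoˡ pos≥0 (J-mono gs n (÷-mono (prime≥1 (proj₁ g)) h)))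

  J≥Q : ∀ {P} → All Good P → ∀ {y} n → 1 ℕ.≤ y → Q P ≤ J P y n
  J≥Q [] {suc y} n h = ≤-refl
  J≥Q (g ∷ gs) {y} n h = ≤-trans (*-monoˡ (p-2≥0 g) (J≥Q gs n h)) (≤+ʳ (*-nonneg pos≥0 (J-nonneg gs _ n)))

  -- The analogue of J for one excluded class: J₁ / Q₁ is the sum of 1/φ(d) over the d ≤ y dividing
  -- ∏ P. It can be compared with a harmonic sum, and its square with J.
  J₁ : List ℕ → ℕ → ℤ
  J₁ [] zero = 0ℤ
  J₁ [] (suc y) = 1ℤ
  J₁ (p ∷ P) y = (+ p - 1ℤ) * J₁ P y + J₁ P (y ÷ p)

  Q₁ : List ℕ → ℤ
  Q₁ [] = 1ℤ
  Q₁ (p ∷ P) = (+ p - 1ℤ) * Q₁ P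

  p-1≥1 : ∀ {p} → 2 ℕ.≤ p → 1ℤ ≤ + p - 1ℤ
  p-1≥1 {p} h2 = lin 1 (λ p → κ 2 ≤' p ⇒ κ 1 ≤' p ⊖ κ 1) tt (+ p) (+≤+ h2)

  p-1≥0 : ∀ {p} → 2 ℕ.≤ p → 0ℤ ≤ + p - 1ℤ
  p-1≥0 h = ≤-trans pos≥0 (p-1≥1 h)

  Q₁≥1 : ∀ {P} → All Good P → 1ℤ ≤ Q₁ P
  Q₁≥1 [] = ≤-refl
  Q₁≥1 (g ∷ gs) = *-≥1 (p-1≥1 (prime≥2 (proj₁ g))) (Q₁≥1 gs)

  J₁-nonneg : ∀ {P} → All Good P → ∀ y → 0ℤ ≤ J₁ P y
  J₁-nonneg [] zero = ≤-refl
  J₁-nonneg [] (suc y) = pos≥0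
  J₁-nonneg (g ∷ gs) y = +-mono-≤ (*-nonneg (p-1≥0 (prime≥2 (proj₁ g))) (J₁-nonneg gs y)) (J₁-nonneg gs _)

  J₁-mono : ∀ {P} → All Good P → ∀ {y z} → y ℕ.≤ z → J₁ P y ≤ J₁ P z
  J₁-mono [] {zero} {z} h = J₁-nonneg [] z
  J₁-mono [] {suc y} {suc z} h = ≤-refl
  J₁-mono (g ∷ gs) h = +-mono-≤ (*-monoˡ (p-1≥0 (prime≥2 (proj₁ g))) (J₁-mono gs h)) (J₁-mono gs (÷-mono (prime≥1 (proj₁ g)) h))

  J₁-square-step : ∀ p Q K K' U A A' B B' → 0ℤ ≤ p - + 2 → 0ℤ ≤ Q → 0ℤ ≤ A → 0ℤ ≤ A' → 0ℤ ≤ B → 0ℤ ≤ B' → B ≤ A → Q * (A * A') ≤ K * U → Q * (A * B') ≤ K' * U → Q * (B * A') ≤ K' * U →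
    (p - + 2) * Q * (((p - 1ℤ) * A + B) * ((p - 1ℤ) * A' + B')) ≤ ((p - + 2) * K + + 2 * K') * ((p - 1ℤ) * (p - 1ℤ) * U)
  J₁-square-step p Q K K' U A A' B B' hc hQ hA hA' hB hB' hBA h₁ h₂ h₃ =
    lin 9 (λ p Q K K' U A A' B B' → (p ⊖ κ 2) ⊗ ((p ⊖ κ 1) ⊗ (p ⊖ κ 1)) ⊗ (Q ⊗ (A ⊗ A')) ≤' (p ⊖ κ 2) ⊗ ((p ⊖ κ 1) ⊗ (p ⊖ κ 1)) ⊗ (K ⊗ U)
       ⇒ (p ⊖ κ 1) ⊗ (p ⊖ κ 1) ⊗ (Q ⊗ (A ⊗ B')) ≤' (p ⊖ κ 1) ⊗ (p ⊖ κ 1) ⊗ (K' ⊗ U)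
       ⇒ (p ⊖ κ 1) ⊗ (p ⊖ κ 1) ⊗ (Q ⊗ (B ⊗ A')) ≤' (p ⊖ κ 1) ⊗ (p ⊖ κ 1) ⊗ (K' ⊗ U)
       ⇒ (p ⊖ κ 2) ⊗ Q ⊗ B' ⊗ B ≤' (p ⊖ κ 2) ⊗ Q ⊗ B' ⊗ A
       ⇒ κ 0 ≤' Q ⊗ (A ⊗ B') ⇒ κ 0 ≤' (p ⊖ κ 1) ⊗ (Q ⊗ (B ⊗ A'))
       ⇒ (p ⊖ κ 2) ⊗ Q ⊗ (((p ⊖ κ 1) ⊗ A ⊕ B) ⊗ ((p ⊖ κ 1) ⊗ A' ⊕ B')) ≤' ((p ⊖ κ 2) ⊗ K ⊕ κ 2 ⊗ K') ⊗ ((p ⊖ κ 1) ⊗ (p ⊖ κ 1) ⊗ U)) tt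
      p Q K K' U A A' B B' (*-monoˡ (*-nonneg hc hd²) h₁) (*-monoˡ hd² h₂) (*-monoˡ hd² h₃) (*-monoˡ (*-nonneg (*-nonneg hc hQ) hB') hBA) (*-nonneg hQ (*-nonneg hA hB')) (*-nonneg hd (*-nonneg hQ (*-nonneg hB hA')))
    where
    hd : 0ℤ ≤ p - 1ℤ
    hd = lin 1 (λ p → κ 0 ≤' p ⊖ κ 2 ⇒ κ 0 ≤' p ⊖ κ 1) tt p hc
    hd² : 0ℤ ≤ (p - 1ℤ) * (p - 1ℤ)
    hd² = *-nonneg hd hd

  -- After division by the Q this says that the product of the sums over d ≤ y and e ≤ y′ is at most
  -- the sum for J up to y y′. At each prime it reduces to (1 + 1/(p - 1))² ≤ 1 + 2/(p - 2).
  J₁-square : ∀ {P} → All Good P → ∀ y y' → Q P * (J₁ P y * J₁ P y') ≤ J₀ P (y ℕ.* y') * (Q₁ P * Q₁ P)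
  J₁-square [] zero y' = ≤-reflexive (trans (cong (1ℤ *_) (*-zeroˡ (J₁ [] y'))) (trans (*-zeroʳ 1ℤ) (sym (*-zeroˡ (1ℤ * 1ℤ)))))
  J₁-square [] (suc y) zero = ≤-reflexive (trans (cong (1ℤ *_) (*-zeroʳ 1ℤ)) (trans (*-zeroʳ 1ℤ) (sym (trans (cong (λ z → J₀ [] z * (1ℤ * 1ℤ)) (ℕP.*-zeroʳ y)) (*-zeroˡ (1ℤ * 1ℤ))))))
  J₁-square [] (suc y) (suc y') = ≤-refl
  J₁-square {p ∷ P} (g ∷ gs) y y' = ≤-trans (J₁-square-step (+ p) (Q P) (J₀ P (y ℕ.* y')) (J₀ P ((y ℕ.* y') ÷ p)) (Q₁ P * Q₁ P) (J₁ P y) (J₁ P y') (J₁ P (y ÷ p)) (J₁ P (y' ÷ p)) (p-2≥0 g) (≤-trans pos≥0 (Q≥1 gs))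
      (J₁-nonneg gs y) (J₁-nonneg gs y') (J₁-nonneg gs (y ÷ p)) (J₁-nonneg gs (y' ÷ p)) (J₁-mono gs (÷-≤x y p)) (J₁-square gs y y')
      (≤-trans (J₁-square gs y (y' ÷ p)) (*-monoʳ U≥0 (J-mono gs 0 (≤-÷ hp (ℕP.≤-trans (ℕP.≤-reflexive (linℕ 3 (λ p y z → p ⊗ (y ⊗ z) ≡' y ⊗ (p ⊗ z)) tt p y (y' ÷ p))) (*-monoʳ-≤ y (÷-≤ hp ℕP.≤-refl)))))))
      (≤-trans (J₁-square gs (y ÷ p) y') (*-monoʳ U≥0 (J-mono gs 0 (≤-÷ hp (ℕP.≤-trans (ℕP.≤-reflexive (sym (ℕP.*-assoc p (y ÷ p) y'))) (*-monoˡ-≤ y' (÷-≤ hp ℕP.≤-refl))))))))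
    (≤-reflexive (lin 3 (λ a d q → a ⊗ (d ⊗ d ⊗ (q ⊗ q)) ≡' a ⊗ (d ⊗ q ⊗ (d ⊗ q))) tt ((+ p - + 2) * J₀ P (y ℕ.* y') + + 2 * J₀ P ((y ℕ.* y') ÷ p)) (+ p - 1ℤ) (Q₁ P)))
    where
    hp : 1 ℕ.≤ p
    hp = prime≥1 (proj₁ g)
    U≥0 : 0ℤ ≤ Q₁ P * Q₁ P
    U≥0 = *-nonneg (≤-trans pos≥0 (Q₁≥1 gs)) (≤-trans pos≥0 (Q₁≥1 gs))

  cube : ℕ → ℤ
  cube y = + y * (+ y * + y)

  cube-nonneg : ∀ y → 0ℤ ≤ cube y
  cube-nonneg y = *-nonneg (pos≥0 {y}) (*-nonneg (pos≥0 {y}) (pos≥0 {y}))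

  cube-÷ : ∀ y {p} → 1 ℕ.≤ p → + p * + p * (+ p * cube (y ÷ p)) ≤ cube y
  cube-÷ y {p} hp = ≤-trans (≤-reflexive (lin 2 (λ p z → p ⊗ p ⊗ (p ⊗ (z ⊗ (z ⊗ z))) ≡' p ⊗ z ⊗ (p ⊗ z ⊗ (p ⊗ z))) tt (+ p) (+ (y ÷ p)))) (*-mono nn le (*-nonneg nn nn) (*-mono nn le nn le))
    where
    nn : 0ℤ ≤ + p * + (y ÷ p)
    nn = *-nonneg (pos≥0 {p}) (pos≥0 {y ÷ p})
    le : + p * + (y ÷ p) ≤ + y
    le = subst (_≤ + y) (pos-* p (y ÷ p)) (+≤+ (÷-≤ hp ℕP.≤-refl))

  err-bound : ∀ R y → err (good R) y ≤ Q (good R) * (+ suc R * cube y)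
  err-bound zero zero = *-nonneg pos≥0 (*-nonneg pos≥0 (cube-nonneg 0))
  err-bound zero (suc y) = *-≥1 ≤-refl (*-≥1 ≤-refl (*-≥1 {+ suc y} one (*-≥1 {+ suc y} one one)))
    where
    one : 1ℤ ≤ + suc y
    one = +≤+ (s≤s z≤n)
  err-bound (suc n) y with oddPrime? (suc n) | suc n ∣? h
  ... | yes (pp , h3) | no nd = lin 6 (λ p q Y Y' e e' → (p ⊖ κ 2) ⊗ e ≤' (p ⊖ κ 2) ⊗ (q ⊗ (p ⊗ Y)) ⇒ p ⊗ p ⊗ e' ≤' p ⊗ p ⊗ (q ⊗ (p ⊗ Y')) ⇒ q ⊗ (p ⊗ p ⊗ (p ⊗ Y')) ≤' q ⊗ Y ⇒ q ⊗ Y ⊗ κ 1 ≤' q ⊗ Y ⊗ (p ⊖ κ 2)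
          ⇒ (p ⊖ κ 2) ⊗ e ⊕ p ⊗ p ⊗ e' ≤' (p ⊖ κ 2) ⊗ q ⊗ ((κ 1 ⊕ p) ⊗ Y)) tt
      (+ suc n) (Q (good n)) (cube y) (cube (y ÷ suc n)) (err (good n) y) (err (good n) (y ÷ suc n)) (*-monoˡ (p-2≥0 g) (err-bound n y)) (*-monoˡ (*-nonneg (pos≥0 {suc n}) (pos≥0 {suc n})) (err-bound n (y ÷ suc n)))
      (*-monoˡ q≥0 (cube-÷ y (s≤s z≤n))) (*-monoˡ (*-nonneg q≥0 (cube-nonneg y)) (p-2≥1 g))
    where
    g : Good (suc n)
    g = pp , h3 , nd
    q≥0 : 0ℤ ≤ Q (good n)
    q≥0 = ≤-trans pos≥0 (Q≥1 (good-Good n))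
  ... | yes _ | yes _ = ≤-trans (err-bound n y) (*-monoˡ (≤-trans pos≥0 (Q≥1 (good-Good n))) (*-monoʳ (cube-nonneg y) (+≤+ (n≤1+n _))))
  ... | no _ | _ = ≤-trans (err-bound n y) (*-monoˡ (≤-trans pos≥0 (Q≥1 (good-Good n))) (*-monoʳ (cube-nonneg y) (+≤+ (n≤1+n _))))

  Πb≥1 : ∀ R → 1ℤ ≤ Πb R
  Πb≥1 zero = ≤-refl
  Πb≥1 (suc n) with oddPrime? (suc n) | suc n ∣? h
  ... | yes _ | yes _ = *-≥1 {+ suc n} (+≤+ (s≤s z≤n)) (Πb≥1 n)
  ... | yes _ | no _ = Πb≥1 n
  ... | no _ | _ = Πb≥1 n

  Qb≥1 : ∀ R → 1ℤ ≤ Qb R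
  Qb≥1 zero = ≤-refl
  Qb≥1 (suc n) with oddPrime? (suc n) | suc n ∣? h
  ... | yes (pp , _) | yes _ = *-≥1 (p-1≥1 (prime≥2 pp)) (Qb≥1 n)
  ... | yes _ | no _ = Qb≥1 n
  ... | no _ | _ = Qb≥1 n

  Πb-Qb : ∀ R → Πb R * Πb R * ∏ (oddPrimes R) plain ≤ Qb R * Qb R * ∏ (oddPrimes R) (raised h)
  Πb-Qb zero = ≤-refl
  Πb-Qb (suc n) with oddPrime? (suc n) | suc n ∣? h
  ... | yes (pp , h3) | yes d = subst (λ i → + suc n * Πb n * (+ suc n * Πb n) * (+ suc n * D) ≤ (+ suc n - 1ℤ) * Qb n * ((+ suc n - 1ℤ) * Qb n) * ((+ suc n + + 6 * i) * N)) (sym (𝟙-yes (suc n ∣? h) d))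
      (lin 5 (λ p a d b e → p ⊗ p ⊗ p ⊗ (a ⊗ a ⊗ d) ≤' p ⊗ p ⊗ p ⊗ (b ⊗ b ⊗ e) ⇒ p ⊗ b ⊗ b ⊗ e ⊗ κ 3 ≤' p ⊗ b ⊗ b ⊗ e ⊗ p ⇒ κ 0 ≤' b ⊗ b ⊗ e ⇒ κ 0 ≤' p ⊗ (b ⊗ b ⊗ e)
        ⇒ p ⊗ a ⊗ (p ⊗ a) ⊗ (p ⊗ d) ≤' (p ⊖ κ 1) ⊗ b ⊗ ((p ⊖ κ 1) ⊗ b) ⊗ ((p ⊕ κ 6 ⊗ κ 1) ⊗ e)) tt (+ suc n) (Πb n) D (Qb n) N
        (*-monoˡ (*-nonneg (*-nonneg p≥0 p≥0) p≥0) (Πb-Qb n)) (*-monoˡ (*-nonneg (*-nonneg (*-nonneg p≥0 Qb≥0) Qb≥0) N≥0) (+≤+ h3)) (*-nonneg (*-nonneg Qb≥0 Qb≥0) N≥0) (*-nonneg p≥0 (*-nonneg (*-nonneg Qb≥0 Qb≥0) N≥0)))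
    where
    D N : ℤ
    D = ∏ (oddPrimes n) plain
    N = ∏ (oddPrimes n) (raised h)
    p≥0 : 0ℤ ≤ + suc n
    p≥0 = pos≥0
    Qb≥0 : 0ℤ ≤ Qb n
    Qb≥0 = ≤-trans pos≥0 (Qb≥1 n)
    N≥0 : 0ℤ ≤ N
    N≥0 = ∏-nonneg (oddPrimes n) (raised-nonneg h)
  ... | yes (pp , h3) | no nd = subst (λ i → Πb n * Πb n * (+ suc n * ∏ (oddPrimes n) plain) ≤ Qb n * Qb n * ((+ suc n + + 6 * i) * ∏ (oddPrimes n) (raised h))) (sym (𝟙-no (suc n ∣? h) nd))
      (lin 5 (λ p a d b e → p ⊗ (a ⊗ a ⊗ d) ≤' p ⊗ (b ⊗ b ⊗ e) ⇒ a ⊗ a ⊗ (p ⊗ d) ≤' b ⊗ b ⊗ ((p ⊕ κ 6 ⊗ κ 0) ⊗ e)) tt (+ suc n) (Πb n) (∏ (oddPrimes n) plain) (Qb n) (∏ (oddPrimes n) (raised h)) (*-monoˡ (pos≥0 {suc n}) (Πb-Qb n)))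
  ... | no _ | _ = Πb-Qb n

  module Comparison (ρ : ℕ) where

    open Bounded ρ
    open RoughSums ρ

    -- Rs sifts out 2 and all primes in (R, X]. Lowering R moves the odd primes into Rs, until at R
    -- = 0 only n = 1 is left.
    Covered : ℕ → List ℕ → Set
    Covered R Rs = ∀ {n p} → Prime p → p ℕ.≤ X → R < p ⊎ p ≡ 2 → Rough Rs n → ¬ p ∣ n

    Covered-∷ : ∀ {R Rs} → Covered (suc R) Rs → Covered R (suc R ∷ Rs)
    Covered-∷ {R} c {p = p} pp hX (inj₂ e) (_ ∷ r) d = c pp hX (inj₂ e) r d
    Covered-∷ {R} c {p = p} pp hX (inj₁ lt) (nd ∷ r) d with suc R ℕ.≟ p
    ... | yes refl = nd d
    ... | no ne = c pp hX (inj₁ (ℕP.≤∧≢⇒< lt ne)) r d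

    Covered-skip : ∀ {R Rs} → ¬ OddPrime (suc R) → Covered (suc R) Rs → Covered R Rs
    Covered-skip {R} nop c pp hX (inj₂ e) r d = c pp hX (inj₂ e) r d
    Covered-skip {R} nop c {p = p} pp hX (inj₁ lt) r d with suc R ℕ.≟ p
    ... | no ne = c pp hX (inj₁ (ℕP.≤∧≢⇒< lt ne)) r d
    ... | yes refl = c pp hX (inj₂ (ℕP.≤-antisym (≤-pred (≰⇒> λ h3 → nop (pp , h3))) (prime≥2 pp))) r d

    rough-base : ∀ {Rs} y → y ℕ.≤ X → Covered 0 Rs → A Rs y ≤ V * J₁ [] y
    rough-base zero hy c = ≤-reflexive (sym (*-zeroʳ V))
    rough-base {Rs} (suc y) hy c = ≤-trans (≤-reflexive (∑-single {k = 1} ℕP.≤-refl (s≤s z≤n) vanish))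
        (≤-trans (*-monoʳ (w-nonneg 1) (𝟙≤1 (rough? Rs 1))) (≤-reflexive (trans (*-identityˡ (w 1)) (trans w1≡V (sym (*-identityʳ V))))))
      where
      vanish : ∀ n → 1 ℕ.≤ n → n ℕ.≤ suc y → n ≢ 1 → 𝟙 (rough? Rs n) * w n ≡ 0ℤ
      vanish n h₁ h₂ ne with prime-divisor (ℕP.≤∧≢⇒< h₁ (ne ∘ sym))
      ... | p , pp , d = trans (cong (_* w n) (𝟙-no (rough? Rs n) λ r → c pp (ℕP.≤-trans (Dv.∣⇒≤ {{nz h₁}} d) (ℕP.≤-trans h₂ hy)) (inj₁ (prime≥1 pp)) r d)) (*-zeroˡ (w n))

    -- A good prime reproduces one step of the recursion of `J₁` by `A-good`; a prime dividing h
    -- costs the factor p / (p - 1) by `A-bad`.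
    rough-bound : ∀ R {Rs} y → y ℕ.≤ X → Covered R Rs → Q₁ (good R) * (Qb R * A Rs y) ≤ Πb R * (V * J₁ (good R) y)
    rough-bound zero {Rs} y hy c = ≤-trans (≤-reflexive (trans (*-identityˡ (1ℤ * A Rs y)) (*-identityˡ (A Rs y)))) (≤-trans (rough-base y hy c) (≤-reflexive (sym (*-identityˡ (V * J₁ [] y)))))
    rough-bound (suc n) {Rs} y hy c with oddPrime? (suc n) | suc n ∣? h
    ... | yes (pp , h3) | no nd = lin 10 (λ p q b a a' a'' u v j j' → q ⊗ b ⊗ ((p ⊖ κ 1) ⊗ a) ≤' q ⊗ b ⊗ ((p ⊖ κ 1) ⊗ a' ⊕ a'') ⇒ (p ⊖ κ 1) ⊗ (q ⊗ (b ⊗ a')) ≤' (p ⊖ κ 1) ⊗ (u ⊗ (v ⊗ j)) ⇒ q ⊗ (b ⊗ a'') ≤' u ⊗ (v ⊗ j')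
          ⇒ (p ⊖ κ 1) ⊗ q ⊗ (b ⊗ a) ≤' u ⊗ (v ⊗ ((p ⊖ κ 1) ⊗ j ⊕ j'))) tt
        (+ suc n) (Q₁ (good n)) (Qb n) (A Rs y) (A (suc n ∷ Rs) y) (A (suc n ∷ Rs) (y ÷ suc n)) (Πb n) V (J₁ (good n) y) (J₁ (good n) (y ÷ suc n))
        (*-monoˡ (*-nonneg (≤-trans pos≥0 (Q₁≥1 (good-Good n))) (≤-trans pos≥0 (Qb≥1 n))) (A-good Rs pp y hy))
        (*-monoˡ (p-1≥0 (prime≥2 pp)) (rough-bound n y hy (Covered-∷ c))) (rough-bound n (y ÷ suc n) (ℕP.≤-trans (÷-≤x y (suc n)) hy) (Covered-∷ c))
    ... | yes (pp , h3) | yes d = lin 8 (λ p q b a a' u v j → q ⊗ b ⊗ ((p ⊖ κ 1) ⊗ a) ≤' q ⊗ b ⊗ (p ⊗ a') ⇒ p ⊗ (q ⊗ (b ⊗ a')) ≤' p ⊗ (u ⊗ (v ⊗ j))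
          ⇒ q ⊗ ((p ⊖ κ 1) ⊗ b ⊗ a) ≤' p ⊗ u ⊗ (v ⊗ j)) tt
        (+ suc n) (Q₁ (good n)) (Qb n) (A Rs y) (A (suc n ∷ Rs) y) (Πb n) V (J₁ (good n) y)
        (*-monoˡ (*-nonneg (≤-trans pos≥0 (Q₁≥1 (good-Good n))) (≤-trans pos≥0 (Qb≥1 n))) (A-bad Rs pp y hy))
        (*-monoˡ (pos≥0 {suc n}) (rough-bound n y hy (Covered-∷ c)))
    ... | no no' | _ = rough-bound n y hy (Covered-skip no' c)

    prime-2 : Prime 2
    prime-2 = prime[2]

    J₁-lower : (1ℤ + + ρ) * (Q₁ (good X) * Qb X) ≤ + 4 * (Πb X * J₁ (good X) X)
    J₁-lower = *-cancel V≥1 (lin 8 (λ v r q b a a₂ u j → q ⊗ b ⊗ (v ⊗ (κ 1 ⊕ r)) ≤' q ⊗ b ⊗ (κ 2 ⊗ a) ⇒ q ⊗ b ⊗ ((κ 2 ⊖ κ 1) ⊗ a) ≤' q ⊗ b ⊗ (κ 2 ⊗ a₂) ⇒ q ⊗ (b ⊗ a₂) ≤' u ⊗ (v ⊗ j)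
        ⇒ v ⊗ ((κ 1 ⊕ r) ⊗ (q ⊗ b)) ≤' v ⊗ (κ 4 ⊗ (u ⊗ j))) tt V (+ ρ) (Q₁ (good X)) (Qb X) (A [] X) (A (2 ∷ []) X) (Πb X) (J₁ (good X) X)
        (*-monoˡ qb≥0 (≤-trans (harmonic-lower ρ ℕP.≤-refl) (≤-reflexive (cong (+ 2 *_) (∑-ext X λ n → sym (trans (cong (_* w n) (𝟙-yes (rough? [] n) [])) (*-identityˡ (w n))))))))
        (*-monoˡ qb≥0 (A-bad [] prime-2 X ℕP.≤-refl)) (rough-bound X X ℕP.≤-refl covered))
      where
      qb≥0 : 0ℤ ≤ Q₁ (good X) * Qb X
      qb≥0 = *-nonneg (≤-trans pos≥0 (Q₁≥1 (good-Good X))) (≤-trans pos≥0 (Qb≥1 X))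
      covered : Covered X (2 ∷ [])
      covered pp hX (inj₁ lt) _ d = contradiction hX (ℕP.<⇒≱ lt)
      covered pp hX (inj₂ refl) (nd ∷ []) d = nd d

    J-lower : (1ℤ + + ρ) * (1ℤ + + ρ) * (Q (good X) * (Qb X * Qb X)) ≤ + 16 * (Πb X * Πb X * J₀ (good X) (X ℕ.* X))
    J-lower = *-cancel {Q₁ (good X) * Q₁ (good X)} (*-≥1 (Q₁≥1 (good-Good X)) (Q₁≥1 (good-Good X)))
      (lin 7 (λ r q₁ q b u j₁ j → q ⊗ ((κ 1 ⊕ r) ⊗ (q₁ ⊗ b) ⊗ ((κ 1 ⊕ r) ⊗ (q₁ ⊗ b))) ≤' q ⊗ (κ 4 ⊗ (u ⊗ j₁) ⊗ (κ 4 ⊗ (u ⊗ j₁))) ⇒ u ⊗ u ⊗ (q ⊗ (j₁ ⊗ j₁)) ≤' u ⊗ u ⊗ (j ⊗ (q₁ ⊗ q₁))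
          ⇒ q₁ ⊗ q₁ ⊗ ((κ 1 ⊕ r) ⊗ (κ 1 ⊕ r) ⊗ (q ⊗ (b ⊗ b))) ≤' q₁ ⊗ q₁ ⊗ (κ 16 ⊗ (u ⊗ u ⊗ j))) tt
        (+ ρ) (Q₁ (good X)) (Q (good X)) (Qb X) (Πb X) (J₁ (good X) X) (J₀ (good X) (X ℕ.* X))
        (*-monoˡ (≤-trans pos≥0 (Q≥1 (good-Good X))) (*-mono nn J₁-lower nn J₁-lower)) (*-monoˡ (*-nonneg u≥0 u≥0) (J₁-square (good-Good X) X X)))
      where
      u≥0 : 0ℤ ≤ Πb X
      u≥0 = ≤-trans pos≥0 (Πb≥1 X)
      nn : 0ℤ ≤ (1ℤ + + ρ) * (Q₁ (good X) * Qb X)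
      nn = *-nonneg (pos≥0 {suc ρ}) (*-nonneg (≤-trans pos≥0 (Q₁≥1 (good-Good X))) (≤-trans pos≥0 (Qb≥1 X)))

    E : ℤ
    E = + suc X * cube (X ℕ.* X)

    sieve-bad : ∀ x → Z (good X) x * ((1ℤ + + ρ) * (1ℤ + + ρ)) * (Qb X * Qb X) ≤ + 16 * (Πb X * Πb X * (+ x + + 2 * (E * E)))
    sieve-bad x = *-cancel {Qg * Jg} (*-≥1 (Q≥1 gs) J≥1) (sieve-arith (Z (good X) x) (1ℤ + + ρ) (Qb X) (Πb X) Qg Jg (+ x) E (err (good X) (X ℕ.* X))
        (∑-nonneg x λ n _ _ → 𝟙-nonneg (sifted? (good X) n)) (≤-trans pos≥0 (Πb≥1 X)) (≤-trans pos≥0 (Q≥1 gs)) (J≥Q gs 0 XX≥1) (err-nonneg gs (X ℕ.* X)) (err-bound X (X ℕ.* X))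
        (selberg-upper gs (good-Distinct X) x (X ℕ.* X)) J-lower)
      where
      Qg Jg : ℤ
      Qg = Q (good X)
      Jg = J₀ (good X) (X ℕ.* X)
      gs : All Good (good X)
      gs = good-Good X
      XX≥1 : 1 ℕ.≤ X ℕ.* X
      XX≥1 = *-mono-≤ (2^≥1 ρ) (2^≥1 ρ)
      J≥1 : 1ℤ ≤ Jg
      J≥1 = ≤-trans (Q≥1 gs) (J≥Q gs 0 XX≥1)
      sieve-arith : ∀ z r b u q j x E e → 0ℤ ≤ z → 0ℤ ≤ u → 0ℤ ≤ q → q ≤ j → 0ℤ ≤ e → e ≤ q * E → z * (j * j) ≤ x * (q * j) + + 2 * (e * e) → r * r * (q * (b * b)) ≤ + 16 * (u * u * j) →
        q * j * (z * (r * r) * (b * b)) ≤ q * j * (+ 16 * (u * u * (x + + 2 * (E * E))))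
      sieve-arith z r b u q j x E e hz hu hq hj he hE hs hJ = lin 9 (λ z r b u q j x E e → z ⊗ j ⊗ (r ⊗ r ⊗ (q ⊗ (b ⊗ b))) ≤' z ⊗ j ⊗ (κ 16 ⊗ (u ⊗ u ⊗ j)) ⇒ u ⊗ u ⊗ (z ⊗ (j ⊗ j)) ≤' u ⊗ u ⊗ (x ⊗ (q ⊗ j) ⊕ κ 2 ⊗ (e ⊗ e))
           ⇒ u ⊗ u ⊗ (e ⊗ e) ≤' u ⊗ u ⊗ (q ⊗ E ⊗ (q ⊗ E)) ⇒ u ⊗ u ⊗ q ⊗ E ⊗ E ⊗ q ≤' u ⊗ u ⊗ q ⊗ E ⊗ E ⊗ j ⇒ q ⊗ j ⊗ (z ⊗ (r ⊗ r) ⊗ (b ⊗ b)) ≤' q ⊗ j ⊗ (κ 16 ⊗ (u ⊗ u ⊗ (x ⊕ κ 2 ⊗ (E ⊗ E))))) tt z r b u q j x E e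
          (*-monoˡ (*-nonneg hz (≤-trans hq hj)) hJ) (*-monoˡ uu hs) (*-monoˡ uu (*-mono he hE he hE))
          (*-monoˡ (subst (0ℤ ≤_) (lin 3 (λ u q E → u ⊗ u ⊗ q ⊗ (E ⊗ E) ≡' u ⊗ u ⊗ q ⊗ E ⊗ E) tt u q E) (*-nonneg (*-nonneg uu hq) (square≥0 E))) hj)
        where
        uu : 0ℤ ≤ u * u
        uu = *-nonneg hu hu

    -- The count is O(x / ρ²) times the product of 1 + 6/q over q ∣ h. Its denominators are cleared
    -- over all odd primes up to X, so that the bounds for different h can be added.
    sieve-bound : ∀ x → Z (good X) x * ((1ℤ + + ρ) * (1ℤ + + ρ)) * ∏ (oddPrimes X) plain ≤ + 16 * (∏ (oddPrimes X) (raised h) * (+ x + + 2 * (E * E)))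
    sieve-bound x = *-cancel {Πb X * Πb X} (*-≥1 (Πb≥1 X) (Πb≥1 X)) (lin 6 (λ u b d n z y → z ⊗ (u ⊗ u ⊗ d) ≤' z ⊗ (b ⊗ b ⊗ n) ⇒ n ⊗ (z ⊗ (b ⊗ b)) ≤' n ⊗ (κ 16 ⊗ (u ⊗ u ⊗ y)) ⇒ u ⊗ u ⊗ (z ⊗ d) ≤' u ⊗ u ⊗ (κ 16 ⊗ (n ⊗ y))) tt
      (Πb X) (Qb X) (∏ (oddPrimes X) plain) (∏ (oddPrimes X) (raised h)) (Z (good X) x * ((1ℤ + + ρ) * (1ℤ + + ρ))) (+ x + + 2 * (E * E))
      (*-monoˡ (*-nonneg (∑-nonneg x λ n _ _ → 𝟙-nonneg (sifted? (good X) n)) (square≥0 (1ℤ + + ρ))) (Πb-Qb X)) (*-monoˡ (∏-nonneg (oddPrimes X) (raised-nonneg h)) (sieve-bad x)))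

-- Romanoff's estimate

odd-list-product : ∀ {p P} → Prime p → All Prime P → All (λ q → p ≢ q) P → Coprime p (product P)
odd-list-product pp [] [] (_ , d1) = Dv.∣1⇒≡1 d1
odd-list-product {p} {q ∷ P} pp (pq ∷ ps) (ne ∷ nes) = Co.sym (coprime-* (λ {k} → Co.sym (coprime-prime pq λ d → ne (sym (prime-∣-prime pq pp d))) {k}) (λ {k} → Co.sym (odd-list-product pp ps nes) {k}))

least : ∀ {P : ℕ → Set} (P? : ∀ n → Dec (P n)) K → (∀ m → 1 ℕ.≤ m → m ℕ.≤ K → ¬ P m) ⊎ (∃ λ t → 1 ℕ.≤ t × t ℕ.≤ K × P t × (∀ m → 1 ℕ.≤ m → m < t → ¬ P m))
least P? zero = inj₁ λ m h₁ h₂ → contradiction (ℕP.≤-trans h₁ h₂) λ ()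
least P? (suc K) with least P? K | P? (suc K)
... | inj₂ (t , h₁ , h₂ , pt , min) | _ = inj₂ (t , h₁ , m≤n⇒m≤1+n h₂ , pt , min)
... | inj₁ none | yes p = inj₂ (suc K , s≤s z≤n , ℕP.≤-refl , p , λ m h₁ h₂ → none m h₁ (≤-pred h₂))
... | inj₁ none | no np = inj₁ λ m h₁ h₂ → go m h₁ (ℕP.m≤n⇒m<n∨m≡n h₂)
  where
  go : ∀ m → 1 ℕ.≤ m → m < suc K ⊎ m ≡ suc K → _
  go m h₁ (inj₁ lt) = none m h₁ (≤-pred lt)
  go m h₁ (inj₂ refl) = np

∏𝟙-case : ∀ {P : ℕ → Set} (d : ∀ q → Dec (P q)) T → (All P T × ∏ T (λ q → 𝟙 (d q)) ≡ 1ℤ) ⊎ (¬ All P T × ∏ T (λ q → 𝟙 (d q)) ≡ 0ℤ)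
∏𝟙-case d [] = inj₁ ([] , refl)
∏𝟙-case d (q ∷ T) with 𝟙-case (d q) | ∏𝟙-case d T
... | inj₁ (p , i) | inj₁ (ps , j) rewrite i | j = inj₁ (p ∷ ps , *-identityˡ 1ℤ)
... | inj₁ (p , i) | inj₂ (n , j) rewrite i | j = inj₂ ((λ { (_ ∷ ps) → n ps }) , *-zeroʳ 1ℤ)
... | inj₂ (n , i) | _ rewrite i = inj₂ ((λ { (p ∷ _) → n p }) , *-zeroˡ (∏ T (λ q → 𝟙 (d q))))

mersenne : ℕ → ℕ
mersenne m = 2 ^ m ℕ.∸ 1

suc-mersenne : ∀ m → suc (mersenne m) ≡ 2 ^ m
suc-mersenne m = m+[n∸m]≡n (2^≥1 m)

mersenne-+ : ∀ t r → mersenne (t ℕ.+ r) ≡ 2 ^ r ℕ.* mersenne t ℕ.+ mersenne r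
mersenne-+ t r = ℕP.suc-injective (trans (suc-mersenne (t ℕ.+ r)) (trans (^-distribˡ-+-* 2 t r)
  (linℕ 4 (λ a b x y → a ≡' κ 1 ⊕ x ⇒ b ≡' κ 1 ⊕ y ⇒ a ⊗ b ≡' (κ 1 ⊕ x) ⊗ b ⇒ a ⊗ b ≡' κ 1 ⊕ (b ⊗ x ⊕ y)) tt (2 ^ t) (2 ^ r) (mersenne t) (mersenne r)
    (sym (suc-mersenne t)) (sym (suc-mersenne r)) (cong (ℕ._* 2 ^ r) (sym (suc-mersenne t))))))

∣-mersenne-diff : ∀ {q} t r → q ∣ mersenne t → q ∣ mersenne (t ℕ.+ r) → q ∣ mersenne r
∣-mersenne-diff {q} t r d e = Dv.∣m+n∣m⇒∣n (subst (q ∣_) (mersenne-+ t r) e) (Dv.∣n⇒∣m*n (2 ^ r) d)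

AllDiv : List ℕ → ℕ → Set
AllDiv T m = All (λ q → q ∣ mersenne m) T

period-∣ : ∀ {T t} → 1 ℕ.≤ t → AllDiv T t → (∀ m → 1 ℕ.≤ m → m < t → ¬ AllDiv T m) → ∀ m → AllDiv T m → t ∣ m
period-∣ {T} {t} ht at min = <-rec (λ m → AllDiv T m → t ∣ m) go
  where
  go : ∀ m → (∀ {r} → r < m → AllDiv T r → t ∣ r) → AllDiv T m → t ∣ m
  go zero ih am = t Dv.∣0
  go (suc m) ih am with t ℕ.≤? suc m
  ... | no nle = contradiction am (min (suc m) (s≤s z≤n) (≰⇒> nle))
  ... | yes le = subst (t ∣_) split (Dv.∣m∣n⇒∣m+n Dv.∣-refl (ih (ℕP.∸-monoʳ-< ht le) (All.map (λ { {q} (d , e) → ∣-mersenne-diff t (suc m ℕ.∸ t) d (subst (λ z → q ∣ mersenne z) (sym split) e) }) (All.zip (at , am)))))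
    where
    split : t ℕ.+ (suc m ℕ.∸ t) ≡ suc m
    split = m+[n∸m]≡n le

-- For odd q: the order of 2 modulo q is at most i.
Seen : ℕ → ℕ → Set
Seen i q = ∃ λ l → l < i × q ∣ mersenne (suc l)

seen? : ∀ i q → Dec (Seen i q)
seen? i q = anyUpTo? (λ l → q ∣? mersenne (suc l)) i

4^-interval : ∀ J {t} → 1 ℕ.≤ t → t < 4 ^ suc J → ∃ λ j → j ℕ.≤ J × 4 ^ j ℕ.≤ t × t < 4 ^ suc j
4^-interval zero h₁ h₂ = 0 , z≤n , h₁ , h₂
4^-interval (suc J) {t} h₁ h₂ with 4 ^ suc J ℕ.≤? t
... | yes le = suc J , ℕP.≤-refl , le , h₂
... | no nle with 4^-interval J h₁ (≰⇒> nle)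
...   | j , a , b , c = j , m≤n⇒m≤1+n a , b , c

-- The exponents m with q ∣ 2^m − 1 for all q ∈ T are the multiples of a period t.
count-bound : ∀ T J → ∑ (4 ^ J) (λ m → ∏ T (λ q → 𝟙 (q ∣? mersenne m))) ≤ ∑ (suc J) (λ j → + (4 ^ (suc J ℕ.∸ j)) * ∏ T (λ q → 𝟙 (seen? (4 ^ j) q)))
count-bound T J = go (least (λ m → All.all? (λ q → q ∣? mersenne m) T) K)
  where
  K : ℕ
  K = 4 ^ J
  a : ℕ → ℤ
  a m = ∏ T (λ q → 𝟙 (q ∣? mersenne m))
  b : ℕ → ℤ
  b j = ∏ T (λ q → 𝟙 (seen? (4 ^ j) q))
  term≥0 : ∀ j → 0ℤ ≤ + (4 ^ (suc J ℕ.∸ j)) * b j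
  term≥0 j = *-nonneg pos≥0 (∏-nonneg T λ q → 𝟙-nonneg (seen? (4 ^ j) q))
  go : (∀ m → 1 ℕ.≤ m → m ℕ.≤ K → ¬ AllDiv T m) ⊎ (∃ λ t → 1 ℕ.≤ t × t ℕ.≤ K × AllDiv T t × (∀ m → 1 ℕ.≤ m → m < t → ¬ AllDiv T m)) → ∑ K a ≤ ∑ (suc J) (λ j → + (4 ^ (suc J ℕ.∸ j)) * b j)
  go (inj₁ none) = ≤-trans (≤-reflexive (∑-zero K zero-term)) (∑-nonneg (suc J) λ j _ _ → term≥0 j)
    where
    zero-term : ∀ m → 1 ℕ.≤ m → m ℕ.≤ K → a m ≡ 0ℤ
    zero-term m h₁ h₂ with ∏𝟙-case (λ q → q ∣? mersenne m) T
    ... | inj₁ (am , _) = contradiction am (none m h₁ h₂)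
    ... | inj₂ (_ , e) = e
  go (inj₂ (t , ht , t≤K , at , min)) with 4^-interval J ht (≤-<-trans t≤K (^-monoʳ-< 4 (s≤s (s≤s z≤n)) (ℕP.n<1+n J)))
  ... | j , j≤J , lo , hi = ≤-trans count (≤-trans (≤-reflexive (sym b≡)) (∑-term {k = suc j} (s≤s z≤n) (s≤s j≤J) λ j _ _ → term≥0 j))
    where
    a≤ : ∀ m → a m ≤ 𝟙 (t ∣? m) * 1ℤ
    a≤ m with ∏𝟙-case (λ q → q ∣? mersenne m) T
    ... | inj₁ (am , e) = ≤-reflexive (trans e (sym (trans (*-identityʳ _) (𝟙-yes (t ∣? m) (period-∣ ht at min m am)))))
    ... | inj₂ (_ , e) = ≤-trans (≤-reflexive e) (*-nonneg (𝟙-nonneg (t ∣? m)) pos≥0)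
    K÷t : K ÷ t ℕ.≤ 4 ^ (J ℕ.∸ j)
    K÷t = *-cancelˡ-≤ t {{nz ht}} (ℕP.≤-trans (÷-≤ ht ℕP.≤-refl) (ℕP.≤-trans (ℕP.≤-reflexive (trans (cong (4 ^_) (sym (m+[n∸m]≡n j≤J))) (^-distribˡ-+-* 4 j (J ℕ.∸ j)))) (*-monoˡ-≤ (4 ^ (J ℕ.∸ j)) lo)))
    count : ∑ K a ≤ + (4 ^ (J ℕ.∸ j))
    count = ≤-trans (∑-mono K λ m _ _ → a≤ m) (≤-trans (≤-reflexive (trans (sym (∑-multiples K (λ _ → 1ℤ) ht)) (trans (∑-const (K ÷ t) 1ℤ) (*-identityʳ (+ (K ÷ t)))))) (+≤+ K÷t))
    b≡ : + (4 ^ (suc J ℕ.∸ suc j)) * b (suc j) ≡ + (4 ^ (J ℕ.∸ j))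
    b≡ with ∏𝟙-case (seen? (4 ^ suc j)) T
    ... | inj₁ (_ , e) = trans (cong (+ (4 ^ (J ℕ.∸ j)) *_) e) (*-identityʳ _)
    ... | inj₂ (n , _) = contradiction (All.map (λ {q} d → ℕ.pred t , ≤-<-trans (ℕP.pred[n]≤n {t}) hi , subst (λ z → q ∣ mersenne z) (sym (ℕP.suc-pred t {{nz ht}})) d) at) n

seenRaised : ℕ → ℕ → ℤ
seenRaised i q = + q + + 6 * 𝟙 (seen? i q)

-- The product is multiplied out: each q either contributes the factor q or moves to T with the
-- factor 6. `count-bound` settles every set T, and folding the sums up again turns the condition q
-- ∣ 2^m - 1 into a bound for the order of 2 modulo q.
expand-bound : ∀ L T J → ∑ (4 ^ J) (λ m → ∏ L (raised (mersenne m)) * ∏ T (λ q → 𝟙 (q ∣? mersenne m)))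
  ≤ ∑ (suc J) (λ j → + (4 ^ (suc J ℕ.∸ j)) * (∏ L (seenRaised (4 ^ j)) * ∏ T (λ q → 𝟙 (seen? (4 ^ j) q))))
expand-bound [] T J = ≤-trans (≤-reflexive (∑-ext (4 ^ J) λ m → *-identityˡ _)) (≤-trans (count-bound T J)
  (≤-reflexive (∑-ext (suc J) λ j → cong (+ (4 ^ (suc J ℕ.∸ j)) *_) (sym (*-identityˡ _)))))
expand-bound (q ∷ L) T J = ≤-trans (≤-reflexive lhs) (≤-trans (+-mono-≤ (*-monoˡ {+ q} pos≥0 (expand-bound L T J)) (*-monoˡ {+ 6} pos≥0 (expand-bound L (q ∷ T) J))) (≤-reflexive (sym rhs)))
  where
  K : ℕ
  K = 4 ^ J
  lhs : ∑ K (λ m → ∏ (q ∷ L) (raised (mersenne m)) * ∏ T (λ q → 𝟙 (q ∣? mersenne m))) ≡ + q * ∑ K (λ m → ∏ L (raised (mersenne m)) * ∏ T (λ q → 𝟙 (q ∣? mersenne m))) + + 6 * ∑ K (λ m → ∏ L (raised (mersenne m)) * ∏ (q ∷ T) (λ q → 𝟙 (q ∣? mersenne m)))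
  lhs = trans (∑-ext K λ m → lin 4 (λ q i l t → (q ⊕ κ 6 ⊗ i) ⊗ l ⊗ t ≡' q ⊗ (l ⊗ t) ⊕ κ 6 ⊗ (l ⊗ (i ⊗ t))) tt (+ q) (𝟙 (q ∣? mersenne m)) (∏ L (raised (mersenne m))) (∏ T (λ q → 𝟙 (q ∣? mersenne m))))
    (trans (∑-+ K _ _) (cong₂ _+_ (∑-*ˡ K (+ q) _) (∑-*ˡ K (+ 6) _)))
  rhs : ∑ (suc J) (λ j → + (4 ^ (suc J ℕ.∸ j)) * (∏ (q ∷ L) (seenRaised (4 ^ j)) * ∏ T (λ q → 𝟙 (seen? (4 ^ j) q))))
    ≡ + q * ∑ (suc J) (λ j → + (4 ^ (suc J ℕ.∸ j)) * (∏ L (seenRaised (4 ^ j)) * ∏ T (λ q → 𝟙 (seen? (4 ^ j) q)))) + + 6 * ∑ (suc J) (λ j → + (4 ^ (suc J ℕ.∸ j)) * (∏ L (seenRaised (4 ^ j)) * ∏ (q ∷ T) (λ q → 𝟙 (seen? (4 ^ j) q))))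
  rhs = trans (∑-ext (suc J) λ j → lin 5 (λ q i l t c → c ⊗ ((q ⊕ κ 6 ⊗ i) ⊗ l ⊗ t) ≡' q ⊗ (c ⊗ (l ⊗ t)) ⊕ κ 6 ⊗ (c ⊗ (l ⊗ (i ⊗ t)))) tt (+ q) (𝟙 (seen? (4 ^ j) q)) (∏ L (seenRaised (4 ^ j))) (∏ T (λ q → 𝟙 (seen? (4 ^ j) q))) (+ (4 ^ (suc J ℕ.∸ j))))
    (trans (∑-+ (suc J) _ _) (cong₂ _+_ (∑-*ˡ (suc J) (+ q) _) (∑-*ˡ (suc J) (+ 6) _)))

module Marked {P : ℕ → Set} (d : ∀ q → Dec (P q)) where

  G : ℕ → ℤ
  G R = ∏ (oddPrimes R) (λ q → + q + + 6 * 𝟙 (d q))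

  D : ℕ → ℤ
  D R = ∏ (oddPrimes R) plain

  both : ∀ {q} → Dec (OddPrime q) → Dec (P q) → List ℕ → List ℕ
  both {q} (yes _) (yes _) L = q ∷ L
  both (yes _) (no _) L = L
  both (no _) _ L = L

  marked : ℕ → ℕ → List ℕ
  marked Y zero = []
  marked Y (suc r) = both (oddPrime? (suc r ℕ.+ Y)) (d (suc r ℕ.+ Y)) (marked Y r)

  marked-odd : ∀ Y r → All OddPrime (marked Y r)
  marked-odd Y zero = []
  marked-odd Y (suc r) with oddPrime? (suc r ℕ.+ Y) | d (suc r ℕ.+ Y)
  ... | yes o | yes _ = o ∷ marked-odd Y r
  ... | yes _ | no _ = marked-odd Y r
  ... | no _ | _ = marked-odd Y r

  marked-P : ∀ Y r → All P (marked Y r)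
  marked-P Y zero = []
  marked-P Y (suc r) with oddPrime? (suc r ℕ.+ Y) | d (suc r ℕ.+ Y)
  ... | yes _ | yes p = p ∷ marked-P Y r
  ... | yes _ | no _ = marked-P Y r
  ... | no _ | _ = marked-P Y r

  marked-≤ : ∀ Y r → All (ℕ._≤ r ℕ.+ Y) (marked Y r)
  marked-≤ Y zero = []
  marked-≤ Y (suc r) with oddPrime? (suc r ℕ.+ Y) | d (suc r ℕ.+ Y)
  ... | yes _ | yes _ = ℕP.≤-refl ∷ All.map m≤n⇒m≤1+n (marked-≤ Y r)
  ... | yes _ | no _ = All.map m≤n⇒m≤1+n (marked-≤ Y r)
  ... | no _ | _ = All.map m≤n⇒m≤1+n (marked-≤ Y r)

  G-nonneg : ∀ R → 0ℤ ≤ G R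
  G-nonneg R = ∏-nonneg (oddPrimes R) λ q → ≤-trans (pos≥0 {q}) (≤+ʳ (*-nonneg pos≥0 (𝟙-nonneg (d q))))

  -- The Bernoulli inequality for the product of the factors 1 + 6/q with Y < q.
  tail : ∀ {Y a K} → 6 ℕ.* a ℕ.≤ Y → 0ℤ ≤ K → G Y ≤ K * D Y → ∀ r → length (marked Y r) ℕ.≤ a → G (r ℕ.+ Y) * (+ a - + length (marked Y r)) ≤ K * (+ a * D (r ℕ.+ Y))
  tail {Y} {a} {K} h hK hG zero _ = lin 4 (λ g a k d → a ⊗ g ≤' a ⊗ (k ⊗ d) ⇒ g ⊗ (a ⊖ κ 0) ≤' k ⊗ (a ⊗ d)) tt (G Y) (+ a) K (D Y) (*-monoˡ (pos≥0 {a}) hG)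
  tail {Y} {a} {K} h hK hG (suc r) le with oddPrime? (suc r ℕ.+ Y) | d (suc r ℕ.+ Y)
  ... | no _ | _ = tail h hK hG r le
  ... | yes _ | no np = subst (λ i → (+ (suc r ℕ.+ Y) + + 6 * i) * G (r ℕ.+ Y) * (+ a - + length (marked Y r)) ≤ K * (+ a * (+ (suc r ℕ.+ Y) * D (r ℕ.+ Y)))) (sym (𝟙-no (d (suc r ℕ.+ Y)) np))
      (lin 6 (λ q g c a k d → q ⊗ (g ⊗ (a ⊖ c)) ≤' q ⊗ (k ⊗ (a ⊗ d)) ⇒ (q ⊕ κ 6 ⊗ κ 0) ⊗ g ⊗ (a ⊖ c) ≤' k ⊗ (a ⊗ (q ⊗ d))) tt (+ (suc r ℕ.+ Y)) (G (r ℕ.+ Y)) (+ length (marked Y r)) (+ a) K (D (r ℕ.+ Y))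
        (*-monoˡ (pos≥0 {suc r ℕ.+ Y}) (tail h hK hG r le)))
  ... | yes _ | yes p = subst (λ i → (+ (suc r ℕ.+ Y) + + 6 * i) * G (r ℕ.+ Y) * (+ a - + suc (length (marked Y r))) ≤ K * (+ a * (+ (suc r ℕ.+ Y) * D (r ℕ.+ Y)))) (sym (𝟙-yes (d (suc r ℕ.+ Y)) p))
      (lin 6 (λ q g c a k d → q ⊗ (g ⊗ (a ⊖ c)) ≤' q ⊗ (k ⊗ (a ⊗ d)) ⇒ g ⊗ (κ 6 ⊗ (a ⊖ (κ 1 ⊕ c))) ≤' g ⊗ q ⇒ (q ⊕ κ 6 ⊗ κ 1) ⊗ g ⊗ (a ⊖ (κ 1 ⊕ c)) ≤' k ⊗ (a ⊗ (q ⊗ d))) tt (+ (suc r ℕ.+ Y)) (G (r ℕ.+ Y)) (+ length (marked Y r)) (+ a) K (D (r ℕ.+ Y))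
        (*-monoˡ (pos≥0 {suc r ℕ.+ Y}) (tail h hK hG r (<⇒≤ le))) (*-monoˡ (G-nonneg (r ℕ.+ Y)) q-large))
    where
    q-large : + 6 * (+ a - (1ℤ + + length (marked Y r))) ≤ + (suc r ℕ.+ Y)
    q-large = lin 4 (λ a c y r → κ 6 ⊗ a ≤' y ⇒ κ 0 ≤' c ⇒ κ 0 ≤' r ⇒ κ 6 ⊗ (a ⊖ (κ 1 ⊕ c)) ≤' κ 1 ⊕ (r ⊕ y)) tt (+ a) (+ length (marked Y r)) (+ Y) (+ r) (subst (_≤ + Y) (pos-* 6 a) (+≤+ h)) pos≥0 pos≥0

  tail-double : ∀ {Y a K} → 1 ℕ.≤ a → 6 ℕ.* a ℕ.≤ Y → 0ℤ ≤ K → G Y ≤ K * D Y → ∀ r → 2 ℕ.* length (marked Y r) ℕ.≤ a → G (r ℕ.+ Y) ≤ + 2 * K * D (r ℕ.+ Y)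
  tail-double {Y} {a} {K} ha h hK hG r le = *-cancel {+ a} (+≤+ ha) (lin 5 (λ g a c k d → g ⊗ (a ⊖ c) ≤' k ⊗ (a ⊗ d) ⇒ g ⊗ (κ 2 ⊗ c) ≤' g ⊗ a ⇒ a ⊗ g ≤' a ⊗ (κ 2 ⊗ k ⊗ d)) tt (G (r ℕ.+ Y)) (+ a) (+ length (marked Y r)) K (D (r ℕ.+ Y))
    (tail h hK hG r (ℕP.≤-trans (m≤m+n _ _) le)) (*-monoˡ (G-nonneg (r ℕ.+ Y)) (subst (_≤ + a) (pos-* 2 (length (marked Y r))) (+≤+ le))))

D≥1 : ∀ R → 1ℤ ≤ ∏ (oddPrimes R) plain
D≥1 R = ∏-pos (All.map (λ o → +≤+ (prime≥1 (proj₁ o))) (oddPrimes-odd R))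

∏-mono : ∀ L {f g} → (∀ q → 0ℤ ≤ f q) → (∀ q → f q ≤ g q) → ∏ L f ≤ ∏ L g
∏-mono [] h₀ h = ≤-refl
∏-mono (q ∷ L) h₀ h = *-mono (h₀ q) (h q) (∏-nonneg L h₀) (∏-mono L h₀ h)

module Every = Marked {λ _ → ⊤} (λ _ → yes tt)

Every-suc : ∀ n → Every.G n ≤ Every.G (suc n)
Every-suc n with oddPrime? (suc n)
... | no _ = ≤-refl
... | yes _ = ≤-trans (≤-reflexive (sym (*-identityˡ (Every.G n)))) (*-monoʳ (Every.G-nonneg n) (≤-trans (+≤+ (s≤s z≤n)) (≤+ʳ {+ suc n} (*-nonneg pos≥0 (𝟙-nonneg (yes tt))))))

Every-mono : ∀ {m n} → m ℕ.≤ n → Every.G m ≤ Every.G n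
Every-mono {m} {n} h = go (ℕP.≤⇒≤′ h)
  where
  go : ∀ {n} → m ℕ.≤′ n → Every.G m ≤ Every.G n
  go ℕ.≤′-refl = ≤-refl
  go (ℕ.≤′-step {n} le) = ≤-trans (go le) (Every-suc n)

-- Each prime beyond 2^k weighs at least S (k - 1), and 224 = 14 · 16 is the constant of `chebyshev`
-- at the height 16 · 2^k.
block-count : ∀ k r → r ℕ.+ 2 ^ k ℕ.≤ 2 ^ (k ℕ.+ 4) → + length (Every.marked (2 ^ k) r) * (+ k - 1ℤ) ≤ + 224 * + (2 ^ k)
block-count k r h = *-cancel S≥1 (≤-trans (lower r h) (≤-trans (chebyshev (r ℕ.+ Y) h)
    (lin 4 (λ s y r z → s ⊗ r ≤' s ⊗ (κ 16 ⊗ y) ⇒ κ 14 ⊗ (s ⊗ r) ≤' s ⊗ (κ 224 ⊗ y)) tt S (+ Y) (+ (r ℕ.+ Y)) 0ℤ (*-monoˡ (≤-trans pos≥0 S≥1) total))))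
  where
  open Scaled (k ℕ.+ 4)
  Y : ℕ
  Y = 2 ^ k
  total : + (r ℕ.+ Y) ≤ + 16 * + Y
  total = ≤-trans (+≤+ h) (≤-reflexive (trans (cong +_ (trans (^-distribˡ-+-* 2 k 4) (ℕP.*-comm Y 16))) (pos-* 16 Y)))
  each : ∀ q → Prime q → Y ℕ.≤ q → S * (+ k - 1ℤ) ≤ Λ q
  each q pq lo = subst (S * (+ k - 1ℤ) ≤_) (sym (Λ-p pq)) (lin 4 (λ s k l g → s ⊗ k ≤' s ⊗ g ⇒ s ⊗ g ≤' l ⇒ κ 0 ≤' s ⇒ s ⊗ (k ⊖ κ 1) ≤' l) tt S (+ k) (+ ℓ q) (+ lg q)
    (*-monoˡ (≤-trans pos≥0 S≥1) (+≤+ (≤-lg lo))) (subst (_≤ + ℓ q) (pos-* s (lg q)) (+≤+ (ℓ-lower (prime≥1 pq)))) (≤-trans pos≥0 S≥1))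
  lower : ∀ r → r ℕ.+ Y ℕ.≤ X → S * (+ length (Every.marked Y r) * (+ k - 1ℤ)) ≤ ∑ (r ℕ.+ Y) Λ
  lower zero _ = ≤-trans (≤-reflexive (trans (cong (S *_) (*-zeroˡ (+ k - 1ℤ))) (*-zeroʳ S))) (∑-nonneg Y λ n _ _ → Λ-nonneg n)
  lower (suc r) h with oddPrime? (suc r ℕ.+ Y)
  ... | no _ = ≤-trans (lower r (<⇒≤ h)) (≤+ʳ (Λ-nonneg (suc r ℕ.+ Y)))
  ... | yes (pq , _) = lin 5 (λ s c k a l → s ⊗ (c ⊗ (k ⊖ κ 1)) ≤' a ⇒ s ⊗ (k ⊖ κ 1) ≤' l ⇒ s ⊗ ((κ 1 ⊕ c) ⊗ (k ⊖ κ 1)) ≤' a ⊕ l) tt S (+ length (Every.marked Y r)) (+ k) (∑ (r ℕ.+ Y) Λ) (Λ (suc r ℕ.+ Y))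
      (lower r (<⇒≤ h)) (each (suc r ℕ.+ Y) pq (m≤n+m Y (suc r)))

opaque
  -- 4 · 897 = 3588 exceeds 3585 = 224 · 16 + 1, which is what the division in `block-sparse` needs.
  -- It is opaque, like `C₀`, since a product over the primes up to 16^897 must never be evaluated.
  j₀ : ℕ
  j₀ = 897

  j₀≥1 : 1 ℕ.≤ j₀
  j₀≥1 = s≤s z≤n

  j₀-large : ∀ {j} → j₀ ℕ.≤ j → 3585 ℕ.≤ 4 ℕ.* j
  j₀-large h = ℕP.≤-trans (ℕP.≤ᵇ⇒≤ 3585 3588 tt) (*-monoʳ-≤ 4 h)

opaque
  C₀ : ℤ
  C₀ = Every.G (16 ^ j₀)

  C₀-def : C₀ ≡ Every.G (16 ^ j₀)
  C₀-def = refl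

C₀≥0 : 0ℤ ≤ C₀
C₀≥0 = subst (0ℤ ≤_) (sym C₀-def) (Every.G-nonneg (16 ^ j₀))

16^≡ : ∀ j → 16 ^ j ≡ 2 ^ (4 ℕ.* j)
16^≡ j = ^-*-assoc 2 4 j

double-K : ∀ j → + 2 * (C₀ * + (2 ^ j)) ≡ C₀ * + (2 ^ suc j)
double-K j = trans (lin 2 (λ c a → κ 2 ⊗ (c ⊗ a) ≡' c ⊗ (κ 2 ⊗ a)) tt C₀ (+ (2 ^ j))) (cong (C₀ *_) (sym (pos-* 2 (2 ^ j))))

block-sparse : ∀ j r → j₀ ℕ.≤ suc j → r ℕ.+ 16 ^ suc j ℕ.≤ 16 ^ suc (suc j) → length (Every.marked (16 ^ suc j) r) ℕ.≤ 16 ^ j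
block-sparse j r hj hr = drop‿+≤+ (cancel (≤-trans bc (≤-reflexive (cong (λ z → + 224 * z) (trans (cong +_ (sym (16^≡ (suc j)))) (pos-* 16 (16 ^ j)))))))
  where
  c : ℕ
  c = length (Every.marked (16 ^ suc j) r)
  k : ℕ
  k = 4 ℕ.* suc j
  bc : + c * (+ k - 1ℤ) ≤ + 224 * + (2 ^ k)
  bc = subst (λ Y → + length (Every.marked Y r) * (+ k - 1ℤ) ≤ + 224 * + (2 ^ k)) (sym (16^≡ (suc j)))
    (block-count k r (subst₂ (λ a b → r ℕ.+ a ℕ.≤ b) (16^≡ (suc j)) (trans (16^≡ (suc (suc j))) (cong (2 ^_) (linℕ 1 (λ j → κ 4 ⊗ (κ 1 ⊕ j) ≡' κ 4 ⊗ j ⊕ κ 4) tt (suc j)))) hr))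
  cancel : + c * (+ k - 1ℤ) ≤ + 224 * (+ 16 * + (16 ^ j)) → + c ≤ + (16 ^ j)
  cancel h = *-cancel {+ 3584} (+≤+ (s≤s z≤n)) (lin 3 (λ c k a → c ⊗ (k ⊖ κ 1) ≤' κ 224 ⊗ (κ 16 ⊗ a) ⇒ c ⊗ κ 3585 ≤' c ⊗ k ⇒ κ 3584 ⊗ c ≤' κ 3584 ⊗ a) tt (+ c) (+ k) (+ (16 ^ j)) h (*-monoˡ (pos≥0 {c}) (+≤+ (j₀-large hj))))

12≤16 : ∀ a → 6 ℕ.* (2 ℕ.* a) ℕ.≤ 16 ℕ.* a
12≤16 a = linℕ 1 (λ a → κ 6 ⊗ (κ 2 ⊗ a) ≤' κ 16 ⊗ a) tt a

-- The product of 1 + 6/q over q ≤ 16^j really grows like a power of j. The crude bound that each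
-- block at most doubles it is enough, since 2^j is beaten by the weights 4^(-j) in `geometric`.
Small : ℕ → Set
Small j = ∀ R → R ℕ.≤ 16 ^ j → Every.G R ≤ C₀ * + (2 ^ j) * ∏ (oddPrimes R) plain

small-base : ∀ j → j ℕ.≤ j₀ → Small j
small-base j le R hR = ≤-trans (Every-mono (ℕP.≤-trans hR (^-monoʳ-≤ 16 le))) (≤-trans (≤-reflexive (sym C₀-def)) (≤-trans (≤-reflexive (sym (trans (cong (_* 1ℤ) (*-identityʳ C₀)) (*-identityʳ C₀))))
  (*-mono (*-nonneg C₀≥0 (pos≥0 {1})) (*-monoˡ C₀≥0 (+≤+ (2^≥1 j))) pos≥0 (D≥1 R))))

small-step : ∀ j → j₀ ℕ.≤ suc j → Small (suc j) → Small (suc (suc j))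
small-step j hj ih R hR with R ℕ.≤? 16 ^ suc j
... | yes le = ≤-trans (ih R le) (*-monoʳ (≤-trans pos≥0 (D≥1 R)) (*-monoˡ C₀≥0 (+≤+ (^-monoʳ-≤ 2 (n≤1+n (suc j))))))
... | no gt = subst₂ (λ n K → Every.G n ≤ K * ∏ (oddPrimes n) plain) r+Y (double-K (suc j))
    (Every.tail-double (*-mono-≤ {1} {2} (s≤s z≤n) (m^n>0 16 j)) (12≤16 (16 ^ j)) (*-nonneg C₀≥0 pos≥0) (ih (16 ^ suc j) ℕP.≤-refl) r
      (*-monoʳ-≤ 2 (block-sparse j r hj (ℕP.≤-trans (ℕP.≤-reflexive r+Y) hR))))
  where
  r : ℕ
  r = R ℕ.∸ 16 ^ suc j
  r+Y : r ℕ.+ 16 ^ suc j ≡ R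
  r+Y = m∸n+n≡m (<⇒≤ (≰⇒> gt))

small-suc : ∀ j → Small j → Small (suc j)
small-suc j ih with suc j ℕ.≤? j₀
small-suc j ih | yes le = small-base (suc j) le
small-suc zero ih | no nle = contradiction j₀≥1 nle
small-suc (suc j) ih | no nle = small-step j (≤-pred (≰⇒> nle)) ih

small-primes : ∀ j → Small j
small-primes zero = small-base 0 z≤n
small-primes (suc j) = small-suc j (small-primes j)

mersenneProduct : ℕ → ℕ
mersenneProduct zero = 1
mersenneProduct (suc i) = mersenne (suc i) ℕ.* mersenneProduct i

mersenne≥1 : ∀ i → 1 ℕ.≤ mersenne (suc i)
mersenne≥1 i = ≤-pred (subst (2 ℕ.≤_) (sym (suc-mersenne (suc i))) (*-monoʳ-≤ 2 (2^≥1 i)))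

mersenneProduct≥1 : ∀ i → 1 ℕ.≤ mersenneProduct i
mersenneProduct≥1 zero = ℕP.≤-refl
mersenneProduct≥1 (suc i) = *-mono-≤ (mersenne≥1 i) (mersenneProduct≥1 i)

mersenneProduct-upper : ∀ i → mersenneProduct i ℕ.≤ 2 ^ (i ℕ.* i)
mersenneProduct-upper zero = ℕP.≤-refl
mersenneProduct-upper (suc i) = ℕP.≤-trans (*-mono-≤ (m∸n≤m (2 ^ suc i) 1) (mersenneProduct-upper i))
  (ℕP.≤-trans (ℕP.≤-reflexive (sym (^-distribˡ-+-* 2 (suc i) (i ℕ.* i)))) (^-monoʳ-≤ 2 (linℕ 1 (λ i → κ 0 ≤' i ⇒ κ 1 ⊕ i ⊕ i ⊗ i ≤' (κ 1 ⊕ i) ⊗ (κ 1 ⊕ i)) tt i z≤n)))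

seen-∣ : ∀ {i q} → Seen i q → q ∣ mersenneProduct i
seen-∣ {suc i} (l , lt , d) with ℕP.m≤n⇒m<n∨m≡n lt
... | inj₁ l<i = Dv.∣n⇒∣m*n (mersenne (suc i)) (seen-∣ (l , ≤-pred l<i , d))
... | inj₂ refl = Dv.∣m⇒∣m*n (mersenneProduct i) d

product-∣ : ∀ {P F} → All Prime P → All (_∣ F) P → Selection.Distinct 0 P → product P ∣ F
product-∣ [] [] Selection.[] = Dv.1∣ _
product-∣ {p ∷ P} {F} (pp ∷ ps) (d ∷ ds) (ne Selection.∷ dis) with product-∣ ps ds dis
... | divides k e = subst (p ℕ.* product P ∣_) (sym e) (Dv.*-monoˡ-∣ (product P) (Co.coprime-divisor {p} {product P} {k} (λ {x} → odd-list-product pp ps ne {x}) (subst (p ∣_) (trans e (ℕP.*-comm k (product P))) d)))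

module Large (j : ℕ) where

  i : ℕ
  i = 4 ^ j

  open Marked (seen? i)

  marked-Distinct : ∀ Y r → Selection.Distinct 0 (marked Y r)
  marked-Distinct Y zero = Selection.[]
  marked-Distinct Y (suc r) with oddPrime? (suc r ℕ.+ Y) | seen? i (suc r ℕ.+ Y)
  ... | yes _ | yes _ = All.map (λ { le refl → ℕP.<⇒≱ ℕP.≤-refl le }) (marked-≤ Y r) Selection.∷ marked-Distinct Y r
  ... | yes _ | no _ = marked-Distinct Y r
  ... | no _ | _ = marked-Distinct Y r

  -- The seen primes divide the product of 2^l - 1 over l ≤ i, which is at most 2^(i²). Hence there
  -- are at most i² = 16^j of them.
  marked-few : ∀ Y r → length (marked Y r) ℕ.≤ 16 ^ j
  marked-few Y r = ℕP.≤-trans (≮⇒≥ λ lt → ℕP.<⇒≱ (^-monoʳ-< 2 (s≤s (s≤s z≤n)) lt) (ℕP.≤-trans (Scaled.2^length 0 primes)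
      (ℕP.≤-trans (Dv.∣⇒≤ {{nz (mersenneProduct≥1 i)}} (product-∣ primes (All.map seen-∣ (marked-P Y r)) (marked-Distinct Y r))) (mersenneProduct-upper i))))
      (ℕP.≤-reflexive (sym (^-*-distrib 4 4 j)))
    where
    primes : All Prime (marked Y r)
    primes = All.map proj₁ (marked-odd Y r)

  G≤Every : ∀ R → G R ≤ Every.G R
  G≤Every R = ∏-mono (oddPrimes R) (λ q → ≤-trans (pos≥0 {q}) (≤+ʳ (*-nonneg pos≥0 (𝟙-nonneg (seen? i q))))) λ q →
    +-monoʳ-≤ (+ q) (*-monoˡ {+ 6} pos≥0 (≤-trans (𝟙≤1 (seen? i q)) (≤-reflexive (sym (𝟙-yes (yes tt) tt)))))

  seen-bound : ∀ R → G R ≤ C₀ * + (2 ^ suc (suc j)) * ∏ (oddPrimes R) plain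
  seen-bound R with R ℕ.≤? 16 ^ suc j
  ... | yes le = ≤-trans (G≤Every R) (≤-trans (small-primes (suc j) R le) (*-monoʳ (≤-trans pos≥0 (D≥1 R)) (*-monoˡ C₀≥0 (+≤+ (^-monoʳ-≤ 2 (n≤1+n (suc j)))))))
  ... | no gt = subst₂ (λ n K → G n ≤ K * ∏ (oddPrimes n) plain) (m∸n+n≡m (<⇒≤ (≰⇒> gt))) (double-K (suc j))
      (tail-double (*-mono-≤ {1} {2} (s≤s z≤n) (m^n>0 16 j)) (12≤16 (16 ^ j)) (*-nonneg C₀≥0 pos≥0) (≤-trans (G≤Every (16 ^ suc j)) (small-primes (suc j) (16 ^ suc j) ℕP.≤-refl)) (R ℕ.∸ 16 ^ suc j)
        (*-monoʳ-≤ 2 (marked-few (16 ^ suc j) (R ℕ.∸ 16 ^ suc j))))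

geometric : ∀ n → ∑ n (λ j → + (4 ^ (n ℕ.∸ j)) * + (2 ^ j)) + + (2 ^ n) ≤ + (4 ^ n)
geometric zero = ≤-refl
geometric (suc n) = lin 6 (λ a b c d e f → a ⊕ b ≤' c ⇒ d ≡' κ 4 ⊗ a ⊕ e ⇒ e ≡' κ 2 ⊗ b ⇒ f ≡' κ 4 ⊗ c ⇒ d ⊕ e ≤' f) tt
    (∑ n (λ j → + (4 ^ (n ℕ.∸ j)) * + (2 ^ j))) (+ (2 ^ n)) (+ (4 ^ n)) (∑ (suc n) (λ j → + (4 ^ (suc n ℕ.∸ j)) * + (2 ^ j))) (+ (2 ^ suc n)) (+ (4 ^ suc n))
    (geometric n) (cong₂ _+_ (trans (∑-cong n step) (∑-*ˡ n (+ 4) _)) (trans (cong (λ z → + (4 ^ z) * + (2 ^ suc n)) (ℕP.n∸n≡0 n)) (*-identityˡ (+ (2 ^ suc n))))) (pos-* 2 (2 ^ n)) (pos-* 4 (4 ^ n))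
  where
  step : ∀ j → 1 ℕ.≤ j → j ℕ.≤ n → + (4 ^ (suc n ℕ.∸ j)) * + (2 ^ j) ≡ + 4 * (+ (4 ^ (n ℕ.∸ j)) * + (2 ^ j))
  step j _ h = trans (cong (_* + (2 ^ j)) (trans (cong (λ z → + (4 ^ z)) (ℕP.+-∸-assoc 1 h)) (pos-* 4 (4 ^ (n ℕ.∸ j))))) (*-assoc (+ 4) (+ (4 ^ (n ℕ.∸ j))) (+ (2 ^ j)))

romanoff : ∀ R J → ∑ (4 ^ J) (λ m → ∏ (oddPrimes R) (raised (mersenne m))) ≤ + 16 * C₀ * (+ (4 ^ J) * ∏ (oddPrimes R) plain)
romanoff R J = ≤-trans (≤-reflexive (∑-ext (4 ^ J) λ m → sym (*-identityʳ _))) (≤-trans (expand-bound (oddPrimes R) [] J)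
  (≤-trans (∑-mono (suc J) λ j _ _ → each j) (≤-trans (≤-reflexive (∑-*ˡ (suc J) (+ 4 * (C₀ * D)) _))
    (lin 5 (λ c d s a b → c ⊗ d ⊗ (s ⊕ a) ≤' c ⊗ d ⊗ (κ 4 ⊗ b) ⇒ κ 0 ≤' c ⊗ d ⊗ a ⇒ κ 4 ⊗ (c ⊗ d) ⊗ s ≤' κ 16 ⊗ c ⊗ (b ⊗ d)) tt C₀ D (∑ (suc J) (λ j → + (4 ^ (suc J ℕ.∸ j)) * + (2 ^ j))) (+ (2 ^ suc J)) (+ (4 ^ J))
      (*-monoˡ cd≥0 (subst (∑ (suc J) (λ j → + (4 ^ (suc J ℕ.∸ j)) * + (2 ^ j)) + + (2 ^ suc J) ≤_) (pos-* 4 (4 ^ J)) (geometric (suc J)))) (*-nonneg cd≥0 pos≥0)))))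
  where
  D : ℤ
  D = ∏ (oddPrimes R) plain
  cd≥0 : 0ℤ ≤ C₀ * D
  cd≥0 = *-nonneg C₀≥0 (≤-trans pos≥0 (D≥1 R))
  each : ∀ j → + (4 ^ (suc J ℕ.∸ j)) * (∏ (oddPrimes R) (seenRaised (4 ^ j)) * 1ℤ) ≤ + 4 * (C₀ * D) * (+ (4 ^ (suc J ℕ.∸ j)) * + (2 ^ j))
  each j = lin 5 (λ a g c d b → a ⊗ g ≤' a ⊗ (c ⊗ (κ 2 ⊗ (κ 2 ⊗ b)) ⊗ d) ⇒ a ⊗ (g ⊗ κ 1) ≤' κ 4 ⊗ (c ⊗ d) ⊗ (a ⊗ b)) tt (+ (4 ^ (suc J ℕ.∸ j))) (∏ (oddPrimes R) (seenRaised (4 ^ j))) C₀ D (+ (2 ^ j))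
    (*-monoˡ (pos≥0 {4 ^ (suc J ℕ.∸ j)}) (subst (λ z → ∏ (oddPrimes R) (seenRaised (4 ^ j)) ≤ C₀ * z * D) (trans (pos-* 2 (2 ^ suc j)) (cong (+ 2 *_) (pos-* 2 (2 ^ j)))) (Large.seen-bound j R)))

-- Moments of the number of representations

∑-≤-indicator : ∀ x y → ∑ x (λ m → 𝟙 (m ℕ.≤? y)) ≤ + y
∑-≤-indicator x y with ℕP.≤-total x y
... | inj₁ h = ≤-trans (ones x) (+≤+ h)
  where
  ones : ∀ x → ∑ x (λ m → 𝟙 (m ℕ.≤? y)) ≤ + x
  ones x = ≤-trans (∑-mono x λ m _ _ → 𝟙≤1 (m ℕ.≤? y)) (≤-reflexive (trans (∑-const x 1ℤ) (*-identityʳ (+ x))))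
... | inj₂ h = ≤-trans (≤-reflexive (∑-extend h λ n lt _ → 𝟙-no (n ℕ.≤? y) (ℕP.<⇒≱ lt))) (≤-trans (∑-mono y λ m _ _ → 𝟙≤1 (m ℕ.≤? y)) (≤-reflexive (trans (∑-const y 1ℤ) (*-identityʳ (+ y)))))

∑-reverse : ∀ n (g : ℕ → ℤ) → ∑ n (λ j → g (suc n ℕ.∸ j)) ≡ ∑ n g
∑-reverse zero g = refl
∑-reverse (suc n) g = trans (∑-split 1 n (λ j → g (suc (suc n) ℕ.∸ j))) (trans (cong₂ _+_ (+-identityˡ (g (suc n))) (∑-reverse n g)) (+-comm (g (suc n)) (∑ n g)))

-- If m exceeds X, primes m and m + h have no prime divisor up to X; smaller m are counted
-- trivially.
prime-pairs : ∀ h ρ x → ∑ x (λ m → 𝟙 (prime? m) * 𝟙 (prime? (m ℕ.+ h))) ≤ + (2 ^ ρ) + Selection.Z h (Range.good h (2 ^ ρ)) x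
prime-pairs h ρ x = ≤-trans (∑-mono x λ m _ _ → each m) (≤-trans (≤-reflexive (∑-+ x _ _)) (+-monoˡ-≤ (Z (good X) x) (∑-≤-indicator x X)))
  where
  open Selection h
  open Range h
  X : ℕ
  X = 2 ^ ρ
  large : ∀ {m q} → ¬ m ℕ.≤ X → Prime m → q ℕ.≤ X × Good q → ¬ q ∣ m
  large nle pm (le , pq , _) d with prime-∣-prime pq pm d
  ... | refl = nle le
  each : ∀ m → 𝟙 (prime? m) * 𝟙 (prime? (m ℕ.+ h)) ≤ 𝟙 (m ℕ.≤? X) + 𝟙 (sifted? (good X) m)
  each m with 𝟙-case (m ℕ.≤? X) | 𝟙-case (prime? m) | 𝟙-case (prime? (m ℕ.+ h))
  ... | inj₁ (_ , i) | _ | _ rewrite i = ≤-trans (*-mono (𝟙-nonneg (prime? m)) (𝟙≤1 (prime? m)) (𝟙-nonneg (prime? (m ℕ.+ h))) (𝟙≤1 (prime? (m ℕ.+ h)))) (≤-trans (≤-reflexive (*-identityˡ 1ℤ)) (≤+ʳ (𝟙-nonneg (sifted? (good X) m))))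
  ... | inj₂ (_ , i) | inj₂ (_ , j) | _ rewrite i | j = ≤-trans (≤-reflexive (*-zeroˡ (𝟙 (prime? (m ℕ.+ h))))) (+-mono-≤ (≤-refl {0ℤ}) (𝟙-nonneg (sifted? (good X) m)))
  ... | inj₂ (_ , i) | inj₁ _ | inj₂ (_ , j) rewrite i | j = ≤-trans (≤-reflexive (*-zeroʳ (𝟙 (prime? m)))) (+-mono-≤ (≤-refl {0ℤ}) (𝟙-nonneg (sifted? (good X) m)))
  ... | inj₂ (nle , i) | inj₁ (pm , j) | inj₁ (pmh , l) rewrite i | j | l = ≤-reflexive (trans (*-identityˡ 1ℤ) (sym (trans (+-identityˡ _) (𝟙-yes (sifted? (good X) m)
        (All.map (λ g → large nle pm g , large (λ le → nle (ℕP.≤-trans (m≤m+n m h) le)) pmh g) (All.zip (good-≤ X , good-Good X)))))))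

∏-congAll : ∀ {P : ℕ → Set} {L f g} → All P L → (∀ q → P q → f q ≡ g q) → ∏ L f ≡ ∏ L g
∏-congAll [] h = refl
∏-congAll {L = q ∷ L} (p ∷ ps) h = cong₂ _*_ (h q p) (∏-congAll ps h)

-- The gaps 2^k - 2^j are powers of 2 times Mersenne numbers, and odd primes see only the latter.
raised-2^* : ∀ k n R → ∏ (oddPrimes R) (raised (2 ^ k ℕ.* n)) ≡ ∏ (oddPrimes R) (raised n)
raised-2^* k n R = ∏-congAll (oddPrimes-odd R) λ { q (pq , h3) → cong (λ z → + q + + 6 * z) (𝟙-cong (q ∣? 2 ^ k ℕ.* n) (q ∣? n)
  (λ d → ∣-cancel-prime-^ k prime[2] (λ d2 → <⇒≢ h3 (prime-∣-prime prime[2] pq d2)) d) (Dv.∣n⇒∣m*n (2 ^ k))) }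

module _ (t ρ : ℕ) (h : 14 ℕ.* ρ ℕ.+ 2 ℕ.≤ t) where

  N₁ : ℕ
  N₁ = 2 ^ suc t

  -- E is (X + 1) X⁶ with X = 2^ρ, thus at most 2^(7 ρ + 1), and E² is at most 2^(14 ρ + 2).
  error-small : ∀ h → + 2 * (Range.Comparison.E h ρ * Range.Comparison.E h ρ) ≤ + N₁
  error-small _ = subst (_≤ + N₁) (trans (pos-* 2 (e ℕ.* e)) (cong (+ 2 *_) (trans (pos-* e e) (cong₂ _*_ e≡ e≡)))) (+≤+ (ℕP.≤-trans (*-monoʳ-≤ 2 (*-mono-≤ e≤ e≤))
      (ℕP.≤-trans (ℕP.≤-reflexive (cong (2 ℕ.*_) (sym (^-distribˡ-+-* 2 f f)))) (^-monoʳ-≤ 2 (s≤s (linℕ 2 (λ r t → κ 14 ⊗ r ⊕ κ 2 ≤' t ⇒ (κ 1 ⊕ r ⊕ ((r ⊕ r) ⊕ ((r ⊕ r) ⊕ (r ⊕ r)))) ⊕ (κ 1 ⊕ r ⊕ ((r ⊕ r) ⊕ ((r ⊕ r) ⊕ (r ⊕ r)))) ≤' t) tt ρ t h))))))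
    where
    X Y e f : ℕ
    X = 2 ^ ρ
    Y = X ℕ.* X
    e = suc X ℕ.* (Y ℕ.* (Y ℕ.* Y))
    f = suc ρ ℕ.+ ((ρ ℕ.+ ρ) ℕ.+ ((ρ ℕ.+ ρ) ℕ.+ (ρ ℕ.+ ρ)))
    e≡ : + e ≡ + suc X * (+ Y * (+ Y * + Y))
    e≡ = trans (pos-* (suc X) (Y ℕ.* (Y ℕ.* Y))) (cong (+ suc X *_) (trans (pos-* Y (Y ℕ.* Y)) (cong (+ Y *_) (pos-* Y Y))))
    Y≤ : Y ℕ.≤ 2 ^ (ρ ℕ.+ ρ)
    Y≤ = ℕP.≤-reflexive (sym (^-distribˡ-+-* 2 ρ ρ))
    join : ∀ {a b} m n → a ℕ.≤ 2 ^ m → b ℕ.≤ 2 ^ n → a ℕ.* b ℕ.≤ 2 ^ (m ℕ.+ n)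
    join m n p q = ℕP.≤-trans (*-mono-≤ p q) (ℕP.≤-reflexive (sym (^-distribˡ-+-* 2 m n)))
    e≤ : e ℕ.≤ 2 ^ f
    e≤ = join (suc ρ) _ (linℕ 1 (λ x → κ 1 ≤' x ⇒ κ 1 ⊕ x ≤' κ 2 ⊗ x) tt X (2^≥1 ρ)) (join (ρ ℕ.+ ρ) _ Y≤ (join (ρ ℕ.+ ρ) (ρ ℕ.+ ρ) Y≤ Y≤))

  sifted-pairs : ∀ k m → Selection.Z (2 ^ k ℕ.* mersenne m) (Range.good (2 ^ k ℕ.* mersenne m) (2 ^ ρ)) N₁ * ((1ℤ + + ρ) * (1ℤ + + ρ)) * ∏ (oddPrimes (2 ^ ρ)) plain
    ≤ + 32 * + N₁ * ∏ (oddPrimes (2 ^ ρ)) (raised (mersenne m))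
  sifted-pairs k m = ≤-trans (Range.Comparison.sieve-bound g ρ N₁) (≤-trans (≤-reflexive (cong (λ z → + 16 * (z * (+ N₁ + + 2 * (E * E)))) (raised-2^* k (mersenne m) (2 ^ ρ))))
      (lin 3 (λ n x e → n ⊗ e ≤' n ⊗ x ⇒ κ 16 ⊗ (n ⊗ (x ⊕ e)) ≤' κ 32 ⊗ x ⊗ n) tt N (+ N₁) (+ 2 * (E * E)) (*-monoˡ (∏-nonneg (oddPrimes (2 ^ ρ)) (raised-nonneg (mersenne m))) (error-small g))))
    where
    g : ℕ
    g = 2 ^ k ℕ.* mersenne m
    E N : ℤ
    E = Range.Comparison.E g ρ
    N = ∏ (oddPrimes (2 ^ ρ)) (raised (mersenne m))

power-4 : ∀ {t} → 1 ℕ.≤ t → ∃ λ J → t ℕ.≤ 4 ^ J × 4 ^ J ℕ.≤ 4 ℕ.* t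
power-4 {t} ht with 4^-interval t ht (ℕP.<-≤-trans (n<2^n t) (ℕP.≤-trans (^-monoˡ-≤ t {2} {4} (s≤s (s≤s z≤n))) (^-monoʳ-≤ 4 (n≤1+n t))))
... | j , _ , lo , hi = suc j , <⇒≤ hi , *-monoʳ-≤ 4 lo

opaque
  -- 256 comes from `small-part`. The other constant is 256 · 32 · 16 · 4: the square of t ≤ 16 (1 +
  -- ρ), the factors 32 of `sifted-pairs` and 16 of `romanoff`, and 4^J ≤ 4 t.
  C₁ : ℤ
  C₁ = + 256 + + 524288 * C₀

  C₁-def : C₁ ≡ + 256 + + 524288 * C₀
  C₁-def = refl

C₁≥0 : 0ℤ ≤ C₁
C₁≥0 = subst (0ℤ ≤_) (sym C₁-def) (+-mono-≤ (pos≥0 {256}) (*-nonneg pos≥0 C₀≥0))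

sieve-sum-arith : ∀ t R D S x j c → 1ℤ ≤ t → 1ℤ ≤ D → 0ℤ ≤ S → 0ℤ ≤ x → 0ℤ ≤ c → t ≤ + 16 * R → j ≤ + 4 * t → S * (R * R) * D ≤ + 32 * x * (+ 16 * c * (j * D)) → t * S ≤ + 524288 * c * x
sieve-sum-arith t R D S x j c ht hD hS hx hc hR hj h = *-cancel {t * D} (*-≥1 ht hD) (≤-trans
    (lin 4 (λ t D S R → D ⊗ S ⊗ (t ⊗ t) ≤' D ⊗ S ⊗ (κ 16 ⊗ R ⊗ (κ 16 ⊗ R)) ⇒ t ⊗ D ⊗ (t ⊗ S) ≤' κ 256 ⊗ (S ⊗ (R ⊗ R) ⊗ D)) tt t D S R (*-monoˡ (*-nonneg (≤-trans pos≥0 hD) hS) (*-mono t≥0 hR t≥0 hR)))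
    (lin 7 (λ t D S R x j c → S ⊗ (R ⊗ R) ⊗ D ≤' κ 32 ⊗ x ⊗ (κ 16 ⊗ c ⊗ (j ⊗ D)) ⇒ x ⊗ c ⊗ D ⊗ j ≤' x ⊗ c ⊗ D ⊗ (κ 4 ⊗ t) ⇒ κ 256 ⊗ (S ⊗ (R ⊗ R) ⊗ D) ≤' t ⊗ D ⊗ (κ 524288 ⊗ c ⊗ x)) tt t D S R x j c h (*-monoˡ (*-nonneg (*-nonneg hx hc) (≤-trans pos≥0 hD)) hj)))
  where
  t≥0 : 0ℤ ≤ t
  t≥0 = ≤-trans pos≥0 ht

module SecondMoment {B : ℕ → Set} (B? : ∀ n → Dec (B n)) (B-prime : ∀ {n} → B n → Prime n) (k₀ : ℕ) where

  -- Steps of 24 keep 2^k in one class of the final modulus.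
  k : ℕ → ℕ
  k i = k₀ ℕ.+ 24 ℕ.* i

  -- For n ≤ 2^(k i) the truncated difference is 0, which is not prime, so such n contribute
  -- nothing.
  shift : ℕ → ℕ → ℤ
  shift i n = 𝟙 (B? (n ℕ.∸ 2 ^ k i))

  r : ℕ → ℕ → ℤ
  r I n = ∑ I (λ i → shift i n)

  B-0 : ¬ B 0
  B-0 b = contradiction (prime≥1 (B-prime b)) λ ()

  ∑-shifted : ∀ {c x} (g : ℕ → ℤ) → c ℕ.≤ x → ∑ x (λ n → 𝟙 (B? (n ℕ.∸ c)) * g n) ≡ ∑ (x ℕ.∸ c) (λ m → 𝟙 (B? m) * g (c ℕ.+ m))
  ∑-shifted {c} {x} g h = trans (cong (λ z → ∑ z (λ n → 𝟙 (B? (n ℕ.∸ c)) * g n)) (sym (m+[n∸m]≡n h))) (trans (∑-split c (x ℕ.∸ c) _)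
    (trans (cong₂ _+_ (∑-zero c λ n _ le → trans (cong (λ z → 𝟙 (B? z) * g n) (ℕP.m≤n⇒m∸n≡0 le)) (trans (cong (_* g n) (𝟙-no (B? 0) B-0)) (*-zeroˡ (g n))))
      (∑-ext (x ℕ.∸ c) λ m → cong (λ z → 𝟙 (B? z) * g (c ℕ.+ m)) (ℕP.m+n∸m≡n c m))) (+-identityˡ _)))

  gap : ∀ i {j} → 1 ℕ.≤ j → j ℕ.≤ i → 2 ^ k (suc i) ≡ 2 ^ k j ℕ.+ 2 ^ k j ℕ.* mersenne (24 ℕ.* (suc i ℕ.∸ j))
  gap i {j} _ h = trans (cong (2 ^_) (trans (cong (λ z → k₀ ℕ.+ 24 ℕ.* z) (sym (m+[n∸m]≡n (m≤n⇒m≤1+n h)))) (linℕ 3 (λ a j d → a ⊕ κ 24 ⊗ (j ⊕ d) ≡' a ⊕ κ 24 ⊗ j ⊕ κ 24 ⊗ d) tt k₀ j (suc i ℕ.∸ j))))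
    (trans (^-distribˡ-+-* 2 (k j) (24 ℕ.* (suc i ℕ.∸ j))) (trans (cong (2 ^ k j ℕ.*_) (sym (suc-mersenne (24 ℕ.* (suc i ℕ.∸ j))))) (ℕP.*-suc (2 ^ k j) _)))

  module At (t I : ℕ) (ht : 16 ℕ.≤ t) (hI : k₀ ℕ.+ 24 ℕ.* I ℕ.≤ t) where

    ρ X N₂ : ℕ
    ρ = t ÷ 16
    X = 2 ^ ρ
    N₂ = 2 ^ suc t

    ρ≤ : 16 ℕ.* ρ ℕ.≤ t
    ρ≤ = ÷-≤ (s≤s z≤n) ℕP.≤-refl

    hρ : 14 ℕ.* ρ ℕ.+ 2 ℕ.≤ t
    hρ = linℕ 2 (λ r t → κ 16 ⊗ r ≤' t ⇒ κ 1 ≤' r ⇒ κ 14 ⊗ r ⊕ κ 2 ≤' t) tt ρ t ρ≤ (÷-pos (s≤s z≤n) ht)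

    t≤16ρ : + t ≤ + 16 * (1ℤ + + ρ)
    t≤16ρ = subst (+ t ≤_) (pos-* 16 (suc ρ)) (+≤+ (<⇒≤ (÷-lt t (s≤s z≤n))))

    k≤t : ∀ {i} → i ℕ.≤ I → k i ℕ.≤ t
    k≤t h = ℕP.≤-trans (ℕP.+-monoʳ-≤ k₀ (*-monoʳ-≤ 24 h)) hI

    2^k≤ : ∀ {i} → i ℕ.≤ I → 2 ^ k i ℕ.≤ N₂
    2^k≤ h = ^-monoʳ-≤ 2 (m≤n⇒m≤1+n (k≤t h))

    sifted : ℕ → ℕ → ℤ
    sifted i j = Selection.Z (2 ^ k j ℕ.* mersenne (24 ℕ.* (suc i ℕ.∸ j))) (Range.good (2 ^ k j ℕ.* mersenne (24 ℕ.* (suc i ℕ.∸ j))) X) N₂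

    pair-bound : ∀ i j → suc i ℕ.≤ I → 1 ℕ.≤ j → j ℕ.≤ i → ∑ N₂ (λ n → shift (suc i) n * shift j n) ≤ + X + sifted i j
    pair-bound i j hi h₁ h₂ = ≤-trans (≤-reflexive (trans (∑-shifted (shift j) (2^k≤ hi)) (∑-ext (N₂ ℕ.∸ c) λ m → cong (λ z → 𝟙 (B? m) * 𝟙 (B? z)) (index m))))
      (≤-trans (∑-mono (N₂ ℕ.∸ c) λ m _ _ → *-mono (𝟙-nonneg (B? m)) (weaken m) (𝟙-nonneg (B? (m ℕ.+ h))) (weaken (m ℕ.+ h)))
        (≤-trans (∑-range (m∸n≤m N₂ c) λ m _ _ → *-nonneg (𝟙-nonneg (prime? m)) (𝟙-nonneg (prime? (m ℕ.+ h)))) (prime-pairs h ρ N₂)))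
      where
      c h : ℕ
      c = 2 ^ k (suc i)
      h = 2 ^ k j ℕ.* mersenne (24 ℕ.* (suc i ℕ.∸ j))
      index : ∀ m → (c ℕ.+ m) ℕ.∸ 2 ^ k j ≡ m ℕ.+ h
      index m = trans (cong (ℕ._∸ 2 ^ k j) (trans (cong (ℕ._+ m) (gap i h₁ h₂)) (trans (ℕP.+-assoc (2 ^ k j) h m) (cong (2 ^ k j ℕ.+_) (ℕP.+-comm h m))))) (ℕP.m+n∸m≡n (2 ^ k j) (m ℕ.+ h))
      weaken : ∀ m → 𝟙 (B? m) ≤ 𝟙 (prime? m)
      weaken m with 𝟙-case (B? m)
      ... | inj₁ (b , e) = ≤-reflexive (trans e (sym (𝟙-yes (prime? m) (B-prime b))))
      ... | inj₂ (_ , e) = ≤-trans (≤-reflexive e) (𝟙-nonneg (prime? m))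

    D : ℤ
    D = ∏ (oddPrimes X) plain

    mersenne-sum : ∀ i J → suc i ℕ.≤ I → t ℕ.≤ 4 ^ J → ∑ i (λ d → ∏ (oddPrimes X) (raised (mersenne (24 ℕ.* d)))) ≤ + 16 * C₀ * (+ (4 ^ J) * D)
    mersenne-sum i J hi hJ = ≤-trans (∑-range {i} {4 ^ J ÷ 24} (≤-÷ (s≤s z≤n) (ℕP.≤-trans (*-monoʳ-≤ 24 (<⇒≤ hi)) (ℕP.≤-trans (m≤n+m (24 ℕ.* I) k₀) (ℕP.≤-trans hI hJ)))) λ d _ _ → g≥0 (24 ℕ.* d))
      (≤-trans (≤-reflexive (∑-multiples (4 ^ J) {24} g (s≤s z≤n))) (≤-trans (∑-mono (4 ^ J) λ m _ _ → ≤-trans (*-monoʳ (g≥0 m) (𝟙≤1 (24 ∣? m))) (≤-reflexive (*-identityˡ (g m)))) (romanoff X J)))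
      where
      g : ℕ → ℤ
      g m = ∏ (oddPrimes X) (raised (mersenne m))
      g≥0 : ∀ m → 0ℤ ≤ g m
      g≥0 m = ∏-nonneg (oddPrimes X) (raised-nonneg (mersenne m))

    sifted≥0 : ∀ i j → 0ℤ ≤ sifted i j
    sifted≥0 i j = ∑-nonneg N₂ λ n _ _ → 𝟙-nonneg (Selection.sifted? (2 ^ k j ℕ.* mersenne (24 ℕ.* (suc i ℕ.∸ j))) (Range.good (2 ^ k j ℕ.* mersenne (24 ℕ.* (suc i ℕ.∸ j))) X) n)

    sifted-sum : ∀ i → suc i ℕ.≤ I → + t * ∑ i (sifted i) ≤ + 524288 * C₀ * + N₂
    sifted-sum i hi with power-4 {t} (ℕP.≤-trans (s≤s z≤n) ht)
    ... | J , lo , hi′ = sieve-sum-arith (+ t) (1ℤ + + ρ) D (∑ i (sifted i)) (+ N₂) (+ (4 ^ J)) C₀ (+≤+ (ℕP.≤-trans (s≤s z≤n) ht)) (D≥1 X) (∑-nonneg i λ j _ _ → sifted≥0 i j) pos≥0 C₀≥0 t≤16ρ (subst (+ (4 ^ J) ≤_) (pos-* 4 t) (+≤+ hi′))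
        (≤-trans (≤-reflexive (trans (cong (_* D) (sym (∑-*ʳ i ((1ℤ + + ρ) * (1ℤ + + ρ)) (sifted i)))) (sym (∑-*ʳ i D _))))
          (≤-trans (∑-mono i λ j _ _ → sifted-pairs t ρ hρ (k j) (24 ℕ.* (suc i ℕ.∸ j)))
            (≤-trans (≤-reflexive (trans (∑-*ˡ i (+ 32 * + N₂) _) (cong (+ 32 * + N₂ *_) (∑-reverse i (λ d → ∏ (oddPrimes X) (raised (mersenne (24 ℕ.* d)))))))) (*-monoˡ (*-nonneg pos≥0 pos≥0) (mersenne-sum i J hi lo)))))

    small-part : + t * (+ t * + X) ≤ + 256 * + N₂
    small-part = ≤-trans (*-mono pos≥0 t≤X (*-nonneg pos≥0 pos≥0) (*-monoʳ {+ X} pos≥0 t≤X)) (≤-trans (≤-reflexive (lin 1 (λ x → κ 16 ⊗ x ⊗ (κ 16 ⊗ x ⊗ x) ≡' κ 256 ⊗ (x ⊗ (x ⊗ x))) tt (+ X))) (*-monoˡ pos≥0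
        (subst (_≤ + N₂) (trans (pos-* X (X ℕ.* X)) (cong (+ X *_) (pos-* X X))) (+≤+ (ℕP.≤-trans (ℕP.≤-reflexive (trans (cong (X ℕ.*_) (sym (^-distribˡ-+-* 2 ρ ρ))) (sym (^-distribˡ-+-* 2 ρ (ρ ℕ.+ ρ)))))
          (^-monoʳ-≤ 2 (linℕ 2 (λ r t → κ 14 ⊗ r ⊕ κ 2 ≤' t ⇒ κ 0 ≤' r ⇒ r ⊕ (r ⊕ r) ≤' κ 1 ⊕ t) tt ρ t hρ z≤n)))))))
      where
      t≤X : + t ≤ + 16 * + X
      t≤X = ≤-trans t≤16ρ (*-monoˡ pos≥0 (+≤+ (n<2^n ρ)))

    I≤t : I ℕ.≤ t
    I≤t = linℕ 3 (λ k I t → k ⊕ κ 24 ⊗ I ≤' t ⇒ κ 0 ≤' k ⇒ κ 0 ≤' I ⇒ I ≤' t) tt k₀ I t hI z≤n z≤n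

    cross-bound : ∀ i → suc i ℕ.≤ I → + t * ∑ N₂ (λ n → shift (suc i) n * r i n) ≤ C₁ * + N₂
    cross-bound i hi = ≤-trans (*-monoˡ pos≥0 total) (lin 7 (λ t i x s n c d → t ⊗ s ≤' κ 524288 ⊗ c ⊗ n ⇒ t ⊗ (t ⊗ x) ≤' κ 256 ⊗ n ⇒ t ⊗ x ⊗ i ≤' t ⊗ x ⊗ t ⇒ d ⊗ n ≡' (κ 256 ⊕ κ 524288 ⊗ c) ⊗ n ⇒ t ⊗ (i ⊗ x ⊕ s) ≤' d ⊗ n) tt
        (+ t) (+ i) (+ X) (∑ i (sifted i)) (+ N₂) C₀ C₁ (sifted-sum i hi) small-part (*-monoˡ (*-nonneg pos≥0 pos≥0) (+≤+ (ℕP.≤-trans (<⇒≤ hi) I≤t))) (cong (_* + N₂) C₁-def))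
      where
      total : ∑ N₂ (λ n → shift (suc i) n * r i n) ≤ + i * + X + ∑ i (sifted i)
      total = ≤-trans (≤-reflexive (trans (∑-ext N₂ λ n → sym (∑-*ˡ i (shift (suc i) n) (λ j → shift j n))) (∑-swap N₂ i _)))
        (≤-trans (∑-mono i λ j h₁ h₂ → pair-bound i j hi h₁ h₂) (≤-reflexive (trans (∑-+ i (λ _ → + X) (sifted i)) (cong (_+ ∑ i (sifted i)) (∑-const i (+ X))))))

    -- `shift` takes the values 0 and 1, so its square is itself: the diagonal terms add up to the
    -- first moment, and only products with earlier shifts call for the sieve.
    moment-rec : ∀ i → i ℕ.≤ I → + t * ∑ N₂ (λ n → r i n * r i n) ≤ + t * ∑ N₂ (r i) + + 2 * + i * (C₁ * + N₂)
    moment-rec zero _ = ≤-reflexive (trans (cong (+ t *_) (trans (∑-ext N₂ λ n → *-zeroˡ 0ℤ) refl)) (lin 2 (λ a b → a ≡' a ⊕ κ 2 ⊗ κ 0 ⊗ b) tt (+ t * ∑ N₂ (λ _ → 0ℤ)) (C₁ * + N₂)))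
    moment-rec (suc i) h = lin 9 (λ t i a b c d e f n → t ⊗ a ≤' t ⊗ b ⊕ κ 2 ⊗ i ⊗ n ⇒ t ⊗ c ≤' n ⇒ d ≡' a ⊕ κ 2 ⊗ c ⊕ e ⇒ t ⊗ d ≡' t ⊗ (a ⊕ κ 2 ⊗ c ⊕ e) ⇒ f ≡' b ⊕ e ⇒ t ⊗ f ≡' t ⊗ (b ⊕ e) ⇒ t ⊗ d ≤' t ⊗ f ⊕ κ 2 ⊗ (κ 1 ⊕ i) ⊗ n) tt
        (+ t) (+ i) (∑ N₂ (λ n → r i n * r i n)) (∑ N₂ (r i)) (∑ N₂ (λ n → shift (suc i) n * r i n)) (∑ N₂ (λ n → r (suc i) n * r (suc i) n)) (∑ N₂ (shift (suc i))) (∑ N₂ (r (suc i))) (C₁ * + N₂)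
        (moment-rec i (<⇒≤ h)) (cross-bound i h) sq (cong (+ t *_) sq) (∑-+ N₂ (r i) (shift (suc i))) (cong (+ t *_) (∑-+ N₂ (r i) (shift (suc i))))
      where
      sq : ∑ N₂ (λ n → r (suc i) n * r (suc i) n) ≡ ∑ N₂ (λ n → r i n * r i n) + + 2 * ∑ N₂ (λ n → shift (suc i) n * r i n) + ∑ N₂ (shift (suc i))
      sq = trans (∑-ext N₂ λ n → trans (lin 2 (λ a b → (a ⊕ b) ⊗ (a ⊕ b) ≡' a ⊗ a ⊕ κ 2 ⊗ (b ⊗ a) ⊕ b ⊗ b) tt (r i n) (shift (suc i) n)) (cong (λ z → r i n * r i n + + 2 * (shift (suc i) n * r i n) + z) (Selection.𝟙-sq 0 (B? (n ℕ.∸ 2 ^ k (suc i))))))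
        (trans (∑-+ N₂ _ _) (cong (_+ ∑ N₂ (shift (suc i))) (trans (∑-+ N₂ _ _) (cong (λ z → ∑ N₂ (λ n → r i n * r i n) + z) (∑-*ˡ N₂ (+ 2) _)))))

    second-moment : ∑ N₂ (λ n → r I n * r I n) ≤ ∑ N₂ (r I) + + 2 * (C₁ * + N₂)
    second-moment = *-cancel {+ t} (+≤+ (ℕP.≤-trans (s≤s z≤n) ht)) (lin 5 (λ t i a b n → t ⊗ a ≤' t ⊗ b ⊕ κ 2 ⊗ i ⊗ n ⇒ n ⊗ i ≤' n ⊗ t ⇒ t ⊗ a ≤' t ⊗ (b ⊕ κ 2 ⊗ n)) tt (+ t) (+ I) (∑ N₂ (λ n → r I n * r I n)) (∑ N₂ (r I)) (C₁ * + N₂)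
      (moment-rec I ℕP.≤-refl) (*-monoˡ (*-nonneg C₁≥0 pos≥0) (+≤+ I≤t)))

    first-moment : + I * ∑ (2 ^ t) (λ m → 𝟙 (B? m)) ≤ ∑ N₂ (r I)
    first-moment = ≤-trans (≤-reflexive (sym (∑-const I P))) (≤-trans (∑-mono I λ i _ h → each i h) (≤-reflexive (∑-swap I N₂ shift)))
      where
      P : ℤ
      P = ∑ (2 ^ t) (λ m → 𝟙 (B? m))
      each : ∀ i → i ℕ.≤ I → P ≤ ∑ N₂ (shift i)
      each i h = ≤-trans (∑-range (ℕP.m+n≤o⇒m≤o∸n (2 ^ t) (ℕP.≤-trans (ℕP.+-monoʳ-≤ (2 ^ t) (^-monoʳ-≤ 2 (k≤t h))) (ℕP.≤-reflexive (linℕ 1 (λ a → a ⊕ a ≡' κ 2 ⊗ a) tt (2 ^ t))))) λ m _ _ → 𝟙-nonneg (B? m))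
        (≤-reflexive (trans (∑-ext (N₂ ℕ.∸ 2 ^ k i) λ m → sym (*-identityʳ (𝟙 (B? m)))) (trans (sym (∑-shifted (λ _ → 1ℤ) (2^k≤ h))) (∑-ext N₂ λ n → *-identityʳ (shift i n)))))

-- Provides the duplicate-free lists that `DensityZero` speaks of, so that it can be applied to sums
-- of indicators.
module Members {P : ℕ → Set} (d : ∀ n → Dec (P n)) where

  members : ℕ → List ℕ
  members zero = []
  members (suc n) = keep (d (suc n)) (suc n) (members n)

  members-All : ∀ x → All (λ n → 1 ℕ.≤ n × n ℕ.≤ x × P n) (members x)
  members-All zero = []
  members-All (suc n) with d (suc n)
  ... | yes p = (s≤s z≤n , ℕP.≤-refl , p) ∷ All.map (λ { (a , b , c) → a , m≤n⇒m≤1+n b , c }) (members-All n)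
  ... | no _ = All.map (λ { (a , b , c) → a , m≤n⇒m≤1+n b , c }) (members-All n)

  members-Unique : ∀ x → Unique (members x)
  members-Unique zero = []
  members-Unique (suc n) with d (suc n)
  ... | yes _ = All.map (λ { (_ , le , _) refl → ℕP.<⇒≱ ℕP.≤-refl le }) (members-All n) ∷ members-Unique n
  ... | no _ = members-Unique n

  members-length : ∀ x → ∑ x (λ n → 𝟙 (d n)) ≡ + length (members x)
  members-length zero = refl
  members-length (suc n) with d (suc n)
  ... | yes p = trans (cong₂ _+_ (members-length n) (𝟙-yes (yes p) p)) (+-comm (+ length (members n)) 1ℤ)
  ... | no np = trans (cong₂ _+_ (members-length n) (𝟙-no (no np) np)) (+-identityʳ (+ length (members n)))

double : ∀ t → 2 ^ suc t ≡ 2 ^ t ℕ.+ 2 ^ t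
double t = linℕ 1 (λ a → κ 2 ⊗ a ≡' a ⊕ a) tt (2 ^ t)

sparse-arith : ∀ (D m U u t t₁ : ℤ) → 0ℤ ≤ m → 1ℤ ≤ u → 0ℤ ≤ D → 0ℤ ≤ t₁ → m ≤ + 24 * u + U → + 8 * (1ℤ + D) * U ≤ + 8 * (1ℤ + D) * (u * (t₁ + + 15)) + + 4 * (u * t) →
  t₁ + + 2 * ((1ℤ + D) * (t₁ + + 39)) + 1ℤ ≤ t → 1ℤ + D * m ≤ u * t
sparse-arith D m U u t t₁ hm hu hD ht₁ h₁ h₂ h₃ = lin 6 (λ D m U u t t₁ → κ 0 ≤' m ⇒ κ 1 ≤' u ⇒ κ 0 ≤' u ⊗ t₁ ⇒ κ 8 ⊗ (κ 1 ⊕ D) ⊗ m ≤' κ 8 ⊗ (κ 1 ⊕ D) ⊗ (κ 24 ⊗ u ⊕ U) ⇒ κ 8 ⊗ (κ 1 ⊕ D) ⊗ U ≤' κ 8 ⊗ (κ 1 ⊕ D) ⊗ (u ⊗ (t₁ ⊕ κ 15)) ⊕ κ 4 ⊗ (u ⊗ t)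
    ⇒ u ⊗ (t₁ ⊕ κ 2 ⊗ ((κ 1 ⊕ D) ⊗ (t₁ ⊕ κ 39)) ⊕ κ 1) ≤' u ⊗ t ⇒ κ 1 ⊕ D ⊗ m ≤' u ⊗ t) tt D m U u t t₁ hm hu (*-nonneg u≥0 ht₁) (*-monoˡ (*-nonneg (pos≥0 {8}) (+-mono-≤ (pos≥0 {1}) hD)) h₁) h₂ (*-monoˡ u≥0 h₃)
  where
  u≥0 : 0ℤ ≤ u
  u≥0 = ≤-trans pos≥0 hu

-- From density zero to sparse primes

module FromDensity (M : ℕ) (hM : 1 ℕ.≤ M) (b k₀ : ℕ) {A : ℕ → Set} (dz : DensityZero A) (n₀ : ℕ) where

  open Residues M hM

  B : ℕ → Set
  B n = Prime n × n ~ b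

  B? : ∀ n → Dec (B n)
  B? n = prime? n ×-dec (n ~? b)

  open SecondMoment {B} B? proj₁ k₀

  module _ (inA : ∀ p i → Prime p → p ~ b → 1 ℕ.≤ i → n₀ ℕ.≤ p ℕ.+ 2 ^ k i → A (p ℕ.+ 2 ^ k i)) where

    -- A decidable predicate that implies A from n₀ on; indicator sums require decidability, which A
    -- need not have.
    Supp : ℕ → ℕ → Set
    Supp I n = ∃ λ l → l < I × B (n ℕ.∸ 2 ^ k (suc l))

    supp? : ∀ I n → Dec (Supp I n)
    supp? I n = anyUpTo? (λ l → B? (n ℕ.∸ 2 ^ k (suc l))) I

    supp-A : ∀ {I n} → n₀ ℕ.≤ n × Supp I n → A n
    supp-A {I} {n} (hn , l , _ , pp , e) = subst A n≡ (inA (n ℕ.∸ c) (suc l) pp e (s≤s z≤n) (subst (n₀ ℕ.≤_) (sym n≡) hn))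
      where
      c : ℕ
      c = 2 ^ k (suc l)
      n≡ : n ℕ.∸ c ℕ.+ c ≡ n
      n≡ = m∸n+n≡m {n} {c} (<⇒≤ (ℕP.m∸n≢0⇒n<m {n} {c} λ z → contradiction (prime≥1 (subst Prime z pp)) λ ()))

    supp-count : ∀ q → 1 ℕ.≤ q → ∃ λ N → ∀ I x → N ℕ.≤ x → + q * ∑ x (λ n → 𝟙 (supp? I n)) ≤ + q * + n₀ + + x
    supp-count q hq with dz q hq
    ... | N , few = N , λ I x hx → ≤-trans (*-monoˡ pos≥0 (≤-trans (∑-mono x λ n _ _ → each I n) (≤-reflexive (∑-+ x _ _))))
        (lin 5 (λ q a b c x → q ⊗ a ≤' q ⊗ c ⇒ q ⊗ b ≤' x ⇒ q ⊗ (a ⊕ b) ≤' q ⊗ c ⊕ x) tt (+ q) (∑ x (λ n → 𝟙 (n ℕ.≤? n₀))) (∑ x (λ n → 𝟙 (late I n))) (+ n₀) (+ x) (*-monoˡ pos≥0 (∑-≤-indicator x n₀)) (sparse I x hx))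
      where
      late : ∀ I n → Dec (n₀ ℕ.≤ n × Supp I n)
      late I n = (n₀ ℕ.≤? n) ×-dec supp? I n
      sparse : ∀ I x → N ℕ.≤ x → + q * ∑ x (λ n → 𝟙 (late I n)) ≤ + x
      sparse I x hx = subst (_≤ + x) (trans (pos-* q (length (members x))) (cong (+ q *_) (sym (members-length x)))) (+≤+ (few x hx (members x) (members-Unique x) (All.map (λ { (a , b , c) → a , b , supp-A c }) (members-All x))))
        where open Members (late I)
      each : ∀ I n → 𝟙 (supp? I n) ≤ 𝟙 (n ℕ.≤? n₀) + 𝟙 (late I n)
      each I n with 𝟙-case (supp? I n) | ℕP.≤-total n n₀
      ... | inj₂ (_ , i) | _ rewrite i = +-mono-≤ (𝟙-nonneg (n ℕ.≤? n₀)) (𝟙-nonneg (late I n))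
      ... | inj₁ (_ , i) | inj₁ le rewrite i | 𝟙-yes (n ℕ.≤? n₀) le = ≤+ʳ (𝟙-nonneg (late I n))
      ... | inj₁ (s , i) | inj₂ le rewrite i | 𝟙-yes (late I n) (le , s) = ≤+ˡ (𝟙-nonneg (n ℕ.≤? n₀))

    -- AM–GM in place of the Cauchy–Schwarz inequality.
    pointwise : ∀ (λ' : ℤ) I n → + 2 * λ' * r I n ≤ λ' * λ' * 𝟙 (supp? I n) + r I n * r I n
    pointwise l I n with 𝟙-case (supp? I n)
    ... | inj₁ (_ , i) rewrite i = lin 2 (λ l r → κ 0 ≤' (l ⊖ r) ⊗ (l ⊖ r) ⇒ κ 2 ⊗ l ⊗ r ≤' l ⊗ l ⊗ κ 1 ⊕ r ⊗ r) tt l (r I n) (Selection.square≥0 0 (l - r I n))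
    ... | inj₂ (ns , i) rewrite i = ≤-reflexive (trans (cong (+ 2 * l *_) r≡0) (trans (lin 1 (λ l → κ 2 ⊗ l ⊗ κ 0 ≡' l ⊗ l ⊗ κ 0 ⊕ κ 0 ⊗ κ 0) tt l) (cong (λ z → l * l * 0ℤ + z * z) (sym r≡0))))
      where
      r≡0 : r I n ≡ 0ℤ
      r≡0 = ∑-zero I λ { (suc l) _ h → 𝟙-no (B? (n ℕ.∸ 2 ^ k (suc l))) λ b → ns (l , h , b) }

    P : ℕ → ℤ
    P t = ∑ (2 ^ t) (λ m → 𝟙 (B? m))

    P≥0 : ∀ t → 0ℤ ≤ P t
    P≥0 t = ∑-nonneg (2 ^ t) λ m _ _ → 𝟙-nonneg (B? m)

    c₁ : ℕ
    c₁ = ℤ.∣ C₁ ∣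

    c₁-≡ : + c₁ ≡ C₁
    c₁-≡ = 0≤i⇒+∣i∣≡i C₁≥0

    moments-combine : ∀ (l R P s R₂ x c n t I : ℤ) → 1ℤ ≤ l → 0ℤ ≤ R → + 2 * l * R ≤ l * l * s + R₂ → R₂ ≤ R + + 2 * (c * x) → l * l * s ≤ l * l * n + x → l * l * n ≤ x → I * P ≤ R → t ≤ + 48 * I → 0ℤ ≤ P → l * (t * P) ≤ + 96 * ((1ℤ + c) * x)
    moments-combine l R P s R₂ x c n t I hl hR h₁ h₂ h₃ h₄ h₅ h₆ hP = lin 10 (λ l R P s R₂ x c n t I → κ 2 ⊗ l ⊗ R ≤' l ⊗ l ⊗ s ⊕ R₂ ⇒ R₂ ≤' R ⊕ κ 2 ⊗ (c ⊗ x) ⇒ l ⊗ l ⊗ s ≤' l ⊗ l ⊗ n ⊕ x ⇒ l ⊗ l ⊗ n ≤' x ⇒ l ⊗ (I ⊗ P) ≤' l ⊗ R ⇒ l ⊗ P ⊗ t ≤' l ⊗ P ⊗ (κ 48 ⊗ I) ⇒ R ⊗ κ 1 ≤' R ⊗ l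
        ⇒ l ⊗ (t ⊗ P) ≤' κ 96 ⊗ ((κ 1 ⊕ c) ⊗ x)) tt l R P s R₂ x c n t I h₁ h₂ h₃ h₄ (*-monoˡ l≥0 h₅) (*-monoˡ (*-nonneg l≥0 hP) h₆) (*-monoˡ hR hl)
      where
      l≥0 : 0ℤ ≤ l
      l≥0 = ≤-trans pos≥0 hl

    prime-count : ∀ q → 1 ℕ.≤ q → ∃ λ t₀ → ∀ t → t₀ ℕ.≤ t → + q * (+ t * P t) ≤ + (2 ^ t)
    prime-count q hq = t₀ , bound
      where
      l Q : ℕ
      -- `moments-combine` gives l t P ≤ 96 (1 + C₁) 2^(t + 1), so this l leaves 1 / q. The density
      -- parameter is its square Q, since the support enters with the weight l².
      l = 192 ℕ.* suc c₁ ℕ.* q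
      Q = l ℕ.* l
      l≥1 : 1 ℕ.≤ l
      l≥1 = *-mono-≤ {1} {192 ℕ.* suc c₁} (s≤s z≤n) hq
      counted = supp-count Q (*-mono-≤ l≥1 l≥1)
      t₀ : ℕ
      t₀ = proj₁ counted ℕ.+ Q ℕ.* n₀ ℕ.+ 16 ℕ.+ (k₀ ℕ.+ 24 ℕ.* suc k₀)
      bound : ∀ t → t₀ ℕ.≤ t → + q * (+ t * P t) ≤ + (2 ^ t)
      bound t ht = *-cancel {+ (192 ℕ.* suc c₁)} (+≤+ (s≤s z≤n)) (lin 5 (λ a q y c x → a ⊗ q ⊗ y ≤' κ 96 ⊗ (c ⊗ (κ 2 ⊗ x)) ⇒ a ≡' κ 192 ⊗ c ⇒ a ⊗ x ≡' κ 192 ⊗ c ⊗ x ⇒ a ⊗ (q ⊗ y) ≤' a ⊗ x) tt (+ (192 ℕ.* suc c₁)) (+ q) (+ t * P t) (1ℤ + + c₁) (+ (2 ^ t))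
          main (pos-* 192 (suc c₁)) (cong (_* + (2 ^ t)) (pos-* 192 (suc c₁))))
        where
        part : ∀ {a} → a ℕ.≤ t₀ → a ℕ.≤ t
        part h = ℕP.≤-trans h ht
        a₁ a₂ a₄ : ℕ
        a₁ = proj₁ counted
        a₂ = Q ℕ.* n₀
        a₄ = k₀ ℕ.+ 24 ℕ.* suc k₀
        below : ∀ {a} → a ℕ.≤ t₀ → a ℕ.≤ 2 ^ suc t
        below h = ℕP.≤-trans (part h) (ℕP.≤-trans (<⇒≤ (n<2^n t)) (^-monoʳ-≤ 2 (n≤1+n t)))
        I : ℕ
        I = (t ℕ.∸ k₀) ÷ 24
        k₀≤t : a₄ ℕ.≤ t
        k₀≤t = part (m≤n+m a₄ (a₁ ℕ.+ a₂ ℕ.+ 16))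
        I-upper : k₀ ℕ.+ 24 ℕ.* I ℕ.≤ t
        I-upper = ℕP.≤-trans (ℕP.+-monoʳ-≤ k₀ (÷-≤ (s≤s z≤n) ℕP.≤-refl)) (ℕP.≤-reflexive (m+[n∸m]≡n (ℕP.≤-trans (m≤m+n k₀ _) k₀≤t)))
        I-large : suc k₀ ℕ.≤ I
        I-large = ≤-÷ (s≤s z≤n) (ℕP.m+n≤o⇒m≤o∸n (24 ℕ.* suc k₀) (subst (ℕ._≤ t) (ℕP.+-comm k₀ _) k₀≤t))
        t≤48I : + t ≤ + 48 * + I
        t≤48I = lin 4 (λ t d k I → t ≡' k ⊕ d ⇒ κ 1 ⊕ d ≤' κ 24 ⊗ (κ 1 ⊕ I) ⇒ κ 1 ⊕ k ≤' I ⇒ κ 0 ≤' k ⇒ t ≤' κ 48 ⊗ I) tt (+ t) (+ (t ℕ.∸ k₀)) (+ k₀) (+ I) (cong +_ (sym (m+[n∸m]≡n (ℕP.≤-trans (m≤m+n k₀ _) k₀≤t))))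
          (subst (+ suc (t ℕ.∸ k₀) ≤_) (pos-* 24 (suc I)) (+≤+ (÷-lt (t ℕ.∸ k₀) (s≤s z≤n)))) (+≤+ I-large) pos≥0
        open At t I (part (ℕP.≤-trans (m≤n+m 16 (a₁ ℕ.+ a₂)) (m≤m+n _ a₄))) I-upper
        R : ℤ
        R = ∑ N₂ (r I)
        R≥0 : 0ℤ ≤ R
        R≥0 = ∑-nonneg N₂ λ n _ _ → ∑-nonneg I λ i _ _ → 𝟙-nonneg (B? (n ℕ.∸ 2 ^ k i))
        ll : + Q ≡ + l * + l
        ll = pos-* l l
        s : ℤ
        s = ∑ N₂ (λ n → 𝟙 (supp? I n))
        main : + (192 ℕ.* suc c₁) * + q * (+ t * P t) ≤ + 96 * ((1ℤ + + c₁) * (+ 2 * + (2 ^ t)))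
        main = subst₂ (λ a b → a * (+ t * P t) ≤ + 96 * ((1ℤ + + c₁) * b)) (pos-* (192 ℕ.* suc c₁) q) (pos-* 2 (2 ^ t))
          (subst (λ c → + l * (+ t * P t) ≤ + 96 * ((1ℤ + c) * + N₂)) (sym c₁-≡)
            (moments-combine (+ l) R (P t) s (∑ N₂ (λ n → r I n * r I n)) (+ N₂) C₁ (+ n₀) (+ t) (+ I) (+≤+ l≥1) R≥0
              (subst₂ _≤_ (∑-*ˡ N₂ (+ 2 * + l) (r I)) (trans (∑-+ N₂ _ _) (cong (_+ ∑ N₂ (λ n → r I n * r I n)) (∑-*ˡ N₂ (+ l * + l) (λ n → 𝟙 (supp? I n))))) (∑-mono N₂ λ n _ _ → pointwise (+ l) I n))
              second-moment (subst (λ z → z * s ≤ z * + n₀ + + N₂) ll (proj₂ counted I N₂ (below (ℕP.≤-trans (m≤m+n a₁ a₂) (ℕP.≤-trans (m≤m+n _ 16) (m≤m+n _ a₄))))))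
              (subst (_≤ + N₂) (trans (pos-* Q n₀) (cong (_* + n₀) ll)) (+≤+ (below (ℕP.≤-trans (m≤n+m a₂ a₁) (ℕP.≤-trans (m≤m+n _ 16) (m≤m+n _ a₄)))))) first-moment t≤48I (P≥0 t)))

    -- Beyond 2^t₁ a dyadic block has at most a fraction 1 / q of the order 2^t / t of primes in the
    -- class, each of weight about t / 2^t; so every block adds at most 4 S V / q. Mertens bounds
    -- the part below 2^t₁, and `primePowers-bound` the proper prime powers.
    density-sparse : Sparse M hM b
    density-sparse D = N , bound
      where
      D' q t₁ N : ℕ
      D' = suc D
      q = 8 ℕ.* D'
      counted = prime-count q (s≤s z≤n)
      t₁ = proj₁ counted
      N = t₁ ℕ.+ 2 ℕ.* (D' ℕ.* (t₁ ℕ.+ 39)) ℕ.+ 1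
      bound : ∀ T (M≤X : M ℕ.≤ 2 ^ T) t → N ℕ.≤ t → suc t ℕ.≤ T → + D * AtScale.mass M hM T M≤X b t ℤ.< AtScale.SV M hM T M≤X * + t
      bound T M≤X t ht htT = suc[i]≤j⇒i<j (sparse-arith (+ D) (mass b t) (U t) SV (+ t) (+ t₁) (mass-nonneg b t) (*-≥1 S≥1 V≥1) pos≥0 pos≥0 mass≤ U≤ big)
        where
        open AtScale M hM T M≤X using (mass; mass-nonneg; SV; S; s; V; S≥1; V≥1; SV≥0; w; w-nonneg; w-anti; w-*; Λ; Λ-nonneg; Λ-p; ℓ; ℓ-upper; mertens-upper; primePowers-bound; F)
        U : ℕ → ℤ
        U t = ∑ (2 ^ t) (λ n → 𝟙 (B? n) * (Λ n * w n))
        block : ∀ t → t₁ ℕ.≤ t → suc t ℕ.≤ T → + q * ∑ (2 ^ t) (λ n → 𝟙 (B? (2 ^ t ℕ.+ n)) * (Λ (2 ^ t ℕ.+ n) * w (2 ^ t ℕ.+ n))) ≤ + 4 * SV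
        block t ht htT = lin 8 (λ q p t s w a v B → s ⊗ w ⊗ (q ⊗ ((κ 1 ⊕ t) ⊗ p)) ≤' s ⊗ w ⊗ (κ 2 ⊗ a) ⇒ s ⊗ (w ⊗ a) ≡' s ⊗ v ⇒ κ 0 ≤' s ⊗ w ⊗ (q ⊗ (p ⊗ t)) ⇒ q ⊗ B ≤' q ⊗ (p ⊗ (s ⊗ (κ 2 ⊕ t) ⊗ w)) ⇒ q ⊗ B ≤' κ 4 ⊗ (s ⊗ v)) tt
            (+ q) (P (suc t)) (+ t) S (w (2 ^ t)) (+ (2 ^ t)) V terms (*-monoˡ sw≥0 (subst (+ q * (+ suc t * P (suc t)) ≤_) (pos-* 2 (2 ^ t)) (proj₂ counted (suc t) (m≤n⇒m≤1+n ht))))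
            (cong (S *_) (w-* (2^≥1 t) (^-monoʳ-≤ 2 (<⇒≤ htT)))) (*-nonneg sw≥0 (*-nonneg (pos≥0 {q}) (*-nonneg (P≥0 (suc t)) (pos≥0 {t})))) (*-monoˡ (pos≥0 {q}) (≤-trans (∑-mono (2 ^ t) each) (≤-trans (≤-reflexive (∑-*ʳ (2 ^ t) C _)) (*-monoʳ C≥0 tail-P))))
          where
          terms C : ℤ
          terms = ∑ (2 ^ t) (λ n → 𝟙 (B? (2 ^ t ℕ.+ n)) * (Λ (2 ^ t ℕ.+ n) * w (2 ^ t ℕ.+ n)))
          C = S * (+ 2 + + t) * w (2 ^ t)
          sw≥0 : 0ℤ ≤ S * w (2 ^ t)
          sw≥0 = *-nonneg (≤-trans pos≥0 S≥1) (w-nonneg (2 ^ t))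
          C≥0 : 0ℤ ≤ C
          C≥0 = *-nonneg (*-nonneg (≤-trans pos≥0 S≥1) (pos≥0 {2 ℕ.+ t})) (w-nonneg (2 ^ t))
          tail-P : ∑ (2 ^ t) (λ n → 𝟙 (B? (2 ^ t ℕ.+ n))) ≤ P (suc t)
          tail-P = ≤-trans (≤+ˡ (P≥0 t)) (≤-reflexive (sym (trans (cong (λ z → ∑ z (λ m → 𝟙 (B? m))) (double t)) (∑-split (2 ^ t) (2 ^ t) _))))
          each : ∀ n → 1 ℕ.≤ n → n ℕ.≤ 2 ^ t → 𝟙 (B? (2 ^ t ℕ.+ n)) * (Λ (2 ^ t ℕ.+ n) * w (2 ^ t ℕ.+ n)) ≤ 𝟙 (B? (2 ^ t ℕ.+ n)) * C
          each n _ hn = 𝟙-*-≤ (B? p) λ { (pp , _) → *-mono (Λ-nonneg p) (Λ≤ pp) (w-nonneg p) (w-anti (2^≥1 t) (m≤m+n _ n)) }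
            where
            p : ℕ
            p = 2 ^ t ℕ.+ n
            Λ≤ : Prime p → Λ p ≤ S * (+ 2 + + t)
            Λ≤ pp = ≤-trans (≤-reflexive (Λ-p pp)) (subst (+ ℓ p ≤_) (pos-* s (suc (suc t))) (+≤+ (ℕP.≤-trans (ℓ-upper p) (*-monoʳ-≤ s (s≤s (lg-pred-2^ (ℕP.≤-trans (ℕP.+-monoʳ-≤ (2 ^ t) hn) (ℕP.≤-reflexive (sym (double t))))))))))
        U-rec : ∀ r → r ℕ.+ t₁ ℕ.≤ T → + q * U (r ℕ.+ t₁) ≤ + q * (SV * (+ t₁ + + 15)) + + 4 * (SV * + r)
        U-rec zero h = ≤-trans (*-monoˡ (pos≥0 {q}) (≤-trans (∑-mono (2 ^ t₁) λ n _ _ → ≤-trans (*-monoʳ (*-nonneg (Λ-nonneg n) (w-nonneg n)) (𝟙≤1 (B? n))) (≤-reflexive (*-identityˡ (Λ n * w n))))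
            (≤-trans (mertens-upper (2 ^ t₁) (2^≥1 t₁) (^-monoʳ-≤ 2 h)) (≤-reflexive (trans (cong (λ z → SV * + z + + 15 * SV) (lg-2^ t₁)) (lin 2 (λ u t → u ⊗ t ⊕ κ 15 ⊗ u ≡' u ⊗ (t ⊕ κ 15)) tt SV (+ t₁)))))))
          (lin 2 (λ a u → a ≤' a ⊕ κ 4 ⊗ (u ⊗ κ 0)) tt (+ q * (SV * (+ t₁ + + 15))) SV)
        U-rec (suc r) h = lin 7 (λ q u v b a s r → q ⊗ u ≤' a ⊕ κ 4 ⊗ (s ⊗ r) ⇒ q ⊗ b ≤' κ 4 ⊗ s ⇒ v ≡' u ⊕ b ⇒ q ⊗ v ≡' q ⊗ (u ⊕ b) ⇒ q ⊗ v ≤' a ⊕ κ 4 ⊗ (s ⊗ (κ 1 ⊕ r))) tt (+ q) (U (r ℕ.+ t₁)) (U (suc r ℕ.+ t₁)) (∑ (2 ^ j) (λ n → f (2 ^ j ℕ.+ n))) (+ q * (SV * (+ t₁ + + 15))) SV (+ r)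
            (U-rec r (<⇒≤ h)) (block j (m≤n+m t₁ r) h) split (cong (+ q *_) split)
          where
          j : ℕ
          j = r ℕ.+ t₁
          f : ℕ → ℤ
          f n = 𝟙 (B? n) * (Λ n * w n)
          split : U (suc r ℕ.+ t₁) ≡ U j + ∑ (2 ^ j) (λ n → f (2 ^ j ℕ.+ n))
          split = trans (cong (λ z → ∑ z f) (double j)) (∑-split (2 ^ j) (2 ^ j) f)
        t₁≤t : t₁ ℕ.≤ t
        t₁≤t = ℕP.≤-trans (ℕP.≤-trans (m≤m+n t₁ _) (m≤m+n _ 1)) ht
        U≤ : + 8 * (1ℤ + + D) * U t ≤ + 8 * (1ℤ + + D) * (SV * (+ t₁ + + 15)) + + 4 * (SV * + t)
        U≤ = subst (λ z → z * U t ≤ z * (SV * (+ t₁ + + 15)) + + 4 * (SV * + t)) (pos-* 8 D') (≤-trans (subst (λ z → + q * U z ≤ + q * (SV * (+ t₁ + + 15)) + + 4 * (SV * + (t ℕ.∸ t₁))) (m∸n+n≡m t₁≤t)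
            (U-rec (t ℕ.∸ t₁) (ℕP.≤-trans (ℕP.≤-reflexive (m∸n+n≡m t₁≤t)) (<⇒≤ htT))))
          (+-monoʳ-≤ (+ q * (SV * (+ t₁ + + 15))) (*-monoˡ {+ 4} pos≥0 (*-monoˡ SV≥0 (+≤+ (m∸n≤m t t₁))))))
        mass≤ : mass b t ≤ + 24 * SV + U t
        mass≤ = ≤-trans (∑-mono (2 ^ t) λ n _ _ → each n) (≤-trans (≤-reflexive (∑-+ (2 ^ t) _ _)) (+-monoˡ-≤ (U t) (primePowers-bound (2 ^ t)
            (ℕP.≤-trans (ℕP.+-monoˡ-≤ (2 ^ t) (2^≥1 t)) (ℕP.≤-trans (ℕP.≤-reflexive (sym (double t))) (^-monoʳ-≤ 2 htT))))))
          where
          each : ∀ n → F b n * Λ n ≤ 𝟙 (¬? (prime? n)) * (Λ n * w n) + 𝟙 (B? n) * (Λ n * w n)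
          each n = ≤-trans (≤-reflexive (lin 3 (λ i w l → i ⊗ w ⊗ l ≡' i ⊗ (l ⊗ w)) tt (𝟙 (1 ℕ.* n ~? b)) (w n) (Λ n))) (≤-trans (*-monoʳ (*-nonneg (Λ-nonneg n) (w-nonneg n)) cases) (≤-reflexive (*-distribʳ-+ (Λ n * w n) (𝟙 (¬? (prime? n))) (𝟙 (B? n)))))
            where
            cases : 𝟙 (1 ℕ.* n ~? b) ≤ 𝟙 (¬? (prime? n)) + 𝟙 (B? n)
            cases with 𝟙-case (1 ℕ.* n ~? b) | prime? n
            ... | inj₂ (_ , i) | d rewrite i = +-mono-≤ (𝟙-nonneg (¬? d)) (𝟙-nonneg (d ×-dec (n ~? b)))
            ... | inj₁ (_ , i) | no np rewrite i | 𝟙-yes (¬? (no np)) np = ≤+ʳ (𝟙-nonneg (no np ×-dec (n ~? b)))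
            ... | inj₁ (e , i) | yes pp rewrite i | 𝟙-yes (yes pp ×-dec (n ~? b)) (pp , ~-trans (~-reflexive (sym (ℕP.*-identityˡ n))) e) = ≤+ˡ (𝟙-nonneg (¬? (yes pp)))
        big : + t₁ + + 2 * ((1ℤ + + D) * (+ t₁ + + 39)) + 1ℤ ≤ + t
        big = subst (λ z → + t₁ + z + 1ℤ ≤ + t) (trans (pos-* 2 (D' ℕ.* (t₁ ℕ.+ 39))) (cong (+ 2 *_) (pos-* D' (t₁ ℕ.+ 39)))) (+≤+ ht)

    density-coprime : Coprime b M → ⊥
    density-coprime c = no-sparse-class M hM (λ {d} → c {d}) density-sparse

-- The covering system

candidates : List ℕ
candidates = 509203 ∷ 762701 ∷ 992077 ∷ 1247173 ∷ 1254341 ∷ 1330207 ∷ 1330319 ∷ 1730653 ∷ 1730681 ∷ 1976473 ∷ 2313487 ∷ 2344211 ∷ 2554843 ∷ 3177553 ∷ 3292241 ∷ 3419789 ∷ 3423373 ∷ 3661529 ∷ 3661543 ∷ 3784439 ∷ 4384979 ∷ 4442323 ∷ 4506097 ∷ 4507889 ∷ 4626967 ∷ 5049251 ∷ 5050147 ∷ 6610811 ∷ 7117807 ∷ 7576559 ∷ 7629217 ∷ 8086751 ∷ 8101087 ∷ 8252819 ∷ 8253043 ∷ 8643209 ∷ 9053711 ∷ 9053767 ∷ 9545351 ∷ 9560713 ∷ 9666029 ∷ 10219379 ∷ 10280827 ∷ 10581097 ∷ 10609769 ∷ 10702091 ∷ 10913233 ∷ 10913681 ∷ []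
sift : (ℕ → Bool) → List ℕ → List ℕ
sift f [] = []
sift f (x ∷ xs) with f x
... | true = x ∷ sift f xs
... | false = sift f xs

someᵇ : (ℕ → Bool) → List ℕ → Bool
someᵇ f [] = false
someᵇ f (x ∷ xs) with f x
... | true = true
... | false = someᵇ f xs

allBelow : ℕ → (ℕ → Bool) → Bool
allBelow zero f = true
allBelow (suc n) f = f n ∧ allBelow n f

-- Two powers that differ modulo 241 cannot both be congruent to c there. A single remaining power
-- either avoids c or determines c modulo 241, and then a candidate with this residue must be
-- present. This saves branching over 241 residues.
leaf : List ℕ → List ℕ → Bool
leaf [] L = false
leaf (v ∷ []) L = someᵇ (λ a → a ℕ.% 241 ℕ.≡ᵇ v ℕ.% 241) L
leaf (v ∷ v' ∷ _) L = not (v ℕ.% 241 ℕ.≡ᵇ v' ℕ.% 241)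

-- A decision tree over the residues of an unknown c: K keeps the powers of 2 that differ from c
-- modulo all primes met so far, L the candidates that agree with c there. It replaces a check of
-- every class of the modulus.
covered : List ℕ → List ℕ → List ℕ → Bool
covered [] K L = leaf K L
covered (q ∷ qs) K L = allBelow (suc q) λ r → covered qs (sift (λ v → not (v ℕ.% suc q ℕ.≡ᵇ r)) K) (sift (λ a → a ℕ.% suc q ℕ.≡ᵇ r) L)

powers : List ℕ
powers = map (λ k → 2 ^ suc k) (upTo 24)

-- The primes 3, 5, 7, 13, 17, stored as predecessors so that `suc q` is visibly nonzero; 241 is
-- left to the leaves.
tree : List ℕ
tree = 2 ∷ 4 ∷ 6 ∷ 12 ∷ 16 ∷ []

opaque
  covering-check : T (covered tree powers candidates)
  covering-check = tt

T-not-≡ᵇ : ∀ {a b} → T (not (a ℕ.≡ᵇ b)) → a ≢ b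
T-not-≡ᵇ {a} {b} h e with a ℕ.≡ᵇ b | ℕP.≡⇒≡ᵇ a b e
... | true | _ = h

sift-∈ : ∀ f xs {x} → x ∈ sift f xs → x ∈ xs × T (f x)
sift-∈ f (y ∷ xs) h with f y in e
sift-∈ f (y ∷ xs) (here refl) | true = here refl , subst T (sym e) tt
sift-∈ f (y ∷ xs) (there h) | true with sift-∈ f xs h
... | a , b = there a , b
sift-∈ f (y ∷ xs) h | false with sift-∈ f xs h
... | a , b = there a , b

someᵇ-∈ : ∀ f xs → T (someᵇ f xs) → ∃ λ x → x ∈ xs × T (f x)
someᵇ-∈ f (x ∷ xs) h with f x in e
... | true = x , here refl , subst T (sym e) tt
... | false with someᵇ-∈ f xs h
...   | y , a , b = y , there a , b

allBelow-T : ∀ n f → T (allBelow n f) → ∀ {r} → r < n → T (f r)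
allBelow-T (suc n) f h {r} lt with Equivalence.to (T-∧ {f n}) h | r ℕ.≟ n
... | a , _ | yes refl = a
... | _ , b | no ne = allBelow-T n f b (ℕP.≤∧≢⇒< (≤-pred lt) ne)

Avoids Agrees : ℕ → ℕ → ℕ → Set
Avoids c v q = v ℕ.% suc q ≢ c ℕ.% suc q
Agrees c a q = a ℕ.% suc q ≡ c ℕ.% suc q

Outcome : ℕ → List ℕ → List ℕ → List ℕ → Set
Outcome c qs K L = (∃ λ v → v ∈ K × All (Avoids c v) qs × Avoids c v 240) ⊎ (∃ λ a → a ∈ L × All (Agrees c a) qs × Agrees c a 240)

leaf-sound : ∀ c K L → T (leaf K L) → Outcome c [] K L
leaf-sound c (v ∷ []) L h with v ℕ.% 241 ℕ.≟ c ℕ.% 241 | someᵇ-∈ (λ a → a ℕ.% 241 ℕ.≡ᵇ v ℕ.% 241) L h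
... | no ne | _ = inj₁ (v , here refl , [] , ne)
... | yes e | a , m , t = inj₂ (a , m , [] , trans (≡ᵇ⇒≡ _ _ t) e)
leaf-sound c (v ∷ v' ∷ K) L h with v ℕ.% 241 ℕ.≟ c ℕ.% 241
... | no ne = inj₁ (v , here refl , [] , ne)
... | yes e = inj₁ (v' , there (here refl) , [] , λ e' → T-not-≡ᵇ {v ℕ.% 241} {v' ℕ.% 241} h (trans e (sym e')))

covered-sound : ∀ c qs K L → T (covered qs K L) → Outcome c qs K L
covered-sound c [] K L h = leaf-sound c K L h
covered-sound c (q ∷ qs) K L h with covered-sound c qs _ _ (allBelow-T (suc q) _ h (DM.m%n<n c (suc q)))
... | inj₁ (v , m , a , b) with sift-∈ _ K m
...   | m' , t = inj₁ (v , m' , T-not-≡ᵇ t ∷ a , b)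
covered-sound c (q ∷ qs) K L h | inj₂ (v , m , a , b) with sift-∈ _ L m
...   | m' , t = inj₂ (v , m' , ≡ᵇ⇒≡ _ _ t ∷ a , b)

modulusPrimes : List ℕ
modulusPrimes = 2 ∷ 3 ∷ 5 ∷ 7 ∷ 13 ∷ 17 ∷ 241 ∷ []

modulusPrimes-prime : All Prime modulusPrimes
modulusPrimes-prime = from-yes (All.all? prime? modulusPrimes)

opaque
  modulus : ℕ
  modulus = 11184810

  modulus-def : modulus ≡ 11184810
  modulus-def = refl

  modulus≥1 : 1 ℕ.≤ modulus
  modulus≥1 = s≤s z≤n

  modulus-product : modulus ≡ product modulusPrimes
  modulus-product = refl

  candidates<modulus : All (_< modulus) candidates
  candidates<modulus = from-yes (All.all? (ℕ._<? 11184810) candidates)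

  -- The numbers modulus / r for the primes r dividing the modulus.
  cofactors : List ℕ
  cofactors = 5592405 ∷ 3728270 ∷ 2236962 ∷ 1597830 ∷ 860370 ∷ 657930 ∷ 46410 ∷ []

  cofactor-∈ : ∀ {r f} → r ∈ modulusPrimes → r ℕ.* f ≡ modulus → f ∈ cofactors
  cofactor-∈ (here refl) e = here (*-cancelˡ-≡ _ 5592405 2 e)
  cofactor-∈ (there (here refl)) e = there (here (*-cancelˡ-≡ _ 3728270 3 e))
  cofactor-∈ (there (there (here refl))) e = there (there (here (*-cancelˡ-≡ _ 2236962 5 e)))
  cofactor-∈ (there (there (there (here refl)))) e = there (there (there (here (*-cancelˡ-≡ _ 1597830 7 e))))
  cofactor-∈ (there (there (there (there (here refl))))) e = there (there (there (there (here (*-cancelˡ-≡ _ 860370 13 e)))))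
  cofactor-∈ (there (there (there (there (there (here refl)))))) e = there (there (there (there (there (here (*-cancelˡ-≡ _ 657930 17 e))))))
  cofactor-∈ (there (there (there (there (there (there (here refl))))))) e = there (there (there (there (there (there (here (*-cancelˡ-≡ _ 46410 241 e)))))))

  no-shift : All (λ a → All (λ f → All (λ a' → a' ≢ (a ℕ.+ f) ℕ.% 11184810) candidates) cofactors) candidates
  no-shift = from-yes (All.all? (λ a → All.all? (λ f → All.all? (λ a' → ¬? (a' ℕ.≟ (a ℕ.+ f) ℕ.% 11184810)) candidates) cofactors) candidates)

  no-shift-% : ∀ {a a' f} → a ∈ candidates → a' ∈ candidates → f ∈ cofactors → a' ℕ.% 11184810 ≢ (a ℕ.+ f) ℕ.% 11184810
  no-shift-% {a} {a'} {f} m m' mf e = All.lookup (All.lookup (All.lookup no-shift m) mf) m' (trans (sym (DM.m<n⇒m%n≡m (All.lookup candidates<modulus m'))) e)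

  modulus-period : 2 ℕ.* 2 ^ 24 ≡ 2 ℕ.+ 3 ℕ.* modulus
  modulus-period = refl

module R = Residues modulus modulus≥1
open R using (_~_; cong-mod; ~-trans; ~-sym; ~-intro; ~-reflexive)

opaque
  unfolding modulus

  no-shift-≁ : ∀ {a a' f} → a ∈ candidates → a' ∈ candidates → f ∈ cofactors → ¬ a' ~ a ℕ.+ f
  no-shift-≁ m m' mf (cong-mod e) = no-shift-% m m' mf e

prime-∣-modulus : ∀ {p} → Prime p → p ∣ modulus → p ∈ modulusPrimes
prime-∣-modulus {p} pp d = factorisationHasAllPrimeFactors pp (subst (p ∣_) modulus-product d) modulusPrimes-prime

modulus-∣ : ∀ {F} → All (_∣ F) modulusPrimes → modulus ∣ F
modulus-∣ {F} ds = subst (_∣ F) (sym modulus-product) (product-∣ modulusPrimes-prime ds distinct)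
  where
  distinct : Selection.Distinct 0 modulusPrimes
  distinct = ((λ ()) ∷ (λ ()) ∷ (λ ()) ∷ (λ ()) ∷ (λ ()) ∷ (λ ()) ∷ []) Selection.∷ (((λ ()) ∷ (λ ()) ∷ (λ ()) ∷ (λ ()) ∷ (λ ()) ∷ []) Selection.∷ (((λ ()) ∷ (λ ()) ∷ (λ ()) ∷ (λ ()) ∷ []) Selection.∷
    (((λ ()) ∷ (λ ()) ∷ (λ ()) ∷ []) Selection.∷ (((λ ()) ∷ (λ ()) ∷ []) Selection.∷ (((λ ()) ∷ []) Selection.∷ ([] Selection.∷ Selection.[]))))))

%-≡⇒∣ : ∀ a b q .{{_ : ℕ.NonZero q}} → a ℕ.% q ≡ b ℕ.% q → q ∣ ℕ.∣ a - b ∣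
%-≡⇒∣ a b q e = divides ℕ.∣ a ℕ./ q - b ℕ./ q ∣ (trans (cong₂ ℕ.∣_-_∣ (DM.m≡m%n+[m/n]*n a q) (trans (DM.m≡m%n+[m/n]*n b q) (cong (ℕ._+ (b ℕ./ q) ℕ.* q) (sym e))))
  (trans (ℕP.∣m+n-m+o∣≡∣n-o∣ (a ℕ.% q) _ _) (sym (ℕP.*-distribʳ-∣-∣ q (a ℕ./ q) (b ℕ./ q)))))

∣⇒%-≡ : ∀ a b q .{{_ : ℕ.NonZero q}} → q ∣ ℕ.∣ a - b ∣ → a ℕ.% q ≡ b ℕ.% q
∣⇒%-≡ a b q (divides k e) with ℕP.≤-total a b
... | inj₁ le = sym (trans (cong (ℕ._% q) (sym (trans (cong (a ℕ.+_) (trans (sym e) (m≤n⇒∣m-n∣≡n∸m le))) (m+[n∸m]≡n le)))) (DM.[m+kn]%n≡m%n a k q))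
... | inj₂ le = trans (cong (ℕ._% q) (sym (trans (cong (b ℕ.+_) (trans (sym e) (trans (ℕP.∣-∣-comm a b) (m≤n⇒∣m-n∣≡n∸m le)))) (m+[n∸m]≡n le)))) (DM.[m+kn]%n≡m%n b k q)

candidates-odd : All (λ a → a ℕ.% 2 ≡ 1) candidates
candidates-odd = from-yes (All.all? (λ a → a ℕ.% 2 ℕ.≟ 1) candidates)

-- c - v modulo the modulus, without subtraction.
complement : ℕ → ℕ → ℕ
complement c v = c ℕ.+ (modulus ℕ.∸ 1) ℕ.* v

complement-+ : ∀ c v → complement c v ℕ.+ v ≡ c ℕ.+ v ℕ.* modulus
complement-+ c v = linℕ 4 (λ c v m k → m ≡' κ 1 ⊕ k ⇒ v ⊗ m ≡' v ⊗ (κ 1 ⊕ k) ⇒ c ⊕ k ⊗ v ⊕ v ≡' c ⊕ v ⊗ m) tt c v modulus (modulus ℕ.∸ 1) M≡ (cong (v ℕ.*_) M≡)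
  where
  M≡ : modulus ≡ suc (modulus ℕ.∸ 1)
  M≡ = sym (m+[n∸m]≡n modulus≥1)

∣-complement : ∀ {c v q} → suc q ∣ modulus → suc q ∣ complement c v → v ℕ.% suc q ≡ c ℕ.% suc q
∣-complement {c} {v} {q} dM d@(divides j e) with Dv.∣n⇒∣m*n v dM
... | divides l e' = trans (sym (DM.[m+kn]%n≡m%n v j (suc q))) (trans (cong (ℕ._% suc q) (trans (ℕP.+-comm v _) (trans (cong (ℕ._+ v) (sym e)) (trans (complement-+ c v) (cong (c ℕ.+_) e'))))) (DM.[m+kn]%n≡m%n c l (suc q)))

module _ (c : ℕ) (odd : c ℕ.% 2 ≡ 1) where

  avoid : ∀ {k} → All (Avoids c (2 ^ suc k)) tree → Avoids c (2 ^ suc k) 240 → ∀ {p} → p ∈ modulusPrimes → p ∣ modulus → ¬ p ∣ complement c (2 ^ suc k)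
  avoid {k} _ _ (here refl) dM d = contradiction (trans (sym (trans (cong (ℕ._% 2) (ℕP.*-comm 2 (2 ^ k))) (DM.m*n%n≡0 (2 ^ k) 2))) (trans (∣-complement dM d) odd)) λ ()
  avoid (a ∷ _) _ (there (here refl)) dM d = a (∣-complement dM d)
  avoid (_ ∷ a ∷ _) _ (there (there (here refl))) dM d = a (∣-complement dM d)
  avoid (_ ∷ _ ∷ a ∷ _) _ (there (there (there (here refl)))) dM d = a (∣-complement dM d)
  avoid (_ ∷ _ ∷ _ ∷ a ∷ _) _ (there (there (there (there (here refl))))) dM d = a (∣-complement dM d)
  avoid (_ ∷ _ ∷ _ ∷ _ ∷ a ∷ _) _ (there (there (there (there (there (here refl)))))) dM d = a (∣-complement dM d)
  avoid _ a (there (there (there (there (there (there (here refl))))))) dM d = a (∣-complement dM d)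

  coprime-complement : ∀ {k} → All (Avoids c (2 ^ suc k)) tree → Avoids c (2 ^ suc k) 240 → Coprime (complement c (2 ^ suc k)) modulus
  coprime-complement {k} as a with coprime? (complement c (2 ^ suc k)) modulus
  ... | yes h = h
  ... | no nh with nonCoprime-prime {complement c (2 ^ suc k)} (ℕP.≤-trans (n≢0⇒n>0 λ { refl → contradiction odd λ () }) (m≤m+n c _)) nh
  ...   | p , pp , d , dM = contradiction d (avoid {k} as a (prime-∣-modulus pp dM) dM)

  agree : ∀ {a} → a ∈ candidates → All (Agrees c a) tree → Agrees c a 240 → a ~ c
  agree {a} m (a₃ ∷ a₅ ∷ a₇ ∷ a₁₃ ∷ a₁₇ ∷ []) a₂₄₁ = cong-mod (∣⇒%-≡ a c modulus (modulus-∣ (%-≡⇒∣ a c 2 (trans (All.lookup candidates-odd m) (sym odd)) ∷ %-≡⇒∣ a c 3 a₃ ∷ %-≡⇒∣ a c 5 a₅ ∷ %-≡⇒∣ a c 7 a₇ ∷ %-≡⇒∣ a c 13 a₁₃ ∷ %-≡⇒∣ a c 17 a₁₇ ∷ %-≡⇒∣ a c 241 a₂₄₁ ∷ [])))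

  Classified : Set
  Classified = (∃ λ k → Coprime (complement c (2 ^ suc k)) modulus) ⊎ (∃ λ a → a ∈ candidates × a ~ c)

  from-outcome : Outcome c tree powers candidates → Classified
  from-outcome (inj₂ (a , m , as , a′)) = inj₂ (a , m , agree m as a′)
  from-outcome (inj₁ (v , m , as , a′)) = from-power (∈-map⁻ (λ k → 2 ^ suc k) m)
    where
    from-power : (∃ λ k → k ∈ upTo 24 × v ≡ 2 ^ suc k) → Classified
    from-power (k , _ , e) = inj₁ (k , λ {x} → coprime-complement {k} (subst (λ u → All (Avoids c u) tree) e as) (subst (λ u → Avoids c u 240) e a′) {x})

  opaque
    classify : Classified
    classify = from-outcome (covered-sound c tree powers candidates covering-check)

candidates-map : residues ≡ map +_ candidates
candidates-map = refl

~-+ : ∀ m .{{_ : ℕ.NonZero m}} {a b c d} → a ℕ.% m ≡ b ℕ.% m → c ℕ.% m ≡ d ℕ.% m → (a ℕ.+ c) ℕ.% m ≡ (b ℕ.+ d) ℕ.% m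
~-+ m {a} {b} {c} {d} e f = trans (DM.%-distribˡ-+ a c m) (trans (cong₂ (λ x y → (x ℕ.+ y) ℕ.% m) e f) (sym (DM.%-distribˡ-+ b d m)))

-- Quasi-non-representable classes

2^-step : ∀ j → 2 ^ suc j ℕ.* 2 ^ 24 ~ 2 ^ suc j
2^-step j = ~-intro 0 (3 ℕ.* 2 ^ j) (linℕ 3 (λ a b m → κ 2 ⊗ b ≡' κ 2 ⊕ κ 3 ⊗ m ⇒ a ⊗ (κ 2 ⊗ b) ≡' a ⊗ (κ 2 ⊕ κ 3 ⊗ m) ⇒ κ 2 ⊗ a ⊗ b ⊕ κ 0 ≡' κ 2 ⊗ a ⊕ κ 3 ⊗ a ⊗ m) tt (2 ^ j) (2 ^ 24) modulus
  modulus-period (cong (2 ^ j ℕ.*_) modulus-period))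

2^-periodic : ∀ k i → 2 ^ (suc k ℕ.+ 24 ℕ.* i) ~ 2 ^ suc k
2^-periodic k zero = ~-reflexive (cong (2 ^_) (ℕP.+-identityʳ (suc k)))
2^-periodic k (suc i) = ~-trans (~-reflexive (trans (cong (2 ^_) (linℕ 2 (λ k i → κ 1 ⊕ k ⊕ κ 24 ⊗ (κ 1 ⊕ i) ≡' κ 1 ⊕ k ⊕ κ 24 ⊗ i ⊕ κ 24) tt k i)) (^-distribˡ-+-* 2 (suc k ℕ.+ 24 ℕ.* i) 24)))
  (~-trans (2^-step (k ℕ.+ 24 ℕ.* i)) (2^-periodic k i))

in-progression : ∀ {n a} → n ~ a → a ℕ.≤ n → InProg modulus (+ a) (+ n)
in-progression {n} {a} (cong-mod e) le with %-≡⇒∣ a n modulus {{R.M≢0}} (sym e)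
... | divides h eq = h , cong +_ (trans (sym (m∸n+n≡m le)) (cong (ℕ._+ a) (trans (sym (m≤n⇒∣m-n∣≡n∸m le)) (trans eq (ℕP.*-comm h modulus)))))

progression-~ : ∀ {n a} → InProg modulus (+ a) (+ n) → n ~ a
progression-~ {n} {a} (h , e) = ~-intro 0 h (trans (ℕP.+-identityʳ n) (trans (+-injective e) (linℕ 3 (λ m h a → m ⊗ h ⊕ a ≡' a ⊕ h ⊗ m) tt modulus h a)))

DensityZero-⊆ : ∀ {A B : ℕ → Set} → (∀ {n} → A n → B n) → DensityZero B → DensityZero A
DensityZero-⊆ sub dz k hk with dz k hk
... | N , h = N , λ x hx xs u as → h x hx xs u (All.map (λ { (a , b , c) → a , b , sub c }) as)

2∣modulus : 2 ∣ modulus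
2∣modulus = subst (2 ∣_) (sym modulus-product) (divides 5592405 refl)

odd⇒2∤ : ∀ {n} → Odd n → ¬ 2 ∣ n
odd⇒2∤ (k , refl) d = contradiction (Dv.∣1⇒≡1 (Dv.∣m+n∣m⇒∣n (subst (2 ∣_) (ℕP.+-comm 1 (2 ℕ.* k)) d) (Dv.m∣m*n k))) λ ()

-- Even numbers lie outside `InU`, so the exceptional set is the whole class, of density 1 / M. The
-- parameter 2 M of `DensityZero` is contradicted at a + M H, where H exceeds both a and the
-- threshold N.
no-even : ∀ {a} → 2 ∣ a → ¬ QuasiNonRep modulus (+ a)
no-even {a} d (_ , _ , dz) = ℕP.<⇒≱ a<H (ℕP.≤-trans (m≤n*m H modulus {{R.M≢0}}) few)
  where
  M N H x : ℕ
  M = modulus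
  N = proj₁ (dz (2 ℕ.* M) (*-mono-≤ {1} {2} (s≤s z≤n) modulus≥1))
  H = suc (a ℕ.+ N)
  x = a ℕ.+ M ℕ.* H
  a<H : a < H
  a<H = s≤s (m≤m+n a N)
  f : ℕ → ℕ
  f h = a ℕ.+ M ℕ.* suc h
  xs : List ℕ
  xs = map f (upTo H)
  member : ∀ {h} → h < H → 1 ℕ.≤ f h × f h ℕ.≤ x × (InProg M (+ a) (+ f h) × ¬ InU (f h))
  member {h} lt = ℕP.≤-trans (*-mono-≤ modulus≥1 (s≤s (z≤n {h}))) (m≤n+m _ a) , ℕP.+-monoʳ-≤ a (*-monoʳ-≤ M lt) ,
    (suc h , cong +_ (ℕP.+-comm a _)) , λ { (_ , odd , _) → odd⇒2∤ odd (Dv.∣m∣n⇒∣m+n d (Dv.∣m⇒∣m*n (suc h) 2∣modulus)) }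
  unique : Unique xs
  unique = Un.map⁺ (λ {i} {j} e → ℕP.suc-injective (*-cancelˡ-≡ (suc i) (suc j) M {{R.M≢0}} (ℕP.+-cancelˡ-≡ a _ _ e))) (Un.upTo⁺ H)
  few : M ℕ.* H ℕ.≤ a
  few = linℕ 3 (λ m h a → κ 2 ⊗ m ⊗ h ≤' a ⊕ m ⊗ h ⇒ m ⊗ h ≤' a) tt M H a (subst (λ l → 2 ℕ.* M ℕ.* l ℕ.≤ x) (trans (LP.length-map f (upTo H)) (LP.length-upTo H))
    (proj₂ (dz (2 ℕ.* M) (*-mono-≤ {1} {2} (s≤s z≤n) modulus≥1)) x (ℕP.≤-trans (m≤n+m N (suc a)) (ℕP.≤-trans (m≤n*m H M {{R.M≢0}}) (m≤n+m _ a))) xs unique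
      (AllP.map⁺ (All.tabulate λ m → member (∈-upTo⁻ m)))))

no-coprime : ∀ {a} k → Coprime (complement a (2 ^ suc k)) modulus → ¬ QuasiNonRep modulus (+ a)
no-coprime {a} k c (_ , _ , dz) = FromDensity.density-coprime modulus modulus≥1 b (suc k) dz a represented (λ {x} → c {x})
  where
  b : ℕ
  b = complement a (2 ^ suc k)
  represented : ∀ p i → Prime p → p ~ b → 1 ℕ.≤ i → a ℕ.≤ p ℕ.+ 2 ^ (suc k ℕ.+ 24 ℕ.* i) → InProg modulus (+ a) (+ (p ℕ.+ 2 ^ (suc k ℕ.+ 24 ℕ.* i))) × ¬ InU (p ℕ.+ 2 ^ (suc k ℕ.+ 24 ℕ.* i))
  represented p i pp (cong-mod e) _ le = in-progression residue le , λ { (_ , _ , f) → f p (suc k ℕ.+ 24 ℕ.* i) (s≤s z≤n) refl pp }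
    where
    residue : p ℕ.+ 2 ^ (suc k ℕ.+ 24 ℕ.* i) ~ a
    residue = ~-trans (cong-mod (~-+ modulus {{R.M≢0}} e (R._~_.residue-≡ (2^-periodic k i)))) (~-intro 0 (2 ^ suc k) (trans (ℕP.+-identityʳ _) (complement-+ a (2 ^ suc k))))

listed : ∀ a → QuasiNonRep modulus (+ a) → ∃ λ c → c ∈ candidates × c ~ a
listed a q with a ℕ.% 2 in e | DM.m%n<n a 2
... | zero | _ = contradiction q (no-even (Dv.m%n≡0⇒n∣m a 2 e))
... | suc (suc _) | s≤s (s≤s ())
... | suc zero | _ with classify a e
...   | inj₁ (k , c) = contradiction q (no-coprime k λ {x} → c {x})
...   | inj₂ found = found

coverers : List ℕ
coverers = 2 ∷ 4 ∷ 6 ∷ 12 ∷ 16 ∷ 240 ∷ []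

Covers : ℕ → ℕ → ℕ → Set
Covers a j q = 2 ^ j ℕ.% suc q ≡ a ℕ.% suc q

opaque
  candidates-covered : All (λ a → All (λ j → Any (Covers a j) coverers) (upTo 24)) candidates
  candidates-covered = from-yes (All.all? (λ a → All.all? (λ j → Any.any? (λ q → 2 ^ j ℕ.% suc q ℕ.≟ a ℕ.% suc q) coverers) (upTo 24)) candidates)

  coverers-period : All (λ q → 2 ^ 24 ℕ.% suc q ≡ 1 ℕ.% suc q) coverers
  coverers-period = from-yes (All.all? (λ q → 2 ^ 24 ℕ.% suc q ℕ.≟ 1 ℕ.% suc q) coverers)

  coverers-prime : All (λ q → Prime (suc q)) coverers
  coverers-prime = from-yes (All.all? (λ q → prime? (suc q)) coverers)

coverers-∣ : All (λ q → suc q ∣ modulus) coverers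
coverers-∣ = subst (λ m → All (λ q → suc q ∣ m) coverers) (sym modulus-product) (from-yes (All.all? (λ q → suc q ∣? 11184810) coverers))

2^-cover-period : ∀ {q} → q ∈ coverers → ∀ j i → 2 ^ (j ℕ.+ 24 ℕ.* i) ℕ.% suc q ≡ 2 ^ j ℕ.% suc q
2^-cover-period {q} m j zero = cong (λ z → 2 ^ z ℕ.% suc q) (ℕP.+-identityʳ j)
2^-cover-period {q} m j (suc i) = trans (cong (ℕ._% suc q) (trans (cong (2 ^_) (linℕ 2 (λ j i → j ⊕ κ 24 ⊗ (κ 1 ⊕ i) ≡' j ⊕ κ 24 ⊗ i ⊕ κ 24) tt j i)) (^-distribˡ-+-* 2 (j ℕ.+ 24 ℕ.* i) 24)))
  (trans (Residues._~_.residue-≡ (Residues.~-* (suc q) (s≤s z≤n) {2 ^ (j ℕ.+ 24 ℕ.* i)} {2 ^ j} {2 ^ 24} {1} (Residues.cong-mod (2^-cover-period m j i)) (Residues.cong-mod (All.lookup coverers-period m))))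
    (cong (ℕ._% suc q) (ℕP.*-identityʳ (2 ^ j))))

cover : ∀ {a} → a ∈ candidates → ∀ k → ∃ λ q → q ∈ coverers × Covers a k q
cover {a} m k with find (All.lookup (All.lookup candidates-covered m) (∈-upTo⁺ (DM.m%n<n k 24)))
... | q , mq , e = q , mq , trans (trans (cong (λ z → 2 ^ z ℕ.% suc q) (trans (DM.m≡m%n+[m/n]*n k 24) (cong (k ℕ.% 24 ℕ.+_) (ℕP.*-comm (k ℕ./ 24) 24)))) (2^-cover-period mq (k ℕ.% 24) (k ℕ./ 24))) e

~⇒%-≡ : ∀ {n a q} → n ~ a → suc q ∣ modulus → n ℕ.% suc q ≡ a ℕ.% suc q
~⇒%-≡ {n} {a} {q} (cong-mod e) d = ∣⇒%-≡ n a (suc q) (Dv.∣-trans d (%-≡⇒∣ n a modulus {{R.M≢0}} e))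

exceptions : ℕ → List ℕ
exceptions x = cartesianProductWith (λ i q → 2 ^ i ℕ.+ suc q) (upTo (suc (lg x))) coverers

-- In n = p + 2^k the covering congruences force p to be one of the covering primes.
exceptional : ∀ {a n x} → a ∈ candidates → n ~ a → 1 ℕ.≤ n → n ℕ.≤ x → ¬ InU n → n ∈ exceptions x
exceptional {a} {n} {x} m e hn hx nu with n ∈? exceptions x
... | yes h = h
... | no nh = contradiction (hn , odd , λ p k _ n≡ pp → nh (in-exceptions p k n≡ pp)) nu
  where
  odd : Odd n
  odd = n ℕ./ 2 , trans (DM.m≡m%n+[m/n]*n n 2) (cong₂ ℕ._+_ (trans (~⇒%-≡ e 2∣modulus) (All.lookup candidates-odd m)) (ℕP.*-comm (n ℕ./ 2) 2))
  in-exceptions : ∀ p k → n ≡ p ℕ.+ 2 ^ k → Prime p → n ∈ exceptions x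
  in-exceptions p k n≡ pp with cover m k
  ... | q , mq , c = subst (_∈ exceptions x) (sym (trans n≡ (trans (ℕP.+-comm p _) (cong (2 ^ k ℕ.+_) (sym q≡p)))))
      (∈-cartesianProductWith⁺ (λ i q → 2 ^ i ℕ.+ suc q) (∈-upTo⁺ (s≤s (≤-lg {x} {k} (ℕP.≤-trans (m≤n+m (2 ^ k) p) (ℕP.≤-trans (ℕP.≤-reflexive (sym n≡)) hx))))) mq)
    where
    q∣p : suc q ∣ p
    q∣p = subst (suc q ∣_) (trans (cong₂ ℕ.∣_-_∣ (ℕP.+-comm p (2 ^ k)) (sym (ℕP.+-identityʳ (2 ^ k)))) (trans (ℕP.∣m+n-m+o∣≡∣n-o∣ (2 ^ k) p 0) (ℕP.∣-∣-identityʳ p)))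
      (%-≡⇒∣ (p ℕ.+ 2 ^ k) (2 ^ k) (suc q) (trans (cong (ℕ._% suc q) (sym n≡)) (trans (~⇒%-≡ e (All.lookup coverers-∣ mq)) (sym c))))
    q≡p : suc q ≡ p
    q≡p = prime-∣-prime (All.lookup coverers-prime mq) pp q∣p

length-⊆ : ∀ {xs : List ℕ} ys → Unique xs → All (_∈ ys) xs → length xs ℕ.≤ length ys
length-⊆ ys [] [] = z≤n
length-⊆ {x ∷ xs} ys (ne ∷ u) (m ∷ ms) with ∈-∃++ m
... | as , bs , refl = ℕP.≤-trans (s≤s (length-⊆ (as ++ bs) u (All.map shrink (All.zip (ne , ms))))) (ℕP.≤-reflexive (trans (cong suc (LP.length-++ as)) (trans (sym (+-suc (length as) (length bs))) (sym (LP.length-++ as)))))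
  where
  shrink : ∀ {y} → x ≢ y × y ∈ as ++ x ∷ bs → y ∈ as ++ bs
  shrink (ne , h) with ∈-++⁻ as h
  ... | inj₁ l = ∈-++⁺ˡ l
  ... | inj₂ (here e) = contradiction (sym e) ne
  ... | inj₂ (there r) = ∈-++⁺ʳ as r

length-product : ∀ (is qs : List ℕ) → length (cartesianProductWith (λ i q → 2 ^ i ℕ.+ suc q) is qs) ≡ length is ℕ.* length qs
length-product [] qs = refl
length-product (i ∷ is) qs = trans (LP.length-++ (map (λ q → 2 ^ i ℕ.+ suc q) qs)) (cong₂ ℕ._+_ (LP.length-map _ qs) (length-product is qs))

square≤2^ : ∀ m → (4 ℕ.+ m) ℕ.* (4 ℕ.+ m) ℕ.≤ 2 ^ (4 ℕ.+ m)
square≤2^ zero = ℕP.≤-refl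
square≤2^ (suc m) = linℕ 2 (λ m a → (κ 4 ⊕ m) ⊗ (κ 4 ⊕ m) ≤' a ⇒ κ 0 ≤' m ⇒ κ 0 ≤' m ⊗ m ⇒ (κ 4 ⊕ (κ 1 ⊕ m)) ⊗ (κ 4 ⊕ (κ 1 ⊕ m)) ≤' κ 2 ⊗ a) tt m (2 ^ (4 ℕ.+ m)) (square≤2^ m) z≤n z≤n

log-small : ∀ k t → 12 ℕ.* k ℕ.+ 4 ℕ.≤ t → k ℕ.* (suc t ℕ.* 6) ℕ.≤ 2 ^ t
log-small k t h = linℕ 3 (λ k n a → n ⊗ (κ 12 ⊗ k) ≤' n ⊗ n ⇒ n ⊗ n ≤' κ 2 ⊗ a ⇒ k ⊗ (n ⊗ κ 6) ≤' a) tt k (suc t) (2 ^ t)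
  (*-monoʳ-≤ (suc t) (ℕP.≤-trans (m≤m+n _ 4) (ℕP.≤-trans h (n≤1+n t)))) (subst (λ n → n ℕ.* n ℕ.≤ 2 ^ n) (m+[n∸m]≡n (ℕP.≤-trans (m≤n+m 4 (12 ℕ.* k)) (ℕP.≤-trans h (n≤1+n t)))) (square≤2^ (suc t ℕ.∸ 4)))

candidate-QNR : ∀ {a} → a ∈ candidates → QuasiNonRep modulus (+ a)
candidate-QNR {a} m = modulus≥1 , +<+ (n≢0⇒n>0 λ { refl → contradiction (All.lookup candidates-odd m) λ () }) , dz
  where
  dz : DensityZero (λ n → InProg modulus (+ a) (+ n) × ¬ InU n)
  dz k hk = 2 ^ N , λ x hx xs u as → ℕP.≤-trans (*-monoʳ-≤ k (ℕP.≤-trans (length-⊆ (exceptions x) u (All.map (λ { (h₁ , h₂ , ip , nu) → exceptional m (progression-~ ip) h₁ h₂ nu }) as))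
      (ℕP.≤-reflexive (trans (length-product (upTo (suc (lg x))) coverers) (cong (ℕ._* 6) (LP.length-upTo (suc (lg x))))))))
      (ℕP.≤-trans (log-small k (lg x) (ℕP.≤-trans (ℕP.≤-reflexive (sym (lg-2^ N))) (lg-mono hx))) (lg-lower (ℕP.≤-trans (2^≥1 N) hx)))
    where
    -- Up to x there are at most 6 (lg x + 1) exceptions, and `log-small` asks for lg x ≥ 12 k + 4.
    N : ℕ
    N = 12 ℕ.* k ℕ.+ 4

candidate-% : ∀ {c} → c ∈ candidates → ∀ a → c ~ a → ∃ λ h → a ≡ modulus ℕ.* h ℕ.+ c
candidate-% {c} m a (cong-mod e) = ℕ._/_ a modulus {{R.M≢0}} , trans (DM.m≡m%n+[m/n]*n a modulus {{R.M≢0}}) (trans (ℕP.+-comm _ (ℕ._/_ a modulus {{R.M≢0}} ℕ.* modulus))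
  (cong₂ ℕ._+_ (ℕP.*-comm _ modulus) (trans (sym e) (DM.m<n⇒m%n≡m {{R.M≢0}} (All.lookup candidates<modulus m)))))

candidate-∈ : ∀ {c} → c ∈ candidates → + c ∈ residues
candidate-∈ {c} m = subst (+ c ∈_) (sym candidates-map) (∈-map⁺ +_ m)

-- The candidate c congruent to a is its least nonnegative residue, so a = c + M h. For h > 0 the
-- progression starting at c properly contains the one starting at a.
longest⇒listed : ∀ a → LongestQNR modulus a → a ∈ residues
longest⇒listed (+ α) (q , max) with listed α q
... | c , m , e with c ℕ.≟ α | candidate-% m α e
...   | yes refl | _ = candidate-∈ m
...   | no ne | h , α≡ = contradiction (modulus , + c , candidate-QNR m , sub , nsub) max
  where
  sub : ProgSub modulus (+ α) modulus (+ c)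
  sub x (i , x≡) = i ℕ.+ h , trans x≡ (cong +_ (trans (cong (modulus ℕ.* i ℕ.+_) α≡) (linℕ 4 (λ m i h c → m ⊗ i ⊕ (m ⊗ h ⊕ c) ≡' m ⊗ (i ⊕ h) ⊕ c) tt modulus i h c)))
  nsub : ¬ ProgSub modulus (+ c) modulus (+ α)
  nsub s with s (+ c) (0 , cong (λ z → + (z ℕ.+ c)) (sym (ℕP.*-zeroʳ modulus)))
  ... | i , e = ne (ℕP.≤-antisym (ℕP.≤-trans (m≤n+m c _) (ℕP.≤-reflexive (sym α≡))) (ℕP.≤-trans (m≤n+m α _) (ℕP.≤-reflexive (sym (+-injective e)))))

no-larger : ∀ {c} → c ∈ candidates → ∀ m' α' → QuasiNonRep m' (+ α') → ProgSub modulus (+ c) m' (+ α') → ¬ ProgSub m' (+ α') modulus (+ c) → ⊥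
no-larger {c} m m' α' (hm , +<+ hα , dz) sub nsub with sub (+ c) (0 , cong (λ z → + (z ℕ.+ c)) (sym (ℕP.*-zeroʳ modulus))) | sub (+ (modulus ℕ.+ c)) (1 , cong (λ z → + (z ℕ.+ c)) (sym (ℕP.*-identityʳ modulus)))
... | h₀ , e₀ | h₁ , e₁ = by-quotient m'∣M
  where
  c≡ : c ≡ m' ℕ.* h₀ ℕ.+ α'
  c≡ = +-injective e₀
  m'∣M : m' ∣ modulus
  m'∣M = Dv.∣m+n∣m⇒∣n (divides h₁ (linℕ 6 (λ M c m h₀ h₁ α → c ≡' m ⊗ h₀ ⊕ α ⇒ M ⊕ c ≡' m ⊗ h₁ ⊕ α ⇒ m ⊗ h₀ ⊕ M ≡' h₁ ⊗ m) tt modulus c m' h₀ h₁ α' c≡ (+-injective e₁))) (Dv.m∣m*n h₀)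
  by-quotient : m' ∣ modulus → ⊥
  by-quotient (divides zero e) = contradiction (subst (1 ℕ.≤_) e modulus≥1) λ ()
  by-quotient (divides (suc zero) e) = nsub λ x → λ { (i , x≡) → i , trans x≡ (cong₂ (λ m a → + (m ℕ.* i ℕ.+ a)) M≡ (sym (α≡ h₀ c≡))) }
    where
    M≡ : m' ≡ modulus
    M≡ = sym (trans e (ℕP.*-identityˡ m'))
    α≡ : ∀ h → c ≡ m' ℕ.* h ℕ.+ α' → c ≡ α'
    α≡ zero c≡ = trans c≡ (cong (ℕ._+ α') (ℕP.*-zeroʳ m'))
    α≡ (suc h) c≡ = contradiction (ℕP.≤-trans (m≤m*n modulus (suc h)) (ℕP.≤-trans (m≤m+n _ α') (ℕP.≤-reflexive (sym (trans c≡ (cong (λ m → m ℕ.* suc h ℕ.+ α') M≡)))))) (ℕP.<⇒≱ (All.lookup candidates<modulus m))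
  by-quotient (divides (suc (suc d)) e) with prime-divisor {suc (suc d)} (s≤s (s≤s z≤n))
  ... | r , pr , divides k e′ = shifted (listed (c ℕ.+ f) (modulus≥1 , +<+ (ℕP.≤-trans (candidate≥1 m) (m≤m+n c f)) , DensityZero-⊆ (λ { (ip , nu) → widen ip , nu }) dz))
    where
    -- This is M / r. It is a multiple of m′ because r divides M / m′, so c + f still lies in the
    -- larger progression.
    f : ℕ
    f = k ℕ.* m'
    rf : r ℕ.* f ≡ modulus
    rf = sym (trans e (trans (cong (ℕ._* m') e′) (linℕ 3 (λ k r m → k ⊗ r ⊗ m ≡' r ⊗ (k ⊗ m)) tt k r m')))
    candidate≥1 : ∀ {c} → c ∈ candidates → 1 ℕ.≤ c
    candidate≥1 m = n≢0⇒n>0 λ { refl → contradiction (All.lookup candidates-odd m) λ () }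
    widen : ∀ {n} → InProg modulus (+ (c ℕ.+ f)) (+ n) → InProg m' (+ α') (+ n)
    widen (i , n≡) = suc (suc d) ℕ.* i ℕ.+ h₀ ℕ.+ k , trans n≡ (cong +_ (linℕ 8 (λ M i c k m h α D → M ≡' D ⊗ m ⇒ M ⊗ i ≡' D ⊗ m ⊗ i ⇒ c ≡' m ⊗ h ⊕ α ⇒ M ⊗ i ⊕ (c ⊕ k ⊗ m) ≡' m ⊗ (D ⊗ i ⊕ h ⊕ k) ⊕ α) tt modulus i c k m' h₀ α' (suc (suc d)) e (cong (ℕ._* i) e) c≡))
    shifted : (∃ λ c' → c' ∈ candidates × c' ~ c ℕ.+ f) → ⊥
    shifted (c' , mc' , e″) = no-shift-≁ m mc' (cofactor-∈ (prime-∣-modulus pr (divides f (trans (sym rf) (ℕP.*-comm r f)))) rf) e″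

listed⇒longest : ∀ a → a ∈ residues → LongestQNR modulus a
listed⇒longest a h with ∈-map⁻ +_ (subst (a ∈_) candidates-map h)
... | c , m , refl = candidate-QNR m , λ { (m' , + α' , q , sub , nsub) → no-larger m m' α' q sub nsub }

theorem3 : (a : ℤ) → LongestQNR 11184810 a ⇔ (a ∈ residues)
theorem3 a = subst (λ m → LongestQNR m a ⇔ (a ∈ residues)) modulus-def (mk⇔ (longest⇒listed a) (listed⇒longest a))
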